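{- Let $G$ be a finitely generated group and $S$ a finite generating set. Let $F(n)=2(2n^2+3n-2)^2(2n^2+4n-1)$ and $\check F(n)=4(2n^2+3n-2)^2(n+2)n$. If $G$ contains an element of order at least $F(2|S|^2+28|S|-4)$, then there exists a generating set $T$ containing $S$, with at most $2|S|^2+28|S|$ elements, such that $(G,S,T)$ is a strong colour-rigid triple. If $S$ contains no elements of order $2$ and $G$ has an element of order at least $\check F(2|S|^2+28|S|-4)$, then $T$ can moreover be taken with no element of order $2$.
   Context: Generating sets never contain the identity $1_G$. Elements of infinite order count as having order at least any given number. $S^\pm=S\cup S^{ -1}$. $\mathrm{Cay}(G,S)$ is the simple undirected graph with vertex set $G$ and edge set $\{(g,h)\mid g^{ -1}h\in S^\pm\}$. $\mathrm{Ball}_{\mathrm{Cay}(G,S)}(1_G)$ is the induced subgraph on $\{1_G\}\cup S^\pm$. For a subgraph $B$ of $\mathrm{Cay}(G,S)$, a colour-preserving automorphism of $B$ is a permutation $\varphi$ of the vertex set of $B$ with $\varphi(gs)\in\{\varphi(g)s,\varphi(g)s^{ -1}\}$ for all $g\in G$, $s\in S^\pm$ such that $(g,gs)$ is an edge of $B$. For generating sets $S\subseteq T$, $(G,S,T)$ is a strong colour-rigid triple if every (graph) automorphism of $\mathrm{Ball}_{\mathrm{Cay}(G,T)}(1_G)$ fixing $1_G$ acts by colour-preserving automorphisms on $\mathrm{Ball}_{\mathrm{Cay}(G,S)}(1_G)$, i.e. restricts to a colour-preserving automorphism of $\mathrm{Ball}_{\mathrm{Cay}(G,S)}(1_G)$.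 -}

module Defs where

open import Level using (_⊔_; suc)
open import Algebra.Bundles using (Group)
import Algebra.Definitions.RawMonoid as RawMonoidDefs
import Algebra.Properties.Group as GroupProperties
open import Data.Integer.Base using (ℤ; +_)
import Data.Integer.Base as ℤᵇ
open import Data.List.Base using (List; _∷_; _++_; map; foldr; length)
open import Data.List.Relation.Unary.All using (All)
open import Data.List.Relation.Unary.Any using (here)
import Data.List.Membership.Setoid as Membership
import Data.List.Membership.Setoid.Properties as Membershipₚ
import Data.List.Relation.Binary.Subset.Setoid as Subset
import Data.List.Relation.Binary.Subset.Setoid.Properties as Subsetₚ
import Data.List.Relation.Unary.Unique.Setoid as Uniqueness
open import Data.Nat.Base as ℕ using (ℕ)
open import Data.Product.Base using (Σ; _×_; _,_; proj₁; ∃-syntax; map₂)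
open import Data.Sum.Base using (_⊎_; [_,_]′)
open import Function.Base using (_∘_; _on_)
open import Function.Bundles using (Inverse; _⇔_)
open import Relation.Binary.Bundles using (Setoid)
open import Relation.Binary.Core using (Rel)
open import Relation.Binary.Definitions using (Symmetric; _Respectsˡ_; _Respectsʳ_)
import Relation.Binary.Construct.On as On
open import Relation.Nullary.Negation.Core using (¬_)
open import Relation.Unary using (Pred)

-- The polynomials live on ℤ because they are evaluated at N ∣ S ∣ - 4,
-- which is negative when S is empty.

module _ where
  open ℤᵇ using (_+_; _-_; _*_; _^_)

  F : ℤ → ℤ
  F n = + 2 * (+ 2 * n ^ 2 + + 3 * n - + 2) ^ 2 * (+ 2 * n ^ 2 + + 4 * n - + 1)

  F̌ : ℤ → ℤ
  F̌ n = + 4 * (+ 2 * n ^ 2 + + 3 * n - + 2) ^ 2 * (n + + 2) * n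

N : ℕ → ℕ
N k = 2 ℕ.* k ℕ.^ 2 ℕ.+ 28 ℕ.* k

record SimpleGraph v ℓ e : Set (suc (v ⊔ ℓ ⊔ e)) where
  field
    vertices : Setoid v ℓ
  open Setoid vertices public using (_≈_) renaming (Carrier to Vertex)
  field
    Adj        : Rel Vertex e
    Adj-sym    : Symmetric Adj
    Adj-irrefl : ∀ {u v} → u ≈ v → ¬ Adj u v
    Adj-respˡ  : Adj Respectsˡ _≈_
    Adj-respʳ  : Adj Respectsʳ _≈_

open SimpleGraph using (vertices; Adj)

Permutation : ∀ {a ℓ} → Setoid a ℓ → Set (a ⊔ ℓ)
Permutation V = Inverse V V

IsGraphAutomorphism : ∀ {v ℓ e} (Γ : SimpleGraph v ℓ e) →
                      Permutation (vertices Γ) → Set (v ⊔ e)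
IsGraphAutomorphism Γ φ = ∀ u v → Adj Γ u v ⇔ Adj Γ (φ.to u) (φ.to v)
  where module φ = Inverse φ

Induced : ∀ {v ℓ e p} (Γ : SimpleGraph v ℓ e) →
          Pred (SimpleGraph.Vertex Γ) p → SimpleGraph (v ⊔ p) ℓ e
Induced Γ P = record
  { vertices   = On.setoid {B = Σ Γ.Vertex P} Γ.vertices proj₁
  ; Adj        = Γ.Adj on proj₁
  ; Adj-sym    = Γ.Adj-sym
  ; Adj-irrefl = Γ.Adj-irrefl
  ; Adj-respˡ  = Γ.Adj-respˡ
  ; Adj-respʳ  = Γ.Adj-respʳ
  } where module Γ = SimpleGraph Γ

module Cayley {c ℓ} (G : Group c ℓ) where

  open Group G
  open GroupProperties G using (⁻¹-involutive; ⁻¹-anti-homo-\\; ε⁻¹≈ε)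
  open RawMonoidDefs rawMonoid using () renaming (_×_ to _times_)
  open Membership setoid using () renaming (_∈_ to _∈ₗ_)
  open Subset setoid using () renaming (_⊆_ to _⊆ₗ_)
  open Uniqueness setoid using (Unique)

  infixr 8 _^_
  _^_ : Carrier → ℕ → Carrier
  g ^ n = n times g

  HasOrder : Carrier → ℕ → Set ℓ
  HasOrder g n = 1 ℕ.≤ n × g ^ n ≈ ε × (∀ m → 1 ℕ.≤ m → g ^ m ≈ ε → n ℕ.≤ m)

  -- Vacuously true for elements of infinite order.
  HasOrderAtLeast : Carrier → ℤ → Set ℓ
  HasOrderAtLeast g k = ∀ n → HasOrder g n → k ℤᵇ.≤ + n

  infix 9 _±
  _± : List Carrier → List Carrier
  S ± = S ++ map _⁻¹ S

  -- Listed without repetition, so that the length is the cardinality.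
  record GeneratingSet : Set (c ⊔ ℓ) where
    field
      elements  : List Carrier
      unique    : Unique elements
      ε∉        : ¬ (ε ∈ₗ elements)
      generates : ∀ g → ∃[ ws ] All (_∈ₗ elements ±) ws × g ≈ foldr _∙_ ε ws

  open GeneratingSet using (elements)

  ∣_∣ : GeneratingSet → ℕ
  ∣ S ∣ = length (elements S)

  infix 4 _∈ˢ_ _∈±_ _⊆_

  _∈ˢ_ : Carrier → GeneratingSet → Set (c ⊔ ℓ)
  g ∈ˢ S = g ∈ₗ elements S

  _∈±_ : Carrier → GeneratingSet → Set (c ⊔ ℓ)
  g ∈± S = g ∈ₗ elements S ±

  _⊆_ : GeneratingSet → GeneratingSet → Set (c ⊔ ℓ)
  S ⊆ T = elements S ⊆ₗ elements T

  ∈ₗ-resp : ∀ {g h} xs → g ≈ h → g ∈ₗ xs → h ∈ₗ xs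
  ∈ₗ-resp xs = Membershipₚ.∈-resp-≈ setoid

  ±-sym : ∀ xs {g} → g ∈ₗ xs ± → g ⁻¹ ∈ₗ xs ±
  ±-sym xs g∈ = [ fromS , fromInv ]′ (Membershipₚ.∈-++⁻ setoid xs g∈)
    where
    fromS : ∀ {g} → g ∈ₗ xs → g ⁻¹ ∈ₗ xs ±
    fromS = Membershipₚ.∈-++⁺ʳ setoid xs ∘ Membershipₚ.∈-map⁺ setoid setoid ⁻¹-cong
    fromInv : ∀ {g} → g ∈ₗ map _⁻¹ xs → g ⁻¹ ∈ₗ xs ±
    fromInv g∈ with Membershipₚ.∈-map⁻ setoid setoid g∈
    ... | s , s∈ , g≈s⁻¹ = Membershipₚ.∈-++⁺ˡ setoid
      (∈ₗ-resp xs (sym (trans (⁻¹-cong g≈s⁻¹) (⁻¹-involutive s))) s∈)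

  ε∉± : ∀ S → ¬ (ε ∈± S)
  ε∉± S ε∈ = [ GeneratingSet.ε∉ S , fromInv ]′ (Membershipₚ.∈-++⁻ setoid (elements S) ε∈)
    where
    fromInv : ¬ (ε ∈ₗ map _⁻¹ (elements S))
    fromInv ε∈ with Membershipₚ.∈-map⁻ setoid setoid ε∈
    ... | s , s∈ , ε≈s⁻¹ = GeneratingSet.ε∉ S
      (∈ₗ-resp (elements S)
        (trans (sym (⁻¹-involutive s)) (trans (⁻¹-cong (sym ε≈s⁻¹)) ε⁻¹≈ε)) s∈)

  ±-mono : ∀ {xs ys} → xs ⊆ₗ ys → xs ± ⊆ₗ ys ±
  ±-mono xs⊆ys = Subsetₚ.++⁺ setoid xs⊆ys (Subsetₚ.map⁺ setoid setoid ⁻¹-cong xs⊆ys)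

  Cay : GeneratingSet → SimpleGraph c ℓ (c ⊔ ℓ)
  Cay S = record
    { vertices   = setoid
    ; Adj        = λ g h → g ⁻¹ ∙ h ∈± S
    ; Adj-sym    = λ {g} {h} p → ∈ₗ-resp _ (⁻¹-anti-homo-\\ g h) (±-sym (elements S) p)
    ; Adj-irrefl = λ {g} g≈h p →
        ε∉± S (∈ₗ-resp _ (trans (∙-congˡ (sym g≈h)) (inverseˡ g)) p)
    ; Adj-respˡ  = λ g≈g′ → ∈ₗ-resp _ (∙-congʳ (⁻¹-cong g≈g′))
    ; Adj-respʳ  = λ h≈h′ → ∈ₗ-resp _ (∙-congˡ h≈h′)
    }

  BallVertex : GeneratingSet → Pred Carrier (c ⊔ ℓ)
  BallVertex S g = g ∈ₗ ε ∷ elements S ±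

  Ball : GeneratingSet → SimpleGraph (c ⊔ ℓ) ℓ (c ⊔ ℓ)
  Ball S = Induced (Cay S) (BallVertex S)

  𝟙 : ∀ S → SimpleGraph.Vertex (Ball S)
  𝟙 S = ε , here refl

  include : ∀ {S T} → S ⊆ T → SimpleGraph.Vertex (Ball S) → SimpleGraph.Vertex (Ball T)
  include S⊆T = map₂ (Subsetₚ.∷⁺ʳ setoid ε (±-mono S⊆T))

  -- For subgraphs of Cay S induced on a set P of vertices.  An edge
  -- (g , gs) is given by its endpoints u and v together with v ≈ u s.
  IsColourPreserving : ∀ {p} S (P : Pred Carrier p) →
                       Permutation (vertices (Induced (Cay S) P)) → Set (c ⊔ ℓ ⊔ p)
  IsColourPreserving S P φ = ∀ u v s → s ∈± S → proj₁ v ≈ proj₁ u ∙ s →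
    Adj (Induced (Cay S) P) u v →
    proj₁ (φ.to v) ≈ proj₁ (φ.to u) ∙ s ⊎ proj₁ (φ.to v) ≈ proj₁ (φ.to u) ∙ s ⁻¹
    where module φ = Inverse φ

  IsRestriction : ∀ {S T} → S ⊆ T → Permutation (vertices (Ball T)) →
                  Permutation (vertices (Ball S)) → Set (c ⊔ ℓ)
  IsRestriction {S} {T} S⊆T φ ψ =
    ∀ v → proj₁ (Inverse.to φ (include {S} {T} S⊆T v)) ≈ proj₁ (Inverse.to ψ v)

  StrongColourRigidTriple : ∀ S T → S ⊆ T → Set (c ⊔ ℓ)
  StrongColourRigidTriple S T S⊆T =
    (φ : Permutation (vertices (Ball T))) → IsGraphAutomorphism (Ball T) φ →
    proj₁ (Inverse.to φ (𝟙 T)) ≈ ε →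
    ∃[ ψ ] IsRestriction {S} {T} S⊆T φ ψ × IsColourPreserving S (BallVertex S) ψ

  NoElementOfOrder2 : GeneratingSet → Set (c ⊔ ℓ)
  NoElementOfOrder2 S = ∀ s → s ∈ˢ S → ¬ HasOrder s 2

{-# OPTIONS --safe #-}

-- T is obtained from S by adding at most two hubs and several gadgets, each of
-- which consists of a few new elements: powers of an element z of large order,
-- multiplied by old elements, and generic enough that no other coincidences
-- occur.  Hubs and generators are called coloured.
--
-- A marker {w , v⁻¹ w} raises the degree of v in the ball and of no other
-- coloured element, except possibly v².  Markers make the degrees of the
-- coloured pairs {v , v⁻¹} distinct and larger than all other degrees, so that
-- an automorphism fixing 1 maps every coloured element to itself or to its
-- inverse.  A tie is a gadget that gives a hub and a generator u a common
-- uncoloured neighbour; then an automorphism fixing the hub fixes u as well.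
-- Which ties exist depends on whether u commutes with a small power of z,
-- inverts one, or does neither.
--
-- If no generator inverts a small power of z, then one hub X suffices.  For a
-- power X of z, either every generator is fixed or every generator is inverted.
-- The latter is impossible if some generator commutes with no small power of z,
-- and it preserves colours if any two generators g , u commute or have the same
-- square.  Otherwise X is multiplied by a generator g that neither commutes
-- with u nor inverts it: then u is moved to a conjugate of u⁻¹, which is absurd.
--
-- If a generator g inverts z, then the hubs are a power x of z and y = g⁻¹ x.
-- The triangle 1 , g , x has the side y, which forces x to be fixed.  The
-- generators that invert a power of z are tied to y and the others to x.  If y
-- is inverted, then the former all have the same square as y and y⁴ = ε, and the
-- colours are preserved again.
--
-- With at most two classes of generators no hub is needed.

module Submission where

open import Defs
open import Level using (Level; _⊔_; Lift; lift; lower)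
open import Axiom.ExcludedMiddle using (ExcludedMiddle)
open import Algebra.Bundles using (Group)
import Algebra.Properties.Group as GroupProperties
import Algebra.Properties.Monoid.Mult as Mult
open import Data.Bool.Base using (Bool; true; false; not)
import Data.Bool.Properties as Boolₚ
open import Data.Empty using (⊥; ⊥-elim)
import Data.Fin.Base as Fin
open Fin using (Fin; zero; suc)
import Data.Fin.Properties as Finₚ
open import Data.Integer using (+_; _-_)
import Data.Integer as ℤ
import Data.Integer.Properties as ℤₚ
open import Data.List.Base using (List; []; _∷_; _++_; [_]; map; length; filter; deduplicate; applyUpTo; tabulate; cartesianProductWith)
open import Data.List.Properties using (length-map; length-++; length-applyUpTo; length-tabulate; length-filter)
open import Data.List.Relation.Unary.All as All using (All; []; _∷_)
import Data.List.Relation.Unary.All.Properties as Allₚ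
open import Data.List.Relation.Unary.Any as Any using (Any; here; there)
open import Data.List.Relation.Unary.AllPairs as AllPairs using (AllPairs; []; _∷_)
import Data.List.Relation.Unary.AllPairs.Properties as AllPairsₚ
import Data.List.Membership.Setoid as Membership
import Data.List.Membership.Setoid.Properties as Membershipₚ
import Data.List.Relation.Unary.Unique.Setoid as Uniqueness
import Data.List.Relation.Unary.Unique.Setoid.Properties as Uniquenessₚ
import Data.List.Relation.Unary.Unique.DecSetoid.Properties as DecUniquenessₚ
open import Data.Nat.Base as ℕ using (ℕ; zero; suc; _≤_; _<_; z≤n; s≤s; _+_; _*_; _∸_)
import Data.Nat.Properties as ℕₚ
open import Data.Product.Base using (_×_; _,_; proj₁; proj₂; ∃-syntax; Σ-syntax)
open import Data.Sum.Base using (_⊎_; inj₁; inj₂; [_,_]′)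
open import Data.Unit.Polymorphic.Base using (⊤; tt)
open import Data.Vec.Base using (Vec; lookup)
open import Function.Base using (_∘_; id; _$_)
open import Function.Bundles using (Inverse; Equivalence)
open import Relation.Binary.Bundles using (DecSetoid)
open import Relation.Binary.Definitions using (Decidable)
import Relation.Binary.PropositionalEquality.Core as ≡
open ≡ using (_≡_)
import Relation.Binary.Reasoning.Setoid as SetoidReasoning
import Relation.Binary.Reflection as Reflection
open import Relation.Nullary.Decidable using (Dec; yes; no; map′)
open import Relation.Nullary.Negation using (¬_; contradiction)

-- New elements are never products of two elements of the ball built so far. Hence an old `v` gains
-- a neighbour only if it is a quotient of two new signed elements. In every gadget such old `v` are
-- coloured, products of two coloured elements, or on a reserved list. Uncoloured elements are
-- chosen outside this set and so keep the degree, at most 6, with which they enter, while markers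
-- raise the coloured ones to at least 7.
--
-- Gadgets are found by pigeonhole: each forbidden equation excludes at most one exponent of `z`.
-- With a generic generator this holds only for exponents at small distance, hence the division into
-- windows. In all, `z` must have no torsion up to `12n⁶`, where `n = 2k² + 28k - 4` for `k`
-- generators; both thresholds are at least `16n⁶`.
--
-- If `y` is inverted, the colours survive because an element inverting a power of `z` is not a
-- product of two that commute with powers of `z`. A generic generator would spoil this; one
-- additional tie, between `y` and a single generic generator, shows that there is none in that
-- case.

-- Inequalities between the sizes of sets, the ranges of exponents and the torsion bound.

module Estimates where
  open import Data.Nat.Solver using (module +-*-Solver)
  open +-*-Solver
  open ℕₚ.≤-Reasoning

  below : ∀ {a b} c → a + c ≡ b → a ≤ b
  below c e = ℕₚ.≤-trans (ℕₚ.m≤m+n _ c) (ℕₚ.≤-reflexive e)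

  strictly : ∀ {a b} p c → a + (p + suc c) ≡ b → a < b
  strictly {a} p c e = ℕₚ.<-≤-trans (ℕₚ.m<m+n a (ℕₚ.<-≤-trans (s≤s z≤n) (ℕₚ.m≤n+m (suc c) p))) (ℕₚ.≤-reflexive e)

  -- The value of 2 k² + 28 k − 4 at k = 3 + j.
  modulus : ℕ → ℕ
  modulus j = j * j * 2 + j * 40 + 98

  -- Here `l` is the length of a set in the tying phase: `k` generators, at most two hubs, and three
  -- elements for each of at most `u + 1` ties, one of them being the additional tie to a generic
  -- generator.
  size-estimate : ∀ {u k j l} → k ≡ 3 + j → u ≤ k → l ≤ u * 3 + (5 + k) → suc (2 * l) ≤ j * 8 + 35
  size-estimate {u} {k} {j} {l} k≡ u≤k l≤ = begin
    suc (2 * l)                          ≤⟨ s≤s (ℕₚ.*-monoʳ-≤ 2 (ℕₚ.≤-trans l≤ (ℕₚ.+-monoˡ-≤ (5 + k) (ℕₚ.*-monoˡ-≤ 3 u≤k)))) ⟩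
    suc (2 * (k * 3 + (5 + k)))          ≡⟨ ≡.cong (λ k → suc (2 * (k * 3 + (5 + k)))) k≡ ⟩
    suc (2 * ((3 + j) * 3 + (5 + (3 + j)))) ≡⟨ solve 1 (λ j → con 1 :+ con 2 :* ((con 3 :+ j) :* con 3 :+ (con 5 :+ (con 3 :+ j)))
                                             := j :* con 8 :+ con 35) ≡.refl j ⟩
    j * 8 + 35                           ∎

  short-estimate : ∀ j {s} → s ≤ j * 8 + 35 → 5 * s < 2 * modulus j
  short-estimate j {s} s≤ = ℕₚ.≤-<-trans (ℕₚ.*-monoʳ-≤ 5 s≤) (strictly (j * j * 4 + j * 40) 20 (solve 1 (λ j →
    con 5 :* (j :* con 8 :+ con 35) :+ (j :* j :* con 4 :+ j :* con 40 :+ con 21)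
    := con 2 :* (j :* j :* con 2 :+ j :* con 40 :+ con 98)) ≡.refl j))

  room-estimate : ∀ j {s r} → s ≤ j * 8 + 35 → r ≤ j * 2 + 6 → 3 * (s * s) + 10 * s + 3 + 3 * r < modulus j * modulus j
  room-estimate j {s} {r} s≤ r≤ = ℕₚ.≤-<-trans
    (ℕₚ.+-mono-≤ (ℕₚ.+-monoˡ-≤ 3 (ℕₚ.+-mono-≤ (ℕₚ.*-monoʳ-≤ 3 (ℕₚ.*-mono-≤ s≤ s≤)) (ℕₚ.*-monoʳ-≤ 10 s≤))) (ℕₚ.*-monoʳ-≤ 3 r≤))
    (strictly (j * j * j * j * 4 + j * j * j * 160 + j * j * 1800 + j * 6074) 5557 (solve 1 (λ j →
      con 3 :* ((j :* con 8 :+ con 35) :* (j :* con 8 :+ con 35)) :+ con 10 :* (j :* con 8 :+ con 35) :+ con 3 :+ con 3 :* (j :* con 2 :+ con 6)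
        :+ (j :* j :* j :* j :* con 4 :+ j :* j :* j :* con 160 :+ j :* j :* con 1800 :+ j :* con 6074 :+ con 5558)
      := (j :* j :* con 2 :+ j :* con 40 :+ con 98) :* (j :* j :* con 2 :+ j :* con 40 :+ con 98)) ≡.refl j))

  -- Markers must be found up to the final size `4 + n = 2k² + 28k`. A single generator already
  -- gives `n = 26`.
  marker-estimate : ∀ {n i l} → n ≡ 26 + i → l ≤ 4 + n →
    2 * (suc (2 * l) * suc (2 * l)) + 6 * suc (2 * l) < 12 * (n * n)
  marker-estimate {n} {i} {l} ≡.refl l≤ = begin
    suc (2 * (s * s) + 6 * s)     ≤⟨ s≤s (ℕₚ.+-mono-≤ (ℕₚ.*-monoʳ-≤ 2 (ℕₚ.*-mono-≤ s≤s′ s≤s′)) (ℕₚ.*-monoʳ-≤ 6 s≤s′)) ⟩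
    suc (2 * (s′ * s′) + 6 * s′)  ≤⟨ below (303 + 124 * i + 4 * (i * i)) (solve 1 (λ i →
        con 1 :+ (con 2 :* ((con 61 :+ con 2 :* i) :* (con 61 :+ con 2 :* i)) :+ con 6 :* (con 61 :+ con 2 :* i))
          :+ (con 303 :+ con 124 :* i :+ con 4 :* (i :* i))
        := con 12 :* ((con 26 :+ i) :* (con 26 :+ i))) ≡.refl i) ⟩
    12 * (n * n) ∎
    where
    s s′ : ℕ
    s = suc (2 * l)
    s′ = 61 + 2 * i
    s≤s′ : s ≤ s′
    s≤s′ = ℕₚ.≤-trans (s≤s (ℕₚ.*-monoʳ-≤ 2 l≤))
      (ℕₚ.≤-reflexive (solve 1 (λ i → con 1 :+ con 2 :* (con 4 :+ (con 26 :+ i)) := con 61 :+ con 2 :* i) ≡.refl i))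

  words-estimate : ∀ s n → 1 ≤ n → 3 * s ≤ n → 3 * (s * s * s) < n * n * (2 * n)
  words-estimate s n 1≤n 3s≤n = begin-strict
    3 * (s * s * s)      ≡⟨ solve 1 (λ s → con 3 :* (s :* s :* s) := s :* s :* (con 3 :* s)) ≡.refl s ⟩
    s * s * (3 * s)      ≤⟨ ℕₚ.*-mono-≤ (ℕₚ.*-mono-≤ s≤n s≤n) 3s≤n ⟩
    n * n * n            <⟨ ℕₚ.*-monoʳ-< (n * n) {{ℕₚ.m*n≢0 n n {{positive}} {{positive}}}} (ℕₚ.m<m+n n (ℕₚ.≤-trans 1≤n (ℕₚ.m≤m+n n 0))) ⟩
    n * n * (2 * n)      ∎
    where
    positive : ℕ.NonZero n
    positive = ℕ.>-nonZero 1≤n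
    s≤n : s ≤ n
    s≤n = ℕₚ.≤-trans (ℕₚ.m≤n*m s 3) 3s≤n

  generators-estimate : ∀ j → 3 * suc (2 * (3 + j)) ≤ modulus j
  generators-estimate j = below (j * j * 2 + j * 34 + 77) (solve 1 (λ j → con 3 :* (con 1 :+ con 2 :* (con 3 :+ j))
    :+ (j :* j :* con 2 :+ j :* con 34 :+ con 77) := j :* j :* con 2 :+ j :* con 40 :+ con 98) ≡.refl j)

  few-torsion : ∀ {n} → 6 ≤ n → 3 * (12 * (n * n)) * (12 * (n * n)) ≤ 12 * (n * n * n * (n * n * n))
  few-torsion {n} 6≤n = begin
    3 * (12 * (n * n)) * (12 * (n * n))     ≡⟨ solve 1 (λ n → con 3 :* (con 12 :* (n :* n)) :* (con 12 :* (n :* n))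
                                                 := con 12 :* (con 36 :* (n :* n :* n :* n))) ≡.refl n ⟩
    12 * (36 * (n * n * n * n))             ≤⟨ ℕₚ.*-monoʳ-≤ 12 (ℕₚ.*-monoˡ-≤ (n * n * n * n) (ℕₚ.*-mono-≤ 6≤n 6≤n)) ⟩
    12 * (n * n * (n * n * n * n))          ≡⟨ solve 1 (λ n → con 12 :* (n :* n :* (n :* n :* n :* n))
                                                 := con 12 :* (n :* n :* n :* (n :* n :* n))) ≡.refl n ⟩
    12 * (n * n * n * (n * n * n))          ∎

  module _ {n : ℕ} (72≤n : 72 ≤ n) where
    private
      n⁵ : ℕ
      n⁵ = n * n * (n * n) * n

      scaled : ∀ c → c ≤ 864 → c * n⁵ ≤ 12 * (n * n * n * (n * n * n))
      scaled c le = begin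
        c * n⁵                            ≤⟨ ℕₚ.*-monoˡ-≤ n⁵ (ℕₚ.≤-trans le (ℕₚ.*-monoʳ-≤ 12 72≤n)) ⟩
        12 * n * n⁵                       ≡⟨ solve 1 (λ n → con 12 :* n :* (n :* n :* (n :* n) :* n)
                                               := con 12 :* (n :* n :* n :* (n :* n :* n))) ≡.refl n ⟩
        12 * (n * n * n * (n * n * n))    ∎

      nonZero : ℕ.NonZero n
      nonZero = ℕ.>-nonZero (ℕₚ.≤-trans (s≤s z≤n) 72≤n)

    -- For `M = 12n²` and `L = 2n` this is `864 n⁵ ≤ 12 n⁶`, the most demanding of the four bounds
    -- and the origin of `72 ≤ n`.
    marker-torsion : 3 * (12 * (n * n)) * (12 * (n * n)) * (2 * n) ≤ 12 * (n * n * n * (n * n * n))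
    marker-torsion = ℕₚ.≤-trans (ℕₚ.≤-reflexive (solve 1 (λ n → con 3 :* (con 12 :* (n :* n)) :* (con 12 :* (n :* n)) :* (con 2 :* n)
      := con 864 :* (n :* n :* (n :* n) :* n)) ≡.refl n)) (scaled 864 ℕₚ.≤-refl)

    tie-torsion : 3 * (n * n * (2 * n)) * (2 * n) * (2 * n) ≤ 12 * (n * n * n * (n * n * n))
    tie-torsion = ℕₚ.≤-trans (ℕₚ.≤-reflexive (solve 1 (λ n → con 3 :* (n :* n :* (con 2 :* n)) :* (con 2 :* n) :* (con 2 :* n)
      := con 24 :* (n :* n :* (n :* n) :* n)) ≡.refl n)) (scaled 24 (ℕₚ.m≤m+n 24 840))

    class-torsion : 3 * (2 * n) * (2 * n) * (2 * n) ≤ 12 * (n * n * n * (n * n * n))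
    class-torsion = begin
      3 * (2 * n) * (2 * n) * (2 * n)   ≡⟨ solve 1 (λ n → con 3 :* (con 2 :* n) :* (con 2 :* n) :* (con 2 :* n) := con 24 :* (n :* n :* n)) ≡.refl n ⟩
      24 * (n * n * n)                  ≤⟨ ℕₚ.*-monoʳ-≤ 24 (ℕₚ.m≤m*n (n * n * n) (n * n) {{ℕₚ.m*n≢0 n n {{nonZero}} {{nonZero}}}}) ⟩
      24 * (n * n * n * (n * n))        ≡⟨ solve 1 (λ n → con 24 :* (n :* n :* n :* (n :* n)) := con 24 :* (n :* n :* (n :* n) :* n)) ≡.refl n ⟩
      24 * n⁵                           ≤⟨ scaled 24 (ℕₚ.m≤m+n 24 840) ⟩
      12 * (n * n * n * (n * n * n))    ∎

    mixed-torsion : 2 * (2 * n * (2 * n) * (2 * n)) * (2 * n) ≤ 12 * (n * n * n * (n * n * n))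
    mixed-torsion = begin
      2 * (2 * n * (2 * n) * (2 * n)) * (2 * n) ≡⟨ solve 1 (λ n → con 2 :* (con 2 :* n :* (con 2 :* n) :* (con 2 :* n)) :* (con 2 :* n)
                                                     := con 32 :* (n :* n :* (n :* n))) ≡.refl n ⟩
      32 * (n * n * (n * n))                    ≤⟨ ℕₚ.*-monoʳ-≤ 32 (ℕₚ.m≤m*n (n * n * (n * n)) n {{nonZero}}) ⟩
      32 * n⁵                                   ≤⟨ scaled 32 (ℕₚ.m≤m+n 32 832) ⟩
      12 * (n * n * n * (n * n * n))            ∎

-- Lower bounds for the two order thresholds.

module Thresholds where
  open import Data.Nat.Solver using (module +-*-Solver)
  open +-*-Solver

  sixth : ℕ → ℕ
  sixth n = n * n * n * (n * n * n)

  -- The natural number `v` frees later comparisons with exponents from signs.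
  Exceeds : ℤ.ℤ → ℕ → Set
  Exceeds i n = Σ[ v ∈ ℕ ] i ≡ + v × n < v

  pos-minus : ∀ c {x} a → x ≡ c + a → + x - + c ≡ + a
  pos-minus c {x} a e = ≡.trans (≡.cong (λ x → + x - + c) e) (≡.trans (ℤₚ.m-n≡m⊖n (c + a) c)
    (≡.trans (ℤₚ.⊖-≥ (ℕₚ.m≤m+n c a)) (≡.cong +_ (ℕₚ.m+n∸m≡n c a))))

  private
    pos-square : ∀ n → (+ n) ℤ.^ 2 ≡ + (n * (n * 1))
    pos-square n = ≡.sym (≡.trans (ℤₚ.pos-* n (n * 1)) (≡.cong (+ n ℤ.*_) (ℤₚ.pos-* n 1)))

    quadratic : ∀ n d e a → 2 * (n * (n * 1)) + d * n ≡ e + a → + 2 ℤ.* (+ n) ℤ.^ 2 ℤ.+ + d ℤ.* + n - + e ≡ + a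
    quadratic n d e a h = ≡.trans (≡.cong₂ (λ x y → x ℤ.+ y - + e)
      (≡.trans (≡.cong (+ 2 ℤ.*_) (pos-square n)) (≡.sym (ℤₚ.pos-* 2 (n * (n * 1))))) (≡.sym (ℤₚ.pos-* d n)))
      (pos-minus e a h)

    twelve : ∀ n → 1 ≤ n → 12 * sixth n < 16 * sixth n
    twelve n 1≤n = ℕₚ.*-monoˡ-< (sixth n) {{ℕₚ.m*n≢0 _ _ {{cube}} {{cube}}}} (ℕₚ.m≤m+n 13 3)
      where
      positive = ℕ.>-nonZero 1≤n
      cube : ℕ.NonZero (n * n * n)
      cube = ℕₚ.m*n≢0 (n * n) n {{ℕₚ.m*n≢0 n n {{positive}} {{positive}}}} {{positive}}

    leading : ∀ m → 2 * (suc m * (suc m * 1)) + 3 * suc m ≡ 2 + (2 * (suc m * suc m) + suc (3 * m))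
    leading = solve 1 (λ m → con 2 :* ((con 1 :+ m) :* ((con 1 :+ m) :* con 1)) :+ con 3 :* (con 1 :+ m)
      := con 2 :+ (con 2 :* ((con 1 :+ m) :* (con 1 :+ m)) :+ (con 1 :+ con 3 :* m))) ≡.refl

    second : ∀ m → 2 * (suc m * (suc m * 1)) + 4 * suc m ≡ 1 + (2 * (suc m * suc m) + (3 + 4 * m))
    second = solve 1 (λ m → con 2 :* ((con 1 :+ m) :* ((con 1 :+ m) :* con 1)) :+ con 4 :* (con 1 :+ m)
      := con 1 :+ (con 2 :* ((con 1 :+ m) :* (con 1 :+ m)) :+ (con 3 :+ con 4 :* m))) ≡.refl

  -- The leading terms alone give `2 (2n²)² (2n²) = 16n⁶`; for positive `n` what they omit is not
  -- negative.
  F-exceeds : ∀ n → 1 ≤ n → Exceeds (F (+ n)) (12 * sixth n)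
  F-exceeds (suc m) 1≤n = 2 * (a * (a * 1)) * b , equation , ℕₚ.<-≤-trans (twelve n 1≤n) (ℕₚ.≤-trans
    (ℕₚ.≤-reflexive (solve 1 (λ n → con 16 :* (n :* n :* n :* (n :* n :* n))
      := con 2 :* (con 2 :* (n :* n) :* (con 2 :* (n :* n) :* con 1)) :* (con 2 :* (n :* n))) ≡.refl n))
    (ℕₚ.*-mono-≤ (ℕₚ.*-monoʳ-≤ 2 (ℕₚ.*-mono-≤ a≥ (ℕₚ.*-monoˡ-≤ 1 a≥))) (ℕₚ.m≤m+n (2 * (n * n)) (3 + 4 * m))))
    where
    n = suc m
    a = 2 * (n * n) + suc (3 * m)
    b = 2 * (n * n) + (3 + 4 * m)
    a≥ : 2 * (n * n) ≤ a
    a≥ = ℕₚ.m≤m+n (2 * (n * n)) (suc (3 * m))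
    equation : F (+ n) ≡ + (2 * (a * (a * 1)) * b)
    equation = ≡.trans (≡.cong₂ (λ x y → + 2 ℤ.* x ℤ.^ 2 ℤ.* y) (quadratic n 3 2 a (leading m)) (quadratic n 4 1 b (second m)))
      (≡.trans (≡.cong (λ x → + 2 ℤ.* x ℤ.* + b) (pos-square a))
      (≡.sym (≡.trans (ℤₚ.pos-* (2 * (a * (a * 1))) b) (≡.cong (ℤ._* + b) (ℤₚ.pos-* 2 (a * (a * 1)))))))

  -- Again `4 (2n²)² n n = 16n⁶`, so that both halves of the theorem reduce to the same torsion
  -- bound.
  F̌-exceeds : ∀ n → 1 ≤ n → Exceeds (F̌ (+ n)) (12 * sixth n)
  F̌-exceeds (suc m) 1≤n = 4 * (a * (a * 1)) * (n + 2) * n , equation , ℕₚ.<-≤-trans (twelve n 1≤n) (ℕₚ.≤-trans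
    (ℕₚ.≤-reflexive (solve 1 (λ n → con 16 :* (n :* n :* n :* (n :* n :* n))
      := con 4 :* (con 2 :* (n :* n) :* (con 2 :* (n :* n) :* con 1)) :* n :* n) ≡.refl n))
    (ℕₚ.*-monoˡ-≤ n (ℕₚ.*-mono-≤ (ℕₚ.*-monoʳ-≤ 4 (ℕₚ.*-mono-≤ a≥ (ℕₚ.*-monoˡ-≤ 1 a≥))) (ℕₚ.m≤m+n n 2))))
    where
    n = suc m
    a = 2 * (n * n) + suc (3 * m)
    a≥ : 2 * (n * n) ≤ a
    a≥ = ℕₚ.m≤m+n (2 * (n * n)) (suc (3 * m))
    equation : F̌ (+ n) ≡ + (4 * (a * (a * 1)) * (n + 2) * n)
    equation = ≡.trans (≡.cong (λ x → + 4 ℤ.* x ℤ.^ 2 ℤ.* + (n + 2) ℤ.* + n) (quadratic n 3 2 a (leading m)))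
      (≡.trans (≡.cong (λ x → + 4 ℤ.* x ℤ.* + (n + 2) ℤ.* + n) (pos-square a))
      (≡.sym (≡.trans (ℤₚ.pos-* (4 * (a * (a * 1)) * (n + 2)) n) (≡.cong (ℤ._* + n)
        (≡.trans (ℤₚ.pos-* (4 * (a * (a * 1))) (n + 2)) (≡.cong (ℤ._* + (n + 2)) (ℤₚ.pos-* 4 (a * (a * 1)))))))))

module Construction {c ℓ : Level} (em : ExcludedMiddle (c ⊔ ℓ)) (G : Group c ℓ) where
  open Group G hiding (_-_)
  open GroupProperties G using (⁻¹-involutive; ⁻¹-anti-homo-∙; ε⁻¹≈ε; ∙-cancelˡ; ∙-cancelʳ; x∙y⁻¹≈ε⇒x≈y)
  open Cayley G
  open GeneratingSet using (elements)

  -- Word equations, decided by free reduction.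

  module GroupSolver where

    infixl 7 _·_
    data Expr (n : ℕ) : Set where
      var : Fin n → Expr n
      one : Expr n
      _·_ : Expr n → Expr n → Expr n
      inv : Expr n → Expr n

    Word : ℕ → Set
    Word n = List (Bool × Fin n)

    signed : Bool → Carrier → Carrier
    signed true  x = x
    signed false x = x ⁻¹

    ⟦_⟧ : ∀ {n} → Expr n → Vec Carrier n → Carrier
    ⟦ var i ⟧ ρ = lookup ρ i
    ⟦ one ⟧ ρ = ε
    ⟦ a · b ⟧ ρ = ⟦ a ⟧ ρ ∙ ⟦ b ⟧ ρ
    ⟦ inv a ⟧ ρ = ⟦ a ⟧ ρ ⁻¹

    evalWord : ∀ {n} → Word n → Vec Carrier n → Carrier
    evalWord [] ρ = ε
    evalWord ((s , i) ∷ xs) ρ = signed s (lookup ρ i) ∙ evalWord xs ρ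

    cancels? : ∀ {n} (s : Bool) (i : Fin n) (t : Bool) (j : Fin n) → Dec (s ≡ not t × i ≡ j)
    cancels? s i t j with s Boolₚ.≟ not t | i Finₚ.≟ j
    ... | yes p | yes q = yes (p , q)
    ... | no ¬p | _     = no (¬p ∘ proj₁)
    ... | yes _ | no ¬q = no (¬q ∘ proj₂)

    push : ∀ {n} → Bool → Fin n → Word n → Word n
    push s i [] = (s , i) ∷ []
    push s i ((t , j) ∷ xs) with cancels? s i t j
    ... | yes _ = xs
    ... | no  _ = (s , i) ∷ (t , j) ∷ xs

    -- The sign tells whether `a` or its inverse is put in front of `xs`, which carries `inv` down
    -- to the variables. With an accumulator, cancellation happens only at the head of the word.
    normalise : ∀ {n} → Bool → Expr n → Word n → Word n
    normalise s (var i) xs = push s i xs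
    normalise s one xs = xs
    normalise true  (a · b) xs = normalise true a (normalise true b xs)
    normalise false (a · b) xs = normalise false b (normalise false a xs)
    normalise s (inv a) xs = normalise (not s) a xs

    cancel-signed : ∀ t x y → signed (not t) x ∙ (signed t x ∙ y) ≈ y
    cancel-signed true  x y =
      trans (sym (assoc _ _ _)) (trans (∙-congʳ (inverseˡ x)) (identityˡ y))
    cancel-signed false x y =
      trans (sym (assoc _ _ _)) (trans (∙-congʳ (inverseʳ x)) (identityˡ y))

    push-correct : ∀ {n} s (i : Fin n) xs ρ →
                   evalWord (push s i xs) ρ ≈ signed s (lookup ρ i) ∙ evalWord xs ρ
    push-correct s i [] ρ = refl
    push-correct s i ((t , j) ∷ xs) ρ with cancels? s i t j
    ... | yes (≡.refl , ≡.refl) = sym (cancel-signed t (lookup ρ i) (evalWord xs ρ))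
    ... | no _ = refl

    signed-not : ∀ s x → signed (not s) x ≈ signed s (x ⁻¹)
    signed-not true  x = refl
    signed-not false x = sym (⁻¹-involutive x)

    normalise-correct : ∀ {n} s (a : Expr n) xs ρ →
                        evalWord (normalise s a xs) ρ ≈ signed s (⟦ a ⟧ ρ) ∙ evalWord xs ρ
    normalise-correct s (var i) xs ρ = push-correct s i xs ρ
    normalise-correct true  one xs ρ = sym (identityˡ _)
    normalise-correct false one xs ρ = sym (trans (∙-congʳ ε⁻¹≈ε) (identityˡ _))
    normalise-correct true (a · b) xs ρ =
      trans (normalise-correct true a _ ρ)
        (trans (∙-congˡ (normalise-correct true b xs ρ)) (sym (assoc _ _ _)))
    normalise-correct false (a · b) xs ρ =
      trans (normalise-correct false b _ ρ)
        (trans (∙-congˡ (normalise-correct false a xs ρ))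
          (trans (sym (assoc _ _ _)) (∙-congʳ (sym (⁻¹-anti-homo-∙ _ _)))))
    normalise-correct s (inv a) xs ρ =
      trans (normalise-correct (not s) a xs ρ) (∙-congʳ (signed-not s _))

    ⟦_⇓⟧ : ∀ {n} → Expr n → Vec Carrier n → Carrier
    ⟦ a ⇓⟧ = evalWord (normalise true a [])

    correct : ∀ {n} (a : Expr n) ρ → ⟦ a ⇓⟧ ρ ≈ ⟦ a ⟧ ρ
    correct a ρ = trans (normalise-correct true a [] ρ) (identityʳ _)

    open Reflection setoid var ⟦_⟧ ⟦_⇓⟧ correct public using (solve; _⊜_)

    sandwich : ∀ p q {a b} → a ≈ b → p ∙ a ∙ q ≈ p ∙ b ∙ q
    sandwich p q a≈b = ∙-congʳ (∙-congˡ a≈b)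

  -- Finite subsets of the group and degrees in the ball.

  module Counting where
    open GroupSolver
    open Membership setoid public using () renaming (_∈_ to _∈ₗ_)
    open Uniqueness setoid using (Unique)

    dec : ∀ (P : Set (c ⊔ ℓ)) → Dec P
    dec P = em {P}

    -- Excluded middle is given at one level only; lifting brings equations and statements about
    -- exponents up to it.
    em≈ : ∀ {P : Set ℓ} → Dec P
    em≈ {P} = map′ lower lift (em {Lift c P})

    emℓ₀ : ∀ {P : Set} → Dec P
    emℓ₀ {P} = map′ lower lift (em {Lift (c ⊔ ℓ) P})

    _≈?_ : Decidable _≈_
    x ≈? y = em≈

    decSetoid : DecSetoid c ℓ
    decSetoid = record { Carrier = Carrier ; _≈_ = _≈_
      ; isDecEquivalence = record { isEquivalence = isEquivalence ; _≟_ = _≈?_ } }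

    nodup : List Carrier → List Carrier
    nodup = deduplicate _≈?_

    nodup-unique : ∀ xs → Unique (nodup xs)
    nodup-unique = DecUniquenessₚ.deduplicate-! decSetoid

    ∈-nodup⁺ : ∀ {xs x} → x ∈ₗ xs → x ∈ₗ nodup xs
    ∈-nodup⁺ = Membershipₚ.∈-deduplicate⁺ setoid _≈?_ (λ y≈z x≈y → trans x≈y (sym y≈z) )

    ∈-nodup⁻ : ∀ xs {x} → x ∈ₗ nodup xs → x ∈ₗ xs
    ∈-nodup⁻ = Membershipₚ.∈-deduplicate⁻ setoid _≈?_

    resp : ∀ {xs x y} → x ≈ y → x ∈ₗ xs → y ∈ₗ xs
    resp = Membershipₚ.∈-resp-≈ setoid

    fresh-in : ∀ {x y ys} → All (λ z → ¬ x ≈ z) ys → y ∈ₗ ys → ¬ x ≈ y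
    fresh-in (x≉ ∷ _) (here y≈) x≈y = x≉ (trans x≈y y≈)
    fresh-in (_ ∷ xs≉) (there y∈) = fresh-in xs≉ y∈

    unique-length : ∀ {xs} ys → Unique xs → (∀ {x} → x ∈ₗ xs → x ∈ₗ ys) → length xs ≤ length ys
    unique-length {[]} ys _ _ = z≤n
    unique-length {x ∷ xs} ys (x∉ ∷ u) sub with Membershipₚ.∈-∃++ setoid (sub (here refl))
    ... | as , bs , w , x≈w , ys≋ = ℕₚ.≤-trans (s≤s (unique-length (as ++ bs) u sub′)) (ℕₚ.≤-reflexive eq)
      where
      split : ∀ {y} → y ∈ₗ as ++ w ∷ bs → y ≈ w ⊎ y ∈ₗ as ++ bs
      split y∈ with Membershipₚ.∈-++⁻ setoid as y∈
      ... | inj₁ y∈as = inj₂ (Membershipₚ.∈-++⁺ˡ setoid y∈as)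
      ... | inj₂ (here y≈w) = inj₁ y≈w
      ... | inj₂ (there y∈bs) = inj₂ (Membershipₚ.∈-++⁺ʳ setoid as y∈bs)
      sub′ : ∀ {y} → y ∈ₗ xs → y ∈ₗ as ++ bs
      sub′ y∈ with split (Membershipₚ.∈-resp-≋ setoid ys≋ (sub (there y∈)))
      ... | inj₁ y≈w = contradiction (trans x≈w (sym y≈w)) (fresh-in x∉ y∈)
      ... | inj₂ y∈′ = y∈′
      eq : suc (length (as ++ bs)) ≡ length ys
      eq = ≡.trans (≡.cong suc (length-++ as)) (≡.trans (≡.sym (ℕₚ.+-suc (length as) (length bs)))
        (≡.trans (≡.sym (length-++ as)) (≡.sym (≋-length ys≋))))
        where open import Data.List.Relation.Binary.Equality.Setoid setoid using () renaming (≋-length to ≋-length)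

    injection-length : ∀ {xs} ys (f : Carrier → Carrier) → Unique xs →
      (∀ {x} → x ∈ₗ xs → f x ∈ₗ ys) →
      (∀ {x y} → x ∈ₗ xs → y ∈ₗ xs → f x ≈ f y → x ≈ y) → length xs ≤ length ys
    injection-length {xs} ys f u into inj =
      ℕₚ.≤-trans (ℕₚ.≤-reflexive (≡.sym (length-map f xs)))
        (unique-length ys (uniq xs u inj) λ y∈ → image xs into y∈)
      where
      image : ∀ zs → (∀ {x} → x ∈ₗ zs → f x ∈ₗ ys) → ∀ {y} → y ∈ₗ map f zs → y ∈ₗ ys
      image (z ∷ zs) h (here y≈) = resp (sym y≈) (h (here refl))
      image (z ∷ zs) h (there y∈) = image zs (h ∘ there) y∈
      apart : ∀ x zs → All (λ z → ¬ x ≈ z) zs →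
        (∀ {z} → z ∈ₗ zs → f x ≈ f z → x ≈ z) → All (λ y → ¬ f x ≈ y) (map f zs)
      apart x [] _ _ = []
      apart x (z ∷ zs) (x≉ ∷ x∉) h = (x≉ ∘ h (here refl)) ∷ apart x zs x∉ (h ∘ there)
      uniq : ∀ zs → Unique zs → (∀ {x y} → x ∈ₗ zs → y ∈ₗ zs → f x ≈ f y → x ≈ y) → Unique (map f zs)
      uniq [] _ _ = []
      uniq (z ∷ zs) (z∉ ∷ u) h = apart z zs z∉ (λ y∈ → h (here refl) (there y∈)) ∷ uniq zs u (λ p q → h (there p) (there q))

    neighbours : List Carrier → Carrier → List Carrier
    neighbours T v = filter (λ t → em {v ⁻¹ ∙ t ∈ₗ T ±}) (nodup (T ±))

    -- The degree of v in the ball of T, not counting the edge to ε.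
    degree : List Carrier → Carrier → ℕ
    degree T v = length (neighbours T v)

    adj-resp : ∀ T v {x y} → x ≈ y → v ⁻¹ ∙ x ∈ₗ T ± → v ⁻¹ ∙ y ∈ₗ T ±
    adj-resp T v x≈y = resp (∙-congˡ x≈y)

    ∈-neighbours⁺ : ∀ T v {t} → t ∈ₗ T ± → v ⁻¹ ∙ t ∈ₗ T ± → t ∈ₗ neighbours T v
    ∈-neighbours⁺ T v t∈ = Membershipₚ.∈-filter⁺ setoid _ (adj-resp T v) (∈-nodup⁺ t∈)

    ∈-neighbours⁻ : ∀ T v {t} → t ∈ₗ neighbours T v → t ∈ₗ T ± × v ⁻¹ ∙ t ∈ₗ T ±
    ∈-neighbours⁻ T v t∈ with Membershipₚ.∈-filter⁻ setoid (λ t → em {v ⁻¹ ∙ t ∈ₗ T ±}) (adj-resp T v) t∈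
    ... | t∈′ , adj = ∈-nodup⁻ (T ±) t∈′ , adj

    neighbours-unique : ∀ T v → Unique (neighbours T v)
    neighbours-unique T v = Uniquenessₚ.filter⁺ setoid _ (nodup-unique (T ±))

    degree-≤ : ∀ T v ys → (∀ {t} → t ∈ₗ T ± → v ⁻¹ ∙ t ∈ₗ T ± → t ∈ₗ ys) → degree T v ≤ length ys
    degree-≤ T v ys h = unique-length ys (neighbours-unique T v)
      λ t∈ → let (p , q) = ∈-neighbours⁻ T v t∈ in h p q

    degree-injection : ∀ T v T′ v′ (f : Carrier → Carrier) →
      (∀ {t} → t ∈ₗ T ± → v ⁻¹ ∙ t ∈ₗ T ± → f t ∈ₗ T′ ± × v′ ⁻¹ ∙ f t ∈ₗ T′ ±) →
      (∀ {s t} → s ∈ₗ T ± → t ∈ₗ T ± → f s ≈ f t → s ≈ t) → degree T v ≤ degree T′ v′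
    degree-injection T v T′ v′ f into inj =
      injection-length (neighbours T′ v′) f (neighbours-unique T v)
        (λ t∈ → let (p , q) = ∈-neighbours⁻ T v t∈ ; (p′ , q′) = into p q in ∈-neighbours⁺ T′ v′ p′ q′)
        (λ s∈ t∈ → inj (proj₁ (∈-neighbours⁻ T v s∈)) (proj₁ (∈-neighbours⁻ T v t∈)))

    degree-mono : ∀ T T′ v → (∀ {t} → t ∈ₗ T ± → v ⁻¹ ∙ t ∈ₗ T ± → t ∈ₗ T′ ± × v ⁻¹ ∙ t ∈ₗ T′ ±) →
      degree T v ≤ degree T′ v
    degree-mono T T′ v h = degree-injection T v T′ v id h (λ _ _ e → e)

    degree-suc : ∀ T T′ v {t} → (∀ {s} → s ∈ₗ T ± → s ∈ₗ T′ ±) →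
      ¬ t ∈ₗ T ± → t ∈ₗ T′ ± → v ⁻¹ ∙ t ∈ₗ T′ ± → degree T v < degree T′ v
    degree-suc T T′ v {t} sub t∉ t∈ adj = unique-length {t ∷ neighbours T v} (neighbours T′ v)
      (outside (neighbours T v) (λ s∈ → proj₁ (∈-neighbours⁻ T v s∈)) ∷ neighbours-unique T v) into
      where
      outside : ∀ zs → (∀ {s} → s ∈ₗ zs → s ∈ₗ T ±) → All (λ s → ¬ t ≈ s) zs
      outside [] _ = []
      outside (z ∷ zs) h = (λ t≈z → t∉ (resp (sym t≈z) (h (here refl)))) ∷ outside zs (h ∘ there)
      into : ∀ {s} → s ∈ₗ t ∷ neighbours T v → s ∈ₗ neighbours T′ v
      into (here s≈t) = resp (sym s≈t) (∈-neighbours⁺ T′ v t∈ adj)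
      into (there s∈) = let (p , q) = ∈-neighbours⁻ T v s∈ in ∈-neighbours⁺ T′ v (sub p) (sub q)

    -- Left multiplication by `v⁻¹` maps the common neighbours of `ε` and `v` to those of `v⁻¹` and
    -- `ε`.
    degree-inv-≤ : ∀ T v → degree T v ≤ degree T (v ⁻¹)
    degree-inv-≤ T v = degree-injection T v T (v ⁻¹) (v ⁻¹ ∙_)
      (λ {t} t∈ adj → adj , resp (solve 2 (λ a b → b ⊜ inv (inv a) · (inv a · b)) refl v t) t∈)
      (λ {s} {t} _ _ → ∙-cancelˡ (v ⁻¹) s t)

    degree-cong : ∀ T {v v′} → v ≈ v′ → degree T v ≡ degree T v′
    degree-cong T v≈v′ = ℕₚ.≤-antisym
      (degree-injection T _ T _ id (λ p q → p , resp (∙-congʳ (⁻¹-cong v≈v′)) q) (λ _ _ e → e))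
      (degree-injection T _ T _ id (λ p q → p , resp (∙-congʳ (⁻¹-cong (sym v≈v′))) q) (λ _ _ e → e))

    degree-inv : ∀ T v → degree T (v ⁻¹) ≡ degree T v
    degree-inv T v = ℕₚ.≤-antisym
      (ℕₚ.≤-trans (degree-inv-≤ T (v ⁻¹))
        (ℕₚ.≤-reflexive (degree-cong T (solve 1 (λ a → inv (inv a) ⊜ a) refl v))))
      (degree-inv-≤ T v)

  -- Powers of an element, its normalisers, and the choice of exponents.

  module Powers where
    open GroupSolver
    open Counting
    open Mult monoid using (×-homo-+; ×-assocˡ; ×-congˡ)
    open SetoidReasoning setoid

    -- In other words, conjugation by `u` sends `y` to itself or to its inverse; either way `u`
    -- normalises the subgroup generated by `y`.
    Commutes Inverts : Carrier → Carrier → Set ℓ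
    Commutes u y = y ∙ u ≈ u ∙ y
    Inverts u y = y ∙ u ∙ y ≈ u

    Torsionless : Carrier → ℕ → Set ℓ
    Torsionless z B = ∀ i → 1 ≤ i → i ≤ B → ¬ z ^ i ≈ ε

    ^-+ : ∀ y m n → y ^ (m + n) ≈ y ^ m ∙ y ^ n
    ^-+ y m n = ×-homo-+ y m n

    ^-comm : ∀ y m n → y ^ m ∙ y ^ n ≈ y ^ n ∙ y ^ m
    ^-comm y m n = begin
      y ^ m ∙ y ^ n ≈⟨ ^-+ y m n ⟨
      y ^ (m + n)   ≈⟨ ×-congˡ (ℕₚ.+-comm m n) ⟩
      y ^ (n + m)   ≈⟨ ^-+ y n m ⟩
      y ^ n ∙ y ^ m ∎

    ^-* : ∀ y m n → (y ^ n) ^ m ≈ y ^ (m * n)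
    ^-* y m n = ×-assocˡ y m n

    commutes-ε : ∀ u → Commutes u ε
    commutes-ε u = trans (identityˡ u) (sym (identityʳ u))

    commutes-∙ : ∀ {u x y} → Commutes u x → Commutes u y → Commutes u (x ∙ y)
    commutes-∙ {u} {x} {y} p q = begin
      x ∙ y ∙ u     ≈⟨ assoc _ _ _ ⟩
      x ∙ (y ∙ u)   ≈⟨ ∙-congˡ q ⟩
      x ∙ (u ∙ y)   ≈⟨ assoc _ _ _ ⟨
      x ∙ u ∙ y     ≈⟨ ∙-congʳ p ⟩
      u ∙ x ∙ y     ≈⟨ assoc _ _ _ ⟩
      u ∙ (x ∙ y)   ∎

    commutes-^ : ∀ {u y} n → Commutes u y → Commutes u (y ^ n)
    commutes-^ zero p = commutes-ε _
    commutes-^ (suc n) p = commutes-∙ p (commutes-^ n p)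

    commutes-resp : ∀ {u x y} → x ≈ y → Commutes u x → Commutes u y
    commutes-resp x≈y p = trans (∙-congʳ (sym x≈y)) (trans p (∙-congˡ x≈y))

    commutes-≈ : ∀ {u v y} → u ≈ v → Commutes v y → Commutes u y
    commutes-≈ e p = trans (∙-congˡ e) (trans p (∙-congʳ (sym e)))

    commutes-∙ˡ : ∀ {u v y} → Commutes u y → Commutes v y → Commutes (u ∙ v) y
    commutes-∙ˡ p q = sym (commutes-∙ (sym p) (sym q))

    inverts-resp : ∀ {u x y} → x ≈ y → Inverts u x → Inverts u y
    inverts-resp x≈y p = trans (∙-cong (∙-congʳ (sym x≈y)) (sym x≈y)) p

    commutes-inv : ∀ {u y} → Commutes u y → Commutes (u ⁻¹) y
    commutes-inv {u} {y} p = begin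
      y ∙ u ⁻¹ ≈⟨ solve 2 (λ u y → y · inv u ⊜ inv u · (u · y) · inv u) refl u y ⟩
      u ⁻¹ ∙ (u ∙ y) ∙ u ⁻¹ ≈⟨ sandwich (u ⁻¹) (u ⁻¹) p ⟨
      u ⁻¹ ∙ (y ∙ u) ∙ u ⁻¹ ≈⟨ solve 2 (λ u y → inv u · (y · u) · inv u ⊜ inv u · y) refl u y ⟩
      u ⁻¹ ∙ y ∎

    inverts-inv : ∀ {u y} → Inverts u y → Inverts (u ⁻¹) y
    inverts-inv {u} {y} p = begin
      y ∙ u ⁻¹ ∙ y ≈⟨ sandwich y y (⁻¹-cong p) ⟨
      y ∙ (y ∙ u ∙ y) ⁻¹ ∙ y ≈⟨ solve 2 (λ u y → y · inv (y · u · y) · y ⊜ inv u) refl u y ⟩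
      u ⁻¹ ∎

    inverts-∙ : ∀ {u x y} → x ∙ y ≈ y ∙ x → Inverts u x → Inverts u y → Inverts u (x ∙ y)
    inverts-∙ {u} {x} {y} xy p q = begin
      x ∙ y ∙ u ∙ (x ∙ y) ≈⟨ ∙-congˡ xy ⟩
      x ∙ y ∙ u ∙ (y ∙ x) ≈⟨ solve 3 (λ u x y → x · y · u · (y · x) ⊜ x · (y · u · y) · x) refl u x y ⟩
      x ∙ (y ∙ u ∙ y) ∙ x ≈⟨ sandwich x x q ⟩
      x ∙ u ∙ x ≈⟨ p ⟩
      u ∎

    inverts-square : ∀ {u y} → Inverts u y → Commutes (u ∙ u) y
    inverts-square {u} {y} p = begin
      y ∙ (u ∙ u)                 ≈⟨ ∙-congˡ (∙-congˡ p) ⟨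
      y ∙ (u ∙ (y ∙ u ∙ y))       ≈⟨ solve 2 (λ u y → y · (u · (y · u · y)) ⊜ y · u · y · u · y) refl u y ⟩
      y ∙ u ∙ y ∙ u ∙ y           ≈⟨ ∙-congʳ (∙-congʳ p) ⟩
      u ∙ u ∙ y                   ∎

    inverts-^ : ∀ {u y} n → Inverts u y → Inverts u (y ^ n)
    inverts-^ {u} {y} zero p = trans (identityʳ _) (identityˡ _)
    inverts-^ {u} {y} (suc n) p = inverts-∙ (sym (commutes-^ n refl)) p (inverts-^ n p)

    commutes-inverts : ∀ {u y} → Commutes u y → Inverts u y → y ∙ y ≈ ε
    commutes-inverts {u} {y} p q = ∙-cancelˡ u (y ∙ y) ε (begin
      u ∙ (y ∙ y) ≈⟨ assoc _ _ _ ⟨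
      u ∙ y ∙ y   ≈⟨ ∙-congʳ p ⟨
      y ∙ u ∙ y   ≈⟨ q ⟩
      u           ≈⟨ identityʳ u ⟨
      u ∙ ε       ∎)

    ^-square : ∀ z n → z ^ n ∙ z ^ n ≈ z ^ (2 * n)
    ^-square z n = trans (sym (^-+ z n n)) (×-congˡ (≡.cong (λ k → n + k) (≡.sym (ℕₚ.+-identityʳ n))))

    -- Both relations hold for `z^(ab)`, whose square is therefore trivial.
    commutes-inverts-^ : ∀ {u z a b B} → 1 ≤ a → 1 ≤ b → 2 * (a * b) ≤ B → Torsionless z B →
      Commutes u (z ^ a) → Inverts u (z ^ b) → ⊥
    commutes-inverts-^ {u} {z} {a} {b} 1≤a 1≤b le tl p q =
      tl (2 * (a * b)) (ℕₚ.*-mono-≤ {1} {2} (s≤s z≤n) (ℕₚ.*-mono-≤ 1≤a 1≤b)) le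
        (trans (sym (^-square z (a * b)))
          (commutes-inverts
            (commutes-resp (trans (^-* z b a) (×-congˡ (ℕₚ.*-comm b a))) (commutes-^ b p))
            (inverts-resp (^-* z a b) (inverts-^ a q))))

    torsionless-^ : ∀ {z} d {B B′} → 1 ≤ d → B * d ≤ B′ → Torsionless z B′ → Torsionless (z ^ d) B
    torsionless-^ {z} d 1≤d le tl i 1≤i i≤B eq =
      tl (i * d) (ℕₚ.*-mono-≤ 1≤i 1≤d) (ℕₚ.≤-trans (ℕₚ.*-monoˡ-≤ d i≤B) le) (trans (sym (^-* z i d)) eq)

    torsionless-≤ : ∀ {z B B′} → B ≤ B′ → Torsionless z B′ → Torsionless z B
    torsionless-≤ le tl i p q = tl i p (ℕₚ.≤-trans q le)

    NotNormal : Carrier → Carrier → ℕ → Set ℓ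
    NotNormal u y M = ∀ e → 1 ≤ e → e ≤ M → ¬ Commutes u (y ^ e) × ¬ Inverts u (y ^ e)

    notNormal-inv : ∀ {u y M} → NotNormal u y M → NotNormal (u ⁻¹) y M
    notNormal-inv {u} n e p q = proj₁ (n e p q) ∘ commutes-resp′ ∘ commutes-inv
                              , proj₂ (n e p q) ∘ inverts-resp′ ∘ inverts-inv
      where
      uu : u ⁻¹ ⁻¹ ≈ u
      uu = ⁻¹-involutive u
      commutes-resp′ : ∀ {y} → Commutes (u ⁻¹ ⁻¹) y → Commutes u y
      commutes-resp′ p = trans (∙-congˡ (sym uu)) (trans p (∙-congʳ uu))
      inverts-resp′ : ∀ {y} → Inverts (u ⁻¹ ⁻¹) y → Inverts u y
      inverts-resp′ p = trans (∙-congʳ (∙-congˡ (sym uu))) (trans p uu)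

    data Class (u y : Carrier) (M : ℕ) : Set ℓ where
      central   : ∀ e → 1 ≤ e → e ≤ M → Commutes u (y ^ e) → Class u y M
      inverting : ∀ e → 1 ≤ e → e ≤ M → Inverts u (y ^ e) → Class u y M
      generic   : NotNormal u y M → Class u y M

    classify : ∀ u y M → Class u y M
    classify u y M with em≈ {∃[ e ] 1 ≤ e × e ≤ M × Commutes u (y ^ e)}
    ... | yes (e , p , q , r) = central e p q r
    ... | no ¬c with em≈ {∃[ e ] 1 ≤ e × e ≤ M × Inverts u (y ^ e)}
    ...   | yes (e , p , q , r) = inverting e p q r
    ...   | no ¬i = generic λ e p q → (λ r → ¬c (e , p , q , r)) , (λ r → ¬i (e , p , q , r))

    InjectiveUpTo : ℕ → (ℕ → Carrier) → Set ℓ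
    InjectiveUpTo M f = ∀ m e → 1 ≤ m → 1 ≤ e → m + e ≤ M → ¬ f m ≈ f (m + e)

    -- An expression in a generic `u` takes different values at two exponents only when their
    -- distance is within the bound of `NotNormal`.
    InjectiveWithin : ℕ → (ℕ → Carrier) → Set ℓ
    InjectiveWithin L f = ∀ m e → 1 ≤ e → e ≤ L → ¬ f m ≈ f (m + e)

    within-upTo : ∀ {L f} → InjectiveWithin L f → InjectiveUpTo L f
    within-upTo inj m e _ 1≤e le = inj m e 1≤e (ℕₚ.≤-trans (ℕₚ.m≤n+m e m) le)

    -- An entry `(f , vs)` rules out the exponents `m` with `f m` in `vs`. For injective `f` each
    -- element of `vs` costs at most one exponent, so `total` bounds the loss.
    Forbidden : Set c
    Forbidden = List ((ℕ → Carrier) × List Carrier)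

    total : Forbidden → ℕ
    total [] = 0
    total ((f , vs) ∷ fs) = length vs + total fs

    Candidates : ℕ → List ℕ → Set
    Candidates M ms = AllPairs _<_ ms × All (λ m → 1 ≤ m × m ≤ M) ms

    -- By injectivity at most one candidate has the value `v`. The last component plays the role of
    -- the sublist relation: it carries whatever was known of the candidates over to the survivors.
    discard : ∀ {M f} v → InjectiveUpTo M f → ∀ ms → Candidates M ms →
      ∃[ ms′ ] Candidates M ms′ × length ms ≤ suc (length ms′) ×
               All (λ m → Lift c (¬ f m ≈ v)) ms′ × (∀ {P : ℕ → Set (c ⊔ ℓ)} → All P ms → All P ms′)
    discard v inj [] cs = [] , cs , z≤n , [] , λ _ → []
    discard {M} {f} v inj (m ∷ ms) (m< ∷ ap , (1≤m , m≤) ∷ bs) with f m ≈? v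
    ... | yes fm≈v = ms , (ap , bs) , ℕₚ.≤-refl , rest ms m< bs , λ { (_ ∷ ps) → ps }
      where
      rest : ∀ ns → All (m <_) ns → All (λ n → 1 ≤ n × n ≤ M) ns → All (λ n → Lift c (¬ f n ≈ v)) ns
      rest [] _ _ = []
      rest (n ∷ ns) (m<n ∷ ps) ((_ , n≤) ∷ qs) = lift differ ∷ rest ns ps qs
        where
        n≡ : m + (n ℕ.∸ m) ≡ n
        n≡ = ℕₚ.m+[n∸m]≡n (ℕₚ.<⇒≤ m<n)
        differ : ¬ f n ≈ v
        differ fn≈v = inj m (n ℕ.∸ m) 1≤m (ℕₚ.m<n⇒0<n∸m m<n)
          (ℕₚ.≤-trans (ℕₚ.≤-reflexive n≡) n≤)
          (trans fm≈v (trans (sym fn≈v) (reflexive (≡.cong f (≡.sym n≡)))))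
    ... | no fm≉v with discard v inj ms (ap , bs)
    ...   | ms′ , (ap′ , bs′) , le , av , sub =
      m ∷ ms′ , (lower-all m< ∷ ap′ , (1≤m , m≤) ∷ bs′) , s≤s le , lift fm≉v ∷ av ,
      λ { (p ∷ ps) → p ∷ sub ps }
      where
      lower-all : All (m <_) ms → All (m <_) ms′
      lower-all ps = All.map lower (sub (All.map (lift {ℓ = c ⊔ ℓ}) ps))

    discardAll : ∀ {M f} vs → InjectiveUpTo M f → ∀ ms → Candidates M ms →
      ∃[ ms′ ] Candidates M ms′ × length ms ≤ length vs + length ms′ ×
               All (λ m → ¬ f m ∈ₗ vs) ms′ × (∀ {P : ℕ → Set (c ⊔ ℓ)} → All P ms → All P ms′)
    discardAll [] inj ms cs = ms , cs , ℕₚ.≤-refl , All.universal (λ _ ()) ms , id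
    discardAll (v ∷ vs) inj ms cs with discard v inj ms cs
    ... | ms₁ , cs₁ , le₁ , av₁ , sub₁ with discardAll vs inj ms₁ cs₁
    ...   | ms₂ , cs₂ , le₂ , av₂ , sub₂ =
      ms₂ , cs₂ , ℕₚ.≤-trans le₁ (s≤s le₂) , All.zipWith (λ { (p , q) (here e) → lower p e ; (p , q) (there i) → q i }) (sub₂ av₁ , av₂) , sub₂ ∘ sub₁

    Avoids : Forbidden → ℕ → Set (c ⊔ ℓ)
    Avoids [] m = ⊤
    Avoids ((f , vs) ∷ fs) m = ¬ f m ∈ₗ vs × Avoids fs m

    InjectiveAll : ℕ → Forbidden → Set ℓ
    InjectiveAll M [] = ⊤
    InjectiveAll M ((f , vs) ∷ fs) = InjectiveUpTo M f × InjectiveAll M fs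

    survive : ∀ {M} fs → InjectiveAll M fs → ∀ ms → Candidates M ms → total fs < length ms →
      ∃[ ms′ ] Candidates M ms′ × 1 ≤ length ms′ × All (Avoids fs) ms′ ×
               (∀ {P : ℕ → Set (c ⊔ ℓ)} → All P ms → All P ms′)
    survive [] _ ms cs lt = ms , cs , lt , All.universal (λ _ → tt) ms , id
    survive ((f , vs) ∷ fs) (inj , injs) ms cs lt with discardAll vs inj ms cs
    ... | ms₁ , cs₁ , le₁ , av₁ , sub₁
      with survive fs injs ms₁ cs₁ (ℕₚ.+-cancelˡ-< (length vs) _ _ (ℕₚ.<-≤-trans lt le₁))
    ...   | ms₂ , cs₂ , le₂ , av₂ , sub₂ =
      ms₂ , cs₂ , le₂ , All.zip (sub₂ av₁ , av₂) , sub₂ ∘ sub₁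

    pick : ∀ M fs → InjectiveAll M fs → total fs < M → ∃[ m ] 1 ≤ m × m ≤ M × Avoids fs m
    pick M fs injs lt
      with survive fs injs (applyUpTo suc M)
        ( AllPairsₚ.applyUpTo⁺₁ suc M (λ i<j _ → s≤s i<j)
        , Allₚ.applyUpTo⁺₁ suc M (λ i<M → s≤s z≤n , i<M))
        (ℕₚ.<-≤-trans lt (ℕₚ.≤-reflexive (≡.sym (length-applyUpTo suc M))))
    ... | m ∷ _ , (_ , (1≤m , m≤M) ∷ _) , _ , av ∷ _ , _ = m , 1≤m , m≤M , av

    WithinAll : ℕ → Forbidden → Set ℓ
    WithinAll L [] = ⊤
    WithinAll L ((f , vs) ∷ fs) = InjectiveWithin L f × WithinAll L fs

    private
      translate : ℕ → Forbidden → Forbidden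
      translate a [] = []
      translate a ((f , vs) ∷ fs) = ((λ m → f (a + m)) , vs) ∷ translate a fs

      translate-total : ∀ a fs → total (translate a fs) ≡ total fs
      translate-total a [] = ≡.refl
      translate-total a ((f , vs) ∷ fs) = ≡.cong (λ k → length vs + k) (translate-total a fs)

      translate-injective : ∀ {L} a fs → WithinAll L fs → InjectiveAll L (translate a fs)
      translate-injective a [] _ = tt
      translate-injective a ((f , vs) ∷ fs) (inj , injs) =
        within-upTo (λ m e p q eq → inj (a + m) e p q (trans eq (reflexive (≡.cong f (≡.sym (ℕₚ.+-assoc a m e))))))
        , translate-injective a fs injs

      translate-avoids : ∀ {m} a fs → Avoids (translate a fs) m → Avoids fs (a + m)
      translate-avoids a [] _ = tt
      translate-avoids a ((f , vs) ∷ fs) (p , ps) = p , translate-avoids a fs ps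

    -- The gs are injective on short ranges only, hence one candidate in each of
    -- Q consecutive windows of length L.
    windows : ∀ L gs → WithinAll L gs → total gs < L → ∀ a Q →
      ∃[ ms ] AllPairs _<_ ms × All (λ m → a < m × m ≤ a + Q * L) ms × length ms ≡ Q × All (Avoids gs) ms
    windows L gs inj lt a zero = [] , [] , [] , ≡.refl , []
    windows L gs inj lt a (suc Q)
      with pick L (translate a gs) (translate-injective a gs inj) (≡.subst (_< L) (≡.sym (translate-total a gs)) lt)
         | windows L gs inj lt (a + L) Q
    ... | m , 1≤m , m≤L , av | ms , ap , bs , len , avs =
      a + m ∷ ms , All.map (λ (p , _) → ℕₚ.≤-<-trans (ℕₚ.+-monoʳ-≤ a m≤L) p) bs ∷ ap
      , (ℕₚ.m<m+n a 1≤m , ℕₚ.+-monoʳ-≤ a (ℕₚ.≤-trans m≤L (ℕₚ.m≤m+n L (Q * L))))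
        ∷ All.map (λ (p , q) → ℕₚ.≤-<-trans (ℕₚ.m≤m+n a L) p , ℕₚ.≤-trans q (ℕₚ.≤-reflexive (ℕₚ.+-assoc a L (Q * L)))) bs
      , ≡.cong suc len , translate-avoids a gs av ∷ avs

    -- The `gs` leave one candidate in each of `Q` windows. The functions in `fs` are injective on
    -- the whole range, so each of the fewer than `Q` elements that they forbid destroys at most one
    -- of these candidates.
    pickWindows : ∀ L Q gs fs → WithinAll L gs → total gs < L → InjectiveAll (Q * L) fs → total fs < Q →
      ∃[ m ] 1 ≤ m × m ≤ Q * L × Avoids gs m × Avoids fs m
    pickWindows L Q gs fs within lt inj lt′ with windows L gs within lt 0 Q
    ... | ms , ap , bs , len , avs
      with survive fs inj ms (ap , bs) (ℕₚ.<-≤-trans lt′ (ℕₚ.≤-reflexive (≡.sym len)))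
    ...   | m ∷ _ , (_ , (1≤m , m≤) ∷ _) , _ , av ∷ _ , sub = m , 1≤m , m≤ , All.head (sub avs) , av

    injective-^ : ∀ {y M} → Torsionless y M → InjectiveUpTo M (y ^_)
    injective-^ {y} tl m e 1≤m 1≤e le eq = tl e 1≤e (ℕₚ.≤-trans (ℕₚ.m≤n+m e m) le)
      (∙-cancelˡ (y ^ m) (y ^ e) ε (begin
        y ^ m ∙ y ^ e ≈⟨ ^-+ y m e ⟨
        y ^ (m + e)   ≈⟨ eq ⟨
        y ^ m         ≈⟨ identityʳ _ ⟨
        y ^ m ∙ ε     ∎))

    injective-multiple : ∀ {y M} d → 1 ≤ d → Torsionless y (d * M) → InjectiveUpTo M (λ m → y ^ (d * m))
    injective-multiple {y} {M} d 1≤d tl m e 1≤m 1≤e le eq =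
      injective-^ {y ^ d} (torsionless-^ d 1≤d (ℕₚ.≤-reflexive (ℕₚ.*-comm M d)) tl) m e 1≤m 1≤e le
        (trans (shift m) (trans eq (sym (shift (m + e)))))
      where
      shift : ∀ m → (y ^ d) ^ m ≈ y ^ (d * m)
      shift m = trans (^-* y m d) (×-congˡ (ℕₚ.*-comm m d))

    square cube : Carrier → Carrier
    square w = w ∙ w
    cube w = w ∙ w ∙ w

    injective-square : ∀ {y M} → Torsionless y (3 * M) → InjectiveUpTo M (λ m → square (y ^ m))
    injective-square {y} {M} tl m e p q r eq =
      injective-multiple {y} 2 (s≤s z≤n) (torsionless-≤ (ℕₚ.*-monoˡ-≤ M {2} {3} (s≤s (s≤s z≤n))) tl) m e p q r
        (trans (sym (^-square y m)) (trans eq (^-square y (m + e))))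

    injective-cube : ∀ {y M} → Torsionless y (3 * M) → InjectiveUpTo M (λ m → cube (y ^ m))
    injective-cube {y} {M} tl m e p q r eq =
      injective-multiple {y} 3 (s≤s z≤n) tl m e p q r (trans (cubed m) (trans eq (sym (cubed (m + e)))))
      where
      cubed : ∀ m → y ^ (3 * m) ≈ cube (y ^ m)
      cubed m = trans (^-+ y m (2 * m)) (trans (∙-congˡ (sym (^-square y m))) (sym (assoc _ _ _)))

    -- Two solutions m and m + e of an equation yᵐ u y^{±m} = v show that u
    -- inverts or commutes with yᵉ.
    module _ {u y : Carrier} {M : ℕ} (n : NotNormal u y M) where

      private
        powers : ∀ m e → y ^ (m + e) ≈ y ^ e ∙ y ^ m
        powers m e = trans (^-+ y m e) (^-comm y m e)

      injective-⁺⁺ : InjectiveWithin M (λ m → y ^ m ∙ u ∙ y ^ m)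
      injective-⁺⁺ m e q r eq = proj₂ (n e q r) (begin
        y ^ e ∙ u ∙ y ^ e
          ≈⟨ solve 3 (λ a b u → b · u · b ⊜ inv a · (a · b · u · (b · a)) · inv a) refl (y ^ m) (y ^ e) u ⟩
        (y ^ m) ⁻¹ ∙ (y ^ m ∙ y ^ e ∙ u ∙ (y ^ e ∙ y ^ m)) ∙ (y ^ m) ⁻¹
          ≈⟨ sandwich _ _ (∙-cong (∙-congʳ (^-+ y m e)) (powers m e)) ⟨
        (y ^ m) ⁻¹ ∙ (y ^ (m + e) ∙ u ∙ y ^ (m + e)) ∙ (y ^ m) ⁻¹ ≈⟨ sandwich _ _ eq ⟨
        (y ^ m) ⁻¹ ∙ (y ^ m ∙ u ∙ y ^ m) ∙ (y ^ m) ⁻¹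
          ≈⟨ solve 2 (λ a u → inv a · (a · u · a) · inv a ⊜ u) refl (y ^ m) u ⟩
        u ∎)

      injective-⁻⁺ : InjectiveWithin M (λ m → (y ^ m) ⁻¹ ∙ u ∙ y ^ m)
      injective-⁻⁺ m e q r eq = proj₁ (n e q r) (begin
        y ^ e ∙ u
          ≈⟨ solve 3 (λ a b u → b · u ⊜ b · a · (inv a · u · a) · inv a) refl (y ^ m) (y ^ e) u ⟩
        y ^ e ∙ y ^ m ∙ ((y ^ m) ⁻¹ ∙ u ∙ y ^ m) ∙ (y ^ m) ⁻¹ ≈⟨ sandwich _ _ eq ⟩
        y ^ e ∙ y ^ m ∙ ((y ^ (m + e)) ⁻¹ ∙ u ∙ y ^ (m + e)) ∙ (y ^ m) ⁻¹
          ≈⟨ sandwich _ _ (∙-cong (∙-congʳ (⁻¹-cong (powers m e))) (powers m e)) ⟩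
        y ^ e ∙ y ^ m ∙ ((y ^ e ∙ y ^ m) ⁻¹ ∙ u ∙ (y ^ e ∙ y ^ m)) ∙ (y ^ m) ⁻¹
          ≈⟨ solve 3 (λ a b u → b · a · (inv (b · a) · u · (b · a)) · inv a ⊜ u · b) refl (y ^ m) (y ^ e) u ⟩
        u ∙ y ^ e ∎)

      injective-⁺⁻ : InjectiveWithin M (λ m → y ^ m ∙ u ∙ (y ^ m) ⁻¹)
      injective-⁺⁻ m e q r eq = proj₁ (n e q r) (sym (begin
        u ∙ y ^ e
          ≈⟨ solve 3 (λ a b u → u · b ⊜ inv a · (a · u · inv a) · (a · b)) refl (y ^ m) (y ^ e) u ⟩
        (y ^ m) ⁻¹ ∙ (y ^ m ∙ u ∙ (y ^ m) ⁻¹) ∙ (y ^ m ∙ y ^ e) ≈⟨ sandwich _ _ eq ⟩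
        (y ^ m) ⁻¹ ∙ (y ^ (m + e) ∙ u ∙ (y ^ (m + e)) ⁻¹) ∙ (y ^ m ∙ y ^ e)
          ≈⟨ sandwich _ _ (∙-cong (∙-congʳ (^-+ y m e)) (⁻¹-cong (^-+ y m e))) ⟩
        (y ^ m) ⁻¹ ∙ (y ^ m ∙ y ^ e ∙ u ∙ (y ^ m ∙ y ^ e) ⁻¹) ∙ (y ^ m ∙ y ^ e)
          ≈⟨ solve 3 (λ a b u → inv a · (a · b · u · inv (a · b)) · (a · b) ⊜ b · u) refl (y ^ m) (y ^ e) u ⟩
        y ^ e ∙ u ∎))

      injective-⁻⁻ : InjectiveWithin M (λ m → (y ^ m) ⁻¹ ∙ u ∙ (y ^ m) ⁻¹)
      injective-⁻⁻ m e q r eq = proj₂ (n e q r) (flipped (sym (begin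
        u ≈⟨ solve 2 (λ a u → u ⊜ a · (inv a · u · inv a) · a) refl (y ^ m) u ⟩
        y ^ m ∙ ((y ^ m) ⁻¹ ∙ u ∙ (y ^ m) ⁻¹) ∙ y ^ m ≈⟨ sandwich _ _ eq ⟩
        y ^ m ∙ ((y ^ (m + e)) ⁻¹ ∙ u ∙ (y ^ (m + e)) ⁻¹) ∙ y ^ m
          ≈⟨ sandwich _ _ (∙-cong (∙-congʳ (⁻¹-cong (powers m e))) (⁻¹-cong (^-+ y m e))) ⟩
        y ^ m ∙ ((y ^ e ∙ y ^ m) ⁻¹ ∙ u ∙ (y ^ m ∙ y ^ e) ⁻¹) ∙ y ^ m
          ≈⟨ solve 3 (λ a b u → a · (inv (b · a) · u · inv (a · b)) · a ⊜ inv b · u · inv b) refl (y ^ m) (y ^ e) u ⟩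
        (y ^ e) ⁻¹ ∙ u ∙ (y ^ e) ⁻¹ ∎)))
        where
        flipped : (y ^ e) ⁻¹ ∙ u ∙ (y ^ e) ⁻¹ ≈ u → y ^ e ∙ u ∙ y ^ e ≈ u
        flipped p = trans (sandwich _ _ (sym p))
          (solve 2 (λ b u → b · (inv b · u · inv b) · b ⊜ u) refl (y ^ e) u)

  -- Gadgets, and the invariants that survive their addition.

  module Gadgets where
    open GroupSolver
    open Counting

    Ball₁ : List Carrier → List Carrier
    Ball₁ T = ε ∷ T ±

    ∈-inv : ∀ T {x} → x ∈ₗ T ± → x ⁻¹ ∈ₗ T ±
    ∈-inv T = ±-sym T

    ∈-inv⁻ : ∀ T {x} → x ⁻¹ ∈ₗ T ± → x ∈ₗ T ±
    ∈-inv⁻ T {x} x∈ = resp (solve 1 (λ x → inv (inv x) ⊜ x) refl x) (∈-inv T x∈)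

    Ball₁-inv : ∀ T {x} → x ∈ₗ Ball₁ T → x ⁻¹ ∈ₗ Ball₁ T
    Ball₁-inv T (here x≈ε) = here (trans (⁻¹-cong x≈ε) (ε⁻¹≈ε))
    Ball₁-inv T (there x∈) = there (∈-inv T x∈)

    ±-⊆ : ∀ T T′ → (∀ {x} → x ∈ₗ T → x ∈ₗ T′) → ∀ {x} → x ∈ₗ T ± → x ∈ₗ T′ ±
    ±-⊆ T T′ sub = ±-mono {T} {T′} sub

    ∈-±ˡ : ∀ {T x} → x ∈ₗ T → x ∈ₗ T ±
    ∈-±ˡ = Membershipₚ.∈-++⁺ˡ setoid

    ∈-±⁻ : ∀ T {x} → x ∈ₗ T ± → x ∈ₗ T ⊎ x ⁻¹ ∈ₗ T
    ∈-±⁻ T {x} x∈ with Membershipₚ.∈-++⁻ setoid T x∈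
    ... | inj₁ p = inj₁ p
    ... | inj₂ p with Membershipₚ.∈-map⁻ setoid setoid p
    ...   | s , s∈ , x≈ = inj₂ (resp (sym (trans (⁻¹-cong x≈) (⁻¹-involutive s))) s∈)

    ∈-±⁺ : ∀ T {x} → x ∈ₗ T ⊎ x ⁻¹ ∈ₗ T → x ∈ₗ T ±
    ∈-±⁺ T (inj₁ p) = ∈-±ˡ p
    ∈-±⁺ T (inj₂ p) = ∈-inv⁻ T (∈-±ˡ p)

    ±-++⁻ : ∀ W T {x} → x ∈ₗ (W ++ T) ± → x ∈ₗ W ± ⊎ x ∈ₗ T ±
    ±-++⁻ W T x∈ with ∈-±⁻ (W ++ T) x∈
    ... | inj₁ p = [ inj₁ ∘ ∈-±ˡ , inj₂ ∘ ∈-±ˡ ]′ (Membershipₚ.∈-++⁻ setoid W p)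
    ... | inj₂ p = [ inj₁ ∘ ∈-±⁺ W ∘ inj₂ , inj₂ ∘ ∈-±⁺ T ∘ inj₂ ]′ (Membershipₚ.∈-++⁻ setoid W p)

    ±-++ˡ : ∀ W T {x} → x ∈ₗ W ± → x ∈ₗ (W ++ T) ±
    ±-++ˡ W T = ±-⊆ W (W ++ T) (Membershipₚ.∈-++⁺ˡ setoid)

    ±-++ʳ : ∀ W T {x} → x ∈ₗ T ± → x ∈ₗ (W ++ T) ±
    ±-++ʳ W T = ±-⊆ T (W ++ T) (Membershipₚ.∈-++⁺ʳ setoid W)

    -- The ball of radius two around `ε`.
    Product : List Carrier → Carrier → Set (c ⊔ ℓ)
    Product T x = ∃[ o ] ∃[ o′ ] o ∈ₗ Ball₁ T × o′ ∈ₗ Ball₁ T × x ≈ o ∙ o′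

    product-resp : ∀ T {x y} → x ≈ y → Product T x → Product T y
    product-resp T x≈y (o , o′ , p , q , e) = o , o′ , p , q , trans (sym x≈y) e

    product-inv : ∀ T {x} → Product T x → Product T (x ⁻¹)
    product-inv T (o , o′ , p , q , e) = o′ ⁻¹ , o ⁻¹ , Ball₁-inv T q , Ball₁-inv T p
      , trans (⁻¹-cong e) (⁻¹-anti-homo-∙ o o′)

    product-∈ : ∀ T {x} → x ∈ₗ T ± → Product T x
    product-∈ T {x} x∈ = x , ε , there x∈ , here refl , sym (identityʳ x)

    product-∙ : ∀ T {x y} → x ∈ₗ T ± → y ∈ₗ T ± → Product T (x ∙ y)
    product-∙ T {x} {y} p q = x , y , there p , there q , refl

    product-mono : ∀ T T′ → (∀ {x} → x ∈ₗ T ± → x ∈ₗ T′ ±) → ∀ {x} → Product T x → Product T′ x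
    product-mono T T′ sub (o , o′ , p , q , e) = o , o′ , lift∈ p , lift∈ q , e
      where
      lift∈ : ∀ {x} → x ∈ₗ Ball₁ T → x ∈ₗ Ball₁ T′
      lift∈ (here e) = here e
      lift∈ (there p) = there (sub p)

    module Family {n : ℕ} (T : List Carrier) (a : Fin n → Carrier)
                  (fresh : ∀ i → ¬ Product T (a i)) where

      W T′ : List Carrier
      W = tabulate a
      T′ = W ++ T

      old⊆ : ∀ {x} → x ∈ₗ T ± → x ∈ₗ T′ ±
      old⊆ = ±-++ʳ W T

      new⊆ : ∀ {x} → x ∈ₗ W ± → x ∈ₗ T′ ±
      new⊆ = ±-++ˡ W T

      signed⁻ : ∀ {r} → r ∈ₗ W ± → ∃[ i ] (r ≈ a i ⊎ r ≈ a i ⁻¹)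
      signed⁻ {r} r∈ with ∈-±⁻ W r∈
      ... | inj₁ p = let (i , e) = Membershipₚ.∈-tabulate⁻ setoid p in i , inj₁ e
      ... | inj₂ p = let (i , e) = Membershipₚ.∈-tabulate⁻ setoid p in i ,
        inj₂ (trans (sym (⁻¹-involutive r)) (⁻¹-cong e))

      pos : ∀ i → a i ∈ₗ W ±
      pos i = ∈-±ˡ (Membershipₚ.∈-tabulate⁺ setoid i)

      neg : ∀ i → a i ⁻¹ ∈ₗ W ±
      neg i = ∈-inv W (pos i)

      new-fresh : ∀ {r} → r ∈ₗ W ± → ¬ Product T r
      new-fresh {r} r∈ pr with signed⁻ r∈
      ... | i , inj₁ e = fresh i (product-resp T e pr)
      ... | i , inj₂ e = fresh i (product-resp T
        (trans (⁻¹-cong e) (⁻¹-involutive (a i))) (product-inv T pr))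

      -- An old `x` of this kind gains `r` as a common neighbour with `ε`, and by `old-edge` this is
      -- the only way in which its degree can grow.
      Value : Carrier → Set (c ⊔ ℓ)
      Value x = ∃[ r ] r ∈ₗ W ± × x ⁻¹ ∙ r ∈ₗ W ±

      from-quotient : ∀ {x y} → x ∈ₗ T ± → x ⁻¹ ∙ y ∈ₗ T ± → Product T y
      from-quotient {x} {y} p q =
        product-resp T (solve 2 (λ x y → x · (inv x · y) ⊜ y) refl x y) (product-∙ T p q)

      quotient-product : ∀ {x y} → x ∈ₗ T ± → y ∈ₗ T ± → Product T (x ⁻¹ ∙ y)
      quotient-product p q = product-∙ T (∈-inv T p) q

      -- If only one of `s` and `t⁻¹ s` were new, it would be a product of two old elements, against
      -- freshness.
      old-edge : ∀ {t s} → t ∈ₗ T ± → s ∈ₗ T′ ± → t ⁻¹ ∙ s ∈ₗ T′ ± →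
                 (s ∈ₗ T ± × t ⁻¹ ∙ s ∈ₗ T ±) ⊎ (s ∈ₗ W ± × t ⁻¹ ∙ s ∈ₗ W ±)
      old-edge t∈ s∈ e∈ with ±-++⁻ W T s∈ | ±-++⁻ W T e∈
      ... | inj₁ s∈W | inj₁ e∈W = inj₂ (s∈W , e∈W)
      ... | inj₁ s∈W | inj₂ e∈T = contradiction (from-quotient t∈ e∈T) (new-fresh s∈W)
      ... | inj₂ s∈T | inj₁ e∈W = contradiction (quotient-product t∈ s∈T) (new-fresh e∈W)
      ... | inj₂ s∈T | inj₂ e∈T = inj₁ (s∈T , e∈T)

      degree-unchanged : ∀ {t} → t ∈ₗ T ± → ¬ Value t → degree T′ t ≡ degree T t
      degree-unchanged {t} t∈ nv = ℕₚ.≤-antisym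
        (degree-mono T′ T t λ s∈ e∈ →
          [ id , (λ (p , q) → contradiction (_ , p , q) nv) ]′ (old-edge t∈ s∈ e∈))
        (degree-mono T T′ t λ p q → old⊆ p , old⊆ q)

      degree-grows : ∀ {t} → t ∈ₗ T ± → Value t → degree T t < degree T′ t
      degree-grows {t} t∈ (r , r∈ , q) =
        degree-suc T T′ t old⊆ (λ r∈T → new-fresh r∈ (product-∈ T r∈T)) (new⊆ r∈) (new⊆ q)

      -- The product of two inverses is recorded through `x ⁻¹`, so that an analysis of the products
      -- `a i ∙ a j` serves for both signs.
      value⁻ : ∀ {x} → Value x →
        ∃[ i ] ∃[ j ] (x ≈ a i ∙ a j ⁻¹ ⊎ x ≈ a i ∙ a j ⊎ x ⁻¹ ≈ a i ∙ a j ⊎ x ≈ a i ⁻¹ ∙ a j)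
      value⁻ {x} (r , r∈ , q) with signed⁻ r∈ | signed⁻ q
      ... | i , inj₁ e | j , inj₁ e′ = i , j , inj₁
        (trans (solve 2 (λ x r → x ⊜ r · inv (inv x · r)) refl x r) (∙-cong e (⁻¹-cong e′)))
      ... | i , inj₁ e | j , inj₂ e′ = i , j , inj₂ (inj₁
        (trans (solve 2 (λ x r → x ⊜ r · inv (inv x · r)) refl x r)
          (∙-cong e (trans (⁻¹-cong e′) (⁻¹-involutive (a j))))))
      ... | i , inj₂ e | j , inj₁ e′ = j , i , inj₂ (inj₂ (inj₁
        (trans (solve 2 (λ x r → inv x ⊜ inv x · r · inv r) refl x r)
          (∙-cong e′ (trans (⁻¹-cong e) (⁻¹-involutive (a i)))))))
      ... | i , inj₂ e | j , inj₂ e′ = i , j , inj₂ (inj₂ (inj₂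
        (trans (solve 2 (λ x r → x ⊜ r · inv (inv x · r)) refl x r)
          (∙-cong e (trans (⁻¹-cong e′) (⁻¹-involutive (a j)))))))

      ε∉-new : ¬ ε ∈ₗ T ± → ¬ ε ∈ₗ T′ ±
      ε∉-new ε∉ ε∈ = [ (λ p → new-fresh p (ε , ε , here refl , here refl , sym (identityˡ ε))) , ε∉ ]′
                       (±-++⁻ W T ε∈)

      module _ (quotient : ∀ i j → Product T (a i ∙ a j ⁻¹)) where

        -- Otherwise one of the new elements would have the form `a i ∙ a j ⁻¹`, which `quotient`
        -- makes a product of two old elements.
        conjugate∉W : ∀ i j → ¬ a i ⁻¹ ∙ a j ∈ₗ W ±
        conjugate∉W i j r∈ with signed⁻ r∈
        ... | l , inj₁ e = fresh i (product-resp T (trans (∙-congˡ (⁻¹-cong (sym e)))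
                (solve 2 (λ x y → y · inv (inv x · y) ⊜ x) refl (a i) (a j))) (quotient j l))
        ... | l , inj₂ e = fresh j (product-resp T (trans (∙-congˡ (sym e))
                (solve 2 (λ x y → x · (inv x · y) ⊜ y) refl (a i) (a j))) (quotient i l))

        square∉W : ∀ i → (∀ l → ¬ a i ∙ a i ∙ a l ≈ ε) → ¬ a i ⁻¹ ∙ a i ⁻¹ ∈ₗ W ±
        square∉W i cubes r∈ with signed⁻ r∈
        ... | l , inj₁ e = cubes l (trans (∙-congˡ (sym e))
                (solve 1 (λ x → x · x · (inv x · inv x) ⊜ one) refl (a i)))
        ... | l , inj₂ e = fresh i (product-resp T (trans (∙-congʳ (trans (sym (⁻¹-involutive (a l))) (⁻¹-cong (sym e))))
                (solve 1 (λ x → inv (inv x · inv x) · inv x ⊜ x) refl (a i))) (quotient l i))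

      -- The indices of div and con differ from i because ε ∉ T′ ±.
      data Neighbour (i : Fin n) (t : Carrier) : Set (c ⊔ ℓ) where
        div  : ∀ j → t ≈ a i ∙ a j ⁻¹ → t ∈ₗ T ± → Neighbour i t
        prod : ∀ j → t ≈ a i ∙ a j → t ∈ₗ T ± → Neighbour i t
        con  : ∀ j → t ≈ a j → a i ⁻¹ ∙ a j ∈ₗ T′ ± → Neighbour i t
        opp  : ∀ j → t ≈ a j ⁻¹ → a i ⁻¹ ∙ a j ⁻¹ ∈ₗ T′ ± → Neighbour i t

      -- At least one of `t` and `a i ⁻¹ ∙ t` is new: if both were old, `a i` would be a product of
      -- two old elements.
      neighbour : ∀ i {t} → t ∈ₗ T′ ± → a i ⁻¹ ∙ t ∈ₗ T′ ± → Neighbour i t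
      neighbour i {t} t∈ e∈ with ±-++⁻ W T t∈
      ... | inj₁ t∈W with signed⁻ t∈W
      ...   | j , inj₁ e = con j e (resp (∙-congˡ e) e∈)
      ...   | j , inj₂ e = opp j e (resp (∙-congˡ e) e∈)
      neighbour i {t} t∈ e∈ | inj₂ t∈T with ±-++⁻ W T e∈
      ... | inj₂ e∈T = contradiction
        (product-resp T (solve 2 (λ x y → y · inv (inv x · y) ⊜ x) refl (a i) t)
          (product-∙ T t∈T (∈-inv T e∈T))) (fresh i)
      ... | inj₁ e∈W with signed⁻ e∈W
      ...   | j , inj₁ e = prod j (trans (solve 2 (λ x y → y ⊜ x · (inv x · y)) refl (a i) t) (∙-congˡ e)) t∈T
      ...   | j , inj₂ e = div j (trans (solve 2 (λ x y → y ⊜ x · (inv x · y)) refl (a i) t) (∙-congˡ e)) t∈T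

    -- The setting for the construction: V lists one representative of every
    -- coloured pair {v , v⁻¹}, and Related i p q says that a common neighbour of
    -- p and q which is not coloured is evidence for Conclusion i p q.
    record Setting : Set (Level.suc (c ⊔ ℓ)) where
      field
        V          : List Carrier
        Index      : Set
        Related    : Index → Carrier → Carrier → Set (c ⊔ ℓ)
        Conclusion : Index → Carrier → Carrier → Set (c ⊔ ℓ)
        related-∈  : ∀ {i p q} → Related i p q → p ∈ₗ V ± × q ∈ₗ V ±
        -- Elements whose degrees future ties may raise; no uncoloured element may be one of them.
        Reserved   : Carrier → Set (c ⊔ ℓ)
        reserved-resp : ∀ {x y} → x ≈ y → Reserved x → Reserved y
        reserved-inv  : ∀ {x} → Reserved x → Reserved (x ⁻¹)

    module Stages (setting : Setting) where
      open Setting setting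

      Coloured : Carrier → Set (c ⊔ ℓ)
      Coloured x = x ∈ₗ V ±

      -- What later gadgets may act on, besides coloured elements: `v²` in the case of a marker for
      -- `v`, and reserved elements in the case of ties. An uncoloured element outside this set
      -- keeps its low degree.
      Protected : Carrier → Set (c ⊔ ℓ)
      Protected x = Product V x ⊎ Reserved x

      protected-resp : ∀ {x y} → x ≈ y → Protected x → Protected y
      protected-resp e (inj₁ p) = inj₁ (product-resp V e p)
      protected-resp e (inj₂ p) = inj₂ (reserved-resp e p)

      protected-inv : ∀ {x} → Protected x → Protected (x ⁻¹)
      protected-inv (inj₁ p) = inj₁ (product-inv V p)
      protected-inv (inj₂ p) = inj₂ (reserved-inv p)

      NoInvolution : List Carrier → Set (c ⊔ ℓ)
      NoInvolution T = ∀ {t} → t ∈ₗ T → ¬ t ∙ t ≈ ε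

      -- The bound 6 lies just below the value 7 to which the coloured elements will be raised. In
      -- `conclude` the common neighbour is uncoloured because only such neighbours are known to be
      -- mapped to uncoloured ones.
      record Stage (T : List Carrier) : Set (c ⊔ ℓ) where
        field
          coloured⊆ : ∀ {v} → Coloured v → v ∈ₗ T ±
          ε∉        : ¬ ε ∈ₗ T ±
          low       : ∀ {t} → t ∈ₗ T ± → Coloured t ⊎ (degree T t ≤ 6 × ¬ Protected t)
          conclude  : ∀ i {t p q} → t ∈ₗ T ± → ¬ Coloured t → Related i p q →
                      p ⁻¹ ∙ t ∈ₗ T ± → q ⁻¹ ∙ t ∈ₗ T ± → Conclusion i p q
          noInvolution : NoInvolution V → NoInvolution T

      record Gadget {n : ℕ} (T : List Carrier) (a : Fin n → Carrier) : Set (c ⊔ ℓ) where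
        field
          fresh : ∀ i → ¬ Product T (a i)
        open Family T a fresh public
        field
          unreserved : ∀ i → ¬ Reserved (a i)
          values     : ∀ {x} → x ∈ₗ T ± → Value x → Coloured x ⊎ Protected x
          low        : ∀ i → degree T′ (a i) ≤ 6
          conclude   : ∀ i {t p q} → t ∈ₗ W ± → Related i p q →
                       p ⁻¹ ∙ t ∈ₗ W ± → q ⁻¹ ∙ t ∈ₗ W ± → Conclusion i p q
          noInvolution : NoInvolution V → ∀ i → ¬ a i ∙ a i ≈ ε

      -- Low degrees survive since the gadget acts on coloured and protected elements only. A common
      -- neighbour of two coloured elements is joined to both by old edges or to both by new edges,
      -- so one of the two versions of `conclude` applies.
      extend : ∀ {n T} {a : Fin n → Carrier} → Stage T → Gadget T a → Stage (tabulate a ++ T)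
      extend {n} {T} {a} S Γ = record
        { coloured⊆ = old⊆ ∘ S.coloured⊆
        ; ε∉ = ε∉-new S.ε∉
        ; low = λ t∈ → [ inj₂ ∘ new-low , old-low ]′ (±-++⁻ W T t∈)
        ; conclude = concl
        ; noInvolution = λ nv t∈ → [ (λ p e → let (i , eq) = Membershipₚ.∈-tabulate⁻ setoid p in
                                         noInvolution nv i (trans (∙-cong (sym eq) (sym eq)) e))
                                   , S.noInvolution nv ]′ (Membershipₚ.∈-++⁻ setoid W t∈)
        }
        where
        module S = Stage S
        open Gadget Γ
        new-unprotected : ∀ {r} → r ∈ₗ W ± → ¬ Protected r
        new-unprotected r∈ (inj₁ p) = new-fresh r∈ (product-mono V T S.coloured⊆ p)
        new-unprotected r∈ (inj₂ p) with signed⁻ r∈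
        ... | i , inj₁ e = unreserved i (reserved-resp e p)
        ... | i , inj₂ e = unreserved i (reserved-resp
                (trans (⁻¹-cong e) (⁻¹-involutive (a i))) (reserved-inv p))
        new-low : ∀ {t} → t ∈ₗ W ± → degree T′ t ≤ 6 × ¬ Protected t
        new-low t∈ = bound (signed⁻ t∈) , new-unprotected t∈
          where
          bound : ∀ {t} → ∃[ i ] (t ≈ a i ⊎ t ≈ a i ⁻¹) → degree T′ t ≤ 6
          bound (i , inj₁ e) = ℕₚ.≤-trans (ℕₚ.≤-reflexive (degree-cong T′ e)) (low i)
          bound (i , inj₂ e) = ℕₚ.≤-trans
            (ℕₚ.≤-reflexive (≡.trans (degree-cong T′ e) (degree-inv T′ (a i)))) (low i)
        old-low : ∀ {t} → t ∈ₗ T ± → Coloured t ⊎ (degree T′ t ≤ 6 × ¬ Protected t)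
        old-low t∈ with S.low t∈
        ... | inj₁ v = inj₁ v
        ... | inj₂ (d , np) with dec (Coloured _)
        ...   | yes v = inj₁ v
        ...   | no ¬v = inj₂ (ℕₚ.≤-trans (ℕₚ.≤-reflexive (degree-unchanged t∈ λ val → [ ¬v , np ]′ (values t∈ val))) d , np)
        concl : ∀ i {t p q} → t ∈ₗ T′ ± → ¬ Coloured t → Related i p q →
                p ⁻¹ ∙ t ∈ₗ T′ ± → q ⁻¹ ∙ t ∈ₗ T′ ± → Conclusion i p q
        concl i {t} {p} {q} t∈ t∉V rel p∈ q∈
          with old-edge (S.coloured⊆ (proj₁ (related-∈ rel))) t∈ p∈
             | old-edge (S.coloured⊆ (proj₂ (related-∈ rel))) t∈ q∈
        ... | inj₁ (a , b) | inj₁ (a′ , b′) = S.conclude i a t∉V rel b b′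
        ... | inj₂ (a , b) | inj₂ (a′ , b′) = conclude i a rel b b′
        ... | inj₁ (a , b) | inj₂ (a′ , b′) = contradiction (product-∈ T a) (new-fresh a′)
        ... | inj₂ (a , b) | inj₁ (a′ , b′) = contradiction (product-∈ T a′) (new-fresh a)

  -- Existence and effect of markers.

  module Markers where
    open GroupSolver
    open Counting
    open Powers
    open Gadgets

    abstract
      size : List Carrier → ℕ
      size T = length (Ball₁ T)

      ball : List Carrier → List Carrier
      ball = Ball₁

      ∈-ball : ∀ T {x} → x ∈ₗ Ball₁ T → x ∈ₗ ball T
      ∈-ball T p = p

      length-ball : ∀ T → length (ball T) ≡ size T
      length-ball T = ≡.refl

      size≡ : ∀ T → size T ≡ suc (2 * length T)
      size≡ T = ≡.cong suc (≡.trans (length-++ T) (≡.cong (λ k → length T + k)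
        (≡.trans (length-map _⁻¹ T) (≡.sym (ℕₚ.+-identityʳ _)))))

      products : List Carrier → List Carrier
      products T = cartesianProductWith _∙_ (Ball₁ T) (Ball₁ T)

      shift : Carrier → List Carrier → List Carrier
      shift κ xs = map (κ ∙_) xs

      ∈-products : ∀ T {x} → Product T x → x ∈ₗ products T
      ∈-products T (o , o′ , p , q , e) =
        resp (sym e) (Membershipₚ.∈-cartesianProductWith⁺ setoid setoid setoid ∙-cong p q)

      ∈-shift : ∀ {κ x y xs} → y ∈ₗ xs → x ≈ κ ∙ y → x ∈ₗ shift κ xs
      ∈-shift y∈ e = resp (sym e) (Membershipₚ.∈-map⁺ setoid setoid ∙-congˡ y∈)

      length-shift : ∀ κ xs → length (shift κ xs) ≡ length xs
      length-shift κ = length-map (κ ∙_)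

      length-products : ∀ T → length (products T) ≡ size T * size T
      length-products T = go (Ball₁ T)
        where
        go : ∀ xs → length (cartesianProductWith _∙_ xs (Ball₁ T)) ≡ length xs * size T
        go [] = ≡.refl
        go (x ∷ xs) = ≡.trans (length-++ (map (x ∙_) (Ball₁ T)))
          (≡.cong₂ _+_ (length-map _ (Ball₁ T)) (go xs))

    Powers₂ : Carrier → Carrier → Set ℓ
    Powers₂ v x = x ≈ v ⊎ x ≈ v ⁻¹ ⊎ x ≈ v ∙ v ⊎ x ≈ (v ∙ v) ⁻¹

    -- w is the new element of a gadget {w , v⁻¹ w}.
    record MarkerFacts (T : List Carrier) (v w : Carrier) (Inv : Set ℓ) : Set (c ⊔ ℓ) where
      field
        fresh₀ : ¬ Product T w
        fresh₁ : ¬ Product T (v ⁻¹ ∙ w)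
        ww     : ¬ w ∙ w ∈ₗ Ball₁ T
        vww    : ¬ v ⁻¹ ∙ w ∙ w ∈ₗ Ball₁ T
        wvw    : w ∙ (v ⁻¹ ∙ w) ∈ₗ Ball₁ T → w ∙ (v ⁻¹ ∙ w) ≈ v ⁻¹
        vwvw   : v ⁻¹ ∙ w ∙ (v ⁻¹ ∙ w) ∈ₗ Ball₁ T → Inv × v ⁻¹ ∙ w ∙ (v ⁻¹ ∙ w) ≈ (v ∙ v) ⁻¹
        conj   : w ⁻¹ ∙ (v ⁻¹ ∙ w) ∈ₗ Ball₁ T → w ⁻¹ ∙ (v ⁻¹ ∙ w) ≈ v ⁻¹

    module _ {T : List Carrier} {v w : Carrier} {Inv : Set ℓ}
             (w∉ : ¬ w ∈ₗ products T) (w∉v : ¬ w ∈ₗ shift v (products T))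
             (ww∉ : ¬ w ∙ w ∈ₗ ball T) (ww∉v : ¬ w ∙ w ∈ₗ shift v (ball T)) where
      open SetoidReasoning setoid

      private
        vww∉ : ¬ v ⁻¹ ∙ w ∙ w ∈ₗ Ball₁ T
        vww∉ p = ww∉v (∈-shift (∈-ball T p) (solve 2 (λ v w → w · w ⊜ v · (inv v · w · w)) refl v w))

        vw∉ : ¬ Product T (v ⁻¹ ∙ w)
        vw∉ p = w∉v (∈-shift (∈-products T p) (solve 2 (λ v w → w ⊜ v · (inv v · w)) refl v w))

      -- When `w` commutes with `v`, every product of two new elements is `w²`, `v⁻¹ w²` or
      -- `v⁻² w²`, which accounts for the three conditions on `w²`.
      markerFacts-central : ¬ w ∙ w ∈ₗ shift (v ∙ v) (ball T) → Commutes (v ⁻¹) w →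
                            MarkerFacts T v w Inv
      markerFacts-central ww∉vv cw = record
        { fresh₀ = w∉ ∘ ∈-products T ; fresh₁ = vw∉ ; ww = ww∉ ∘ ∈-ball T ; vww = vww∉
        ; wvw = λ p → contradiction (resp (trans (sym (assoc _ _ _)) (∙-congʳ cw)) p) vww∉
        ; vwvw = λ p → contradiction (∈-shift (∈-ball T p) (begin
            w ∙ w ≈⟨ solve 2 (λ v w → w · w ⊜ v · v · (inv v · (inv v · w) · w)) refl v w ⟩
            v ∙ v ∙ (v ⁻¹ ∙ (v ⁻¹ ∙ w) ∙ w) ≈⟨ ∙-congˡ (∙-congʳ (∙-congˡ cw)) ⟨
            v ∙ v ∙ (v ⁻¹ ∙ (w ∙ v ⁻¹) ∙ w) ≈⟨ solve 2 (λ v w → v · v · (inv v · (w · inv v) · w) ⊜ v · v · (inv v · w · (inv v · w))) refl v w ⟩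
            v ∙ v ∙ (v ⁻¹ ∙ w ∙ (v ⁻¹ ∙ w)) ∎)) ww∉vv
        ; conj = λ _ → trans (∙-congˡ (sym cw)) (solve 2 (λ v w → inv w · (w · inv v) ⊜ inv v) refl v w)
        }

      -- Here `w v⁻¹ w = v⁻¹`, so `v⁻¹ w` has the square `v⁻²` for every choice of `w`. This is why
      -- a marker for an inverting `v` may also raise the degree of `v²`.
      markerFacts-inverting : Inv → Inverts (v ⁻¹) w → MarkerFacts T v w Inv
      markerFacts-inverting i iw = record
        { fresh₀ = w∉ ∘ ∈-products T ; fresh₁ = vw∉ ; ww = ww∉ ∘ ∈-ball T ; vww = vww∉
        ; wvw = λ _ → trans (sym (assoc _ _ _)) iw
        ; vwvw = λ _ → i , (begin
            v ⁻¹ ∙ w ∙ (v ⁻¹ ∙ w) ≈⟨ solve 2 (λ v w → inv v · w · (inv v · w) ⊜ inv v · (w · inv v · w)) refl v w ⟩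
            v ⁻¹ ∙ (w ∙ v ⁻¹ ∙ w) ≈⟨ ∙-congˡ iw ⟩
            v ⁻¹ ∙ v ⁻¹ ≈⟨ solve 1 (λ v → inv v · inv v ⊜ inv (v · v)) refl v ⟩
            (v ∙ v) ⁻¹ ∎)
        ; conj = λ p → contradiction (resp (begin
            w ⁻¹ ∙ (v ⁻¹ ∙ w) ≈⟨ ∙-congˡ (∙-congʳ iw) ⟨
            w ⁻¹ ∙ (w ∙ v ⁻¹ ∙ w ∙ w) ≈⟨ solve 2 (λ v w → inv w · (w · inv v · w · w) ⊜ inv v · w · w) refl v w ⟩
            v ⁻¹ ∙ w ∙ w ∎) p) vww∉
        }

      markerFacts-generic : ¬ w ∙ v ⁻¹ ∙ w ∈ₗ ball T → ¬ w ∙ v ⁻¹ ∙ w ∈ₗ shift v (ball T) →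
                            ¬ w ⁻¹ ∙ v ⁻¹ ∙ w ∈ₗ ball T → MarkerFacts T v w Inv
      markerFacts-generic b₁ b₂ b₃ = record
        { fresh₀ = w∉ ∘ ∈-products T ; fresh₁ = vw∉ ; ww = ww∉ ∘ ∈-ball T ; vww = vww∉
        ; wvw = λ p → contradiction (∈-ball T (resp (sym (assoc _ _ _)) p)) b₁
        ; vwvw = λ p → contradiction (∈-shift (∈-ball T p)
            (solve 2 (λ v w → w · inv v · w ⊜ v · (inv v · w · (inv v · w))) refl v w)) b₂
        ; conj = λ p → contradiction (∈-ball T (resp (sym (assoc _ _ _)) p)) b₃
        }

    InvertsUpTo : Carrier → ℕ → Carrier → Set ℓ
    InvertsUpTo z M v = ∃[ e ] 1 ≤ e × e ≤ M × Inverts v (z ^ e)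

    -- Passing from `z` to `zᵉ` with `e ≤ M` costs one factor `M`; the other is the range of the new
    -- exponent, and 3 leaves room for squares. The bound `room` counts two translates of the
    -- products and six of the ball.
    module FindMarker (T : List Carrier) (v z : Carrier) (M : ℕ)
                      (tl : Torsionless z (3 * M * M))
                      (room : 2 * (size T * size T) + 6 * size T < M) where

      private
        O : List Carrier
        O = ball T

        basic : Carrier → Forbidden
        basic y = ((y ^_) , products T) ∷ ((y ^_) , shift v (products T))
                ∷ ((λ m → square (y ^ m)) , O) ∷ ((λ m → square (y ^ m)) , shift v O)
                ∷ ((λ m → square (y ^ m)) , shift (v ∙ v) O) ∷ []

        extra : Forbidden
        extra = ((λ m → z ^ m ∙ v ⁻¹ ∙ z ^ m) , O) ∷ ((λ m → z ^ m ∙ v ⁻¹ ∙ z ^ m) , shift v O)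
              ∷ ((λ m → (z ^ m) ⁻¹ ∙ v ⁻¹ ∙ z ^ m) , O) ∷ []

        s = size T

        basic-total : ∀ y → total (basic y) ≡ s * s + (s * s + (s + (s + (s + 0))))
        basic-total y rewrite length-shift v (products T) | length-products T
          | length-shift v (ball T) | length-shift (v ∙ v) (ball T) | length-ball T = ≡.refl

        arith₁ : ∀ s → s * s + (s * s + (s + (s + (s + 0)))) ≤ 2 * (s * s) + 6 * s
        arith₁ s = ℕₚ.≤-trans (ℕₚ.m≤m+n _ (3 * s)) (ℕₚ.≤-reflexive (eq s))
          where
          open import Data.Nat.Solver using (module +-*-Solver)
          open +-*-Solver renaming (solve to solveℕ)
          eq : ∀ s → s * s + (s * s + (s + (s + (s + 0)))) + 3 * s ≡ 2 * (s * s) + 6 * s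
          eq = solveℕ 1 (λ s → s :* s :+ (s :* s :+ (s :+ (s :+ (s :+ con 0)))) :+ con 3 :* s
                             := con 2 :* (s :* s) :+ con 6 :* s) ≡.refl

        full-total : total (basic z ++ extra) ≤ 2 * (s * s) + 6 * s
        full-total rewrite length-shift v (products T) | length-products T
          | length-shift v (ball T) | length-shift (v ∙ v) (ball T) | length-ball T = ℕₚ.≤-reflexive (eq s)
          where
          open import Data.Nat.Solver using (module +-*-Solver)
          open +-*-Solver renaming (solve to solveℕ)
          eq : ∀ s → s * s + (s * s + (s + (s + (s + (s + (s + (s + 0))))))) ≡ 2 * (s * s) + 6 * s
          eq = solveℕ 1 (λ s → s :* s :+ (s :* s :+ (s :+ (s :+ (s :+ (s :+ (s :+ (s :+ con 0)))))))
                             := con 2 :* (s :* s) :+ con 6 :* s) ≡.refl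

        injective : ∀ {y} → Torsionless y (3 * M) → InjectiveAll M (basic y)
        injective {y} tly = p , p , q , q , q , tt
          where
          p : InjectiveUpTo M (y ^_)
          p = injective-^ (torsionless-≤ (ℕₚ.m≤n*m M 3) tly)
          q : InjectiveUpTo M (λ m → square (y ^ m))
          q = injective-square tly

        pickBasic : ∀ e → 1 ≤ e → e ≤ M → ∃[ m ] 1 ≤ m × m ≤ M × Avoids (basic (z ^ e)) m
        pickBasic e 1≤e e≤M = pick M (basic (z ^ e))
          (injective (torsionless-^ e 1≤e (ℕₚ.*-monoʳ-≤ (3 * M) e≤M) tl))
          (ℕₚ.≤-<-trans (ℕₚ.≤-trans (ℕₚ.≤-reflexive (basic-total (z ^ e))) (arith₁ s)) room)

        pickGeneric : NotNormal v z M → ∃[ m ] 1 ≤ m × m ≤ M × Avoids (basic z ++ extra) m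
        pickGeneric n = pick M (basic z ++ extra)
          (i₁ , i₁ , i₂ , i₂ , i₂ , within-upTo (injective-⁺⁺ n⁻¹) , within-upTo (injective-⁺⁺ n⁻¹) , within-upTo (injective-⁻⁺ n⁻¹) , tt)
          (ℕₚ.≤-<-trans full-total room)
          where
          n⁻¹ = notNormal-inv n
          tlz : Torsionless z (3 * M)
          tlz = torsionless-≤ (ℕₚ.m≤m*n (3 * M) M {{ℕ.>-nonZero (ℕₚ.≤-<-trans z≤n room)}}) tl
          i₁ = proj₁ (injective tlz)
          i₂ = proj₁ (proj₂ (proj₂ (injective tlz)))

      find : ∃[ w ] MarkerFacts T v w (InvertsUpTo z M v)
      find with classify v z M
      ... | central e 1≤e e≤M comm =
        let (m , _ , _ , a₁ , a₂ , a₃ , a₄ , a₅ , _) = pickBasic e 1≤e e≤M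
        in (z ^ e) ^ m , markerFacts-central a₁ a₂ a₃ a₄ a₅ (commutes-inv (commutes-^ m comm))
      ... | inverting e 1≤e e≤M inverts =
        let (m , _ , _ , a₁ , a₂ , a₃ , a₄ , _) = pickBasic e 1≤e e≤M
        in (z ^ e) ^ m , markerFacts-inverting a₁ a₂ a₃ a₄ (e , 1≤e , e≤M , inverts) (inverts-inv (inverts-^ m inverts))
      ... | generic n =
        let (m , _ , _ , a₁ , a₂ , a₃ , a₄ , _ , b₁ , b₂ , b₃ , _) = pickGeneric n
        in z ^ m , markerFacts-generic a₁ a₂ a₃ a₄ b₁ b₂ b₃

    module MarkerGadget (setting : Setting) where
      open Setting setting
      open Stages setting

      private
        pair : Carrier → Carrier → Fin 2 → Carrier
        pair v w zero = w
        pair v w (suc zero) = v ⁻¹ ∙ w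

      module _ {T : List Carrier} {v w : Carrier} {Inv : Set ℓ} (stage : Stage T)
               (v∈ : v ∈ₗ V) (facts : MarkerFacts T v w Inv)
               (independent : ∀ {i p q} → Related i p q → Powers₂ v p → Powers₂ v q → ⊥) where
        open Stage stage using (coloured⊆; ε∉)
        open MarkerFacts facts

        private
          a : Fin 2 → Carrier
          a = pair v w

          fresh : ∀ i → ¬ Product T (a i)
          fresh zero = fresh₀
          fresh (suc zero) = fresh₁

        open Family T a fresh

        private
          in-ball : ∀ {x y} → x ≈ y → x ∈ₗ T ± → y ∈ₗ Ball₁ T
          in-ball e x∈ = there (resp e x∈)

          inverted : ∀ {x y} → x ⁻¹ ≈ y → x ≈ y ⁻¹
          inverted {x} e = trans (sym (⁻¹-involutive x)) (⁻¹-cong e)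

          vv = v ∙ v

          Allowed : Carrier → Set ℓ
          Allowed x = x ≈ v ⊎ x ≈ v ⁻¹ ⊎ Inv × (x ≈ vv ⊎ x ≈ vv ⁻¹)

          products-values : ∀ i j → a i ∙ a j ∈ₗ Ball₁ T →
                            a i ∙ a j ≈ v ⁻¹ ⊎ Inv × a i ∙ a j ≈ vv ⁻¹
          products-values zero zero p = contradiction p ww
          products-values zero (suc zero) p = inj₁ (wvw p)
          products-values (suc zero) zero p = contradiction p vww
          products-values (suc zero) (suc zero) p = inj₂ (vwvw p)

          quotients : ∀ i j {x} → x ≈ a i ⁻¹ ∙ a j → x ∈ₗ T ± → Allowed x
          quotients zero zero e x∈ = contradiction (resp (trans e (inverseˡ _)) x∈) ε∉
          quotients zero (suc zero) e x∈ = inj₂ (inj₁ (trans e (conj (in-ball e x∈))))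
          quotients (suc zero) zero {x} e x∈ = inj₁ (trans e
            (trans (solve 2 (λ v w → inv (inv v · w) · w ⊜ inv (inv w · (inv v · w))) refl v w)
              (trans (⁻¹-cong (conj (in-ball
                (trans (⁻¹-cong e) (solve 2 (λ v w → inv (inv (inv v · w) · w) ⊜ inv w · (inv v · w)) refl v w))
                (∈-inv T x∈)))) (⁻¹-involutive v))))
          quotients (suc zero) (suc zero) e x∈ = contradiction (resp (trans e (inverseˡ _)) x∈) ε∉

          divisions : ∀ i j {x} → x ≈ a i ∙ a j ⁻¹ → x ∈ₗ T ± → Allowed x
          divisions zero zero e x∈ = contradiction (resp (trans e (inverseʳ _)) x∈) ε∉
          divisions zero (suc zero) e x∈ =
            inj₁ (trans e (solve 2 (λ v w → w · inv (inv v · w) ⊜ v) refl v w))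
          divisions (suc zero) zero e x∈ =
            inj₂ (inj₁ (trans e (solve 2 (λ v w → inv v · w · inv w ⊜ inv v) refl v w)))
          divisions (suc zero) (suc zero) e x∈ = contradiction (resp (trans e (inverseʳ _)) x∈) ε∉

          allowed : ∀ {x} → x ∈ₗ T ± → Value x → Allowed x
          allowed {x} x∈ val with value⁻ val
          ... | i , j , inj₁ e = divisions i j e x∈
          ... | i , j , inj₂ (inj₂ (inj₂ e)) = quotients i j e x∈
          ... | i , j , inj₂ (inj₁ e) with products-values i j (in-ball e x∈)
          ...   | inj₁ f = inj₂ (inj₁ (trans e f))
          ...   | inj₂ (inv? , f) = inj₂ (inj₂ (inv? , inj₂ (trans e f)))
          allowed {x} x∈ val | i , j , inj₂ (inj₂ (inj₁ e)) with products-values i j (in-ball e (∈-inv T x∈))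
          ...   | inj₁ f = inj₁ (trans (inverted (trans e f)) (⁻¹-involutive v))
          ...   | inj₂ (inv? , f) = inj₂ (inj₂ (inv? , inj₁ (trans (inverted (trans e f)) (⁻¹-involutive vv))))

          allowed-powers : ∀ {x} → Allowed x → Powers₂ v x
          allowed-powers (inj₁ e) = inj₁ e
          allowed-powers (inj₂ (inj₁ e)) = inj₂ (inj₁ e)
          allowed-powers (inj₂ (inj₂ (_ , inj₁ e))) = inj₂ (inj₂ (inj₁ e))
          allowed-powers (inj₂ (inj₂ (_ , inj₂ e))) = inj₂ (inj₂ (inj₂ e))

          v∈V : v ∈ₗ V ±
          v∈V = ∈-±ˡ v∈

          other : Fin 2 → Fin 2
          other zero = suc zero
          other (suc zero) = zero

          -- The four kinds of neighbours with two indices make eight; the two that would put `ε`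
          -- among the generators drop out, whence the bound 6.
          candidates : Fin 2 → List Carrier
          candidates i = a i ∙ a (other i) ⁻¹ ∷ a i ∙ a zero ∷ a i ∙ a (suc zero)
                       ∷ a (other i) ∷ a zero ⁻¹ ∷ a (suc zero) ⁻¹ ∷ []

          candidate : ∀ i {t} → t ∈ₗ T′ ± → Neighbour i t → t ∈ₗ candidates i
          candidate i _ (prod zero e _) = there (here e)
          candidate i _ (prod (suc zero) e _) = there (there (here e))
          candidate i _ (opp zero e _) = there (there (there (there (here e))))
          candidate i _ (opp (suc zero) e _) = there (there (there (there (there (here e)))))
          candidate zero _ (div zero e t∈) = contradiction (resp (trans e (inverseʳ _)) t∈) ε∉
          candidate zero _ (div (suc zero) e _) = here e
          candidate (suc zero) _ (div zero e _) = here e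
          candidate (suc zero) _ (div (suc zero) e t∈) = contradiction (resp (trans e (inverseʳ _)) t∈) ε∉
          candidate zero _ (con zero e h) = contradiction (resp (inverseˡ _) h) (ε∉-new ε∉)
          candidate zero _ (con (suc zero) e _) = there (there (there (here e)))
          candidate (suc zero) _ (con zero e _) = there (there (there (here e)))
          candidate (suc zero) _ (con (suc zero) e h) = contradiction (resp (inverseˡ _) h) (ε∉-new ε∉)

        marker : (∀ i → ¬ Reserved (a i)) → Gadget T (pair v w)
        marker unreserved = record
          { fresh = fresh
          ; unreserved = unreserved
          ; values = λ x∈ val → colouredValue (allowed x∈ val)
          ; low = λ i → degree-≤ T′ (a i) (candidates i) λ t∈ h → candidate i t∈ (neighbour i t∈ h)
          ; conclude = λ i {t} {p} {q} t∈ rel p∈ q∈ → ⊥-elim (independent rel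
              (allowed-powers (allowed (coloured⊆ (proj₁ (related-∈ rel))) (t , t∈ , p∈)))
              (allowed-powers (allowed (coloured⊆ (proj₂ (related-∈ rel))) (t , t∈ , q∈))))
          ; noInvolution = λ nv → λ
              { zero e → ww (here e)
              -- If `v⁻¹ w` were an involution, its square would be a ball element equal to `v⁻²`,
              -- and `v` would be an involution as well.
              ; (suc zero) e → nv v∈ (trans (sym (⁻¹-involutive vv))
                  (trans (⁻¹-cong (trans (sym (proj₂ (vwvw (here e)))) e)) (ε⁻¹≈ε))) }
          }
          where
          colouredValue : ∀ {x} → Allowed x → Coloured x ⊎ Protected x
          colouredValue (inj₁ e) = inj₁ (resp (sym e) v∈V)
          colouredValue (inj₂ (inj₁ e)) = inj₁ (resp (sym e) (∈-inv V v∈V))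
          colouredValue (inj₂ (inj₂ (_ , inj₁ e))) = inj₂ (inj₁ (v , v , there v∈V , there v∈V , e))
          colouredValue (inj₂ (inj₂ (_ , inj₂ e))) = inj₂ (inj₁
            (product-resp V (sym e) (product-inv V (product-∙ V v∈V v∈V))))

        marker-raises : degree T v < degree T′ v
        marker-raises = degree-grows (coloured⊆ v∈V) (w , pos zero , pos (suc zero))

        marker-mono : ∀ u → degree T u ≤ degree T′ u
        marker-mono u = degree-mono T T′ u λ p q → old⊆ p , old⊆ q

        marker-spares : ∀ {u} → Coloured u → ¬ u ≈ v → ¬ u ≈ v ⁻¹ →
                        (Inv → ¬ u ≈ vv × ¬ u ≈ vv ⁻¹) → degree T′ u ≡ degree T u
        marker-spares u∈ u≉v u≉v⁻¹ sq = degree-unchanged (coloured⊆ u∈) λ val →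
          [ u≉v , [ u≉v⁻¹ , (λ (i , e) → [ proj₁ (sq i) , proj₂ (sq i) ]′ e) ]′ ]′
            (allowed (coloured⊆ u∈) val)

  -- Making the degrees of the coloured classes distinct and at least 7.

  module Colouring where
    open Counting
    open Powers
    open Gadgets
    open Markers

    atLeast : ℕ → List ℕ → ℕ
    atLeast d [] = 0
    atLeast d (x ∷ xs) with d ℕₚ.≤? x
    ... | yes _ = suc (atLeast d xs)
    ... | no  _ = atLeast d xs

    atLeast-≤ : ∀ d xs → atLeast d xs ≤ length xs
    atLeast-≤ d [] = z≤n
    atLeast-≤ d (x ∷ xs) with d ℕₚ.≤? x
    ... | yes _ = s≤s (atLeast-≤ d xs)
    ... | no  _ = ℕₚ.m≤n⇒m≤1+n (atLeast-≤ d xs)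

    atLeast-mono : ∀ {d d′} xs → d ≤ d′ → atLeast d′ xs ≤ atLeast d xs
    atLeast-mono [] le = z≤n
    atLeast-mono {d} {d′} (x ∷ xs) le with d ℕₚ.≤? x | d′ ℕₚ.≤? x
    ... | yes _ | yes _ = s≤s (atLeast-mono xs le)
    ... | yes _ | no  _ = ℕₚ.m≤n⇒m≤1+n (atLeast-mono xs le)
    ... | no ¬p | yes p = contradiction (ℕₚ.≤-trans le p) ¬p
    ... | no  _ | no  _ = atLeast-mono xs le

    atLeast-mono-< : ∀ {d d′} xs → d < d′ → Any (d ≡_) xs → atLeast d′ xs < atLeast d xs
    atLeast-mono-< {d} {d′} (x ∷ xs) lt d∈ with d ℕₚ.≤? x | d′ ℕₚ.≤? x | d∈
    ... | yes _ | yes p | here ≡.refl = contradiction p (ℕₚ.<⇒≱ lt)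
    ... | yes _ | yes _ | there d∈ = s≤s (atLeast-mono-< xs lt d∈)
    ... | yes _ | no  _ | _ = s≤s (atLeast-mono xs (ℕₚ.<⇒≤ lt))
    ... | no ¬p | yes p | _ = contradiction (ℕₚ.≤-trans (ℕₚ.<⇒≤ lt) p) ¬p
    ... | no ¬p | no  _ | here ≡.refl = contradiction ℕₚ.≤-refl ¬p
    ... | no  _ | no  _ | there d∈ = atLeast-mono-< xs lt d∈

    -- The number of values from d on that a degree has to avoid.
    deficit : ℕ → List ℕ → ℕ
    deficit d ds = (7 ∸ d) + atLeast d ds

    Settled : ℕ → List ℕ → Set
    Settled d ds = 7 ≤ d × ¬ Any (d ≡_) ds

    -- Below 7 the first summand drops. From 7 on an unsettled `d` occurs in `ds`, and that entry is
    -- no longer counted beyond `d`. Any larger `d′` will do, so it does not matter by how much a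
    -- marker raises a degree.
    deficit-decreases : ∀ {d d′} ds → d < d′ → ¬ Settled d ds → deficit d′ ds < deficit d ds
    deficit-decreases {d} {d′} ds lt ns with 7 ℕₚ.≤? d
    ... | no 7≰d = ℕₚ.+-mono-<-≤ (≡.subst (_< 7 ∸ d) (capped d′)
                       (ℕₚ.∸-monoʳ-< {7} {d′ ℕ.⊓ 7} {d} (ℕₚ.⊓-glb lt (ℕₚ.≰⇒> 7≰d)) (ℕₚ.m⊓n≤n d′ 7))) (atLeast-mono ds (ℕₚ.<⇒≤ lt))
      where
      capped : ∀ k → 7 ∸ (k ℕ.⊓ 7) ≡ 7 ∸ k
      capped k with ℕₚ.≤-total k 7
      ... | inj₁ le = ≡.cong (7 ∸_) (ℕₚ.m≤n⇒m⊓n≡m le)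
      ... | inj₂ le = ≡.trans (≡.cong (7 ∸_) (ℕₚ.m≥n⇒m⊓n≡n le)) (≡.sym (ℕₚ.m≤n⇒m∸n≡0 le))
    ... | yes 7≤d with Any.any? (d ℕₚ.≟_) ds
    ...   | yes d∈ = ℕₚ.+-mono-≤-< (ℕₚ.∸-monoʳ-≤ 7 (ℕₚ.<⇒≤ lt)) (atLeast-mono-< ds lt d∈)
    ...   | no d∉ = contradiction (7≤d , d∉) ns

    -- Markers for v do not change the degree of u.
    SparedBy : Carrier → ℕ → Carrier → Carrier → Set ℓ
    SparedBy z M u v =
      ¬ u ≈ v × ¬ u ≈ v ⁻¹ × (InvertsUpTo z M v → ¬ u ≈ v ∙ v × ¬ u ≈ (v ∙ v) ⁻¹)

    -- The number of elements spent on giving distinct degrees, at least 7, to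
    -- todo further elements whose degrees are at least δ.
    cost : ℕ → ℕ → ℕ → ℕ
    cost δ zero done = 0
    cost δ (suc todo) done = 2 * ((7 ∸ δ) + done) + cost δ todo (suc done)

    module Colour (setting : Setting) (z : Carrier) (M bound : ℕ)
                  (tl : Torsionless z (3 * M * M))
                  (room : ∀ T → length T ≤ bound → 2 * (size T * size T) + 6 * size T < M)
                  (unreserved : ∀ x → ¬ Setting.Reserved setting x)
                  (independent : ∀ {i p q v} → v ∈ₗ Setting.V setting → Setting.Related setting i p q →
                                 Powers₂ v p → Powers₂ v q → ⊥) where
      open Setting setting
      open Stages setting
      open MarkerGadget setting

      private
        Spares : Carrier → Carrier → Set ℓ
        Spares = SparedBy z M

      record Extension (T : List Carrier) (cost : ℕ) : Set (c ⊔ ℓ) where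
        field
          T′     : List Carrier
          stage  : Stage T′
          ⊆T′    : ∀ {x} → x ∈ₗ T → x ∈ₗ T′
          length≤ : length T′ ≤ length T + cost
          mono   : ∀ u → degree T u ≤ degree T′ u

      mark : ∀ {T v} → Stage T → v ∈ₗ V → length T ≤ bound →
        Σ[ E ∈ Extension T 2 ] degree T v < degree (Extension.T′ E) v ×
          (∀ {u} → Coloured u → Spares u v → degree (Extension.T′ E) u ≡ degree T u)
      mark {T} {v} stage v∈ le =
        let (w , facts) = FindMarker.find T v z M tl (room T le)
            gadget = marker stage v∈ facts (independent v∈) (λ _ → unreserved _)
        in record { T′ = _ ; stage = extend stage gadget ; ⊆T′ = Membershipₚ.∈-++⁺ʳ setoid _
                  ; length≤ = ℕₚ.≤-reflexive (ℕₚ.+-comm 2 (length T))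
                  ; mono = marker-mono stage v∈ facts (independent v∈) }
          , marker-raises stage v∈ facts (independent v∈)
          , λ u∈ (p , q , r) → marker-spares stage v∈ facts (independent v∈) u∈ p q r

      bump : ∀ fuel {T v} ds → Stage T → v ∈ₗ V → deficit (degree T v) ds ≤ fuel →
        length T + 2 * fuel ≤ bound →
        Σ[ E ∈ Extension T (2 * fuel) ] Settled (degree (Extension.T′ E) v) ds ×
          (∀ {u} → Coloured u → Spares u v → degree (Extension.T′ E) u ≡ degree T u)
      bump fuel {T} {v} ds stage v∈ def le with emℓ₀ {Settled (degree T v) ds}
      ... | yes s = record { T′ = T ; stage = stage ; ⊆T′ = id ; length≤ = ℕₚ.m≤m+n _ _ ; mono = λ _ → ℕₚ.≤-refl }
                  , s , λ _ _ → ≡.refl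
      bump zero ds stage v∈ def le | no ns =
        contradiction (ℕₚ.<-≤-trans (deficit-decreases ds ℕₚ.≤-refl ns) def) λ ()
      bump (suc fuel) {T} {v} ds stage v∈ def le | no ns =
        let (E , lt , same) = mark stage v∈ (ℕₚ.≤-trans (ℕₚ.m≤m+n _ _) le)
            module E = Extension E
            (F , settled , same′) = bump fuel ds E.stage v∈
              (ℕ.s≤s⁻¹ (ℕₚ.≤-trans (deficit-decreases ds lt ns) def))
              (ℕₚ.≤-trans (ℕₚ.+-monoˡ-≤ (2 * fuel) E.length≤)
                (ℕₚ.≤-trans (ℕₚ.≤-reflexive (two (length T) fuel)) le))
            module F = Extension F
        in record { T′ = F.T′ ; stage = F.stage ; ⊆T′ = F.⊆T′ ∘ E.⊆T′
                  ; length≤ = ℕₚ.≤-trans F.length≤ (ℕₚ.≤-trans (ℕₚ.+-monoˡ-≤ (2 * fuel) E.length≤)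
                                (ℕₚ.≤-reflexive (two (length T) fuel)))
                  ; mono = λ u → ℕₚ.≤-trans (E.mono u) (F.mono u) }
         , settled , λ u∈ sp → ≡.trans (same′ u∈ sp) (same u∈ sp)
        where
        two : ∀ n f → n + 2 + 2 * f ≡ n + 2 * suc f
        two n f = ≡.trans (ℕₚ.+-assoc n 2 (2 * f)) (≡.cong (λ k → n + k) (≡.sym (ℕₚ.*-suc 2 f)))

      Distinct : List Carrier → List Carrier → Set (c ⊔ ℓ)
      Distinct T us = ∀ {u v} → u ∈ₗ us → v ∈ₗ us → degree T u ≡ degree T v → u ≈ v

      High : List Carrier → List Carrier → Set (c ⊔ ℓ)
      High T us = ∀ {u} → u ∈ₗ us → 7 ≤ degree T u

      -- Treated elements must be spared by later markers, but not conversely: the degree of an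
      -- untreated element may grow at will, since only its lower bound `δ` is used.
      colour : ∀ δ todo done {T} → Stage T →
        (∀ {v} → v ∈ₗ todo → v ∈ₗ V) → (∀ {v} → v ∈ₗ done → v ∈ₗ V) →
        AllPairs Spares todo → (∀ {u} → u ∈ₗ done → All (Spares u) todo) →
        Distinct T done → High T done → (∀ {v} → v ∈ₗ todo → δ ≤ degree T v) →
        length T + cost δ (length todo) (length done) ≤ bound →
        Σ[ E ∈ Extension T (cost δ (length todo) (length done)) ]
          (let T′ = Extension.T′ E in Σ[ us ∈ List Carrier ] Distinct T′ us × High T′ us ×
            (∀ {u} → u ∈ₗ done ⊎ u ∈ₗ todo → u ∈ₗ us))
      colour δ [] done {T} stage todo⊆ done⊆ _ _ distinct high _ le =
        record { T′ = T ; stage = stage ; ⊆T′ = id ; length≤ = ℕₚ.m≤m+n _ _ ; mono = λ _ → ℕₚ.≤-refl }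
        , done , distinct , high , λ { (inj₁ p) → p }
      colour δ (v ∷ vs) done {T} stage todo⊆ done⊆ (sv ∷ svs) sd distinct high δ≤ le =
        let ds = map (degree T) done
            -- At most `7 ∸ δ` values lie below 7, and each treated element blocks at most one
            -- further value.
            fuel = (7 ∸ δ) + length done
            later = cost δ (length vs) (suc (length done))
            le₁ : length T + 2 * fuel ≤ bound
            le₁ = ℕₚ.≤-trans (ℕₚ.+-monoʳ-≤ (length T) (ℕₚ.m≤m+n (2 * fuel) later)) le
            (E , (7≤ , v∉) , same) = bump fuel ds stage (todo⊆ (here refl))
              (ℕₚ.+-mono-≤ (ℕₚ.∸-monoʳ-≤ 7 (δ≤ (here refl)))
                (ℕₚ.≤-trans (atLeast-≤ (degree T v) ds) (ℕₚ.≤-reflexive (length-map (degree T) done))))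
              le₁
            module E = Extension E
            kept : ∀ {u} → u ∈ₗ done → degree E.T′ u ≡ degree T u
            kept u∈ = same (∈-±ˡ (done⊆ u∈)) (All.head (sd u∈))
            (F , us , distinct′ , high′ , all) = colour δ vs (v ∷ done) E.stage
              (todo⊆ ∘ there) (λ { (here e) → resp (sym e) (todo⊆ (here refl)) ; (there p) → done⊆ p }) svs
              (λ { (here e) → All.map (spares-cong (sym e)) sv ; (there p) → All.tail (sd p) })
              (λ { (here e) (here e′) _ → trans e (sym e′)
                 ; (here e) (there q) eq → contradiction
                     (occurs q (≡.trans (≡.sym (degree-cong E.T′ e)) (≡.trans eq (kept q)))) v∉
                 ; (there p) (here e) eq → contradiction
                     (occurs p (≡.trans (≡.sym (degree-cong E.T′ e)) (≡.trans (≡.sym eq) (kept p)))) v∉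
                 ; (there p) (there q) eq → distinct p q (≡.trans (≡.sym (kept p)) (≡.trans eq (kept q))) })
              (λ { (here e) → ℕₚ.≤-trans 7≤ (ℕₚ.≤-reflexive (degree-cong E.T′ (sym e)))
                 ; (there p) → ℕₚ.≤-trans (high p) (ℕₚ.≤-reflexive (≡.sym (kept p))) })
              (λ p → ℕₚ.≤-trans (δ≤ (there p)) (E.mono _))
              (ℕₚ.≤-trans (ℕₚ.+-monoˡ-≤ later E.length≤)
                (ℕₚ.≤-trans (ℕₚ.≤-reflexive (ℕₚ.+-assoc (length T) (2 * fuel) later)) le))
            module F = Extension F
        in record { T′ = F.T′ ; stage = F.stage ; ⊆T′ = F.⊆T′ ∘ E.⊆T′
                  ; length≤ = ℕₚ.≤-trans F.length≤ (ℕₚ.≤-trans (ℕₚ.+-monoˡ-≤ later E.length≤)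
                                (ℕₚ.≤-reflexive (ℕₚ.+-assoc (length T) (2 * fuel) later)))
                  ; mono = λ u → ℕₚ.≤-trans (E.mono u) (F.mono u) }
         , us , distinct′ , high′
         , λ { (inj₁ p) → all (inj₁ (there p)) ; (inj₂ (here e)) → all (inj₁ (here e)) ; (inj₂ (there p)) → all (inj₂ p) }
        where
        spares-cong : ∀ {u u′ w} → u ≈ u′ → Spares u w → Spares u′ w
        spares-cong e (p , q , r) = (λ f → p (trans e f)) , (λ f → q (trans e f))
          , λ i → (λ f → proj₁ (r i) (trans e f)) , (λ f → proj₂ (r i) (trans e f))
        occurs : ∀ {us u d} → u ∈ₗ us → d ≡ degree T u → Any (d ≡_) (map (degree T) us)
        occurs (here e) eq = here (≡.trans eq (degree-cong T e))
        occurs (there p) eq = there (occurs p eq)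

  -- Ties whose hub commutes with the new element.

  module Ties (setting : Gadgets.Setting) where
    open GroupSolver
    open Counting
    open Powers
    open Gadgets
    open Gadgets.Setting setting
    open Stages setting

    pattern #0 = zero
    pattern #1 = suc zero
    pattern #2 = suc (suc zero)

    module Quotients {n : ℕ} (T : List Carrier) (a : Fin n → Carrier) (fresh : ∀ i → ¬ Product T (a i)) where
      open Family T a fresh

      positive : ∀ i {t p} → t ≈ a i → p ⁻¹ ∙ t ∈ₗ W ± →
                 ∃[ j ] (p ≈ a i ∙ a j ⁻¹ ⊎ p ≈ a i ∙ a j)
      positive i {t} {p} e s∈ with signed⁻ s∈
      ... | j , inj₁ f = j , inj₁ (trans (solve 2 (λ p t → p ⊜ t · inv (inv p · t)) refl p t) (∙-cong e (⁻¹-cong f)))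
      ... | j , inj₂ f = j , inj₂ (trans (solve 2 (λ p t → p ⊜ t · inv (inv p · t)) refl p t)
                                         (∙-cong e (trans (⁻¹-cong f) (⁻¹-involutive (a j)))))

      negative : ∀ i {t p} → t ≈ a i ⁻¹ → p ⁻¹ ∙ t ∈ₗ W ± →
                 ∃[ j ] (p ≈ a i ⁻¹ ∙ a j ⊎ p ⁻¹ ≈ a j ∙ a i)
      negative i {t} {p} e s∈ with signed⁻ s∈
      ... | j , inj₁ f = j , inj₂ (trans (solve 2 (λ p t → inv p ⊜ inv p · t · inv t) refl p t)
                                         (∙-cong f (trans (⁻¹-cong e) (⁻¹-involutive (a i)))))
      ... | j , inj₂ f = j , inj₁ (trans (solve 2 (λ p t → p ⊜ t · inv (inv p · t)) refl p t)
                                         (∙-cong e (trans (⁻¹-cong f) (⁻¹-involutive (a j)))))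

    -- The elements `u` and `x` share the neighbour `q`, as `u⁻¹ q` and `x⁻¹ q` are new. Since `x`
    -- commutes with `q`, the element `q⁻¹` is adjacent to `x⁻¹`, and its other possible old
    -- neighbour is `q⁻¹ u⁻¹ q`: inverting `x` forces `u` to go to that conjugate.
    module CommutingTie {T : List Carrier} (stage : Stage T) (q u x : Carrier)
                        (u∈ : Coloured u) (x∈ : Coloured x) where
      open Stage stage using (coloured⊆; ε∉)

      a : Fin 3 → Carrier
      a #0 = q
      a #1 = u ⁻¹ ∙ q
      a #2 = x ⁻¹ ∙ q

      -- The possible values of p, depending on t = a i or t = a i⁻¹.
      Listed : Bool → Fin 3 → Carrier → Set ℓ
      Listed true  #0 p = p ≈ u ⊎ p ≈ x
      Listed true  #1 p = p ≈ u ⁻¹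
      Listed true  #2 p = p ≈ x ⁻¹
      Listed false #0 p = p ≈ q ⁻¹ ∙ u ⁻¹ ∙ q ⊎ p ≈ x ⁻¹
      Listed false #1 p = p ≈ q ⁻¹ ∙ u ∙ q
      Listed false #2 p = p ≈ x

      record Conditions : Set (c ⊔ ℓ) where
        field
          fresh     : ∀ i → ¬ Product T (a i)
          products∉ : ∀ i j → ¬ a i ∙ a j ∈ₗ Ball₁ T
          quotient∉ : ¬ u ⁻¹ ∙ x ∈ₗ T ±
          commutes  : Commutes x q
          conj∉     : ¬ q ⁻¹ ∙ (u ∙ x ⁻¹) ∙ q ∈ₗ T ±
          -- Keeps `q⁻¹` from being adjacent to `q`, which has six possible neighbours already.
          cube∉     : ¬ cube q ≈ ε × ¬ cube q ≈ u × ¬ cube q ≈ x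
          -- The gadget may raise the degree of this conjugate, which therefore must not be an
          -- uncoloured element of `T`.
          conj-ok   : q ⁻¹ ∙ u ∙ q ∈ₗ T ± → Coloured (q ⁻¹ ∙ u ∙ q) ⊎ Protected (q ⁻¹ ∙ u ∙ q)
          unreserved : ∀ i → ¬ Reserved (a i)
          conclude  : ∀ s i {k p p′} → Related k p p′ → Listed s i p → Listed s i p′ → Conclusion k p p′

      module _ (conditions : Conditions) where
        open Conditions conditions
        open Family T a fresh
        open Quotients T a fresh

        private
          divisions : ∀ i j {p} → p ≈ a i ∙ a j ⁻¹ → p ∈ₗ T ± → Listed true i p
          divisions #0 #0 e p∈ = contradiction (resp (trans e (inverseʳ _)) p∈) ε∉
          divisions #0 #1 e p∈ = inj₁ (trans e (solve 2 (λ q u → q · inv (inv u · q) ⊜ u) refl q u))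
          divisions #0 #2 e p∈ = inj₂ (trans e (solve 2 (λ q u → q · inv (inv u · q) ⊜ u) refl q x))
          divisions #1 #0 e p∈ = trans e (solve 2 (λ q u → inv u · q · inv q ⊜ inv u) refl q u)
          divisions #1 #1 e p∈ = contradiction (resp (trans e (inverseʳ _)) p∈) ε∉
          divisions #1 #2 e p∈ = contradiction (resp (trans e
            (solve 3 (λ q u x → inv u · q · inv (inv x · q) ⊜ inv u · x) refl q u x)) p∈) quotient∉
          divisions #2 #0 e p∈ = trans e (solve 2 (λ q u → inv u · q · inv q ⊜ inv u) refl q x)
          divisions #2 #1 e p∈ = contradiction (resp (trans (⁻¹-cong e)
            (solve 3 (λ q u x → inv (inv x · q · inv (inv u · q)) ⊜ inv u · x) refl q u x)) (∈-inv T p∈)) quotient∉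
          divisions #2 #2 e p∈ = contradiction (resp (trans e (inverseʳ _)) p∈) ε∉

          conj-x : q ⁻¹ ∙ x ∙ q ≈ x
          conj-x = trans (trans (assoc _ _ _) (∙-congˡ (sym commutes))) (solve 2 (λ q x → inv q · (q · x) ⊜ x) refl q x)

          conjugates : ∀ i j {p} → p ≈ a i ⁻¹ ∙ a j → p ∈ₗ T ± → Listed false i p
          conjugates #0 #0 e p∈ = contradiction (resp (trans e (inverseˡ _)) p∈) ε∉
          conjugates #0 #1 e p∈ = inj₁ (trans e (sym (assoc _ _ _)))
          conjugates #0 #2 e p∈ = inj₂ (trans e (trans (solve 2 (λ q x → inv q · (inv x · q) ⊜ inv (inv q · x · q)) refl q x) (⁻¹-cong conj-x)))
          conjugates #1 #0 e p∈ = trans e (solve 2 (λ q u → inv (inv u · q) · q ⊜ inv q · u · q) refl q u)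
          conjugates #1 #1 e p∈ = contradiction (resp (trans e (inverseˡ _)) p∈) ε∉
          conjugates #1 #2 e p∈ = contradiction (resp (trans e
            (solve 3 (λ q u x → inv (inv u · q) · (inv x · q) ⊜ inv q · (u · inv x) · q) refl q u x)) p∈) conj∉
          conjugates #2 #0 e p∈ = trans e (trans (solve 2 (λ q u → inv (inv u · q) · q ⊜ inv q · u · q) refl q x) conj-x)
          conjugates #2 #1 e p∈ = contradiction (resp (trans (⁻¹-cong e)
            (solve 3 (λ q u x → inv (inv (inv x · q) · (inv u · q)) ⊜ inv q · (u · inv x) · q) refl q u x)) (∈-inv T p∈)) conj∉
          conjugates #2 #2 e p∈ = contradiction (resp (trans e (inverseˡ _)) p∈) ε∉

          listed⁺ : ∀ i {t p} → t ≈ a i → p ∈ₗ T ± → p ⁻¹ ∙ t ∈ₗ W ± → Listed true i p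
          listed⁺ i e p∈ s∈ with positive i e s∈
          ... | j , inj₁ f = divisions i j f p∈
          ... | j , inj₂ f = contradiction (there (resp f p∈)) (products∉ i j)

          listed⁻ : ∀ i {t p} → t ≈ a i ⁻¹ → p ∈ₗ T ± → p ⁻¹ ∙ t ∈ₗ W ± → Listed false i p
          listed⁻ i e p∈ s∈ with negative i e s∈
          ... | j , inj₁ f = conjugates i j f p∈
          ... | j , inj₂ f = contradiction (there (resp f (∈-inv T p∈))) (products∉ j i)

          ok-u : ∀ {p} → p ≈ u → Coloured p ⊎ Protected p
          ok-u e = inj₁ (resp (sym e) u∈)
          ok-x : ∀ {p} → p ≈ x → Coloured p ⊎ Protected p
          ok-x e = inj₁ (resp (sym e) x∈)
          ok-conj : ∀ {p} → p ∈ₗ T ± → p ≈ q ⁻¹ ∙ u ∙ q → Coloured p ⊎ Protected p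
          ok-conj p∈ e with conj-ok (resp e p∈)
          ... | inj₁ v = inj₁ (resp (sym e) v)
          ... | inj₂ v = inj₂ (protected-resp (sym e) v)
          ok-inv : ∀ {p} → Coloured (p ⁻¹) ⊎ Protected (p ⁻¹) → Coloured p ⊎ Protected p
          ok-inv (inj₁ v) = inj₁ (∈-inv⁻ V v)
          ok-inv {p} (inj₂ v) = inj₂ (protected-resp (⁻¹-involutive p) (protected-inv v))

          listed-ok : ∀ s i {p} → p ∈ₗ T ± → Listed s i p → Coloured p ⊎ Protected p
          listed-ok true #0 p∈ (inj₁ e) = ok-u e
          listed-ok true #0 p∈ (inj₂ e) = ok-x e
          listed-ok true #1 p∈ e = ok-inv (ok-u (trans (⁻¹-cong e) (⁻¹-involutive u)))
          listed-ok true #2 p∈ e = ok-inv (ok-x (trans (⁻¹-cong e) (⁻¹-involutive x)))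
          listed-ok false #0 p∈ (inj₁ e) = ok-inv (ok-conj (∈-inv T p∈) (trans (⁻¹-cong e)
            (solve 2 (λ q u → inv (inv q · inv u · q) ⊜ inv q · u · q) refl q u)))
          listed-ok false #0 p∈ (inj₂ e) = ok-inv (ok-x (trans (⁻¹-cong e) (⁻¹-involutive x)))
          listed-ok false #1 p∈ e = ok-conj p∈ e
          listed-ok false #2 p∈ e = ok-x e

          uT : u ∈ₗ T ±
          uT = coloured⊆ u∈
          xT : x ∈ₗ T ±
          xT = coloured⊆ x∈

          quotient : ∀ i j → Product T (a i ∙ a j ⁻¹)
          quotient #0 #0 = product-resp T (trans (inverseʳ ε) (sym (inverseʳ _))) (ε , ε ⁻¹ , here refl , Ball₁-inv T (here refl) , refl)
          quotient #0 #1 = product-resp T (solve 2 (λ q u → u ⊜ q · inv (inv u · q)) refl q u) (product-∈ T uT)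
          quotient #0 #2 = product-resp T (solve 2 (λ q u → u ⊜ q · inv (inv u · q)) refl q x) (product-∈ T xT)
          quotient #1 #0 = product-resp T (solve 2 (λ q u → inv u ⊜ inv u · q · inv q) refl q u) (product-∈ T (∈-inv T uT))
          quotient #1 #1 = product-resp T (trans (inverseʳ ε) (sym (inverseʳ _))) (ε , ε ⁻¹ , here refl , Ball₁-inv T (here refl) , refl)
          quotient #1 #2 = product-resp T (solve 3 (λ q u x → inv u · x ⊜ inv u · q · inv (inv x · q)) refl q u x) (product-∙ T (∈-inv T uT) xT)
          quotient #2 #0 = product-resp T (solve 2 (λ q u → inv u ⊜ inv u · q · inv q) refl q x) (product-∈ T (∈-inv T xT))
          quotient #2 #1 = product-resp T (solve 3 (λ q u x → inv u · x ⊜ inv u · q · inv (inv x · q)) refl q x u) (product-∙ T (∈-inv T xT) uT)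
          quotient #2 #2 = product-resp T (trans (inverseʳ ε) (sym (inverseʳ _))) (ε , ε ⁻¹ , here refl , Ball₁-inv T (here refl) , refl)

          cubes : ∀ l → ¬ a #0 ∙ a #0 ∙ a l ≈ ε
          cubes #0 e = proj₁ cube∉ e
          cubes #1 e = proj₁ (proj₂ cube∉) (x∙y⁻¹≈ε⇒x≈y _ _ (trans
            (solve 2 (λ q u → q · q · q · inv u ⊜ q · (q · q · (inv u · q)) · inv q) refl q u)
            (trans (sandwich q (q ⁻¹) e) (solve 1 (λ q → q · one · inv q ⊜ one) refl q))))
          cubes #2 e = proj₂ (proj₂ cube∉) (x∙y⁻¹≈ε⇒x≈y _ _ (trans
            (solve 2 (λ q u → q · q · q · inv u ⊜ q · (q · q · (inv u · q)) · inv q) refl q x)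
            (trans (sandwich q (q ⁻¹) e) (solve 1 (λ q → q · one · inv q ⊜ one) refl q))))

          square∉ : ¬ a #0 ⁻¹ ∙ a #0 ⁻¹ ∈ₗ T′ ±
          square∉ h with ±-++⁻ W T h
          ... | inj₁ h∈ = square∉W quotient #0 cubes h∈
          ... | inj₂ h∈ = products∉ #0 #0 (there (resp
            (solve 1 (λ q → inv (inv q · inv q) ⊜ q · q) refl q) (∈-inv T h∈)))

          candidates : Fin 3 → List Carrier
          candidates #0 = u ∷ x ∷ a #1 ∷ a #2 ∷ a #1 ⁻¹ ∷ a #2 ⁻¹ ∷ []
          candidates #1 = u ⁻¹ ∷ a #0 ∷ a #2 ∷ a #0 ⁻¹ ∷ a #1 ⁻¹ ∷ a #2 ⁻¹ ∷ []
          candidates #2 = x ⁻¹ ∷ a #0 ∷ a #1 ∷ a #0 ⁻¹ ∷ a #1 ⁻¹ ∷ a #2 ⁻¹ ∷ []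

          listed-candidate : ∀ i {t} → Listed true i t → t ∈ₗ candidates i
          listed-candidate #0 (inj₁ e) = here e
          listed-candidate #0 (inj₂ e) = there (here e)
          listed-candidate #1 e = here e
          listed-candidate #2 e = here e

          trivial : ∀ i → ¬ a i ⁻¹ ∙ a i ∈ₗ T′ ±
          trivial i h = ε∉-new ε∉ (resp (inverseˡ (a i)) h)

          candidate : ∀ i {t} → Neighbour i t → t ∈ₗ candidates i
          candidate i (div j e t∈) = listed-candidate i (divisions i j e t∈)
          candidate i (prod j e t∈) = contradiction (there (resp e t∈)) (products∉ i j)
          candidate #0 (con #0 e h) = contradiction h (trivial #0)
          candidate #0 (con #1 e h) = there (there (here e))
          candidate #0 (con #2 e h) = there (there (there (here e)))
          candidate #1 (con #0 e h) = there (here e)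
          candidate #1 (con #1 e h) = contradiction h (trivial #1)
          candidate #1 (con #2 e h) = there (there (here e))
          candidate #2 (con #0 e h) = there (here e)
          candidate #2 (con #1 e h) = there (there (here e))
          candidate #2 (con #2 e h) = contradiction h (trivial #2)
          candidate #0 (opp #0 e h) = contradiction h square∉
          candidate #0 (opp #1 e h) = there (there (there (there (here e))))
          candidate #0 (opp #2 e h) = there (there (there (there (there (here e)))))
          candidate #1 (opp #0 e h) = there (there (there (here e)))
          candidate #1 (opp #1 e h) = there (there (there (there (here e))))
          candidate #1 (opp #2 e h) = there (there (there (there (there (here e)))))
          candidate #2 (opp #0 e h) = there (there (there (here e)))
          candidate #2 (opp #1 e h) = there (there (there (there (here e))))
          candidate #2 (opp #2 e h) = there (there (there (there (there (here e)))))

          bound : ∀ i → degree T′ (a i) ≤ 6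
          bound i = ℕₚ.≤-trans
            (degree-≤ T′ (a i) (candidates i) λ t∈ h → candidate i (neighbour i t∈ h)) (six i)
            where
            six : ∀ i → length (candidates i) ≤ 6
            six #0 = ℕₚ.≤-refl
            six #1 = ℕₚ.≤-refl
            six #2 = ℕₚ.≤-refl

        commutingTie : Gadget T a
        commutingTie = record
          { fresh = fresh
          ; unreserved = unreserved
          ; values = λ x∈ (r , r∈ , s∈) → value x∈ (signed⁻ r∈) s∈
          ; low = bound
          ; conclude = λ k t∈ rel p∈ p′∈ → concl rel (signed⁻ t∈) p∈ p′∈
          ; noInvolution = λ _ i e → products∉ i i (here e)
          }
          where
          value : ∀ {p r} → p ∈ₗ T ± → ∃[ i ] (r ≈ a i ⊎ r ≈ a i ⁻¹) → p ⁻¹ ∙ r ∈ₗ W ± → Coloured p ⊎ Protected p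
          value p∈ (i , inj₁ e) s∈ = listed-ok true i p∈ (listed⁺ i e p∈ s∈)
          value p∈ (i , inj₂ e) s∈ = listed-ok false i p∈ (listed⁻ i e p∈ s∈)
          concl : ∀ {k t p p′} → Related k p p′ → ∃[ i ] (t ≈ a i ⊎ t ≈ a i ⁻¹) →
                  p ⁻¹ ∙ t ∈ₗ W ± → p′ ⁻¹ ∙ t ∈ₗ W ± → Conclusion k p p′
          concl rel (i , inj₁ e) p∈ p′∈ = conclude true i rel
            (listed⁺ i e (coloured⊆ (proj₁ (related-∈ rel))) p∈) (listed⁺ i e (coloured⊆ (proj₂ (related-∈ rel))) p′∈)
          concl rel (i , inj₂ e) p∈ p′∈ = conclude false i rel
            (listed⁻ i e (coloured⊆ (proj₁ (related-∈ rel))) p∈) (listed⁻ i e (coloured⊆ (proj₂ (related-∈ rel))) p′∈)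

  -- Ties between a coloured element inverting `w` and another coloured element.

  module InvertedTies (setting : Gadgets.Setting) where
    open GroupSolver
    open Counting
    open Powers
    open Gadgets
    open Gadgets.Setting setting
    open Stages setting
    open Ties setting using (module Quotients; #0; #1; #2)

    -- The common neighbour of `e` and `f` is `e w`. Because `e` inverts `w`, we have `(e w)² = e²`
    -- and `w (e w) = e` whatever `w` is, so the values `e²` and `f⁻¹ e²` cannot be avoided. The
    -- only old neighbours possible for `(e w)⁻¹` are `e⁻²`, `e⁻¹` and `(f⁻¹ e²)⁻¹`; an automorphism
    -- that sends `e w` there has to respect this.
    module InvertingTie {T : List Carrier} (stage : Stage T) (w e f : Carrier)
                        (e∈ : Coloured e) (f∈ : Coloured f) where
      open Stage stage using (coloured⊆; ε∉)

      a : Fin 3 → Carrier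
      a #0 = e ∙ w
      a #1 = w
      a #2 = f ⁻¹ ∙ (e ∙ w)

      Listed : Bool → Fin 3 → Carrier → Set ℓ
      Listed true  #0 p = p ≈ e ⊎ p ≈ f ⊎ p ≈ e ∙ e
      Listed true  #1 p = p ≈ e ⁻¹ ⊎ p ≈ e
      Listed true  #2 p = p ≈ f ⁻¹ ⊎ p ≈ f ⁻¹ ∙ (e ∙ e)
      Listed false #0 p = p ≈ (e ∙ e) ⁻¹ ⊎ p ≈ e ⁻¹ ⊎ p ≈ (f ⁻¹ ∙ (e ∙ e)) ⁻¹
      Listed false #1 p = Lift ℓ ⊥
      Listed false #2 p = Lift ℓ ⊥

      record Conditions : Set (c ⊔ ℓ) where
        field
          inverts   : Inverts e w
          fresh     : ∀ i → ¬ Product T (a i)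
          products∉ : ∀ i → ¬ a i ∙ a #1 ∈ₗ Ball₁ T × ¬ a i ∙ a #2 ∈ₗ Ball₁ T
          quotient∉ : ¬ e ⁻¹ ∙ f ∈ₗ T ±
          conj₀₁∉   : ¬ w ⁻¹ ∙ e ⁻¹ ∙ w ∈ₗ T ±
          conj₀₂∉   : ¬ w ⁻¹ ∙ (e ⁻¹ ∙ f ⁻¹ ∙ e) ∙ w ∈ₗ T ±
          conj₁₂∉   : ¬ w ⁻¹ ∙ (f ⁻¹ ∙ e) ∙ w ∈ₗ T ±
          -- No choice of `w` removes this value. Either it has been reserved, or the tie is made
          -- while all elements of `T` are coloured.
          value-ok  : f ⁻¹ ∙ (e ∙ e) ∈ₗ T ± → Coloured (f ⁻¹ ∙ (e ∙ e)) ⊎ Protected (f ⁻¹ ∙ (e ∙ e))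
          unreserved : ∀ i → ¬ Reserved (a i)
          conclude  : ∀ s i {k p p′} → Related k p p′ → Listed s i p → Listed s i p′ → Conclusion k p p′

      module _ (conditions : Conditions) where
        open Conditions conditions
        open Family T a fresh
        open Quotients T a fresh

        private
          uT : e ∈ₗ T ±
          uT = coloured⊆ e∈
          xT : f ∈ₗ T ±
          xT = coloured⊆ f∈

          divisions : ∀ i j {p} → p ≈ a i ∙ a j ⁻¹ → p ∈ₗ T ± → Listed true i p
          divisions #0 #0 h p∈ = contradiction (resp (trans h (inverseʳ _)) p∈) ε∉
          divisions #0 #1 h p∈ = inj₁ (trans h (solve 2 (λ e w → e · w · inv w ⊜ e) refl e w))
          divisions #0 #2 h p∈ = inj₂ (inj₁ (trans h (solve 3 (λ e f w → e · w · inv (inv f · (e · w)) ⊜ f) refl e f w)))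
          divisions #1 #0 h p∈ = inj₁ (trans h (solve 2 (λ e w → w · inv (e · w) ⊜ inv e) refl e w))
          divisions #1 #1 h p∈ = contradiction (resp (trans h (inverseʳ _)) p∈) ε∉
          divisions #1 #2 h p∈ = contradiction (resp (trans h
            (solve 3 (λ e f w → w · inv (inv f · (e · w)) ⊜ inv e · f) refl e f w)) p∈) quotient∉
          divisions #2 #0 h p∈ = inj₁ (trans h (solve 3 (λ e f w → inv f · (e · w) · inv (e · w) ⊜ inv f) refl e f w))
          divisions #2 #1 h p∈ = contradiction (resp (trans (⁻¹-cong h)
            (solve 3 (λ e f w → inv (inv f · (e · w) · inv w) ⊜ inv e · f) refl e f w)) (∈-inv T p∈)) quotient∉
          divisions #2 #2 h p∈ = contradiction (resp (trans h (inverseʳ _)) p∈) ε∉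

          conjugates : ∀ i j {p} → p ≈ a i ⁻¹ ∙ a j → ¬ p ∈ₗ T ±
          conjugates #0 #0 h p∈ = contradiction (resp (trans h (inverseˡ _)) p∈) ε∉
          conjugates #0 #1 h p∈ = conj₀₁∉ (resp (trans h (solve 2 (λ e w → inv (e · w) · w ⊜ inv w · inv e · w) refl e w)) p∈)
          conjugates #0 #2 h p∈ = conj₀₂∉ (resp (trans h
            (solve 3 (λ e f w → inv (e · w) · (inv f · (e · w)) ⊜ inv w · (inv e · inv f · e) · w) refl e f w)) p∈)
          conjugates #1 #0 h p∈ = conj₀₁∉ (resp (trans (⁻¹-cong h)
            (solve 2 (λ e w → inv (inv w · (e · w)) ⊜ inv w · inv e · w) refl e w)) (∈-inv T p∈))
          conjugates #1 #1 h p∈ = contradiction (resp (trans h (inverseˡ _)) p∈) ε∉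
          conjugates #1 #2 h p∈ = conj₁₂∉ (resp (trans h
            (solve 3 (λ e f w → inv w · (inv f · (e · w)) ⊜ inv w · (inv f · e) · w) refl e f w)) p∈)
          conjugates #2 #0 h p∈ = conj₀₂∉ (resp (trans (⁻¹-cong h)
            (solve 3 (λ e f w → inv (inv (inv f · (e · w)) · (e · w)) ⊜ inv w · (inv e · inv f · e) · w) refl e f w)) (∈-inv T p∈))
          conjugates #2 #1 h p∈ = conj₁₂∉ (resp (trans (⁻¹-cong h)
            (solve 3 (λ e f w → inv (inv (inv f · (e · w)) · w) ⊜ inv w · (inv f · e) · w) refl e f w)) (∈-inv T p∈))
          conjugates #2 #2 h p∈ = contradiction (resp (trans h (inverseˡ _)) p∈) ε∉

          ewew : a #0 ∙ a #0 ≈ e ∙ e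
          ewew = trans (solve 2 (λ e w → e · w · (e · w) ⊜ e · (w · e · w)) refl e w) (∙-congˡ inverts)
          wew : a #1 ∙ a #0 ≈ e
          wew = trans (sym (assoc _ _ _)) inverts
          fewew : a #2 ∙ a #0 ≈ f ⁻¹ ∙ (e ∙ e)
          fewew = trans (assoc _ _ _) (∙-congˡ ewew)

          listed⁺ : ∀ i {t p} → t ≈ a i → p ∈ₗ T ± → p ⁻¹ ∙ t ∈ₗ W ± → Listed true i p
          listed⁺ i h p∈ s∈ with positive i h s∈
          ... | j , inj₁ g = divisions i j g p∈
          listed⁺ #0 h p∈ s∈ | #0 , inj₂ g = inj₂ (inj₂ (trans g ewew))
          listed⁺ #1 h p∈ s∈ | #0 , inj₂ g = inj₂ (trans g wew)
          listed⁺ #2 h p∈ s∈ | #0 , inj₂ g = inj₂ (trans g fewew)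
          listed⁺ i h p∈ s∈ | #1 , inj₂ g = contradiction (there (resp g p∈)) (proj₁ (products∉ i))
          listed⁺ i h p∈ s∈ | #2 , inj₂ g = contradiction (there (resp g p∈)) (proj₂ (products∉ i))

          turn : ∀ {p y z} → p ⁻¹ ≈ y → y ≈ z → p ≈ z ⁻¹
          turn {p} g h = trans (sym (⁻¹-involutive p)) (⁻¹-cong (trans g h))

          listed⁻ : ∀ i {t p} → t ≈ a i ⁻¹ → p ∈ₗ T ± → p ⁻¹ ∙ t ∈ₗ W ± → Listed false i p
          listed⁻ i h p∈ s∈ with negative i h s∈
          ... | j , inj₁ g = contradiction p∈ (conjugates i j g)
          listed⁻ #0 h p∈ s∈ | #0 , inj₂ g = inj₁ (turn g ewew)
          listed⁻ #0 h p∈ s∈ | #1 , inj₂ g = inj₂ (inj₁ (turn g wew))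
          listed⁻ #0 h p∈ s∈ | #2 , inj₂ g = inj₂ (inj₂ (turn g fewew))
          listed⁻ #1 h p∈ s∈ | j , inj₂ g = contradiction (there (resp g (∈-inv T p∈))) (proj₁ (products∉ j))
          listed⁻ #2 h p∈ s∈ | j , inj₂ g = contradiction (there (resp g (∈-inv T p∈))) (proj₂ (products∉ j))

          Ok : Carrier → Set (c ⊔ ℓ)
          Ok p = Coloured p ⊎ Protected p
          ok-resp : ∀ {p p′} → p′ ≈ p → Ok p → Ok p′
          ok-resp h (inj₁ v) = inj₁ (resp (sym h) v)
          ok-resp h (inj₂ v) = inj₂ (protected-resp (sym h) v)
          ok-inv : ∀ {p} → Ok p → Ok (p ⁻¹)
          ok-inv (inj₁ v) = inj₁ (∈-inv V v)
          ok-inv (inj₂ v) = inj₂ (protected-inv v)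
          ok-square : Ok (e ∙ e)
          ok-square = inj₂ (inj₁ (product-∙ V e∈ e∈))
          ok-value : ∀ {p} → p ∈ₗ T ± → p ≈ f ⁻¹ ∙ (e ∙ e) → Ok p
          ok-value p∈ h = ok-resp h (value-ok (resp h p∈))

          listed-ok : ∀ s i {p} → p ∈ₗ T ± → Listed s i p → Ok p
          listed-ok true #0 p∈ (inj₁ h) = ok-resp h (inj₁ e∈)
          listed-ok true #0 p∈ (inj₂ (inj₁ h)) = ok-resp h (inj₁ f∈)
          listed-ok true #0 p∈ (inj₂ (inj₂ h)) = ok-resp h ok-square
          listed-ok true #1 p∈ (inj₁ h) = ok-resp h (ok-inv (inj₁ e∈))
          listed-ok true #1 p∈ (inj₂ h) = ok-resp h (inj₁ e∈)
          listed-ok true #2 p∈ (inj₁ h) = ok-resp h (ok-inv (inj₁ f∈))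
          listed-ok true #2 p∈ (inj₂ h) = ok-value p∈ h
          listed-ok false #0 p∈ (inj₁ h) = ok-resp h (ok-inv ok-square)
          listed-ok false #0 p∈ (inj₂ (inj₁ h)) = ok-resp h (ok-inv (inj₁ e∈))
          listed-ok false #0 {p} p∈ (inj₂ (inj₂ h)) = ok-resp (sym (⁻¹-involutive p))
            (ok-inv (ok-value (∈-inv T p∈) (trans (⁻¹-cong h) (⁻¹-involutive _))))

          listed-ok false #1 p∈ (lift ())
          listed-ok false #2 p∈ (lift ())

          self : ∀ i → Product T (a i ∙ a i ⁻¹)
          self i = product-resp T (trans (inverseʳ ε) (sym (inverseʳ (a i))))
            (ε , ε ⁻¹ , here refl , Ball₁-inv T (here refl) , refl)

          quotient : ∀ i j → Product T (a i ∙ a j ⁻¹)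
          quotient #0 #0 = self #0
          quotient #0 #1 = product-resp T (solve 2 (λ e w → e ⊜ e · w · inv w) refl e w) (product-∈ T uT)
          quotient #0 #2 = product-resp T (solve 3 (λ e f w → f ⊜ e · w · inv (inv f · (e · w))) refl e f w) (product-∈ T xT)
          quotient #1 #0 = product-resp T (solve 2 (λ e w → inv e ⊜ w · inv (e · w)) refl e w) (product-∈ T (∈-inv T uT))
          quotient #1 #1 = self #1
          quotient #1 #2 = product-resp T (solve 3 (λ e f w → inv e · f ⊜ w · inv (inv f · (e · w))) refl e f w) (product-∙ T (∈-inv T uT) xT)
          quotient #2 #0 = product-resp T (solve 3 (λ e f w → inv f ⊜ inv f · (e · w) · inv (e · w)) refl e f w) (product-∈ T (∈-inv T xT))
          quotient #2 #1 = product-resp T (solve 3 (λ e f w → inv f · e ⊜ inv f · (e · w) · inv w) refl e f w) (product-∙ T (∈-inv T xT) uT)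
          quotient #2 #2 = self #2

          conjugate∉ : ∀ i j → ¬ a i ⁻¹ ∙ a j ∈ₗ T′ ±
          conjugate∉ i j h = [ conjugate∉W quotient i j , conjugates i j refl ]′ (±-++⁻ W T h)

          candidates : Fin 3 → List Carrier
          candidates #0 = e ∷ f ∷ e ∙ e ∷ a #0 ⁻¹ ∷ a #1 ⁻¹ ∷ a #2 ⁻¹ ∷ []
          candidates #1 = e ⁻¹ ∷ e ∷ a #2 ∷ a #0 ⁻¹ ∷ a #1 ⁻¹ ∷ a #2 ⁻¹ ∷ []
          candidates #2 = f ⁻¹ ∷ f ⁻¹ ∙ (e ∙ e) ∷ a #1 ∷ a #0 ⁻¹ ∷ a #1 ⁻¹ ∷ a #2 ⁻¹ ∷ []

          listed-candidate : ∀ i {t} → Listed true i t → t ∈ₗ candidates i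
          listed-candidate #0 (inj₁ h) = here h
          listed-candidate #0 (inj₂ (inj₁ h)) = there (here h)
          listed-candidate #0 (inj₂ (inj₂ h)) = there (there (here h))
          listed-candidate #1 (inj₁ h) = here h
          listed-candidate #1 (inj₂ h) = there (here h)
          listed-candidate #2 (inj₁ h) = here h
          listed-candidate #2 (inj₂ h) = there (here h)

          opposite : ∀ i j {t} → t ≈ a j ⁻¹ → t ∈ₗ candidates i
          opposite #0 #0 h = there (there (there (here h)))
          opposite #0 #1 h = there (there (there (there (here h))))
          opposite #0 #2 h = there (there (there (there (there (here h)))))
          opposite #1 #0 h = there (there (there (here h)))
          opposite #1 #1 h = there (there (there (there (here h))))
          opposite #1 #2 h = there (there (there (there (there (here h)))))
          opposite #2 #0 h = there (there (there (here h)))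
          opposite #2 #1 h = there (there (there (there (here h))))
          opposite #2 #2 h = there (there (there (there (there (here h)))))

          candidate : ∀ i {t} → Neighbour i t → t ∈ₗ candidates i
          candidate i (div j h t∈) = listed-candidate i (divisions i j h t∈)
          candidate #0 (prod #0 h t∈) = there (there (here (trans h ewew)))
          candidate #1 (prod #0 h t∈) = there (here (trans h wew))
          candidate #2 (prod #0 h t∈) = there (here (trans h fewew))
          candidate i (prod #1 h t∈) = contradiction (there (resp h t∈)) (proj₁ (products∉ i))
          candidate i (prod #2 h t∈) = contradiction (there (resp h t∈)) (proj₂ (products∉ i))
          candidate #1 (con #2 h _) = there (there (here h))
          candidate #2 (con #1 h _) = there (there (here h))
          candidate #0 (con j h e∈) = contradiction e∈ (conjugate∉ #0 j)
          candidate #1 (con #0 h e∈) = contradiction e∈ (conjugate∉ #1 #0)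
          candidate #1 (con #1 h e∈) = contradiction e∈ (conjugate∉ #1 #1)
          candidate #2 (con #0 h e∈) = contradiction e∈ (conjugate∉ #2 #0)
          candidate #2 (con #2 h e∈) = contradiction e∈ (conjugate∉ #2 #2)
          candidate i (opp j h _) = opposite i j h

          bound : ∀ i → degree T′ (a i) ≤ 6
          bound i = ℕₚ.≤-trans
            (degree-≤ T′ (a i) (candidates i) λ t∈ h → candidate i (neighbour i t∈ h)) (six i)
            where
            six : ∀ i → length (candidates i) ≤ 6
            six #0 = ℕₚ.≤-refl
            six #1 = ℕₚ.≤-refl
            six #2 = ℕₚ.≤-refl

        invertingTie : Gadget T a
        invertingTie = record
          { fresh = fresh
          ; unreserved = unreserved
          ; values = λ x∈ (r , r∈ , s∈) → value x∈ (signed⁻ r∈) s∈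
          ; low = bound
          ; conclude = λ k t∈ rel p∈ p′∈ → concl rel (signed⁻ t∈) p∈ p′∈
          ; noInvolution = noInv
          }
          where
          value : ∀ {p r} → p ∈ₗ T ± → ∃[ i ] (r ≈ a i ⊎ r ≈ a i ⁻¹) → p ⁻¹ ∙ r ∈ₗ W ± → Ok p
          value p∈ (i , inj₁ h) s∈ = listed-ok true i p∈ (listed⁺ i h p∈ s∈)
          value p∈ (i , inj₂ h) s∈ = listed-ok false i p∈ (listed⁻ i h p∈ s∈)
          concl : ∀ {k t p p′} → Related k p p′ → ∃[ i ] (t ≈ a i ⊎ t ≈ a i ⁻¹) →
                  p ⁻¹ ∙ t ∈ₗ W ± → p′ ⁻¹ ∙ t ∈ₗ W ± → Conclusion k p p′
          concl rel (i , inj₁ h) p∈ p′∈ = conclude true i rel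
            (listed⁺ i h (coloured⊆ (proj₁ (related-∈ rel))) p∈) (listed⁺ i h (coloured⊆ (proj₂ (related-∈ rel))) p′∈)
          concl rel (i , inj₂ h) p∈ p′∈ = conclude false i rel
            (listed⁻ i h (coloured⊆ (proj₁ (related-∈ rel))) p∈) (listed⁻ i h (coloured⊆ (proj₂ (related-∈ rel))) p′∈)
          noInv : NoInvolution V → ∀ i → ¬ a i ∙ a i ≈ ε
          -- An involution `e w` would make `e` an involution, because `(e w)² = e²`; and `e` or its
          -- inverse lies in `V`.
          noInv nv #0 h = [ (λ p → nv p ee) , (λ p → nv p (trans (solve 1 (λ e → inv e · inv e ⊜ inv (e · e)) refl e)
              (trans (⁻¹-cong ee) (ε⁻¹≈ε)))) ]′ (∈-±⁻ V e∈)
            where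
            ee : e ∙ e ≈ ε
            ee = trans (sym ewew) h
          noInv nv #1 h = proj₁ (products∉ #1) (here h)
          noInv nv #2 h = proj₂ (products∉ #2) (here h)

  -- From automorphisms of the ball to maps of the group, and what degrees tell about them.

  module Automorphisms where
    open GroupSolver
    open Counting
    open Gadgets
    open SimpleGraph using (vertices)

    -- An automorphism of the ball together with its inverse, as functions on the whole group, so
    -- that equations need no proofs of membership in the ball.
    record BallMap (T : List Carrier) (f g : Carrier → Carrier) : Set (c ⊔ ℓ) where
      field
        cong   : ∀ {x y} → x ≈ y → f x ≈ f y
        fixes  : f ε ≈ ε
        closed : ∀ {x} → x ∈ₗ T ± → f x ∈ₗ T ±
        adj    : ∀ {x y} → x ∈ₗ T ± → y ∈ₗ T ± → x ⁻¹ ∙ y ∈ₗ T ± → f x ⁻¹ ∙ f y ∈ₗ T ±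
        undo   : ∀ {x} → x ∈ₗ T ± → g (f x) ≈ x

    FixedUpToInverse : List Carrier → (Carrier → Carrier) → Set (c ⊔ ℓ)
    FixedUpToInverse S f = ∀ {x} → x ∈ₗ S ± → f x ≈ x ⊎ f x ≈ x ⁻¹

    -- This concerns the edges that avoid `ε`; those at `ε` are the subject of `FixedUpToInverse`.
    PairsPreserved : List Carrier → (Carrier → Carrier) → Set (c ⊔ ℓ)
    PairsPreserved S f = ∀ {x y} → x ∈ₗ S ± → y ∈ₗ S ± → x ⁻¹ ∙ y ∈ₗ S ± →
      f y ≈ f x ∙ (x ⁻¹ ∙ y) ⊎ f y ≈ f x ∙ (x ⁻¹ ∙ y) ⁻¹

    Rigid : List Carrier → List Carrier → Set (c ⊔ ℓ)
    Rigid S T = ∀ {f g} → BallMap T f g → BallMap T g f → FixedUpToInverse S f × PairsPreserved S f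

    module _ (S T : GeneratingSet) (S⊆T : S ⊆ T) (rigid : Rigid (elements S) (elements T)) where

      private
        Sₗ = elements S
        Tₗ = elements T

        extension : (φ : Permutation (vertices (Ball T))) → Carrier → Carrier
        extension φ x with dec (x ∈ₗ Ball₁ Tₗ)
        ... | yes m = proj₁ (Inverse.to φ (x , m))
        ... | no _ = x

        extension-≈ : ∀ φ x m → extension φ x ≈ proj₁ (Inverse.to φ (x , m))
        extension-≈ φ x m with dec (x ∈ₗ Ball₁ Tₗ)
        ... | yes m′ = Inverse.to-cong φ {x , m′} {x , m} refl
        ... | no ¬m = contradiction m ¬m

        flip : Permutation (vertices (Ball T)) → Permutation (vertices (Ball T))
        flip φ = record { to = φ.from ; from = φ.to ; to-cong = φ.from-cong ; from-cong = φ.to-cong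
                        ; inverse = proj₂ φ.inverse , proj₁ φ.inverse }
          where module φ = Inverse φ

        flip-automorphism : ∀ φ → IsGraphAutomorphism (Ball T) φ → IsGraphAutomorphism (Ball T) (flip φ)
        flip-automorphism φ aut u v = record
          { to = λ h → Equivalence.from (aut (φ.from u) (φ.from v)) (moved (sym (back u)) (sym (back v)) h)
          ; from = λ h → moved (back u) (back v) (Equivalence.to (aut (φ.from u) (φ.from v)) h)
          ; to-cong = λ { ≡.refl → ≡.refl }
          ; from-cong = λ { ≡.refl → ≡.refl } }
          where
          module φ = Inverse φ
          back : ∀ u → proj₁ (φ.to (φ.from u)) ≈ proj₁ u
          back u = proj₁ φ.inverse {u} {φ.from u} refl
          moved : ∀ {x x′ y y′} → x ≈ x′ → y ≈ y′ → x ⁻¹ ∙ y ∈ₗ Tₗ ± → x′ ⁻¹ ∙ y′ ∈ₗ Tₗ ±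
          moved e e′ = resp (∙-cong (⁻¹-cong e) e′)

        ballMap : ∀ φ → IsGraphAutomorphism (Ball T) φ → proj₁ (Inverse.to φ (𝟙 T)) ≈ ε →
                  BallMap Tₗ (extension φ) (extension (flip φ))
        ballMap φ aut fix = record
          { cong = f-cong
          ; fixes = f-ε
          ; closed = λ {x} x∈ → nonidentity x∈ (proj₂ (φ.to (x , there x∈)))
          ; adj = λ {x} {y} x∈ y∈ h → resp
              (∙-cong (⁻¹-cong (sym (extension-≈ φ x (there x∈)))) (sym (extension-≈ φ y (there y∈))))
              (Equivalence.to (aut (x , there x∈) (y , there y∈)) h)
          ; undo = λ x∈ → back (there x∈)
          }
          where
          module φ = Inverse φ
          f = extension φ
          g = extension (flip φ)
          f-cong : ∀ {x y} → x ≈ y → f x ≈ f y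
          f-cong {x} {y} e with dec (y ∈ₗ Ball₁ Tₗ)
          ... | yes m = trans (extension-≈ φ x (resp (sym e) m)) (φ.to-cong e)
          ... | no ¬m with dec (x ∈ₗ Ball₁ Tₗ)
          ...   | yes m = contradiction (resp e m) ¬m
          ...   | no _ = e
          f-ε : f ε ≈ ε
          f-ε = trans (extension-≈ φ ε (here refl)) fix
          back : ∀ {x} (m : x ∈ₗ Ball₁ Tₗ) → g (f x) ≈ x
          back {x} m =
            let y = φ.to (x , m)
                fx≈y = extension-≈ φ x m
            in trans (extension-≈ (flip φ) (f x) (resp (sym fx≈y) (proj₂ y)))
                     (trans (φ.from-cong {f x , resp (sym fx≈y) (proj₂ y)} {y} fx≈y) (proj₂ φ.inverse {x , m} {y} refl))
          nonidentity : ∀ {x} (x∈ : x ∈ₗ Tₗ ±) → proj₁ (φ.to (x , there x∈)) ∈ₗ Ball₁ Tₗ → f x ∈ₗ Tₗ ±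
          nonidentity {x} x∈ (there h) = resp (sym (extension-≈ φ x (there x∈))) h
          nonidentity {x} x∈ (here h) = contradiction
            (resp (trans (sym (back (there x∈))) (trans (g-cong fx≈ε) g-ε)) x∈) (ε∉± T)
            where
            fx≈ε : f x ≈ ε
            fx≈ε = trans (extension-≈ φ x (there x∈)) h
            g-cong : f x ≈ ε → g (f x) ≈ g ε
            g-cong e = trans (extension-≈ (flip φ) (f x) (here e))
              (trans (φ.from-cong {f x , here e} {ε , here refl} e) (sym (extension-≈ (flip φ) ε (here refl))))
            g-ε : g ε ≈ ε
            g-ε = trans (extension-≈ (flip φ) ε (here refl)) (proj₂ φ.inverse {𝟙 T} {𝟙 T} (sym fix))

      strongTriple : StrongColourRigidTriple S T S⊆T
      strongTriple φ aut fix = ψ , (λ v → sym (extension-≈ φ (proj₁ v) (proj₂ (include {S} {T} S⊆T v)))) , colours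
        where
        module φ = Inverse φ
        fix⁻¹ : proj₁ (φ.from (𝟙 T)) ≈ ε
        fix⁻¹ = proj₂ φ.inverse {𝟙 T} {𝟙 T} (sym fix)
        f g : Carrier → Carrier
        f = extension φ
        g = extension (flip φ)
        Φ : BallMap Tₗ f g
        Φ = ballMap φ aut fix
        Ψ : BallMap Tₗ g f
        Ψ = ballMap (flip φ) (flip-automorphism φ aut) fix⁻¹
        module Φ = BallMap Φ
        module Ψ = BallMap Ψ
        S⊆T± : ∀ {x} → x ∈ₗ Sₗ ± → x ∈ₗ Tₗ ±
        S⊆T± = ±-⊆ Sₗ Tₗ S⊆T
        into : ∀ {f g} → BallMap Tₗ f g → FixedUpToInverse Sₗ f → ∀ {x} → x ∈ₗ Ball₁ Sₗ → f x ∈ₗ Ball₁ Sₗ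
        into M fixed (here e) = here (trans (BallMap.cong M e) (BallMap.fixes M))
        into M fixed (there x∈) with fixed x∈
        ... | inj₁ e = there (resp (sym e) x∈)
        ... | inj₂ e = there (resp (sym e) (∈-inv Sₗ x∈))
        undone : ∀ {f g} → BallMap Tₗ f g → BallMap Tₗ g f → ∀ {x} → x ∈ₗ Ball₁ Sₗ → g (f x) ≈ x
        undone M N (there x∈) = BallMap.undo M (S⊆T± x∈)
        undone M N (here e) = trans (BallMap.cong N (trans (BallMap.cong M e) (BallMap.fixes M)))
          (trans (BallMap.fixes N) (sym e))
        ψ : Permutation (vertices (Ball S))
        ψ = record
          { to = λ (x , m) → f x , into Φ (proj₁ (rigid Φ Ψ)) m
          ; from = λ (x , m) → g x , into Ψ (proj₁ (rigid Ψ Φ)) m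
          ; to-cong = Φ.cong
          ; from-cong = Ψ.cong
          ; inverse = (λ {x} e → trans (Φ.cong e) (undone Ψ Φ (proj₂ x)))
                    , (λ {x} e → trans (Ψ.cong e) (undone Φ Ψ (proj₂ x))) }
        colours : IsColourPreserving S (BallVertex S) ψ
        colours (x , mx) (y , my) s s∈ y≈xs adjacent = shape mx my
          where
          s≈ : x ⁻¹ ∙ y ≈ s
          s≈ = trans (∙-congˡ y≈xs) (solve 2 (λ x s → inv x · (x · s) ⊜ s) refl x s)
          shape : x ∈ₗ Ball₁ Sₗ → y ∈ₗ Ball₁ Sₗ → f y ≈ f x ∙ s ⊎ f y ≈ f x ∙ s ⁻¹
          shape (here x≈ε) _ = both (proj₁ (rigid Φ Ψ) s∈)
            where
            y≈s : y ≈ s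
            y≈s = trans y≈xs (trans (∙-congʳ x≈ε) (identityˡ s))
            fx≈ε : f x ≈ ε
            fx≈ε = trans (Φ.cong x≈ε) Φ.fixes
            both : f s ≈ s ⊎ f s ≈ s ⁻¹ → f y ≈ f x ∙ s ⊎ f y ≈ f x ∙ s ⁻¹
            both (inj₁ e) = inj₁ (trans (Φ.cong y≈s) (trans e (sym (trans (∙-congʳ fx≈ε) (identityˡ s)))))
            both (inj₂ e) = inj₂ (trans (Φ.cong y≈s) (trans e (sym (trans (∙-congʳ fx≈ε) (identityˡ (s ⁻¹))))))
          shape (there x∈) (here y≈ε) = both (proj₁ (rigid Φ Ψ) x∈)
            where
            x≈s⁻¹ : x ≈ s ⁻¹
            x≈s⁻¹ = trans (solve 2 (λ x s → x ⊜ x · s · inv s) refl x s)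
                      (trans (∙-congʳ (trans (sym y≈xs) y≈ε)) (identityˡ _))
            fy≈ε : f y ≈ ε
            fy≈ε = trans (Φ.cong y≈ε) Φ.fixes
            both : f x ≈ x ⊎ f x ≈ x ⁻¹ → f y ≈ f x ∙ s ⊎ f y ≈ f x ∙ s ⁻¹
            both (inj₁ e) = inj₁ (trans fy≈ε (sym (trans (∙-congʳ (trans e x≈s⁻¹)) (inverseˡ s))))
            both (inj₂ e) = inj₂ (trans fy≈ε (sym (trans (∙-congʳ (trans e (trans (⁻¹-cong x≈s⁻¹) (⁻¹-involutive s)))) (inverseʳ s))))
          shape (there x∈) (there y∈) with proj₂ (rigid Φ Ψ) x∈ y∈ adjacent
          ... | inj₁ e = inj₁ (trans e (∙-congˡ s≈))
          ... | inj₂ e = inj₂ (trans e (∙-congˡ (⁻¹-cong s≈)))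

    degree-preserved : ∀ {T f g} → BallMap T f g → BallMap T g f → ∀ {v} → v ∈ₗ T ± → degree T (f v) ≡ degree T v
    degree-preserved {T} {f} {g} Φ Ψ {v} v∈ = ℕₚ.≤-antisym
      (ℕₚ.≤-trans (one-way Ψ Φ (Φ.closed v∈)) (ℕₚ.≤-reflexive (degree-cong T (Φ.undo v∈))))
      (one-way Φ Ψ v∈)
      where
      module Φ = BallMap Φ
      one-way : ∀ {f g} → BallMap T f g → BallMap T g f → ∀ {v} → v ∈ₗ T ± → degree T v ≤ degree T (f v)
      one-way {f} M N {v} v∈ = degree-injection T v T (f v) f
        (λ t∈ h → BallMap.closed M t∈ , BallMap.adj M v∈ t∈ h)
        (λ s∈ t∈ e → trans (sym (BallMap.undo M s∈)) (trans (BallMap.cong N e) (BallMap.undo M t∈)))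

    module Coloured-automorphism (setting : Setting) where
      open Setting setting
      open Stages setting

      module _ {T : List Carrier} (stage : Stage T)
               (distinct : ∀ {u v} → u ∈ₗ V → v ∈ₗ V → degree T u ≡ degree T v → u ≈ v)
               (high : ∀ {u} → u ∈ₗ V → 7 ≤ degree T u)
               {f g : Carrier → Carrier} (Φ : BallMap T f g) (Ψ : BallMap T g f) where
        open Stage stage
        private module Φ = BallMap Φ

        private
          representative : ∀ {v} → Coloured v → ∃[ u ] u ∈ₗ V × degree T u ≡ degree T v × (v ≈ u ⊎ v ≈ u ⁻¹)
          representative {v} v∈ with ∈-±⁻ V v∈
          ... | inj₁ p = v , p , ≡.refl , inj₁ refl
          ... | inj₂ p = v ⁻¹ , p , degree-inv T v , inj₂ (sym (⁻¹-involutive v))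

          high± : ∀ {v} → Coloured v → 7 ≤ degree T v
          high± v∈ = let (u , u∈ , eq , _) = representative v∈ in ℕₚ.≤-trans (high u∈) (ℕₚ.≤-reflexive eq)

        -- The image has degree at least 7, hence is coloured, and since degrees distinguish the
        -- classes it lies in the class of `v`.
        coloured-fixed : ∀ {v} → Coloured v → f v ≈ v ⊎ f v ≈ v ⁻¹
        coloured-fixed {v} v∈ with low (Φ.closed (coloured⊆ v∈))
        ... | inj₂ (le , _) = contradiction (ℕₚ.≤-trans (high± v∈) (ℕₚ.≤-trans
                (ℕₚ.≤-reflexive (≡.sym (degree-preserved Φ Ψ (coloured⊆ v∈)))) le)) (ℕₚ.<⇒≱ ℕₚ.≤-refl)
        ... | inj₁ fv∈ with representative v∈ | representative fv∈
        ...   | u , u∈ , eq , r | u′ , u′∈ , eq′ , r′ = combine r r′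
          where
          same : u ≈ u′
          same = distinct u∈ u′∈ (≡.trans eq (≡.trans (≡.sym (degree-preserved Φ Ψ (coloured⊆ v∈))) (≡.sym eq′)))
          combine : v ≈ u ⊎ v ≈ u ⁻¹ → f v ≈ u′ ⊎ f v ≈ u′ ⁻¹ → f v ≈ v ⊎ f v ≈ v ⁻¹
          combine (inj₁ a) (inj₁ b) = inj₁ (trans b (trans (sym same) (sym a)))
          combine (inj₁ a) (inj₂ b) = inj₂ (trans b (⁻¹-cong (trans (sym same) (sym a))))
          combine (inj₂ a) (inj₁ b) = inj₂ (trans b (trans (sym same) (sym (trans (⁻¹-cong a) (⁻¹-involutive u)))))
          combine (inj₂ a) (inj₂ b) = inj₁ (trans b (trans (⁻¹-cong (sym same)) (sym a)))

        -- The image of an uncoloured `t` has degree at most 6, hence is uncoloured. It is a common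
        -- neighbour of `f p` and `f q`, so `conclude` applies to it.
        transport : ∀ i {t p q} → t ∈ₗ T ± → ¬ Coloured t → p ∈ₗ T ± → q ∈ₗ T ± →
          p ⁻¹ ∙ t ∈ₗ T ± → q ⁻¹ ∙ t ∈ₗ T ± → Related i (f p) (f q) → Conclusion i (f p) (f q)
        transport i {t} t∈ t∉ p∈ q∈ a b rel = conclude i (Φ.closed t∈) ft∉ rel (Φ.adj p∈ t∈ a) (Φ.adj q∈ t∈ b)
          where
          ft∉ : ¬ Coloured (f t)
          ft∉ ft∈ with low t∈
          ... | inj₁ t∈V = t∉ t∈V
          ... | inj₂ (le , _) = contradiction (ℕₚ.≤-trans (high± ft∈)
                  (ℕₚ.≤-trans (ℕₚ.≤-reflexive (degree-preserved Φ Ψ t∈)) le)) (ℕₚ.<⇒≱ ℕₚ.≤-refl)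

      stage-transfer : ∀ {T T′} → (∀ {x} → x ∈ₗ T → x ∈ₗ T′) → (∀ {x} → x ∈ₗ T′ → x ∈ₗ T) → Stage T → Stage T′
      stage-transfer {T} {T′} sub sup S = record
        { coloured⊆ = up ∘ S.coloured⊆
        ; ε∉ = S.ε∉ ∘ down
        ; low = λ {t} t∈ → [ inj₁ , (λ (le , np) → inj₂
            (ℕₚ.≤-trans (degree-mono T′ T t λ p q → down p , down q) le , np)) ]′ (S.low (down t∈))
        ; conclude = λ i t∈ t∉ rel a b → S.conclude i (down t∈) t∉ rel (down a) (down b)
        ; noInvolution = λ nv t∈ → S.noInvolution nv (sup t∈)
        }
        where
        module S = Stage S
        up : ∀ {x} → x ∈ₗ T ± → x ∈ₗ T′ ±
        up = ±-⊆ T T′ sub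
        down : ∀ {x} → x ∈ₗ T′ ± → x ∈ₗ T ±
        down = ±-⊆ T′ T sup

  -- Representatives of the classes, the order of marking, and the final generating set.

  module Completion where
    open Counting
    open Powers
    open Gadgets
    open Markers
    open Colouring
    open Automorphisms

    Apart : Carrier → Carrier → Set ℓ
    Apart u v = ¬ u ≈ v × ¬ u ≈ v ⁻¹

    apart-sym : ∀ {u v} → Apart u v → Apart v u
    apart-sym {u} (p , q) = (p ∘ sym) , λ e → q (trans (sym (⁻¹-involutive u)) (⁻¹-cong (sym e)))

    apart-cong : ∀ {u v w} → u ≈ v → Apart v w → Apart u w
    apart-cong e (p , q) = (λ h → p (trans (sym e) h)) , λ h → q (trans (sym e) h)

    all-apart : ∀ {u v vs} → All (Apart u) vs → v ∈ₗ vs → Apart u v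
    all-apart ((p , q) ∷ _) (here e) = (λ h → p (trans h e)) , λ h → q (trans h (⁻¹-cong e))
    all-apart (_ ∷ ps) (there v∈) = all-apart ps v∈

    apart-lookup : ∀ {vs u v} → AllPairs Apart vs → u ∈ₗ vs → v ∈ₗ vs → u ≈ v ⊎ Apart u v
    apart-lookup (ps ∷ _) (here e) (here e′) = inj₁ (trans e (sym e′))
    apart-lookup (ps ∷ _) (here e) (there v∈) = inj₂ (apart-cong e (all-apart ps v∈))
    apart-lookup (ps ∷ _) (there u∈) (here e) = inj₂ (apart-sym (apart-cong e (all-apart ps u∈)))
    apart-lookup (_ ∷ ap) (there u∈) (there v∈) = apart-lookup ap u∈ v∈

    antisymmetric : ∀ {vs u v} → AllPairs Apart vs → u ∈ₗ vs → v ∈ₗ vs → u ≈ v ⁻¹ → u ≈ v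
    antisymmetric ap u∈ v∈ e = [ id , (λ (_ , q) → contradiction e q) ]′ (apart-lookup ap u∈ v∈)

    representatives : List Carrier → List Carrier
    representatives [] = []
    representatives (s ∷ ss) with dec (s ∈ₗ representatives ss ±)
    ... | yes _ = representatives ss
    ... | no  _ = s ∷ representatives ss

    representatives-⊆ : ∀ ss {x} → x ∈ₗ representatives ss → x ∈ₗ ss
    representatives-⊆ (s ∷ ss) x∈ with dec (s ∈ₗ representatives ss ±)
    ... | yes _ = there (representatives-⊆ ss x∈)
    representatives-⊆ (s ∷ ss) (here e) | no _ = here e
    representatives-⊆ (s ∷ ss) (there x∈) | no _ = there (representatives-⊆ ss x∈)

    representatives-cover : ∀ ss {x} → x ∈ₗ ss → x ∈ₗ representatives ss ±
    representatives-cover (s ∷ ss) x∈ with dec (s ∈ₗ representatives ss ±)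
    representatives-cover (s ∷ ss) (here e) | yes p = resp (sym e) p
    representatives-cover (s ∷ ss) (there x∈) | yes _ = representatives-cover ss x∈
    representatives-cover (s ∷ ss) (here e) | no _ = ∈-±ˡ (here e)
    representatives-cover (s ∷ ss) (there x∈) | no _ =
      ±-⊆ (representatives ss) (s ∷ representatives ss) there (representatives-cover ss x∈)

    representatives-length : ∀ ss → length (representatives ss) ≤ length ss
    representatives-length [] = z≤n
    representatives-length (s ∷ ss) with dec (s ∈ₗ representatives ss ±)
    ... | yes _ = ℕₚ.m≤n⇒m≤1+n (representatives-length ss)
    ... | no  _ = s≤s (representatives-length ss)

    outside-apart : ∀ {s} vs → ¬ s ∈ₗ vs ± → All (Apart s) vs
    outside-apart [] _ = []
    outside-apart {s} (v ∷ vs) s∉ =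
      ((λ e → s∉ (∈-±ˡ (here e))) , (λ e → s∉ (∈-±⁺ (v ∷ vs) (inj₂ (here (trans (⁻¹-cong e) (⁻¹-involutive v)))))))
      ∷ outside-apart vs (s∉ ∘ ±-⊆ vs (v ∷ vs) there)

    representatives-apart : ∀ ss → AllPairs Apart (representatives ss)
    representatives-apart [] = []
    representatives-apart (s ∷ ss) with dec (s ∈ₗ representatives ss ±)
    ... | yes _ = representatives-apart ss
    ... | no s∉ = outside-apart (representatives ss) s∉ ∷ representatives-apart ss

    partition-length : ∀ {P Q : Carrier → Set ℓ} (P? : ∀ v → Dec (P v)) (Q? : ∀ v → Dec (Q v)) →
      (∀ {v} → P v → Q v → ⊥) → (∀ {v} → ¬ P v → ¬ Q v → ⊥) → ∀ vs →
      length (filter P? vs) + length (filter Q? vs) ≡ length vs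
    partition-length P? Q? disjoint cover [] = ≡.refl
    partition-length P? Q? disjoint cover (v ∷ vs)
      with P? v | Q? v | partition-length P? Q? disjoint cover vs
    ... | yes p | yes q | _ = ⊥-elim (disjoint p q)
    ... | yes _ | no _  | eq = ≡.cong suc eq
    ... | no _  | yes _ | eq = ≡.trans (ℕₚ.+-suc _ _) (≡.cong suc eq)
    ... | no p  | no q  | _ = ⊥-elim (cover p q)

    -- Reservations guard against ties. They are dropped once all ties are made, so that the markers
    -- may be chosen without regard to them.
    plain : Setting → Setting
    plain setting = record
      { V = V ; Index = Index ; Related = Related ; Conclusion = Conclusion ; related-∈ = related-∈
      ; Reserved = λ _ → Lift (c ⊔ ℓ) ⊥ ; reserved-resp = λ _ → id ; reserved-inv = id }
      where open Setting setting

    forget : ∀ setting {T} → Stages.Stage setting T → Stages.Stage (plain setting) T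
    forget setting stage = record
      { coloured⊆ = coloured⊆ ; ε∉ = ε∉
      ; low = λ t∈ → [ inj₁ , (λ (le , np) → inj₂ (le , λ { (inj₁ p) → np (inj₁ p) })) ]′ (low t∈)
      ; conclude = conclude ; noInvolution = noInvolution }
      where open Stages.Stage stage

    module Order (z : Carrier) (M : ℕ) (tl : Torsionless z (3 * M * M)) where

      private
        Inv : Carrier → Set ℓ
        Inv = InvertsUpTo z M

      inv-resp : ∀ {u v} → u ≈ v → Inv u → Inv v
      inv-resp e (n , p , q , r) = n , p , q , trans (∙-congʳ (∙-congˡ (sym e))) (trans r e)

      -- The square of `v` commutes with the power of `z` that `v` inverts, whereas `u` inverts a
      -- power of `z`: together this yields torsion.
      inv-square : ∀ {u v} → Inv u → Inv v → ¬ u ≈ v ∙ v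
      inv-square {u} {v} (m , 1≤m , m≤ , i) (n , 1≤n , n≤ , j) e =
        commutes-inverts-^ {u} {z} {n} {m} 1≤n 1≤m
          (ℕₚ.≤-trans (ℕₚ.*-monoʳ-≤ 2 (ℕₚ.*-mono-≤ n≤ m≤))
            (ℕₚ.≤-trans (ℕₚ.*-monoˡ-≤ (M * M) {2} {3} (s≤s (s≤s z≤n))) (ℕₚ.≤-reflexive (≡.sym (ℕₚ.*-assoc 3 M M)))))
          tl (trans (∙-congˡ e) (trans (inverts-square j) (∙-congʳ (sym e)))) i

      inv-inv : ∀ {u} → Inv u → Inv (u ⁻¹)
      inv-inv (n , p , q , r) = n , p , q , inverts-inv r

      -- Elements inverting a small power of z come first, since marking such an
      -- element v may change the degree of v².
      sorted : ∀ V → AllPairs Apart V → ∃[ L ] AllPairs (SparedBy z M) L ×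
          (∀ {x} → x ∈ₗ L → x ∈ₗ V) × (∀ {x} → x ∈ₗ V → x ∈ₗ L) × length L ≡ length V
      sorted V ap = L , AllPairsₚ.++⁺ first second cross , L⊆ , ⊆L , len V
        where
        Spares = SparedBy z M
        Inv? : ∀ v → Dec (Inv v)
        Inv? v = em≈
        not? : ∀ v → Dec (¬ Inv v)
        not? v = em≈
        I = filter Inv? V
        C = filter not? V
        L = I ++ C
        spare-II : ∀ us → All Inv us → AllPairs Apart us → AllPairs Spares us
        spare-II [] _ _ = []
        spare-II (u ∷ us) (i ∷ is) (p ∷ ps) = row us is p ∷ spare-II us is ps
          where
          row : ∀ vs → All Inv vs → All (Apart u) vs → All (Spares u) vs
          row [] _ _ = []
          row (v ∷ vs) (j ∷ js) ((a , b) ∷ as) = (a , b , λ _ → inv-square i j ,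
            λ e → inv-square (inv-inv i) j (trans (⁻¹-cong e) (⁻¹-involutive _))) ∷ row vs js as
        spare-not : ∀ {u} vs → All (¬_ ∘ Inv) vs → All (Apart u) vs → All (Spares u) vs
        spare-not [] _ _ = []
        spare-not (v ∷ vs) (n ∷ ns) ((a , b) ∷ as) = (a , b , λ i → contradiction i n) ∷ spare-not vs ns as
        spare-CC : ∀ us → All (¬_ ∘ Inv) us → AllPairs Apart us → AllPairs Spares us
        spare-CC [] _ _ = []
        spare-CC (u ∷ us) (_ ∷ is) (p ∷ ps) = spare-not us is p ∷ spare-CC us is ps
        first : AllPairs Spares I
        first = spare-II I (Allₚ.all-filter Inv? V) (AllPairsₚ.filter⁺ Inv? ap)
        second : AllPairs Spares C
        second = spare-CC C (Allₚ.all-filter not? V) (AllPairsₚ.filter⁺ not? ap)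
        in-I : ∀ {x} → x ∈ₗ I → x ∈ₗ V × Inv x
        in-I = Membershipₚ.∈-filter⁻ setoid Inv? inv-resp
        not-resp : ∀ {x y} → x ≈ y → ¬ Inv x → ¬ Inv y
        not-resp e n i = n (inv-resp (sym e) i)
        in-C : ∀ {x} → x ∈ₗ C → x ∈ₗ V × ¬ Inv x
        in-C = Membershipₚ.∈-filter⁻ setoid not? not-resp
        cross : All (λ u → All (Spares u) C) I
        cross = go I id
          where
          go : ∀ us → (∀ {x} → x ∈ₗ us → x ∈ₗ I) → All (λ u → All (Spares u) C) us
          go [] _ = []
          go (u ∷ us) sub = spare-not C (Allₚ.all-filter not? V) (row C id) ∷ go us (sub ∘ there)
            where
            row : ∀ vs → (∀ {x} → x ∈ₗ vs → x ∈ₗ C) → All (Apart u) vs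
            row [] _ = []
            row (v ∷ vs) sub′ = [ (λ e → contradiction (inv-resp e (proj₂ (in-I (sub (here refl))))) (proj₂ (in-C (sub′ (here refl))))) , id ]′
                (apart-lookup ap (proj₁ (in-I (sub (here refl)))) (proj₁ (in-C (sub′ (here refl)))))
              ∷ row vs (sub′ ∘ there)
        L⊆ : ∀ {x} → x ∈ₗ L → x ∈ₗ V
        L⊆ x∈ = [ proj₁ ∘ in-I , proj₁ ∘ in-C ]′ (Membershipₚ.∈-++⁻ setoid I x∈)
        ⊆L : ∀ {x} → x ∈ₗ V → x ∈ₗ L
        ⊆L {x} x∈ with Inv? x
        ... | yes i = Membershipₚ.∈-++⁺ˡ setoid (Membershipₚ.∈-filter⁺ setoid Inv? inv-resp x∈ i)
        ... | no n = Membershipₚ.∈-++⁺ʳ setoid I (Membershipₚ.∈-filter⁺ setoid not? not-resp x∈ n)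
        len : ∀ V → length (filter Inv? V ++ filter not? V) ≡ length V
        len V = ≡.trans (length-++ (filter Inv? V))
          (partition-length Inv? not? (λ i n → n i) (λ n n′ → n′ n) V)

    Target : GeneratingSet → ℕ → Set (c ⊔ ℓ) → Set (c ⊔ ℓ)
    Target S bound NoInv = ∃[ T ] Σ[ S⊆T ∈ S ⊆ T ]
      (∣ T ∣ ≤ bound × StrongColourRigidTriple S T S⊆T × (NoInv → NoElementOfOrder2 T))

    target-map : ∀ S {bound A B} → (A → B) → Target S bound B → Target S bound A
    target-map S h (T , S⊆T , le , triple , none) = T , S⊆T , le , triple , none ∘ h

    module _ (S : GeneratingSet) (setting : Setting) where
      open Setting setting

      module _ (z : Carrier) (M bound δ : ℕ)
               (tl : Torsionless z (3 * M * M))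
               (room : ∀ T → length T ≤ bound → 2 * (size T * size T) + 6 * size T < M)
               (independent : ∀ {i p q v} → v ∈ₗ V → Related i p q → Powers₂ v p → Powers₂ v q → ⊥)
               (apart : AllPairs Apart V) where
        open Colour (plain setting) z M bound tl room (λ _ → lower) independent
        open Stages (plain setting)

        -- Markers come last. Therefore `rigid` is asked of every further stage containing `T`; the
        -- ties present in `T` persist there.
        complete : ∀ {T} → Stages.Stage setting T → (∀ {s} → s ∈ₗ elements S → s ∈ₗ T) →
          (∀ {v} → v ∈ₗ V → δ ≤ degree T v) → length T + cost δ (length V) 0 ≤ bound →
          (∀ {T′} → Stage T′ → (∀ {x} → x ∈ₗ T → x ∈ₗ T′) → Distinct T′ V → High T′ V → Rigid (elements S) T′) →
          Target S bound (NoInvolution V)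
        complete {T} stage S⊆T δ≤ le rigid = T̂ , S⊆T̂ , length-T̂ , strongTriple S T̂ S⊆T̂ rigid′ , orders
          where
          order = Order.sorted z M tl V apart
          L = proj₁ order
          L⊆V = proj₁ (proj₂ (proj₂ order))
          V⊆L = proj₁ (proj₂ (proj₂ (proj₂ order)))
          lengthL = proj₂ (proj₂ (proj₂ (proj₂ order)))
          coloured = colour δ L [] (forget setting stage) L⊆V (λ ()) (proj₁ (proj₂ order)) (λ ()) (λ ()) (λ ())
            (δ≤ ∘ L⊆V) (≡.subst (λ k → length T + cost δ k 0 ≤ bound) (≡.sym lengthL) le)
          module E = Extension (proj₁ coloured)
          T̂ₗ = nodup E.T′
          us = proj₁ (proj₂ coloured)
          V⊆us : ∀ {x} → x ∈ₗ V → x ∈ₗ us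
          V⊆us = proj₂ (proj₂ (proj₂ (proj₂ coloured))) ∘ inj₂ ∘ V⊆L
          stage′ : Stage T̂ₗ
          stage′ = Coloured-automorphism.stage-transfer (plain setting) ∈-nodup⁺ (∈-nodup⁻ E.T′) E.stage
          S⊆T̂ : ∀ {s} → s ∈ₗ elements S → s ∈ₗ T̂ₗ
          S⊆T̂ = ∈-nodup⁺ ∘ E.⊆T′ ∘ S⊆T
          T̂ : GeneratingSet
          T̂ = record
            { elements = T̂ₗ
            ; unique = nodup-unique E.T′
            ; ε∉ = λ p → Stage.ε∉ stage′ (∈-±ˡ p)
            ; generates = λ g → let (ws , all , e) = GeneratingSet.generates S g in
                ws , All.map (±-⊆ (elements S) T̂ₗ S⊆T̂) all , e }
          same-degree : ∀ v → degree T̂ₗ v ≡ degree E.T′ v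
          same-degree v = ℕₚ.≤-antisym
            (degree-mono T̂ₗ E.T′ v λ p q → ±-⊆ T̂ₗ E.T′ (∈-nodup⁻ E.T′) p , ±-⊆ T̂ₗ E.T′ (∈-nodup⁻ E.T′) q)
            (degree-mono E.T′ T̂ₗ v λ p q → ±-⊆ E.T′ T̂ₗ ∈-nodup⁺ p , ±-⊆ E.T′ T̂ₗ ∈-nodup⁺ q)
          rigid′ : Rigid (elements S) T̂ₗ
          rigid′ = rigid stage′ (∈-nodup⁺ ∘ E.⊆T′)
            (λ {u} {v} u∈ v∈ eq → proj₁ (proj₂ (proj₂ coloured)) (V⊆us u∈) (V⊆us v∈)
              (≡.trans (≡.sym (same-degree u)) (≡.trans eq (same-degree v))))
            (λ {u} u∈ → ℕₚ.≤-trans (proj₁ (proj₂ (proj₂ (proj₂ coloured))) (V⊆us u∈))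
              (ℕₚ.≤-reflexive (≡.sym (same-degree u))))
          length-T̂ : length T̂ₗ ≤ bound
          length-T̂ = ℕₚ.≤-trans (unique-length E.T′ (nodup-unique E.T′) (∈-nodup⁻ E.T′))
            (ℕₚ.≤-trans E.length≤ (≡.subst (λ k → length T + cost δ k 0 ≤ bound) (≡.sym lengthL) le))
          orders : NoInvolution V → NoElementOfOrder2 T̂
          orders nv s s∈ (_ , s²≈ε , _) = Stage.noInvolution stage′ nv s∈
            (trans (∙-congˡ (sym (identityʳ s))) s²≈ε)

  -- Criteria for preserving the colour of an edge, and the case of at most two classes.

  module Pairs where
    open GroupSolver
    open Counting
    open Powers
    open Mult monoid using (×-congʳ; ×-congˡ)
    open Gadgets
    open Markers
    open Colouring
    open Automorphisms
    open Completion

    PairOK : (Carrier → Carrier) → Carrier → Carrier → Set ℓ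
    PairOK f x y = f y ≈ f x ∙ (x ⁻¹ ∙ y) ⊎ f y ≈ f x ∙ (x ⁻¹ ∙ y) ⁻¹

    module _ {f : Carrier → Carrier} {x y : Carrier} where

      pair-fixed : f x ≈ x → f y ≈ y → PairOK f x y
      pair-fixed p q = inj₁ (trans q (trans (solve 2 (λ x y → y ⊜ x · (inv x · y)) refl x y) (∙-congʳ (sym p))))

      pair-flipped-fixed : f x ≈ x ⁻¹ → f y ≈ y → y ≈ x ⁻¹ ∙ y ⁻¹ ∙ x → PairOK f x y
      pair-flipped-fixed p q h = inj₂ (trans q (trans h
        (trans (solve 2 (λ x y → inv x · inv y · x ⊜ inv x · inv (inv x · y)) refl x y) (∙-congʳ (sym p)))))

      pair-fixed-flipped : f x ≈ x → f y ≈ y ⁻¹ → y ⁻¹ ≈ x ∙ y ⁻¹ ∙ x → PairOK f x y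
      pair-fixed-flipped p q h = inj₂ (trans q (trans h
        (trans (solve 2 (λ x y → x · inv y · x ⊜ x · inv (inv x · y)) refl x y) (∙-congʳ (sym p)))))

      -- The new quotient `x y⁻¹` equals `y⁻¹ x`, the inverse of the old one.
      pair-commuting : f x ≈ x ⁻¹ → f y ≈ y ⁻¹ → Commutes x y → PairOK f x y
      pair-commuting p q h = inj₂ (trans q (trans
        (solve 2 (λ x y → inv y ⊜ inv x · inv y · (y · x) · inv y) refl x y)
        (trans (∙-congʳ (∙-congˡ h)) (trans
          (solve 2 (λ x y → inv x · inv y · (x · y) · inv y ⊜ inv x · inv (inv x · y)) refl x y)
          (∙-congʳ (sym p))))))

      -- The new quotient `x y⁻¹` equals the old one, `x⁻¹ y`, exactly when `x² = y²`.
      pair-squares : f x ≈ x ⁻¹ → f y ≈ y ⁻¹ → x ∙ x ≈ y ∙ y → PairOK f x y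
      pair-squares p q h = inj₁ (trans q (trans (solve 1 (λ y → inv y ⊜ inv (y · y) · y) refl y)
        (trans (∙-congʳ (⁻¹-cong (sym h)))
          (trans (solve 2 (λ x y → inv (x · x) · y ⊜ inv x · (inv x · y)) refl x y) (∙-congʳ (sym p))))))

    SameClass : Carrier → Carrier → Set ℓ
    SameClass x y = x ≈ y ⊎ x ≈ y ⁻¹

    class-sym : ∀ {x y} → SameClass x y → SameClass y x
    class-sym (inj₁ e) = inj₁ (sym e)
    class-sym {x} {y} (inj₂ e) = inj₂ (trans (sym (⁻¹-involutive y)) (⁻¹-cong (sym e)))

    commutes-class : ∀ {p q w} → SameClass p q → Commutes q w → Commutes p w
    commutes-class (inj₁ e) k = commutes-≈ e k
    commutes-class (inj₂ e) k = commutes-≈ e (commutes-inv k)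

    class-via : ∀ {r x y} → SameClass x r → SameClass y r → SameClass x y
    class-via (inj₁ p) (inj₁ q) = inj₁ (trans p (sym q))
    class-via {r} (inj₁ p) (inj₂ q) = inj₂ (trans p (trans (sym (⁻¹-involutive r)) (⁻¹-cong (sym q))))
    class-via (inj₂ p) (inj₁ q) = inj₂ (trans p (⁻¹-cong (sym q)))
    class-via (inj₂ p) (inj₂ q) = inj₁ (trans p (sym q))

    class-of : ∀ V {x} → x ∈ₗ V ± → ∃[ r ] r ∈ₗ V × SameClass x r
    class-of V {x} x∈ = [ (λ p → x , p , inj₁ refl) , (λ p → x ⁻¹ , p , inj₂ (sym (⁻¹-involutive x))) ]′ (∈-±⁻ V x∈)

    two-classes : ∀ V → length V ≤ 2 → ∀ {x y s} → x ∈ₗ V ± → y ∈ₗ V ± → s ∈ₗ V ± →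
                  SameClass y x ⊎ SameClass s x ⊎ SameClass s y
    two-classes V le x∈ y∈ s∈ with class-of V x∈ | class-of V y∈ | class-of V s∈
    ... | r₁ , r₁∈ , p | r₂ , r₂∈ , q | r₃ , r₃∈ , t = go V le r₁∈ r₂∈ r₃∈
      where
      into : ∀ {x r v} → SameClass x r → r ≈ v → SameClass x v
      into (inj₁ p) e = inj₁ (trans p e)
      into (inj₂ p) e = inj₂ (trans p (⁻¹-cong e))
      go : ∀ V → length V ≤ 2 → r₁ ∈ₗ V → r₂ ∈ₗ V → r₃ ∈ₗ V → _
      go (v ∷ _) _ (here a) (here b) _ = inj₁ (class-via (into q b) (into p a))
      go (v ∷ _) _ (here a) _ (here b) = inj₂ (inj₁ (class-via (into t b) (into p a)))
      go (v ∷ _) _ _ (here a) (here b) = inj₂ (inj₂ (class-via (into t b) (into q a)))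
      go (v ∷ w ∷ []) _ (there (here a)) (there (here b)) _ = inj₁ (class-via (into q b) (into p a))
      go (v ∷ w ∷ []) _ (there (here a)) _ (there (here b)) = inj₂ (inj₁ (class-via (into t b) (into p a)))
      go (v ∷ w ∷ []) _ _ (there (here a)) (there (here b)) = inj₂ (inj₂ (class-via (into t b) (into q a)))
      go (v ∷ w ∷ u ∷ V) (s≤s (s≤s ())) _ _ _

    module _ {f g : Carrier → Carrier} {T : List Carrier} (Φ : BallMap T f g) where
      open BallMap Φ

      injective : ∀ {x y} → BallMap T g f → x ∈ₗ T ± → y ∈ₗ T ± → f x ≈ f y → x ≈ y
      injective Ψ x∈ y∈ e = trans (sym (undo x∈)) (trans (BallMap.cong Ψ e) (undo y∈))

      -- In the other case `x` and `x⁻¹` have the same image, so they are equal by injectivity.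
      fixed-inverse : ∀ {x} → BallMap T g f → x ∈ₗ T ± → f (x ⁻¹) ≈ x ⁻¹ ⊎ f (x ⁻¹) ≈ x ⁻¹ ⁻¹ →
                      f x ≈ x → f (x ⁻¹) ≈ x ⁻¹
      fixed-inverse Ψ x∈ (inj₁ p) e = p
      fixed-inverse {x} Ψ x∈ (inj₂ p) e = trans p (trans (⁻¹-involutive x) (sym (injective Ψ (∈-inv T x∈) x∈
        (trans p (trans (⁻¹-involutive x) (sym e))))))

      flipped-inverse : ∀ {x} → BallMap T g f → x ∈ₗ T ± → f (x ⁻¹) ≈ x ⁻¹ ⊎ f (x ⁻¹) ≈ x ⁻¹ ⁻¹ →
                        f x ≈ x ⁻¹ → f (x ⁻¹) ≈ x ⁻¹ ⁻¹
      flipped-inverse Ψ x∈ (inj₂ p) e = p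
      flipped-inverse {x} Ψ x∈ (inj₁ p) e = trans p (trans
        (injective Ψ (∈-inv T x∈) x∈ (trans p (sym e))) (sym (⁻¹-involutive x)))

    bare : List Carrier → Setting
    bare V = record
      { V = V ; Index = ⊥ ; Related = λ () ; Conclusion = λ () ; related-∈ = λ { {()} }
      ; Reserved = λ _ → Lift (c ⊔ ℓ) ⊥ ; reserved-resp = λ _ → id ; reserved-inv = id }

    -- With at most two classes, x , y and x⁻¹ y can only lie in S ± if one of x
    -- and y is the square of the other.
    module FewGenerators (S : GeneratingSet) (z : Carrier) (M bound : ℕ)
           (few : length (representatives (elements S)) ≤ 2)
           (tl : Torsionless z (3 * M * M)) (large : 5 ≤ 3 * M * M)
           (room : ∀ T → length T ≤ bound → 2 * (size T * size T) + 6 * size T < M)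
           (le : length (elements S) + cost 0 (length (representatives (elements S))) 0 ≤ bound) where
      private
        Sₗ = elements S
        V = representatives Sₗ
      open Stages (bare V)

      private
        V⊆S : ∀ {x} → x ∈ₗ V ± → x ∈ₗ Sₗ ±
        V⊆S = ±-⊆ V Sₗ (representatives-⊆ Sₗ)

        S⊆V : ∀ {x} → x ∈ₗ Sₗ ± → x ∈ₗ V ±
        S⊆V x∈ = [ representatives-cover Sₗ , ∈-inv⁻ V ∘ representatives-cover Sₗ ]′ (∈-±⁻ Sₗ x∈)

        stage : Stage Sₗ
        stage = record
          { coloured⊆ = V⊆S ; ε∉ = ε∉± S ; low = inj₁ ∘ S⊆V ; conclude = λ ()
          ; noInvolution = λ nv s∈ e → [ (λ p → nv p e) , (λ p → nv p (trans
              (solve 1 (λ x → inv x · inv x ⊜ inv (x · x)) refl _) (trans (⁻¹-cong e) ε⁻¹≈ε))) ]′ (∈-±⁻ V (representatives-cover Sₗ s∈)) }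

        PowerOf : Carrier → Carrier → Set ℓ
        PowerOf e x = ∃[ n ] x ≈ e ^ n

        powers-∙ : ∀ {e x y} → PowerOf e x → PowerOf e y → PowerOf e (x ∙ y)
        powers-∙ {e} (m , p) (n , q) = m + n , trans (∙-cong p q) (sym (^-+ e m n))

        power-5 : ∀ {e x} → e ^ 5 ≈ ε → PowerOf e x → x ^ 5 ≈ ε
        power-5 {e} {x} e⁵ (n , p) = trans (×-congʳ 5 p) (trans (^-* e 5 n)
          (trans (×-congˡ (ℕₚ.*-comm 5 n)) (trans (sym (^-* e n 5)) (trans (×-congʳ n e⁵) (ε^ n)))))
          where
          ε^ : ∀ n → ε ^ n ≈ ε
          ε^ zero = refl
          ε^ (suc n) = trans (identityˡ _) (ε^ n)

        -- Everything is a power of e as soon as every class is e or e².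
        not-order-5 : ∀ e → (∀ {s} → s ∈ₗ Sₗ ± → SameClass s e ⊎ SameClass s (e ∙ e)) → ¬ e ^ 5 ≈ ε
        not-order-5 e classes e⁵ = tl 5 (s≤s z≤n) large (power-5 e⁵ (power z))
          where
          inverse₁ : e ⁻¹ ≈ e ^ 4
          inverse₁ = trans (solve 1 (λ e → inv e ⊜ inv (e · (e · (e · (e · (e · one))))) · (e · (e · (e · (e · one))))) refl e)
            (trans (∙-congʳ (trans (⁻¹-cong e⁵) ε⁻¹≈ε)) (identityˡ _))
          inverse₂ : (e ∙ e) ⁻¹ ≈ e ^ 3
          inverse₂ = trans (solve 1 (λ e → inv (e · e) ⊜ inv (e · (e · (e · (e · (e · one))))) · (e · (e · (e · one)))) refl e)
            (trans (∙-congʳ (trans (⁻¹-cong e⁵) ε⁻¹≈ε)) (identityˡ _))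
          letter : ∀ {s} → SameClass s e ⊎ SameClass s (e ∙ e) → PowerOf e s
          letter (inj₁ (inj₁ p)) = 1 , trans p (sym (identityʳ e))
          letter (inj₁ (inj₂ p)) = 4 , trans p inverse₁
          letter (inj₂ (inj₁ p)) = 2 , trans p (∙-congˡ (sym (identityʳ e)))
          letter (inj₂ (inj₂ p)) = 3 , trans p inverse₂
          word : ∀ ws → All (_∈ₗ Sₗ ±) ws → PowerOf e (Data.List.Base.foldr _∙_ ε ws)
          word [] [] = 0 , refl
          word (w ∷ ws) (p ∷ ps) = powers-∙ (letter (classes p)) (word ws ps)
          power : ∀ g → PowerOf e g
          power g = let (ws , all , eq) = GeneratingSet.generates S g
                        (n , h) = word ws all in n , trans eq h

        module _ {T : List Carrier} (stageT : Stages.Stage (plain (bare V)) T) where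
          open Stages.Stage stageT using (coloured⊆; low)

          old-product : ∀ {x y} → x ∈ₗ V ± → y ∈ₗ V ± → x ∙ y ∈ₗ T ± → x ∙ y ∈ₗ V ±
          old-product x∈ y∈ p = [ id , (λ (_ , np) → contradiction (inj₁ (product-∙ V x∈ y∈)) np) ]′ (low p)

          module _ {f g} (Φ : BallMap T f g) (Ψ : BallMap T g f)
                   (fixed : ∀ {v} → v ∈ₗ V ± → f v ≈ v ⊎ f v ≈ v ⁻¹) where
            open BallMap Φ

            ε∉V : ¬ ε ∈ₗ V ±
            ε∉V = ε∉± S ∘ V⊆S

            -- In the square case e³ would be a third element of the ball.
            no-cube : ∀ {e} → e ∈ₗ V ± → e ∙ e ∈ₗ V ± → ¬ e ∙ e ≈ (e ∙ e) ⁻¹ → ¬ SameClass (e ∙ e) e → ¬ e ∙ (e ∙ e) ∈ₗ T ±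
            no-cube {e} e∈ ee∈ ee≉ apart p = [ (λ c → apart c) , [ first , second ]′ ]′ (two-classes V few e∈ ee∈ (old-product e∈ ee∈ p))
              where
              first : ¬ SameClass (e ∙ (e ∙ e)) e
              first (inj₁ h) = ε∉V (resp (trans (solve 1 (λ e → e · e ⊜ e · (e · e) · inv e) refl e) (trans (∙-congʳ h) (inverseʳ e))) ee∈)
              first (inj₂ h) = ee≉ (trans (solve 1 (λ e → e · e ⊜ inv (e · e) · (e · (e · (e · e)))) refl e)
                (trans (∙-congˡ (trans (∙-congˡ h) (inverseʳ e))) (identityʳ _)))
              classes : ∀ {s} → s ∈ₗ Sₗ ± → SameClass s e ⊎ SameClass s (e ∙ e)
              classes s∈ = [ (λ c → contradiction c apart) , id ]′ (two-classes V few e∈ ee∈ (S⊆V s∈))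
              second : ¬ SameClass (e ∙ (e ∙ e)) (e ∙ e)
              second (inj₁ h) = ε∉V (resp (trans (solve 1 (λ e → e ⊜ e · (e · e) · inv (e · e)) refl e) (trans (∙-congʳ h) (inverseʳ _))) e∈)
              second (inj₂ h) = not-order-5 e classes (trans
                (solve 1 (λ e → e · (e · (e · (e · (e · one)))) ⊜ e · (e · e) · (e · e)) refl e) (trans (∙-congʳ h) (inverseˡ _)))

            -- Apart from inverse pairs, one of `x` and `y` is the square of the other and they
            -- commute. If exactly one of them were inverted, then `x y`, a cube, would lie in the
            -- ball; by `no-cube` this happens only when the one that is a square is an involution.
            pairs : ∀ {x y} → x ∈ₗ V ± → y ∈ₗ V ± → x ⁻¹ ∙ y ∈ₗ V ± → PairOK f x y
            pairs {x} {y} x∈ y∈ s∈ with em≈ {SameClass y x}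
            ... | yes (inj₁ e) = contradiction (resp (trans (∙-congˡ e) (inverseˡ x)) s∈) ε∉V
            ... | yes (inj₂ e) = opposite (fixed x∈)
              where
              fy : f (x ⁻¹) ≈ x ⁻¹ ⊎ f (x ⁻¹) ≈ x ⁻¹ ⁻¹
              fy = fixed (∈-inv V x∈)
              commute : Commutes x y
              commute = trans (∙-congʳ e) (trans (solve 1 (λ x → inv x · x ⊜ x · inv x) refl x) (∙-congˡ (sym e)))
              opposite : f x ≈ x ⊎ f x ≈ x ⁻¹ → PairOK f x y
              opposite (inj₁ p) = pair-fixed p (trans (cong e) (trans (fixed-inverse Φ Ψ (coloured⊆ x∈) fy p) (sym e)))
              opposite (inj₂ p) = pair-commuting p (trans (cong e) (trans (flipped-inverse Φ Ψ (coloured⊆ x∈) fy p) (⁻¹-cong (sym e)))) commute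
            ... | no apart = split (two-classes V few x∈ y∈ s∈)
              where
              adjacent : f x ⁻¹ ∙ f y ∈ₗ T ±
              adjacent = adj (coloured⊆ x∈) (coloured⊆ y∈) (coloured⊆ s∈)
              cases : (f x ≈ x ⁻¹ → f y ≈ y → x ∙ y ∈ₗ T ±) → (f x ≈ x → f y ≈ y ⁻¹ → x ∙ y ∈ₗ T ±) →
                      Commutes x y → (x ∙ y ∈ₗ T ± → (x ≈ x ⁻¹) ⊎ (y ≈ y ⁻¹)) → PairOK f x y
              cases l r com inv? with fixed x∈ | fixed y∈
              ... | inj₁ p | inj₁ q = pair-fixed p q
              ... | inj₂ p | inj₂ q = pair-commuting p q com
              ... | inj₂ p | inj₁ q with inv? (l p q)
              ...   | inj₁ h = pair-fixed (trans p (sym h)) q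
              ...   | inj₂ h = pair-commuting p (trans q h) com
              cases l r com inv? | inj₁ p | inj₂ q with inv? (r p q)
              ...   | inj₁ h = pair-commuting (trans p h) q com
              ...   | inj₂ h = pair-fixed p (trans q (sym h))
              left : f x ≈ x ⁻¹ → f y ≈ y → x ∙ y ∈ₗ T ±
              left p q = resp (∙-cong (trans (⁻¹-cong p) (⁻¹-involutive x)) q) adjacent
              right : Commutes x y → f x ≈ x → f y ≈ y ⁻¹ → x ∙ y ∈ₗ T ±
              right com p q = resp (trans (⁻¹-cong (∙-cong (⁻¹-cong p) q)) (trans (solve 2 (λ x y → inv (inv x · inv y) ⊜ y · x) refl x y) com)) (∈-inv T adjacent)
              split : SameClass y x ⊎ SameClass (x ⁻¹ ∙ y) x ⊎ SameClass (x ⁻¹ ∙ y) y → PairOK f x y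
              split (inj₁ c) = contradiction c apart
              split (inj₂ (inj₁ (inj₂ h))) = contradiction (resp (trans (solve 2 (λ x y → y ⊜ x · (inv x · y)) refl x y) (trans (∙-congˡ h) (inverseʳ x))) y∈) ε∉V
              split (inj₂ (inj₂ (inj₁ h))) = contradiction (resp (trans (solve 2 (λ x y → x ⊜ inv (inv x · y · inv y)) refl x y) (trans (⁻¹-cong (trans (∙-congʳ h) (inverseʳ y))) ε⁻¹≈ε)) x∈) ε∉V
              split (inj₂ (inj₁ (inj₁ h))) = cases left (right com) com involutive
                where
                y≈xx : y ≈ x ∙ x
                y≈xx = trans (solve 2 (λ x y → y ⊜ x · (inv x · y)) refl x y) (∙-congˡ h)
                com : Commutes x y
                com = trans (∙-congʳ y≈xx) (trans (assoc _ _ _) (∙-congˡ (sym y≈xx)))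
                involutive : x ∙ y ∈ₗ T ± → (x ≈ x ⁻¹) ⊎ (y ≈ y ⁻¹)
                involutive p with em≈ {y ≈ y ⁻¹}
                ... | yes q = inj₂ q
                ... | no ¬q = contradiction (resp (∙-congˡ y≈xx) p)
                  (no-cube x∈ (resp y≈xx y∈) (λ q → ¬q (trans y≈xx (trans q (⁻¹-cong (sym y≈xx)))))
                    (λ { (inj₁ q) → apart (inj₁ (trans y≈xx q)) ; (inj₂ q) → apart (inj₂ (trans y≈xx q)) }))
              split (inj₂ (inj₂ (inj₂ h))) = cases left (right com) com involutive
                where
                x≈yy : x ≈ y ∙ y
                x≈yy = trans (solve 2 (λ x y → x ⊜ y · inv (inv x · y)) refl x y) (trans (∙-congˡ (⁻¹-cong h)) (∙-congˡ (⁻¹-involutive y)))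
                com : Commutes x y
                com = trans (∙-congˡ x≈yy) (trans (sym (assoc _ _ _)) (∙-congʳ (sym x≈yy)))
                involutive : x ∙ y ∈ₗ T ± → (x ≈ x ⁻¹) ⊎ (y ≈ y ⁻¹)
                involutive p with em≈ {x ≈ x ⁻¹}
                ... | yes q = inj₁ q
                ... | no ¬q = contradiction (resp (trans (sym com) (∙-congˡ x≈yy)) p)
                  (no-cube y∈ (resp x≈yy x∈) (λ q → ¬q (trans x≈yy (trans q (⁻¹-cong (sym x≈yy)))))
                    (λ q → apart (class-via (inj₁ refl) (swap q))))
                  where
                  swap : SameClass (y ∙ y) y → SameClass x y
                  swap (inj₁ q) = inj₁ (trans x≈yy q)
                  swap (inj₂ q) = inj₂ (trans x≈yy q)

      fewGenerators : Target S bound (NoInvolution V)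
      fewGenerators = complete S (bare V) z M bound 0 tl room (λ { {()} }) (representatives-apart Sₗ) stage id
        (λ _ → z≤n) le λ stageT _ distinct high Φ Ψ →
          let fixed = λ {v} → Coloured-automorphism.coloured-fixed (plain (bare V)) stageT distinct high Φ Ψ {v}
          in (λ x∈ → fixed (S⊆V x∈)) , λ x∈ y∈ s∈ → pairs stageT Φ Ψ fixed (S⊆V x∈) (S⊆V y∈) (S⊆V s∈)

  -- Reduction of the conditions on ties to conditions on a power of `z`.

  module FindTies (setting : Gadgets.Setting) where
    open GroupSolver
    open Counting
    open Powers
    open Gadgets
    open Gadgets.Setting setting
    open Stages setting
    open Markers using (size; ball; ∈-ball; products; ∈-products; shift; ∈-shift)
    open Ties setting
    open InvertedTies setting

    -- Turns a condition on a multiple of `y` into one on `y` itself with a translated list, so that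
    -- one function of the exponent can be tested against several translates.
    shifted : ∀ {κ x y xs} → ¬ y ∈ₗ shift (κ ⁻¹) xs → x ≈ κ ∙ y → ¬ x ∈ₗ xs
    shifted {κ} {x} {y} y∉ e x∈ = y∉ (∈-shift x∈
      (trans (solve 2 (λ κ y → y ⊜ inv κ · (κ · y)) refl κ y) (∙-congˡ (sym e))))

    Irreflexive : Set (c ⊔ ℓ)
    Irreflexive = ∀ {k p p′} → Related k p p′ → ¬ p ≈ p′

    -- Three translates each of the products and of the reserved list, at most ten of the ball, and
    -- three values for a cube.
    room : ℕ → ℕ → ℕ
    room s r = 3 * (s * s) + 10 * s + 3 + 3 * r

    module _ {T : List Carrier} (stage : Stage T) (reserved : List Carrier)
             (∈-reserved : ∀ {x} → Reserved x → x ∈ₗ reserved) where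
      open Stage stage using (coloured⊆)

      private
        s r : ℕ
        s = size T
        r = length reserved

      Fresh : Carrier → Carrier → Set (c ⊔ ℓ)
      Fresh ρ w = ¬ w ∈ₗ shift (ρ ⁻¹) (products T) × ¬ w ∈ₗ shift (ρ ⁻¹) reserved

      fresh-product : ∀ {ρ w a} → Fresh ρ w → a ≈ ρ ∙ w → ¬ Product T a
      fresh-product (p , _) e pr = shifted p e (∈-products T pr)

      fresh-reserved : ∀ {ρ w a} → Fresh ρ w → a ≈ ρ ∙ w → ¬ Reserved a
      fresh-reserved (_ , q) e rv = shifted q e (∈-reserved rv)

      -- The factor `ρ` is `ε`, or the hub itself when the tie is to see conjugation by the hub. As
      -- `w` commutes with `ρ`, `u` and `x`, all products of two new elements are multiples of `w²`.
      module CentralTie (ρ u x w : Carrier) (u∈ : Coloured u) (x∈ : Coloured x) where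
        open CommutingTie stage (ρ ∙ w) u x u∈ x∈

        coefficient : Fin 3 → Carrier
        coefficient #0 = ρ
        coefficient #1 = u ⁻¹ ∙ ρ
        coefficient #2 = x ⁻¹ ∙ ρ

        a≈ : ∀ i → a i ≈ coefficient i ∙ w
        a≈ #0 = refl
        a≈ #1 = sym (assoc _ _ _)
        a≈ #2 = sym (assoc _ _ _)

        conditions :
          Commutes ρ w → Commutes u w → Commutes x w → Commutes x ρ →
          (∀ i → Fresh (coefficient i) w) →
          (∀ i j → ¬ w ∙ w ∈ₗ shift ((coefficient i ∙ coefficient j) ⁻¹) (ball T)) →
          ¬ cube w ∈ₗ shift (cube ρ ⁻¹) (ε ∷ u ∷ x ∷ []) →
          ¬ u ⁻¹ ∙ x ∈ₗ T ± → ¬ ρ ⁻¹ ∙ (u ∙ x ⁻¹) ∙ ρ ∈ₗ T ± →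
          (∀ {p} → p ≈ ρ ⁻¹ ∙ u ∙ ρ → p ∈ₗ T ± → Coloured p ⊎ Protected p) →
          Irreflexive →
          (∀ {k p p′} → Related k p p′ → p ≈ u ⊎ p ≈ x → p′ ≈ u ⊎ p′ ≈ x → Conclusion k p p′) →
          (∀ {k p p′} → Related k p p′ → p ≈ ρ ⁻¹ ∙ u ⁻¹ ∙ ρ ⊎ p ≈ x ⁻¹ → p′ ≈ ρ ⁻¹ ∙ u ⁻¹ ∙ ρ ⊎ p′ ≈ x ⁻¹ → Conclusion k p p′) →
          Conditions
        conditions cρ cu cx xρ fr sq cu∉ q∉ c∉ ok irr concl⁺ concl⁻ = record
          { fresh = λ i → fresh-product (fr i) (a≈ i)
          ; products∉ = λ i j p → shifted (sq i j) (product≈ i j) (∈-ball T p)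
          ; quotient∉ = q∉
          ; commutes = commutes-∙ xρ cx
          ; conj∉ = λ p → c∉ (resp (conj≈ (ux-commutes)) p)
          ; cube∉ = (λ e → shifted cu∉ (sym cube≈) (here e)) , (λ e → shifted cu∉ (sym cube≈) (there (here e)))
                  , (λ e → shifted cu∉ (sym cube≈) (there (there (here e))))
          ; conj-ok = λ p → ok (conj≈ cu) p
          ; unreserved = λ i → fresh-reserved (fr i) (a≈ i)
          ; conclude = concl
          }
          where
          inv-c : ∀ {y} → Commutes y w → Commutes (y ⁻¹) w
          inv-c = commutes-inv
          coeff-c : ∀ i → Commutes (coefficient i) w
          coeff-c #0 = cρ
          coeff-c #1 = commutes-∙ˡ (inv-c cu) cρ
          coeff-c #2 = commutes-∙ˡ (inv-c cx) cρ
          ux-commutes : Commutes (u ∙ x ⁻¹) w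
          ux-commutes = commutes-∙ˡ cu (inv-c cx)
          swap : ∀ p q → Commutes q w → p ∙ w ∙ (q ∙ w) ≈ p ∙ q ∙ (w ∙ w)
          swap p q h = trans (solve 3 (λ p q w → p · w · (q · w) ⊜ p · (w · q) · w) refl p q w)
            (trans (sandwich p w h) (solve 3 (λ p q w → p · (q · w) · w ⊜ p · q · (w · w)) refl p q w))
          product≈ : ∀ i j → a i ∙ a j ≈ coefficient i ∙ coefficient j ∙ (w ∙ w)
          product≈ i j = trans (∙-cong (a≈ i) (a≈ j)) (swap _ _ (coeff-c j))
          cube≈ : cube ρ ∙ cube w ≈ cube (ρ ∙ w)
          cube≈ = sym (trans (∙-congʳ (swap ρ ρ cρ)) (trans
            (solve 2 (λ p w → p · p · (w · w) · (p · w) ⊜ p · p · (w · (w · p)) · w) refl ρ w) (trans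
            (∙-congʳ (∙-congˡ (trans (∙-congˡ cρ) (trans (sym (assoc _ _ _)) (trans (∙-congʳ cρ) (assoc _ _ _))))))
            (solve 2 (λ p w → p · p · (p · (w · w)) · w ⊜ p · p · p · (w · w · w)) refl ρ w))))
          conj≈ : ∀ {y} → Commutes y w → (ρ ∙ w) ⁻¹ ∙ y ∙ (ρ ∙ w) ≈ ρ ⁻¹ ∙ y ∙ ρ
          conj≈ {y} cy = trans (solve 3 (λ p y w → inv (p · w) · y · (p · w) ⊜ inv w · (inv p · y · p · w)) refl ρ y w)
            (trans (∙-congˡ (sym (commutes-∙ˡ (commutes-∙ˡ (inv-c cρ) cy) cρ)))
              (solve 2 (λ w y → inv w · (w · y) ⊜ y) refl w (ρ ⁻¹ ∙ y ∙ ρ)))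
          negative-value : ∀ {p} → Listed false #0 p → p ≈ ρ ⁻¹ ∙ u ⁻¹ ∙ ρ ⊎ p ≈ x ⁻¹
          negative-value (inj₁ e) = inj₁ (trans e (conj≈ (inv-c cu)))
          negative-value (inj₂ e) = inj₂ e
          concl : ∀ s i {k p p′} → Related k p p′ → Listed s i p → Listed s i p′ → Conclusion k p p′
          concl true #0 rel l l′ = concl⁺ rel l l′
          concl true #1 rel l l′ = contradiction (trans l (sym l′)) (irr rel)
          concl true #2 rel l l′ = contradiction (trans l (sym l′)) (irr rel)
          concl false #0 rel l l′ = concl⁻ rel (negative-value l) (negative-value l′)
          concl false #1 rel l l′ = contradiction (trans l (sym l′)) (irr rel)
          concl false #2 rel l l′ = contradiction (trans l (sym l′)) (irr rel)

      -- The conjugate `w⁻¹ u⁻¹ w` is kept out of the ball, so `w⁻¹` is adjacent to no old element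
      -- other than `x⁻¹`. An inverted hub thus finds no image for the common neighbour, and only
      -- the positive conclusion is asked for.
      module GenericTie (u x w : Carrier) (u∈ : Coloured u) (x∈ : Coloured x) where
        open CommutingTie stage w u x u∈ x∈

        coefficient : Fin 3 → Carrier
        coefficient #0 = ε
        coefficient #1 = u ⁻¹
        coefficient #2 = x ⁻¹

        a≈ : ∀ i → a i ≈ coefficient i ∙ w
        a≈ #0 = sym (identityˡ w)
        a≈ #1 = refl
        a≈ #2 = refl

        conditions :
          Commutes x w → (∀ i → Fresh (coefficient i) w) →
          (∀ i → ¬ w ∙ w ∈ₗ shift (coefficient i ⁻¹) (ball T)) →
          ¬ w ∙ w ∈ₗ shift ((u ⁻¹ ∙ x ⁻¹) ⁻¹) (ball T) → ¬ w ∙ w ∈ₗ shift ((x ⁻¹ ∙ x ⁻¹) ⁻¹) (ball T) →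
          (∀ i → ¬ w ∙ u ⁻¹ ∙ w ∈ₗ shift (coefficient i ⁻¹) (ball T)) →
          ¬ w ⁻¹ ∙ u ⁻¹ ∙ w ∈ₗ ball T → ¬ w ⁻¹ ∙ u ⁻¹ ∙ w ∈ₗ shift (x ⁻¹) (ball T) →
          ¬ cube w ∈ₗ ε ∷ u ∷ x ∷ [] → ¬ u ⁻¹ ∙ x ∈ₗ T ± → Irreflexive →
          (∀ {k p p′} → Related k p p′ → p ≈ u ⊎ p ≈ x → p′ ≈ u ⊎ p′ ≈ x → Conclusion k p p′) →
          Conditions
        conditions cx fr sq ux xx wuw con₁ con₂ cu∉ q∉ irr concl⁺ = record
          { fresh = λ i → fresh-product (fr i) (a≈ i)
          ; products∉ = prods
          ; quotient∉ = q∉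
          ; commutes = cx
          ; conj∉ = λ p → shifted con₂ (begin
              (w ⁻¹ ∙ (u ∙ x ⁻¹) ∙ w) ⁻¹ ≈⟨ solve 3 (λ u x w → inv (inv w · (u · inv x) · w) ⊜ inv w · (x · w) · (inv w · inv u · w)) refl u x w ⟩
              w ⁻¹ ∙ (x ∙ w) ∙ (w ⁻¹ ∙ u ⁻¹ ∙ w) ≈⟨ ∙-congʳ (∙-congˡ cx) ⟨
              w ⁻¹ ∙ (w ∙ x) ∙ (w ⁻¹ ∙ u ⁻¹ ∙ w) ≈⟨ solve 3 (λ u x w → inv w · (w · x) · (inv w · inv u · w) ⊜ x · (inv w · inv u · w)) refl u x w ⟩
              x ∙ (w ⁻¹ ∙ u ⁻¹ ∙ w) ∎) (∈-ball T (there (∈-inv T p)))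
          ; cube∉ = (λ e → cu∉ (here e)) , (λ e → cu∉ (there (here e))) , (λ e → cu∉ (there (there (here e))))
          ; conj-ok = λ p → contradiction p conj-u
          ; unreserved = λ i → fresh-reserved (fr i) (a≈ i)
          ; conclude = concl
          }
          where
          open SetoidReasoning setoid
          cx⁻¹ : Commutes (x ⁻¹) w
          cx⁻¹ = commutes-inv cx
          conj-u⁻¹ : ¬ w ⁻¹ ∙ u ⁻¹ ∙ w ∈ₗ T ±
          conj-u⁻¹ p = con₁ (∈-ball T (there p))
          conj-u : ¬ w ⁻¹ ∙ u ∙ w ∈ₗ T ±
          conj-u p = conj-u⁻¹ (resp (solve 2 (λ u w → inv (inv w · u · w) ⊜ inv w · inv u · w) refl u w) (∈-inv T p))
          wxw : w ∙ (x ⁻¹ ∙ w) ≈ x ⁻¹ ∙ (w ∙ w)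
          wxw = trans (sym (assoc _ _ _)) (trans (∙-congʳ cx⁻¹) (assoc _ _ _))
          avoid : ∀ {κ y z} → ¬ y ∈ₗ shift (κ ⁻¹) (ball T) → z ≈ κ ∙ y → ¬ z ∈ₗ Ball₁ T
          avoid y∉ e p = shifted y∉ e (∈-ball T p)
          prods : ∀ i j → ¬ a i ∙ a j ∈ₗ Ball₁ T
          prods #0 #0 = avoid (sq #0) (sym (identityˡ _))
          prods #0 #1 = avoid (wuw #0) (trans (sym (assoc _ _ _)) (sym (identityˡ _)))
          prods #0 #2 = avoid (sq #2) wxw
          prods #1 #0 = avoid (sq #1) (assoc _ _ _)
          prods #1 #1 = avoid (wuw #1) (solve 2 (λ u w → inv u · w · (inv u · w) ⊜ inv u · (w · inv u · w)) refl u w)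
          prods #1 #2 = avoid ux (trans (assoc _ _ _) (trans (∙-congˡ wxw) (sym (assoc _ _ _))))
          prods #2 #0 = avoid (sq #2) (assoc _ _ _)
          prods #2 #1 = avoid (wuw #2) (solve 3 (λ u x w → inv x · w · (inv u · w) ⊜ inv x · (w · inv u · w)) refl u x w)
          prods #2 #2 = avoid xx (trans (assoc _ _ _) (trans (∙-congˡ wxw) (sym (assoc _ _ _))))
          inT : ∀ {k p p′} → Related k p p′ → p ∈ₗ T ± × p′ ∈ₗ T ±
          inT rel = coloured⊆ (proj₁ (related-∈ rel)) , coloured⊆ (proj₂ (related-∈ rel))
          x-value : ∀ {p} → p ∈ₗ T ± → Listed false #0 p → p ≈ x ⁻¹
          x-value p∈ (inj₁ e) = contradiction (resp e p∈) conj-u⁻¹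
          x-value p∈ (inj₂ e) = e
          concl : ∀ s i {k p p′} → Related k p p′ → Listed s i p → Listed s i p′ → Conclusion k p p′
          concl true #0 rel l l′ = concl⁺ rel l l′
          concl true #1 rel l l′ = contradiction (trans l (sym l′)) (irr rel)
          concl true #2 rel l l′ = contradiction (trans l (sym l′)) (irr rel)
          concl false #0 rel l l′ = contradiction
            (trans (x-value (proj₁ (inT rel)) l) (sym (x-value (proj₂ (inT rel)) l′))) (irr rel)
          concl false #1 rel l l′ = contradiction (trans l (sym l′)) (irr rel)
          concl false #2 rel l l′ = contradiction (trans l (sym l′)) (irr rel)

      module TwistedTie (w e f : Carrier) (e∈ : Coloured e) (f∈ : Coloured f) where
        open InvertingTie stage w e f e∈ f∈

        coefficient : Fin 3 → Carrier
        coefficient #0 = e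
        coefficient #1 = ε
        coefficient #2 = f ⁻¹ ∙ e

        a≈ : ∀ i → a i ≈ coefficient i ∙ w
        a≈ #0 = refl
        a≈ #1 = sym (identityˡ w)
        a≈ #2 = sym (assoc _ _ _)

        module _ (inverts : Inverts e w) (fr : ∀ i → Fresh (coefficient i) w)
                 (sq : ∀ i → ¬ w ∙ w ∈ₗ shift (coefficient i ⁻¹) (ball T))
                 (sq⁻¹ : ¬ w ∙ w ∈ₗ shift (e ⁻¹ ⁻¹) (ball T))
                 (q∉ : ¬ e ⁻¹ ∙ f ∈ₗ T ±)
                 (ok : f ⁻¹ ∙ (e ∙ e) ∈ₗ T ± → Coloured (f ⁻¹ ∙ (e ∙ e)) ⊎ Protected (f ⁻¹ ∙ (e ∙ e)))
                 (concl : ∀ s i {k p p′} → Related k p p′ → Listed s i p → Listed s i p′ → Conclusion k p p′) where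
          open SetoidReasoning setoid

          private
            avoid : ∀ {κ y z} → ¬ y ∈ₗ shift (κ ⁻¹) (ball T) → z ≈ κ ∙ y → ¬ z ∈ₗ Ball₁ T
            avoid y∉ h p = shifted y∉ h (∈-ball T p)

            -- w⁻¹ y w = y w² for every y inverted by w.
            conj-inverted : ∀ {y} → Inverts y w → w ⁻¹ ∙ y ∙ w ≈ y ∙ (w ∙ w)
            conj-inverted {y} i = trans (∙-congʳ (∙-congˡ (sym i)))
              (solve 2 (λ y w → inv w · (w · y · w) · w ⊜ y · (w · w)) refl y w)

            conj₀₁ : ¬ w ⁻¹ ∙ e ⁻¹ ∙ w ∈ₗ T ±
            conj₀₁ p = avoid sq⁻¹ (conj-inverted (inverts-inv inverts)) (there p)

            build : (∀ i → ¬ a i ∙ a #2 ∈ₗ Ball₁ T) → ¬ w ⁻¹ ∙ (e ⁻¹ ∙ f ⁻¹ ∙ e) ∙ w ∈ₗ T ± →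
                    ¬ w ⁻¹ ∙ (f ⁻¹ ∙ e) ∙ w ∈ₗ T ± → Conditions
            build p₂ c₀₂ c₁₂ = record
              { inverts = inverts
              ; fresh = λ i → fresh-product (fr i) (a≈ i)
              ; products∉ = λ i → avoid (sq i) (trans (∙-congʳ (a≈ i)) (assoc _ _ _)) , p₂ i
              ; quotient∉ = q∉
              ; conj₀₁∉ = conj₀₁ ; conj₀₂∉ = c₀₂ ; conj₁₂∉ = c₁₂
              ; value-ok = ok
              ; unreserved = λ i → fresh-reserved (fr i) (a≈ i)
              ; conclude = concl
              }

          -- If `e` and `f` both invert `w`, then `f⁻¹ e` commutes with `w`, while the conjugate
          -- `e⁻¹ f⁻¹ e` again inverts it. This reduces the remaining conditions to `w²` and to
          -- `q∉`.
          both-inverted : Inverts f w →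
            ¬ w ∙ w ∈ₗ shift ((e ∙ (f ⁻¹ ∙ e)) ⁻¹) (ball T) →
            ¬ w ∙ w ∈ₗ shift ((f ⁻¹ ∙ e ∙ (f ⁻¹ ∙ e)) ⁻¹) (ball T) →
            ¬ w ∙ w ∈ₗ shift ((e ⁻¹ ∙ f ⁻¹ ∙ e) ⁻¹) (ball T) → Conditions
          both-inverted f-inverts h₁ h₂ h₃ = build prods
            (λ p → avoid h₃ (conj-inverted conj-inverts) (there p))
            (λ p → q∉ (resp (trans (⁻¹-cong (trans (trans (assoc _ _ _) (∙-congˡ (sym fe)))
              (solve 2 (λ w y → inv w · (w · y) ⊜ y) refl w (f ⁻¹ ∙ e)))) (solve 2 (λ e f → inv (inv f · e) ⊜ inv e · f) refl e f)) (∈-inv T p)))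
            where
            conj-inverts : Inverts (e ⁻¹ ∙ f ⁻¹ ∙ e) w
            conj-inverts = begin
              w ∙ (e ⁻¹ ∙ f ⁻¹ ∙ e) ∙ w ≈⟨ solve 3 (λ e f w → w · (inv e · inv f · e) · w ⊜ (w · inv e · w) · (inv w · inv f · inv w) · (w · e · w)) refl e f w ⟩
              (w ∙ e ⁻¹ ∙ w) ∙ (w ⁻¹ ∙ f ⁻¹ ∙ w ⁻¹) ∙ (w ∙ e ∙ w)
                ≈⟨ ∙-cong (∙-cong (inverts-inv inverts) (trans (solve 2 (λ f w → inv w · inv f · inv w ⊜ inv (w · f · w)) refl f w) (⁻¹-cong f-inverts))) inverts ⟩
              e ⁻¹ ∙ f ⁻¹ ∙ e ∎
            fe : w ∙ (f ⁻¹ ∙ e) ≈ f ⁻¹ ∙ e ∙ w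
            fe = begin
              w ∙ (f ⁻¹ ∙ e) ≈⟨ solve 3 (λ e f w → w · (inv f · e) ⊜ (w · inv f · w) · inv w · e) refl e f w ⟩
              (w ∙ f ⁻¹ ∙ w) ∙ w ⁻¹ ∙ e ≈⟨ ∙-cong (∙-congʳ (inverts-inv f-inverts)) (sym inverts) ⟩
              f ⁻¹ ∙ w ⁻¹ ∙ (w ∙ e ∙ w) ≈⟨ solve 3 (λ e f w → inv f · inv w · (w · e · w) ⊜ inv f · e · w) refl e f w ⟩
              f ⁻¹ ∙ e ∙ w ∎
            wfew : w ∙ (f ⁻¹ ∙ (e ∙ w)) ≈ f ⁻¹ ∙ e ∙ (w ∙ w)
            wfew = trans (solve 3 (λ e f w → w · (inv f · (e · w)) ⊜ w · (inv f · e) · w) refl e f w) (trans (∙-congʳ fe) (assoc _ _ _))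
            prods : ∀ i → ¬ a i ∙ a #2 ∈ₗ Ball₁ T
            prods #0 = avoid h₁ (trans (assoc _ _ _) (trans (∙-congˡ wfew) (sym (assoc _ _ _))))
            prods #1 = avoid (sq #2) wfew
            prods #2 = avoid h₂ (trans (∙-congʳ (sym (assoc _ _ _))) (trans (assoc _ _ _) (trans (∙-congˡ wfew) (sym (assoc _ _ _)))))

          -- Only `e` can be moved past `w`. What remains is expressed by `w f⁻¹ w⁻¹ e` and
          -- `w⁻¹ f⁻¹ w⁻¹ e`, which are injective on short ranges of exponents.
          f-generic :
            (∀ i → ¬ w ∙ f ⁻¹ ∙ w ⁻¹ ∙ e ∈ₗ shift (coefficient i ⁻¹) (ball T)) →
            ¬ w ∙ f ⁻¹ ∙ w ⁻¹ ∙ e ∈ₗ shift (e ⁻¹ ⁻¹) (ball T) →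
            ¬ w ⁻¹ ∙ f ⁻¹ ∙ w ⁻¹ ∙ e ∈ₗ ball T → Conditions
          f-generic h₁ h₂ h₃ = build prods
            (λ p → avoid h₂ (begin
              w ⁻¹ ∙ (e ⁻¹ ∙ f ⁻¹ ∙ e) ∙ w ≈⟨ solve 3 (λ e f w → inv w · (inv e · inv f · e) · w ⊜ inv w · inv e · inv f · (e · w)) refl e f w ⟩
              w ⁻¹ ∙ e ⁻¹ ∙ f ⁻¹ ∙ (e ∙ w) ≈⟨ ∙-cong (∙-congʳ we⁻¹) ew ⟩
              e ⁻¹ ∙ w ∙ f ⁻¹ ∙ (w ⁻¹ ∙ e) ≈⟨ solve 3 (λ e f w → inv e · w · inv f · (inv w · e) ⊜ inv e · (w · inv f · inv w · e)) refl e f w ⟩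
              e ⁻¹ ∙ (w ∙ f ⁻¹ ∙ w ⁻¹ ∙ e) ∎) (there p))
            (λ p → h₃ (∈-ball T (there (resp (trans (solve 3 (λ e f w → inv w · (inv f · e) · w ⊜ inv w · inv f · (e · w)) refl e f w)
              (trans (∙-congˡ ew) (sym (assoc _ _ _)))) p))))
            where
            ew : e ∙ w ≈ w ⁻¹ ∙ e
            ew = trans (solve 2 (λ e w → e · w ⊜ inv w · (w · e · w)) refl e w) (∙-congˡ inverts)
            we⁻¹ : w ⁻¹ ∙ e ⁻¹ ≈ e ⁻¹ ∙ w
            we⁻¹ = trans (∙-congˡ (sym (inverts-inv inverts))) (solve 2 (λ e w → inv w · (w · inv e · w) ⊜ inv e · w) refl e w)
            wfew : w ∙ (f ⁻¹ ∙ (e ∙ w)) ≈ w ∙ f ⁻¹ ∙ w ⁻¹ ∙ e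
            wfew = trans (∙-congˡ (∙-congˡ ew)) (solve 3 (λ e f w → w · (inv f · (inv w · e)) ⊜ w · inv f · inv w · e) refl e f w)
            prods : ∀ i → ¬ a i ∙ a #2 ∈ₗ Ball₁ T
            prods i = avoid (h₁ i) (trans (∙-congʳ (a≈ i)) (trans (assoc _ _ _) (∙-congˡ wfew)))

  -- Existence of exponents that satisfy the conditions on ties.

  module TieExistence (setting : Gadgets.Setting) where
    open Counting
    open Powers
    open Gadgets
    open Gadgets.Setting setting
    open Stages setting
    open Markers using (size; ball; products; shift; ∈-shift; length-shift; length-products; length-ball)
    open Ties setting
    open InvertedTies setting
    open FindTies setting

    -- (f , xs , κs) forbids f m ∈ κ xs for all κ in κs.
    Blocks : Set c
    Blocks = List ((ℕ → Carrier) × List Carrier × List Carrier)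

    blockTotal : Blocks → ℕ
    blockTotal [] = 0
    blockTotal ((f , xs , κs) ∷ bs) = length κs * length xs + blockTotal bs

    BlocksInjective : ℕ → Blocks → Set ℓ
    BlocksInjective M [] = ⊤
    BlocksInjective M ((f , _) ∷ bs) = InjectiveUpTo M f × BlocksInjective M bs

    BlocksAvoided : Blocks → ℕ → Set (c ⊔ ℓ)
    BlocksAvoided [] m = ⊤
    BlocksAvoided ((f , xs , κs) ∷ bs) m = All (λ κ → ¬ f m ∈ₗ shift κ xs) κs × BlocksAvoided bs m

    flatten : Blocks → Forbidden
    flatten [] = []
    flatten ((f , xs , κs) ∷ bs) = map (λ κ → f , shift κ xs) κs ++ flatten bs

    flatten-total : ∀ bs → total (flatten bs) ≡ blockTotal bs
    flatten-total [] = ≡.refl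
    flatten-total ((f , xs , κs) ∷ bs) = go κs
      where
      go : ∀ κs → total (map (λ κ → f , shift κ xs) κs ++ flatten bs) ≡ length κs * length xs + blockTotal bs
      go [] = flatten-total bs
      go (κ ∷ κs) = ≡.trans (≡.cong₂ _+_ (length-shift κ xs) (go κs))
        (≡.sym (ℕₚ.+-assoc (length xs) (length κs * length xs) (blockTotal bs)))

    flatten-injective : ∀ {M} bs → BlocksInjective M bs → InjectiveAll M (flatten bs)
    flatten-injective [] _ = tt
    flatten-injective {M} ((f , xs , κs) ∷ bs) (i , is) = go κs
      where
      go : ∀ κs → InjectiveAll M (map (λ κ → f , shift κ xs) κs ++ flatten bs)
      go [] = flatten-injective bs is
      go (κ ∷ κs) = i , go κs

    flatten-avoided : ∀ {m} bs → Avoids (flatten bs) m → BlocksAvoided bs m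
    flatten-avoided [] _ = tt
    flatten-avoided {m} ((f , xs , κs) ∷ bs) av = proj₁ (go κs av) , flatten-avoided bs (proj₂ (go κs av))
      where
      go : ∀ κs → Avoids (map (λ κ → f , shift κ xs) κs ++ flatten bs) m →
           All (λ κ → ¬ f m ∈ₗ shift κ xs) κs × Avoids (flatten bs) m
      go [] av = [] , av
      go (κ ∷ κs) (p , av) = let (ps , rest) = go κs av in p ∷ ps , rest

    abstract
      pickBlocks : ∀ M bs → BlocksInjective M bs → blockTotal bs < M → ∃[ m ] 1 ≤ m × m ≤ M × BlocksAvoided bs m
      pickBlocks M bs inj lt =
        let (m , p , q , av) = pick M (flatten bs) (flatten-injective bs inj)
                                 (≡.subst (_< M) (≡.sym (flatten-total bs)) lt)
        in m , p , q , flatten-avoided bs av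

    BlocksWithin : ℕ → Blocks → Set ℓ
    BlocksWithin L [] = ⊤
    BlocksWithin L ((f , _) ∷ bs) = InjectiveWithin L f × BlocksWithin L bs

    flatten-within : ∀ {L} bs → BlocksWithin L bs → WithinAll L (flatten bs)
    flatten-within [] _ = tt
    flatten-within {L} ((f , xs , κs) ∷ bs) (i , is) = go κs
      where
      go : ∀ κs → WithinAll L (map (λ κ → f , shift κ xs) κs ++ flatten bs)
      go [] = flatten-within bs is
      go (κ ∷ κs) = i , go κs

    abstract
      pickBlockWindows : ∀ L Q gs bs → BlocksWithin L gs → blockTotal gs < L →
        BlocksInjective (Q * L) bs → blockTotal bs < Q → ∃[ m ] BlocksAvoided gs m × BlocksAvoided bs m
      pickBlockWindows L Q gs bs within lt inj lt′ =
        let (m , _ , _ , av , av′) = pickWindows L Q (flatten gs) (flatten bs)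
              (flatten-within gs within) (≡.subst (_< L) (≡.sym (flatten-total gs)) lt)
              (flatten-injective bs inj) (≡.subst (_< Q) (≡.sym (flatten-total bs)) lt′)
        in m , flatten-avoided gs av , flatten-avoided bs av′

    unshift : ∀ {y xs} → ¬ y ∈ₗ shift ε xs → ¬ y ∈ₗ xs
    unshift {y} y∉ p = y∉ (∈-shift p (sym (identityˡ y)))

    private
      split : ∀ {P : Carrier → Set (c ⊔ ℓ)} (k : Fin 3 → Carrier) {xs} → All P (k #0 ∷ k #1 ∷ k #2 ∷ xs) → ∀ i → P (k i)
      split k (p ∷ q ∷ r ∷ _) #0 = p
      split k (p ∷ q ∷ r ∷ _) #1 = q
      split k (p ∷ q ∷ r ∷ _) #2 = r

      grid : ∀ {P : Carrier → Set (c ⊔ ℓ)} (f : Fin 3 → Fin 3 → Carrier) → All P (f #0 #0 ∷ f #0 #1 ∷ f #0 #2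
        ∷ f #1 #0 ∷ f #1 #1 ∷ f #1 #2 ∷ f #2 #0 ∷ f #2 #1 ∷ f #2 #2 ∷ []) → ∀ i j → P (f i j)
      grid {P} f (p ∷ q ∷ r ∷ _) #0 = split {P} (f #0) (p ∷ q ∷ r ∷ [])
      grid {P} f (_ ∷ _ ∷ _ ∷ p ∷ q ∷ r ∷ _) #1 = split {P} (f #1) (p ∷ q ∷ r ∷ [])
      grid {P} f (_ ∷ _ ∷ _ ∷ _ ∷ _ ∷ _ ∷ p ∷ q ∷ r ∷ []) #2 = split {P} (f #2) (p ∷ q ∷ r ∷ [])

      nth₃ : ∀ {P : Carrier → Set (c ⊔ ℓ)} {a b c d xs} → All P (a ∷ b ∷ c ∷ d ∷ xs) → P d
      nth₃ (_ ∷ _ ∷ _ ∷ p ∷ _) = p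

      inverses : (Fin 3 → Carrier) → List Carrier → List Carrier
      inverses k xs = k #0 ⁻¹ ∷ k #1 ⁻¹ ∷ k #2 ⁻¹ ∷ xs

    -- Exponents run through `Q` windows of length `L`. A window has to accommodate the at most five
    -- translates of the ball that are tested against conjugates of a generic element; the number of
    -- windows has to exceed the count of all other conditions.
    module _ {T : List Carrier} (stage : Stage T) (reserved : List Carrier)
             (∈-reserved : ∀ {x} → Reserved x → x ∈ₗ reserved)
             (L Q : ℕ) (short : 5 * size T < L) (enough : room (size T) (length reserved) < Q) where

      private
        M : ℕ
        M = Q * L

        s r : ℕ
        s = size T
        r = length reserved

        within : ∀ a b → a + b ≤ 10 → ∀ P B → P ≡ s * s → B ≡ s →
                 3 * P + (3 * r + (a * B + (b * B + 3))) < Q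
        within a b le P B ≡.refl ≡.refl = ℕₚ.≤-<-trans (ℕₚ.≤-trans
          (ℕₚ.≤-reflexive (eq (s * s) r (a * s) (b * s)))
          (ℕₚ.+-monoˡ-≤ (3 * r) (ℕₚ.+-monoˡ-≤ 3 (ℕₚ.+-monoʳ-≤ (3 * (s * s))
            (ℕₚ.≤-trans (ℕₚ.≤-reflexive (≡.sym (ℕₚ.*-distribʳ-+ s a b))) (ℕₚ.*-monoˡ-≤ s le)))))) enough
          where
          open import Data.Nat.Solver using (module +-*-Solver)
          open +-*-Solver renaming (solve to solveℕ)
          eq : ∀ p r a b → 3 * p + (3 * r + (a + (b + 3))) ≡ 3 * p + (a + b) + 3 + 3 * r
          eq = solveℕ 4 (λ p r a b → con 3 :* p :+ (con 3 :* r :+ (a :+ (b :+ con 3)))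
                                  := con 3 :* p :+ (a :+ b) :+ con 3 :+ con 3 :* r) ≡.refl

        Q≤M : Q ≤ M
        Q≤M = ℕₚ.m≤m*n Q L {{ℕ.>-nonZero (ℕₚ.≤-<-trans z≤n short)}}

        five : ∀ a b → a + b ≡ 5 → a * length (ball T) + (b * length (ball T) + 0) < L
        five a b eq = ≡.subst (_< L) (≡.trans (≡.cong (_* s) (≡.sym eq)) (≡.trans (ℕₚ.*-distribʳ-+ s a b)
          (≡.cong₂ (λ m n → a * m + n) (≡.sym (length-ball T))
            (≡.trans (≡.cong (b *_) (≡.sym (length-ball T))) (≡.sym (ℕₚ.+-identityʳ _)))))) short

        fresh-blocks : (ℕ → Carrier) → (Fin 3 → Carrier) → Blocks → Blocks
        fresh-blocks f k bs = (f , products T , inverses k []) ∷ (f , reserved , inverses k []) ∷ bs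

        powers-injective : ∀ {y} → Torsionless y (3 * M) → InjectiveUpTo M (y ^_)
        powers-injective tl = injective-^ (torsionless-≤ (ℕₚ.m≤n*m M 3) tl)

      centralTie : ∀ y ρ u x (u∈ : Coloured u) (x∈ : Coloured x) → Torsionless y (3 * (Q * L)) →
        Commutes ρ y → Commutes u y → Commutes x y → Commutes x ρ →
        ¬ u ⁻¹ ∙ x ∈ₗ T ± → ¬ ρ ⁻¹ ∙ (u ∙ x ⁻¹) ∙ ρ ∈ₗ T ± →
        (∀ {p} → p ≈ ρ ⁻¹ ∙ u ∙ ρ → p ∈ₗ T ± → Coloured p ⊎ Protected p) →
        Irreflexive →
        (∀ {k p p′} → Related k p p′ → p ≈ u ⊎ p ≈ x → p′ ≈ u ⊎ p′ ≈ x → Conclusion k p p′) →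
        (∀ {k p p′} → Related k p p′ → p ≈ ρ ⁻¹ ∙ u ⁻¹ ∙ ρ ⊎ p ≈ x ⁻¹ → p′ ≈ ρ ⁻¹ ∙ u ⁻¹ ∙ ρ ⊎ p′ ≈ x ⁻¹ → Conclusion k p p′) →
        ∃[ q ] CommutingTie.Conditions stage q u x u∈ x∈
      centralTie y ρ u x u∈ x∈ tl cρ cu cx xρ q∉ c∉ ok irr concl⁺ concl⁻ =
        let (m , _ , _ , p₁ , p₂ , p₃ , p₄ , _) = found
        in ρ ∙ y ^ m , CentralTie.conditions stage reserved ∈-reserved ρ u x (y ^ m) u∈ x∈
             (commutes-^ m cρ) (commutes-^ m cu) (commutes-^ m cx) xρ
             (λ i → split k⁻¹ p₁ i , split k⁻¹ p₂ i) (grid (λ i j → (k i ∙ k j) ⁻¹) p₃) (All.head p₄) q∉ c∉ ok irr concl⁺ concl⁻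
        where
        k k⁻¹ : Fin 3 → Carrier
        k = CentralTie.coefficient stage reserved ∈-reserved ρ u x ε u∈ x∈
        k⁻¹ i = k i ⁻¹
        κs : List Carrier
        κs = (k #0 ∙ k #0) ⁻¹ ∷ (k #0 ∙ k #1) ⁻¹ ∷ (k #0 ∙ k #2) ⁻¹
           ∷ (k #1 ∙ k #0) ⁻¹ ∷ (k #1 ∙ k #1) ⁻¹ ∷ (k #1 ∙ k #2) ⁻¹
           ∷ (k #2 ∙ k #0) ⁻¹ ∷ (k #2 ∙ k #1) ⁻¹ ∷ (k #2 ∙ k #2) ⁻¹ ∷ []
        found = pickBlocks M
          (fresh-blocks (y ^_) k (((λ m → square (y ^ m)) , ball T , κs)
            ∷ ((λ m → cube (y ^ m)) , ε ∷ u ∷ x ∷ [] , cube ρ ⁻¹ ∷ []) ∷ []))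
          (powers-injective tl , powers-injective tl , injective-square tl , injective-cube tl , tt)
          (ℕₚ.<-≤-trans (within 9 0 (ℕₚ.n≤1+n 9) _ _ (length-products T) (length-ball T)) Q≤M)

      genericTie : ∀ z u x (u∈ : Coloured u) (x∈ : Coloured x) → Torsionless z (3 * (Q * L)) →
        NotNormal u z L → Commutes x z → ¬ u ⁻¹ ∙ x ∈ₗ T ± → Irreflexive →
        (∀ {k p p′} → Related k p p′ → p ≈ u ⊎ p ≈ x → p′ ≈ u ⊎ p′ ≈ x → Conclusion k p p′) →
        ∃[ q ] CommutingTie.Conditions stage q u x u∈ x∈
      genericTie z u x u∈ x∈ tl n cx q∉ irr concl⁺ =
        let (m , (p₄ , p₅ , _) , p₁ , p₂ , p₃ , p₆ , _) = found
        in z ^ m , GenericTie.conditions stage reserved ∈-reserved u x (z ^ m) u∈ x∈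
             (commutes-^ m cx) (λ i → split k⁻¹ p₁ i , split k⁻¹ p₂ i) (split k⁻¹ p₃) (nth₃ p₃) (nth₃ (All.tail p₃)) (split k⁻¹ p₄)
             (unshift (All.head p₅)) (All.head (All.tail p₅)) (unshift (All.head p₆)) q∉ irr concl⁺
        where
        k k⁻¹ : Fin 3 → Carrier
        k = GenericTie.coefficient stage reserved ∈-reserved u x ε u∈ x∈
        k⁻¹ i = k i ⁻¹
        n⁻¹ = notNormal-inv n
        found = pickBlockWindows L Q
          ( ((λ m → z ^ m ∙ u ⁻¹ ∙ z ^ m) , ball T , inverses k [])
          ∷ ((λ m → (z ^ m) ⁻¹ ∙ u ⁻¹ ∙ z ^ m) , ball T , ε ∷ x ⁻¹ ∷ []) ∷ [])
          (fresh-blocks (z ^_) k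
            ( ((λ m → square (z ^ m)) , ball T , inverses k ((u ⁻¹ ∙ x ⁻¹) ⁻¹ ∷ (x ⁻¹ ∙ x ⁻¹) ⁻¹ ∷ []))
            ∷ ((λ m → cube (z ^ m)) , ε ∷ u ∷ x ∷ [] , ε ∷ []) ∷ []))
          (injective-⁺⁺ n⁻¹ , injective-⁻⁺ n⁻¹ , tt) (five 3 2 ≡.refl)
          (powers-injective tl , powers-injective tl , injective-square tl , injective-cube tl , tt)
          (within 5 0 (ℕₚ.m≤m+n 5 5) _ _ (length-products T) (length-ball T))

      module _ (e f : Carrier) (e∈ : Coloured e) (f∈ : Coloured f)
               (q∉ : ¬ e ⁻¹ ∙ f ∈ₗ T ±)
               (ok : f ⁻¹ ∙ (e ∙ e) ∈ₗ T ± → Coloured (f ⁻¹ ∙ (e ∙ e)) ⊎ Protected (f ⁻¹ ∙ (e ∙ e)))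
               (concl : ∀ s i {k p p′} → Related k p p′ → InvertingTie.Listed stage ε e f e∈ f∈ s i p →
                          InvertingTie.Listed stage ε e f e∈ f∈ s i p′ → Conclusion k p p′) where
        private
          k k⁻¹ : Fin 3 → Carrier
          k = TwistedTie.coefficient stage reserved ∈-reserved ε e f e∈ f∈
          k⁻¹ i = k i ⁻¹

          -- The values in `Listed` do not involve `w`, but this becomes visible only after matching
          -- on the sign and the index.
          concl′ : ∀ w s i {k p p′} → Related k p p′ → InvertingTie.Listed stage w e f e∈ f∈ s i p →
                          InvertingTie.Listed stage w e f e∈ f∈ s i p′ → Conclusion k p p′
          concl′ w true #0 = concl true #0
          concl′ w true #1 = concl true #1
          concl′ w true #2 = concl true #2
          concl′ w false #0 = concl false #0
          concl′ w false #1 _ (lift ())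
          concl′ w false #2 _ (lift ())

        invertedTie : ∀ y → Torsionless y (3 * (Q * L)) → Inverts e y → Inverts f y →
          ∃[ w ] InvertingTie.Conditions stage w e f e∈ f∈
        invertedTie y tl ie jf =
          let (m , _ , _ , p₁ , p₂ , p₃ , _) = found
          in y ^ m , TwistedTie.both-inverted stage reserved ∈-reserved (y ^ m) e f e∈ f∈ (inverts-^ m ie)
               (λ i → split k⁻¹ p₁ i , split k⁻¹ p₂ i) (split k⁻¹ p₃) (nth₃ p₃) q∉ ok (concl′ (y ^ m)) (inverts-^ m jf)
               (nth₃ (All.tail p₃)) (nth₃ (All.tail (All.tail p₃))) (nth₃ (All.tail (All.tail (All.tail p₃))))
          where
          found = pickBlocks M
            (fresh-blocks (y ^_) k (((λ m → square (y ^ m)) , ball T , inverses k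
              (e ⁻¹ ⁻¹ ∷ (e ∙ (f ⁻¹ ∙ e)) ⁻¹ ∷ (f ⁻¹ ∙ e ∙ (f ⁻¹ ∙ e)) ⁻¹ ∷ (e ⁻¹ ∙ f ⁻¹ ∙ e) ⁻¹ ∷ [])) ∷ []))
            (powers-injective tl , powers-injective tl , injective-square tl , tt)
            (ℕₚ.≤-<-trans (ℕₚ.+-monoʳ-≤ (3 * length (products T)) (ℕₚ.+-monoʳ-≤ (3 * r) (ℕₚ.+-monoʳ-≤ (7 * length (ball T)) z≤n)))
              (ℕₚ.<-≤-trans (within 7 0 (ℕₚ.m≤m+n 7 3) _ _ (length-products T) (length-ball T)) Q≤M))

        twistedTie : ∀ z → Torsionless z (3 * (Q * L)) → Inverts e z → NotNormal f z L →
          ∃[ w ] InvertingTie.Conditions stage w e f e∈ f∈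
        twistedTie z tl ie n =
          let (m , (p₄ , p₅ , _) , p₁ , p₂ , p₃ , _) = found
          in z ^ m , TwistedTie.f-generic stage reserved ∈-reserved (z ^ m) e f e∈ f∈ (inverts-^ m ie)
               (λ i → split k⁻¹ p₁ i , split k⁻¹ p₂ i) (split k⁻¹ p₃) (nth₃ p₃) q∉ ok (concl′ (z ^ m))
               (split k⁻¹ p₄) (nth₃ p₄) (unshift (All.head p₅))
          where
          n⁻¹ = notNormal-inv n
          found = pickBlockWindows L Q
            ( ((λ m → z ^ m ∙ f ⁻¹ ∙ (z ^ m) ⁻¹ ∙ e) , ball T , inverses k (e ⁻¹ ⁻¹ ∷ []))
            ∷ ((λ m → (z ^ m) ⁻¹ ∙ f ⁻¹ ∙ (z ^ m) ⁻¹ ∙ e) , ball T , ε ∷ []) ∷ [])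
            (fresh-blocks (z ^_) k (((λ m → square (z ^ m)) , ball T , inverses k (e ⁻¹ ⁻¹ ∷ [])) ∷ []))
            ( (λ m d p q eq → injective-⁺⁻ n⁻¹ m d p q (∙-cancelʳ e _ _ eq))
            , (λ m d p q eq → injective-⁻⁻ n⁻¹ m d p q (∙-cancelʳ e _ _ eq)) , tt)
            (five 4 1 ≡.refl)
            (powers-injective tl , powers-injective tl , injective-square tl , tt)
            (ℕₚ.≤-<-trans (ℕₚ.+-monoʳ-≤ (3 * length (products T)) (ℕₚ.+-monoʳ-≤ (3 * r) (ℕₚ.+-monoʳ-≤ (4 * length (ball T)) z≤n)))
              (within 4 0 (ℕₚ.m≤m+n 4 6) _ _ (length-products T) (length-ball T)))

  -- Adding ties one after the other.

  module TieSteps (setting : Gadgets.Setting) where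
    open GroupSolver
    open Counting
    open Gadgets
    open Gadgets.Setting setting
    open Stages setting
    open Ties setting
    open InvertedTies setting

    -- The common neighbour is uncoloured, as `transport` requires. The relation is inherited by
    -- larger stages because colours depend on `V` only.
    Tied : List Carrier → Carrier → Carrier → Set (c ⊔ ℓ)
    Tied T p q = ∃[ t ] t ∈ₗ T ± × ¬ Coloured t × p ⁻¹ ∙ t ∈ₗ T ± × q ⁻¹ ∙ t ∈ₗ T ±

    record Enlarged (T : List Carrier) (n : ℕ) : Set (c ⊔ ℓ) where
      field
        T′      : List Carrier
        stage   : Stage T′
        ⊆T′     : ∀ {x} → x ∈ₗ T → x ∈ₗ T′
        length≡ : length T′ ≡ n + length T

    tied-mono : ∀ T T′ {p q} → (∀ {x} → x ∈ₗ T → x ∈ₗ T′) → Tied T p q → Tied T′ p q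
    tied-mono T T′ sub (t , a , b , p , q) = t , up a , b , up p , up q
      where
      up : ∀ {x} → x ∈ₗ T ± → x ∈ₗ T′ ±
      up = ±-⊆ T T′ sub

    degree-positive : ∀ T {v t} → t ∈ₗ T ± → v ⁻¹ ∙ t ∈ₗ T ± → 1 ≤ degree T v
    degree-positive T {v} t∈ h with neighbours T v | ∈-neighbours⁺ T v t∈ h
    ... | _ ∷ _ | _ = s≤s z≤n

    -- This saves one marker for each coloured class (`δ = 1` in `cost`). With three generators the
    -- size bound would otherwise be exceeded.
    tied-degree : ∀ T {p q} → Tied T p q → 1 ≤ degree T p × 1 ≤ degree T q
    tied-degree T (t , a , _ , p , q) = degree-positive T a p , degree-positive T a q

    module _ {T : List Carrier} {n : ℕ} {a : Fin n → Carrier} (stage : Stage T) (Γ : Gadget T a) where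
      open Gadget Γ

      enlarge : Enlarged T n
      enlarge = record { T′ = T′ ; stage = extend stage Γ ; ⊆T′ = Membershipₚ.∈-++⁺ʳ setoid W
        ; length≡ = ≡.trans (length-++ W) (≡.cong (_+ length T) (length-tabulate a)) }

      new-tied : ∀ {i p q} → p ⁻¹ ∙ a i ∈ₗ W ± → q ⁻¹ ∙ a i ∈ₗ W ± → Tied T′ p q
      new-tied {i} hp hq = a i , new⊆ (pos i)
        , (λ v → new-fresh (pos i) (product-∈ T (Stage.coloured⊆ stage v))) , new⊆ hp , new⊆ hq

    commuting-step : ∀ {T} (stage : Stage T) {q u x u∈ x∈} → CommutingTie.Conditions stage q u x u∈ x∈ →
      Σ[ E ∈ Enlarged T 3 ] Tied (Enlarged.T′ E) x u
    commuting-step stage {q} {u} {x} {u∈} {x∈} cond = enlarge stage Γ , new-tied stage Γ {#0} (pos #2) (pos #1)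
      where
      Γ = CommutingTie.commutingTie stage q u x u∈ x∈ cond
      open Gadget Γ

    inverting-step : ∀ {T} (stage : Stage T) {w e f e∈ f∈} → InvertingTie.Conditions stage w e f e∈ f∈ →
      Σ[ E ∈ Enlarged T 3 ] Tied (Enlarged.T′ E) e f
    inverting-step stage {w} {e} {f} {e∈} {f∈} cond =
      enlarge stage Γ , new-tied stage Γ {#0} (resp (solve 2 (λ e w → w ⊜ inv e · (e · w)) refl e w) (pos #1)) (pos #2)
      where
      Γ = InvertingTie.invertingTie stage w e f e∈ f∈ cond
      open Gadget Γ

    tied-sym : ∀ T {p q} → Tied T p q → Tied T q p
    tied-sym T (t , a , b , p , q) = t , a , b , q , p

    tied-cong : ∀ T {p q q′} → q ≈ q′ → Tied T p q → Tied T p q′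
    tied-cong T e (t , a , b , p , q) = t , a , b , p , resp (∙-congʳ (⁻¹-cong e)) q

    abstract
      ties : ∀ hub bound us {T} → Stage T → length us * 3 + length T ≤ bound →
        (∀ {u T} → u ∈ₗ us → Stage T → length T ≤ bound → Σ[ E ∈ Enlarged T 3 ] Tied (Enlarged.T′ E) hub u) →
        Σ[ E ∈ Enlarged T (length us * 3) ] (∀ {u} → u ∈ₗ us → Tied (Enlarged.T′ E) hub u)
      ties hub bound [] stage le step = record { T′ = _ ; stage = stage ; ⊆T′ = id ; length≡ = ≡.refl } , λ ()
      ties hub bound (u ∷ us) {T} stage le step =
        let (E , tied) = step (here refl) stage (ℕₚ.≤-trans (ℕₚ.m≤n+m (length T) _) le)
            module E = Enlarged E
            shifted : length us * 3 + length E.T′ ≡ suc (length us) * 3 + length T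
            shifted = ≡.trans (≡.cong (λ k → length us * 3 + k) E.length≡)
              (≡.trans (≡.sym (ℕₚ.+-assoc (length us * 3) 3 (length T))) (≡.cong (_+ length T) (ℕₚ.+-comm (length us * 3) 3)))
            (E′ , tied′) = ties hub bound us E.stage (ℕₚ.≤-trans (ℕₚ.≤-reflexive shifted) le) (step ∘ there)
            module E′ = Enlarged E′
        in record { T′ = E′.T′ ; stage = E′.stage ; ⊆T′ = E′.⊆T′ ∘ E.⊆T′ ; length≡ = ≡.trans E′.length≡ shifted }
         , λ { (here e) → tied-cong E′.T′ (sym e) (tied-mono E.T′ E′.T′ E′.⊆T′ tied) ; (there p) → tied′ p }

  -- Representatives of the generators and short words in them.

  module Generators (S : GeneratingSet) where
    open GroupSolver
    open Counting
    open Gadgets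
    open Markers
    open Completion

    Sₗ U : List Carrier
    Sₗ = GeneratingSet.elements S
    U = representatives Sₗ

    U⊆S : ∀ {x} → x ∈ₗ U ± → x ∈ₗ Sₗ ±
    U⊆S = ±-⊆ U Sₗ (representatives-⊆ Sₗ)

    S⊆U : ∀ {x} → x ∈ₗ Sₗ ± → x ∈ₗ U ±
    S⊆U x∈ = [ representatives-cover Sₗ , ∈-inv⁻ U ∘ representatives-cover Sₗ ]′ (∈-±⁻ Sₗ x∈)

    ε∉U : ¬ ε ∈ₗ U ±
    ε∉U = ε∉± S ∘ U⊆S

    -- Words of length at most three in the generators. Hubs avoid them, which excludes accidental
    -- relations between a hub and generators.
    Product₃ : Carrier → Set (c ⊔ ℓ)
    Product₃ w = ∃[ a ] a ∈ₗ Ball₁ Sₗ × Product Sₗ (a ⁻¹ ∙ w)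

    product₃-resp : ∀ {v w} → v ≈ w → Product₃ v → Product₃ w
    product₃-resp e (a , a∈ , p) = a , a∈ , product-resp Sₗ (∙-congˡ e) p

    product-product₃ : ∀ {w} → Product Sₗ w → Product₃ w
    product-product₃ {w} p = ε , here refl , product-resp Sₗ (solve 1 (λ w → w ⊜ inv one · w) refl w) p

    ball-product₃ : ∀ {w} → w ∈ₗ Ball₁ Sₗ → Product₃ w
    ball-product₃ {w} w∈ = product-product₃ (w , ε , w∈ , here refl , sym (identityʳ w))

    abstract
      words₃ : List Carrier
      words₃ = cartesianProductWith _∙_ (ball Sₗ) (products Sₗ)

      ∈-words₃ : ∀ {w} → Product₃ w → w ∈ₗ words₃
      ∈-words₃ {w} (a , a∈ , p) = resp (solve 2 (λ a w → a · (inv a · w) ⊜ w) refl a w)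
        (Membershipₚ.∈-cartesianProductWith⁺ setoid setoid setoid ∙-cong (∈-ball Sₗ a∈) (∈-products Sₗ p))

      length-words₃ : length words₃ ≡ size Sₗ * size Sₗ * size Sₗ
      length-words₃ = ≡.trans (go (ball Sₗ)) (≡.trans (≡.cong₂ _*_ (length-ball Sₗ) (length-products Sₗ))
        (≡.sym (ℕₚ.*-assoc (size Sₗ) (size Sₗ) (size Sₗ))))
        where
        go : ∀ xs → length (cartesianProductWith _∙_ xs (products Sₗ)) ≡ length xs * length (products Sₗ)
        go [] = ≡.refl
        go (x ∷ xs) = ≡.trans (length-++ (map (x ∙_) (products Sₗ))) (≡.cong₂ _+_ (length-map _ (products Sₗ)) (go xs))

    InvolutionFree : Set (c ⊔ ℓ)
    InvolutionFree = ∀ {u} → u ∈ₗ U → ¬ u ∙ u ≈ ε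

    involutionFree : NoElementOfOrder2 S → InvolutionFree
    involutionFree none {u} u∈ e = none u (representatives-⊆ Sₗ u∈)
      (s≤s z≤n , trans (∙-congˡ (identityʳ u)) e , least)
      where
      least : ∀ m → 1 ≤ m → u ^ m ≈ ε → 2 ≤ m
      least (suc zero) _ h = contradiction (∈-±ˡ (resp (trans (sym (identityʳ u)) h) u∈)) ε∉U
      least (suc (suc m)) _ _ = s≤s (s≤s z≤n)

  -- One hub to which every generator is tied.

  module OneHub (S : GeneratingSet)
                (X : Carrier) (Negative : Carrier → Set (c ⊔ ℓ)) where
    open GroupSolver
    open Counting
    open Powers
    open Gadgets
    open Markers using (Powers₂; size)
    open Colouring using (cost)
    open Automorphisms
    open Completion
    open Pairs

    open Generators S public

    Hub : Carrier → Set ℓ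
    Hub p = p ≈ X ⊎ p ≈ X ⁻¹

    -- Membership in `U` rather than in `U ±` records a sign: `u` and `u⁻¹` are both representatives
    -- only if they are equal. What an inverted hub implies for a generator is left to `Negative`,
    -- which differs from case to case.
    setting : Setting
    setting = record
      { V = X ∷ U
      ; Index = Fin 1
      ; Related = λ _ p q → Hub p × q ∈ₗ U ±
      ; Conclusion = λ _ p q → (p ≈ X × q ∈ₗ U) ⊎ (p ≈ X ⁻¹ × Negative q)
      ; related-∈ = λ { (h , q∈) → hub∈ h , ±-⊆ U (X ∷ U) there q∈ }
      ; Reserved = λ _ → Lift (c ⊔ ℓ) ⊥ ; reserved-resp = λ _ → id ; reserved-inv = id }
      where
      hub∈ : ∀ {p} → Hub p → p ∈ₗ (X ∷ U) ±
      hub∈ (inj₁ e) = ∈-±ˡ (here e)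
      hub∈ {p} (inj₂ e) = ∈-±⁺ (X ∷ U) (inj₂ (here (trans (⁻¹-cong e) (⁻¹-involutive X))))

    open Setting setting using (V; Related; Conclusion; related-∈)
    open Stages setting
    open FindTies setting using (Irreflexive; room)
    open TieExistence setting
    open TieSteps setting

    module _ (X∉ : ¬ Product Sₗ X) (XX∉ : ¬ X ∙ X ∈ₗ Ball₁ Sₗ)
             (negative-resp : ∀ {p q} → p ≈ q → Negative p → Negative q) where

      X∈V : Coloured X
      X∈V = ∈-±ˡ (here refl)

      U⊆V : ∀ {x} → x ∈ₗ U ± → Coloured x
      U⊆V = ±-⊆ U (X ∷ U) there

      coloured⁻ : ∀ {x} → Coloured x → Hub x ⊎ x ∈ₗ U ±
      coloured⁻ {x} x∈ with ∈-±⁻ (X ∷ U) x∈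
      ... | inj₁ (here e) = inj₁ (inj₁ e)
      ... | inj₁ (there p) = inj₂ (∈-±ˡ p)
      ... | inj₂ (here e) = inj₁ (inj₂ (trans (sym (⁻¹-involutive x)) (⁻¹-cong e)))
      ... | inj₂ (there p) = inj₂ (∈-±⁺ U (inj₂ p))

      hub-product : ∀ {p} → Hub p → ¬ Product Sₗ p
      hub-product (inj₁ e) pr = X∉ (product-resp Sₗ e pr)
      hub-product (inj₂ e) pr = X∉ (product-resp Sₗ (trans (⁻¹-cong e) (⁻¹-involutive X)) (product-inv Sₗ pr))

      hub∉U : ∀ {p} → Hub p → ¬ p ∈ₗ U ±
      hub∉U h p∈ = hub-product h (product-∈ Sₗ (U⊆S p∈))

      irreflexive : Irreflexive
      irreflexive (h , q∈) e = hub∉U h (resp (sym e) q∈)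

      -- Guarantees that a marker never becomes a common neighbour of a hub and a generator, since
      -- it is adjacent only to powers `v^±1` and `v^±2` among the coloured elements.
      independent : ∀ {i p q v} → v ∈ₗ V → Related i p q → Powers₂ v p → Powers₂ v q → ⊥
      independent (here e) (h , q∈) _ (inj₁ f) = hub∉U (inj₁ (trans f e)) q∈
      independent (here e) (h , q∈) _ (inj₂ (inj₁ f)) = hub∉U (inj₂ (trans f (⁻¹-cong e))) q∈
      independent (here e) (h , q∈) _ (inj₂ (inj₂ (inj₁ f))) = XX∉ (there (resp (trans f (∙-cong e e)) (U⊆S q∈)))
      independent (here e) (h , q∈) _ (inj₂ (inj₂ (inj₂ f))) =
        XX∉ (there (resp (trans (⁻¹-cong f) (trans (⁻¹-involutive _) (∙-cong e e))) (∈-inv Sₗ (U⊆S q∈))))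
      independent (there v∈) (h , q∈) (inj₁ f) _ = hub∉U h (resp (sym f) (∈-±ˡ v∈))
      independent (there v∈) (h , q∈) (inj₂ (inj₁ f)) _ = hub∉U h (resp (sym f) (∈-inv U (∈-±ˡ v∈)))
      independent (there v∈) (h , q∈) (inj₂ (inj₂ (inj₁ f))) _ =
        hub-product h (product-resp Sₗ (sym f) (product-∙ Sₗ (U⊆S (∈-±ˡ v∈)) (U⊆S (∈-±ˡ v∈))))
      independent (there v∈) (h , q∈) (inj₂ (inj₂ (inj₂ f))) _ =
        hub-product h (product-resp Sₗ (sym f) (product-inv Sₗ (product-∙ Sₗ (U⊆S (∈-±ˡ v∈)) (U⊆S (∈-±ˡ v∈)))))

      apart : AllPairs Apart V
      apart = outside-apart U (hub∉U (inj₁ refl)) ∷ representatives-apart Sₗ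

      base : List Carrier
      base = X ∷ Sₗ

      base-coloured : ∀ {t} → t ∈ₗ base ± → Coloured t
      base-coloured {t} t∈ with ∈-±⁻ base t∈
      ... | inj₁ (here e) = ∈-±ˡ (here e)
      ... | inj₁ (there p) = U⊆V (S⊆U (∈-±ˡ p))
      ... | inj₂ (here e) = ∈-±⁺ V (inj₂ (here e))
      ... | inj₂ (there p) = U⊆V (S⊆U (∈-±⁺ Sₗ (inj₂ p)))

      baseStage : Stage base
      baseStage = record
        { coloured⊆ = [ hub∈ , (±-⊆ Sₗ base there ∘ U⊆S) ]′ ∘ coloured⁻
        ; ε∉ = ε∉V ∘ coloured⁻ ∘ base-coloured
        ; low = inj₁ ∘ base-coloured
        ; conclude = λ _ t∈ t∉ → contradiction (base-coloured t∈) t∉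
        ; noInvolution = λ nv t∈ e → [ (λ p → nv p e) , (λ p → nv p (trans
            (solve 1 (λ x → inv x · inv x ⊜ inv (x · x)) refl _) (trans (⁻¹-cong e) ε⁻¹≈ε))) ]′
            (∈-±⁻ V (base-coloured (∈-±ˡ t∈))) }
        where
        hub∈ : ∀ {p} → Hub p → p ∈ₗ base ±
        hub∈ (inj₁ e) = ∈-±ˡ (here e)
        hub∈ (inj₂ e) = ∈-±⁺ base (inj₂ (here (trans (⁻¹-cong e) (⁻¹-involutive X))))
        ε∉V : ¬ (Hub ε ⊎ ε ∈ₗ U ±)
        ε∉V (inj₁ h) = hub-product h (ε , ε , here refl , here refl , sym (identityˡ ε))
        ε∉V (inj₂ p) = ε∉U p

      module _ {T : List Carrier} (stage : Stage T) {u : Carrier} (u∈ : u ∈ₗ U ±) where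
        open Stage stage using (coloured⊆; low)

        -- Such products are protected, and uncoloured elements of a stage are not.
        coloured-product : ∀ {p q} → Coloured p → Coloured q → p ∙ q ∈ₗ T ± → Coloured (p ∙ q)
        coloured-product p∈ q∈ h = [ id , (λ (_ , np) → contradiction (inj₁ (product-∙ V p∈ q∈)) np) ]′ (low h)

        quotient∉ : ¬ u ⁻¹ ∙ X ∈ₗ T ±
        quotient∉ h with coloured⁻ (coloured-product (∈-inv V (U⊆V u∈)) X∈V h)
        ... | inj₁ (inj₁ e) = ε∉U (resp (trans (solve 2 (λ u x → u ⊜ inv (inv u · x · inv x)) refl u X)
                (trans (⁻¹-cong (trans (∙-congʳ e) (inverseʳ X))) ε⁻¹≈ε)) u∈)
        ... | inj₁ (inj₂ e) = XX∉ (there (resp (trans (solve 2 (λ u x → u ⊜ x · inv (inv u · x)) refl u X)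
                (∙-congˡ (trans (⁻¹-cong e) (⁻¹-involutive X)))) (U⊆S u∈)))
        ... | inj₂ p = X∉ (product-resp Sₗ (solve 2 (λ u x → u · (inv u · x) ⊜ x) refl u X) (product-∙ Sₗ (U⊆S u∈) (U⊆S p)))

        quotient∉′ : ¬ u ∙ X ⁻¹ ∈ₗ T ±
        quotient∉′ h with coloured⁻ (coloured-product (U⊆V u∈) (∈-inv V X∈V) h)
        ... | inj₁ (inj₂ e) = ε∉U (resp (trans (solve 2 (λ u x → u ⊜ u · inv x · x) refl u X)
                (trans (∙-congʳ e) (inverseˡ X))) u∈)
        ... | inj₁ (inj₁ e) = XX∉ (there (resp (trans (solve 2 (λ u x → u ⊜ u · inv x · x) refl u X) (∙-congʳ e)) (U⊆S u∈)))
        ... | inj₂ p = X∉ (product-resp Sₗ (solve 2 (λ u x → inv (u · inv x) · u ⊜ x) refl u X)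
                (product-∙ Sₗ (∈-inv Sₗ (U⊆S p)) (U⊆S u∈)))

      positive : ∀ {u k p p′} → u ∈ₗ U → Related k p p′ → p ≈ u ⊎ p ≈ X → p′ ≈ u ⊎ p′ ≈ X → Conclusion k p p′
      positive u∈ (h , q∈) (inj₁ e) _ = contradiction (resp (sym e) (∈-±ˡ u∈)) (hub∉U h)
      positive u∈ (h , q∈) (inj₂ e) (inj₁ e′) = inj₁ (e , resp (sym e′) u∈)
      positive u∈ (h , q∈) (inj₂ e) (inj₂ e′) = contradiction q∈ (hub∉U (inj₁ e′))

      module _ {T : List Carrier} (stage : Stage T) (L Q : ℕ) (short : 5 * size T < L) (enough : room (size T) 0 < Q)
               {u : Carrier} (u∈ : u ∈ₗ U) where
        private
          u∈± = ∈-±ˡ u∈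

        central-step : ∀ y → Torsionless y (3 * (Q * L)) → Commutes u y → Commutes X y → Negative (u ⁻¹) →
          Σ[ E ∈ Enlarged T 3 ] Tied (Enlarged.T′ E) X u
        central-step y tl cu cx neg = commuting-step stage (proj₂ (centralTie stage [] (λ { (lift ()) }) L Q short enough
          y ε u X (U⊆V u∈±) X∈V tl (trans (identityʳ y) (sym (identityˡ y))) cu cx (commutes-ε X)
          (quotient∉ stage u∈±)
          (λ h → quotient∉′ stage u∈± (resp (solve 2 (λ u x → inv one · (u · inv x) · one ⊜ u · inv x) refl u X) h))
          (λ e _ → inj₁ (resp (sym (trans e (solve 1 (λ u → inv one · u · one ⊜ u) refl u))) (U⊆V u∈±)))
          (λ {k} → irreflexive {k}) (λ {k} → positive {k = k} u∈) (λ {k} → negative {k})))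
          where
          same : ε ⁻¹ ∙ u ⁻¹ ∙ ε ≈ u ⁻¹
          same = solve 1 (λ u → inv one · inv u · one ⊜ inv u) refl u
          negative : ∀ {k p p′} → Related k p p′ → p ≈ ε ⁻¹ ∙ u ⁻¹ ∙ ε ⊎ p ≈ X ⁻¹ → p′ ≈ ε ⁻¹ ∙ u ⁻¹ ∙ ε ⊎ p′ ≈ X ⁻¹ → Conclusion k p p′
          negative (h , q∈) (inj₁ e) _ = contradiction (resp (sym (trans e same)) (∈-inv U u∈±)) (hub∉U h)
          negative (h , q∈) (inj₂ e) (inj₁ e′) = inj₂ (e , negative-resp (sym (trans e′ same)) neg)
          negative (h , q∈) (inj₂ e) (inj₂ e′) = contradiction q∈ (hub∉U (inj₂ e′))

        -- There is no negative conclusion here: for a generic `u` the new element has no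
        -- counterpart at `X⁻¹`.
        generic-step : ∀ z → Torsionless z (3 * (Q * L)) → NotNormal u z L → Commutes X z →
          Σ[ E ∈ Enlarged T 3 ] Tied (Enlarged.T′ E) X u
        generic-step z tl n cx = commuting-step stage (proj₂ (genericTie stage [] (λ { (lift ()) }) L Q short enough
          z u X (U⊆V u∈±) X∈V tl n cx (quotient∉ stage u∈±) (λ {k} → irreflexive {k}) (λ {k} → positive {k = k} u∈)))

        -- Multiplying the new element by X makes the tie see X⁻¹ u X.
        conjugating-step : (∀ {t} → t ∈ₗ T ± → Coloured t) → ∀ y → Torsionless y (3 * (Q * L)) → Commutes u y → Commutes X y →
          Negative (X ⁻¹ ∙ u ⁻¹ ∙ X) → Σ[ E ∈ Enlarged T 3 ] Tied (Enlarged.T′ E) X u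
        conjugating-step coloured y tl cu cx neg = commuting-step stage (proj₂ (centralTie stage [] (λ { (lift ()) }) L Q short enough
          y X u X (U⊆V u∈±) X∈V tl cx cu cx refl
          (quotient∉ stage u∈±)
          (λ h → quotient∉ stage u∈± (resp (solve 2 (λ u x → inv (inv x · (u · inv x) · x) ⊜ inv u · x) refl u X) (∈-inv T h)))
          (λ _ p∈ → inj₁ (coloured p∈))
          (λ {k} → irreflexive {k}) (λ {k} → positive {k = k} u∈) (λ {k} → negative {k})))
          where
          negative : ∀ {k p p′} → Related k p p′ → p ≈ X ⁻¹ ∙ u ⁻¹ ∙ X ⊎ p ≈ X ⁻¹ → p′ ≈ X ⁻¹ ∙ u ⁻¹ ∙ X ⊎ p′ ≈ X ⁻¹ → Conclusion k p p′
          -- A hub commutes with `X`, so if it were the conjugate of `u⁻¹` by `X` it would be `u⁻¹`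
          -- itself.
          negative (h , q∈) (inj₁ e) _ = contradiction (resp (conj-hub h e) (∈-inv U u∈±)) (hub∉U h)
            where
            conj-hub : ∀ {p} → Hub p → p ≈ X ⁻¹ ∙ u ⁻¹ ∙ X → u ⁻¹ ≈ p
            conj-hub {p} h e = trans (solve 2 (λ u x → inv u ⊜ x · (inv x · inv u · x) · inv x) refl u X)
              (trans (∙-congʳ (∙-congˡ (sym e))) (self h))
              where
              self : ∀ {p} → Hub p → X ∙ p ∙ X ⁻¹ ≈ p
              self (inj₁ e) = trans (∙-congʳ (∙-congˡ e)) (trans (solve 1 (λ x → x · x · inv x ⊜ x) refl X) (sym e))
              self (inj₂ e) = trans (∙-congʳ (∙-congˡ e)) (trans (solve 1 (λ x → x · inv x · inv x ⊜ inv x) refl X) (sym e))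
          negative (h , q∈) (inj₂ e) (inj₁ e′) = inj₂ (e , negative-resp (sym e′) neg)
          negative (h , q∈) (inj₂ e) (inj₂ e′) = contradiction q∈ (hub∉U (inj₂ e′))

      -- What remains to be shown when the hub is inverted. The last hypothesis extends inversion
      -- from the representatives to all of `S ±`.
      FlipsOK : Set (c ⊔ ℓ)
      FlipsOK = ∀ {f} → (∀ {u} → u ∈ₗ U → Negative (f u)) → (∀ {u} → u ∈ₗ U → f u ≈ u ⊎ f u ≈ u ⁻¹) →
        ((∀ {u} → u ∈ₗ U → f u ≈ u ⁻¹) → ∀ {x} → x ∈ₗ Sₗ ± → f x ≈ x ⁻¹) → PairsPreserved Sₗ f

      module _ {T : List Carrier} (stage : Stages.Stage (plain setting) T)
               (distinct : ∀ {u v} → u ∈ₗ V → v ∈ₗ V → degree T u ≡ degree T v → u ≈ v)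
               (high : ∀ {u} → u ∈ₗ V → 7 ≤ degree T u)
               (tied : ∀ {u} → u ∈ₗ U → Tied T X u)
               {f g : Carrier → Carrier} (Φ : BallMap T f g) (Ψ : BallMap T g f) where
        open Coloured-automorphism (plain setting)
        open Stages.Stage stage using (coloured⊆)

        fixed-coloured : ∀ {v} → Coloured v → f v ≈ v ⊎ f v ≈ v ⁻¹
        fixed-coloured = coloured-fixed stage distinct high Φ Ψ

        private
          conclusion : ∀ {u} → u ∈ₗ U → (f X ≈ X × f u ∈ₗ U) ⊎ (f X ≈ X ⁻¹ × Negative (f u))
          conclusion {u} u∈ =
            let (t , t∈ , t∉ , a , b) = tied u∈
            in transport stage distinct high Φ Ψ zero t∈ t∉ (coloured⊆ X∈V) (coloured⊆ (U⊆V (∈-±ˡ u∈))) a b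
                 (fixed-coloured X∈V , image (fixed-coloured (U⊆V (∈-±ˡ u∈))))
            where
            image : f u ≈ u ⊎ f u ≈ u ⁻¹ → f u ∈ₗ U ±
            image (inj₁ e) = resp (sym e) (∈-±ˡ u∈)
            image (inj₂ e) = resp (sym e) (∈-inv U (∈-±ˡ u∈))

          X≉X⁻¹ : ¬ X ≈ X ⁻¹
          X≉X⁻¹ e = XX∉ (here (trans (∙-congʳ e) (inverseˡ X)))

        -- All generators are tied to the same hub, whose image decides. If the hub is fixed, `f u`
        -- is a representative of the class of `u`, hence `u`.
        dichotomy : (∀ {u} → u ∈ₗ U → f u ≈ u) ⊎ (∀ {u} → u ∈ₗ U → Negative (f u))
        dichotomy with fixed-coloured X∈V
        ... | inj₁ e = inj₁ λ {u} u∈ → keep u∈ (conclusion u∈) (fixed-coloured (U⊆V (∈-±ˡ u∈)))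
          where
          keep : ∀ {u} → u ∈ₗ U → (f X ≈ X × f u ∈ₗ U) ⊎ (f X ≈ X ⁻¹ × Negative (f u)) → f u ≈ u ⊎ f u ≈ u ⁻¹ → f u ≈ u
          keep u∈ _ (inj₁ h) = h
          keep u∈ (inj₁ (_ , fu∈)) (inj₂ h) = antisymmetric (representatives-apart Sₗ) fu∈ u∈ h
          keep u∈ (inj₂ (e′ , _)) (inj₂ h) = contradiction (trans (sym e) e′) X≉X⁻¹
        ... | inj₂ e = inj₂ λ u∈ → [ (λ (e′ , _) → contradiction (trans (sym e′) e) X≉X⁻¹) , proj₂ ]′ (conclusion u∈)

        all-fixed : (∀ {u} → u ∈ₗ U → f u ≈ u) → ∀ {x} → x ∈ₗ Sₗ ± → f x ≈ x
        all-fixed h {x} x∈ with ∈-±⁻ U (S⊆U x∈)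
        ... | inj₁ p = h p
        ... | inj₂ p = trans (BallMap.cong Φ (sym (⁻¹-involutive x)))
          (trans (fixed-inverse Φ Ψ (coloured⊆ (U⊆V (∈-±ˡ p))) (fixed-coloured (U⊆V (∈-inv U (∈-±ˡ p)))) (h p)) (⁻¹-involutive x))

        all-flipped : (∀ {u} → u ∈ₗ U → f u ≈ u ⁻¹) → ∀ {x} → x ∈ₗ Sₗ ± → f x ≈ x ⁻¹
        all-flipped h {x} x∈ with ∈-±⁻ U (S⊆U x∈)
        ... | inj₁ p = h p
        ... | inj₂ p = trans (BallMap.cong Φ (sym (⁻¹-involutive x)))
          (trans (flipped-inverse Φ Ψ (coloured⊆ (U⊆V (∈-±ˡ p))) (fixed-coloured (U⊆V (∈-inv U (∈-±ˡ p)))) (h p)) (⁻¹-cong (⁻¹-involutive x)))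

        preserved : FlipsOK → PairsPreserved Sₗ f
        preserved flips with dichotomy
        ... | inj₁ h = λ x∈ y∈ _ → pair-fixed (all-fixed h x∈) (all-fixed h y∈)
        ... | inj₂ neg = flips neg (λ u∈ → fixed-coloured (U⊆V (∈-±ˡ u∈))) all-flipped

      -- The list `us` may omit a generator that is tied in `T₀` already: the conjugating tie has to
      -- be made first, while all elements are coloured.
      finish : ∀ z M B bound → Torsionless z (3 * M * M) →
        (∀ T → length T ≤ bound → 2 * (size T * size T) + 6 * size T < M) →
        ∀ {T₀} → Stage T₀ → (∀ {s} → s ∈ₗ base → s ∈ₗ T₀) → ∀ us → length us * 3 + length T₀ ≤ B →
        (∀ {u T} → u ∈ₗ us → Stage T → length T ≤ B → Σ[ E ∈ Enlarged T 3 ] Tied (Enlarged.T′ E) X u) →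
        (∀ {u} → u ∈ₗ U → u ∈ₗ us ⊎ Tied T₀ X u) →
        ∃[ u ] u ∈ₗ U → B + cost 1 (suc (length U)) 0 ≤ bound → FlipsOK → Target S bound InvolutionFree
      finish z M B bound tl room′ {T₀} stage₀ base⊆ us fits step cover (u₀ , u₀∈) le flips =
        target-map S no-involution
        (complete S setting z M bound 1 tl room′ (λ {i} {p} {q} → independent {i} {p} {q}) apart E.stage
          (E.⊆T′ ∘ base⊆ ∘ there) degrees (ℕₚ.≤-trans (ℕₚ.+-monoˡ-≤ (cost 1 (suc (length U)) 0) length≤) le)
          λ {T′} stage′ T⊆T′ distinct high Φ Ψ →
            let tied′ = λ {u} (u∈ : u ∈ₗ U) → tied-mono E.T′ T′ T⊆T′ (tied u∈)
            in (λ x∈ → fixed-coloured stage′ distinct high tied′ Φ Ψ (U⊆V (S⊆U x∈)))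
             , preserved stage′ distinct high tied′ Φ Ψ flips)
        where
        enlarged = ties X B us stage₀ fits step
        module E = Enlarged (proj₁ enlarged)
        tied : ∀ {u} → u ∈ₗ U → Tied E.T′ X u
        tied u∈ = [ proj₂ enlarged , tied-mono T₀ E.T′ E.⊆T′ ]′ (cover u∈)
        degrees : ∀ {v} → v ∈ₗ V → 1 ≤ degree E.T′ v
        degrees (here e) = ≡.subst (1 ≤_) (degree-cong E.T′ (sym e)) (proj₁ (tied-degree E.T′ (tied u₀∈)))
        degrees (there v∈) = proj₂ (tied-degree E.T′ (tied v∈))
        length≤ : length E.T′ ≤ B
        length≤ = ℕₚ.≤-trans (ℕₚ.≤-reflexive E.length≡) fits
        no-involution : InvolutionFree → NoInvolution V
        no-involution free (here e) ee = XX∉ (here (trans (∙-cong (sym e) (sym e)) ee))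
        no-involution free (there u∈) = free u∈

  -- Two hubs, when a generator inverts `z`.

  module TwoHubs (S : GeneratingSet)
                 (z g x h : Carrier) (L : ℕ) where
    open Mult monoid using (×-congˡ)
    open GroupSolver
    open Counting
    open Powers
    open Gadgets
    open Markers using (Powers₂; size; InvertsUpTo)
    open Colouring using (cost)
    open Automorphisms
    open Completion
    open Pairs
    open Generators S public

    y : Carrier
    y = g ⁻¹ ∙ x

    Inv Gen : Carrier → Set ℓ
    Inv = InvertsUpTo z L
    Gen q = NotNormal q z L

    -- The values `f⁻¹ e²` of the inverting ties with `e = u` and `f = y`.
    R : List Carrier
    R = map (λ u → y ⁻¹ ∙ (u ∙ u)) U ±

    class-∈ : ∀ vs {p v} → v ∈ₗ vs → SameClass p v → p ∈ₗ vs ±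
    class-∈ vs v∈ (inj₁ e) = ∈-±ˡ (resp (sym e) v∈)
    class-∈ vs v∈ (inj₂ e) = resp (sym e) (∈-inv vs (∈-±ˡ v∈))

    -- The third kind of tie is made for at most one generator, `h`. Its purpose is to show that `y`
    -- can be inverted only if no generator is generic.
    Related₂ : Fin 3 → Carrier → Carrier → Set (c ⊔ ℓ)
    Related₂ zero p q = SameClass p x × q ∈ₗ U ± × ¬ Inv q
    Related₂ (suc zero) p q = SameClass p y × q ∈ₗ U ± × Inv q
    Related₂ (suc (suc zero)) p q = SameClass p y × q ∈ₗ U ± × Gen q

    -- The second line yields `u² = y²` when `y` is inverted. In the third line an inverted `y`
    -- would move `h` to `y⁻² h`, although its tie to `x` keeps `h` fixed.
    Conclusion₂ : Fin 3 → Carrier → Carrier → Set (c ⊔ ℓ)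
    Conclusion₂ zero p q = (p ≈ x × q ∈ₗ U) ⊎ p ≈ x ⁻¹
    Conclusion₂ (suc zero) p q = (p ≈ y × q ∈ₗ U) ⊎ (p ≈ y ⁻¹ × q ⁻¹ ∈ₗ U × q ⁻¹ ∙ q ⁻¹ ≈ y ∙ y)
    Conclusion₂ (suc (suc zero)) p q = Lift (c ⊔ ℓ) (p ≈ y ⊎ q ≈ (y ∙ y) ⁻¹ ∙ h)

    related-generator : ∀ i {p q} → Related₂ i p q → q ∈ₗ U ±
    related-generator zero = proj₁ ∘ proj₂
    related-generator (suc zero) = proj₁ ∘ proj₂
    related-generator (suc (suc zero)) = proj₁ ∘ proj₂

    related-hub : ∀ i {p q} → Related₂ i p q → SameClass p x ⊎ SameClass p y
    related-hub zero = inj₁ ∘ proj₁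
    related-hub (suc zero) = inj₂ ∘ proj₁
    related-hub (suc (suc zero)) = inj₂ ∘ proj₁

    setting : Setting
    setting = record
      { V = x ∷ y ∷ U ; Index = Fin 3 ; Related = Related₂ ; Conclusion = Conclusion₂
      ; related-∈ = λ {i} r → [ class-∈ (x ∷ y ∷ U) (here refl) , class-∈ (x ∷ y ∷ U) (there (here refl)) ]′ (related-hub i r)
                            , ±-⊆ U (x ∷ y ∷ U) (there ∘ there) (related-generator i r)
      ; Reserved = _∈ₗ R ; reserved-resp = resp ; reserved-inv = ∈-inv (map (λ u → y ⁻¹ ∙ (u ∙ u)) U) }

    open Setting setting using (V)
    open Stages setting
    open FindTies setting using (Irreflexive; room)
    open Ties setting using (#0; #1; #2)
    open InvertedTies setting using (module InvertingTie)
    open TieExistence setting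
    open TieSteps setting

    module _ (g∈ : g ∈ₗ U) (ig : Inverts g z) (cx : Commutes x z) (ix : Inverts g x) (1≤L : 1 ≤ L)
             (tl : Torsionless z (3 * L * L))
             (x∉ : ¬ Product₃ x) (y∉ : ¬ Product₃ y) (xx∉ : ¬ Product₃ (x ∙ x)) where

      open Order z L tl using (inv-resp; inv-square; inv-inv)

      private
        product₃ : ∀ {a b d w} → a ∈ₗ U ± → b ∈ₗ U ± → d ∈ₗ U ± → w ≈ a ∙ (b ∙ d) → Product₃ w
        product₃ {a} {b} {d} {w} a∈ b∈ d∈ e = a , there (U⊆S a∈) , product-resp Sₗ
          (trans (solve 2 (λ a y → y ⊜ inv a · (a · y)) refl a (b ∙ d)) (∙-congˡ (sym e)))
          (product-∙ Sₗ (U⊆S b∈) (U⊆S d∈))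

        product₂ : ∀ {a b w} → a ∈ₗ U ± → b ∈ₗ U ± → w ≈ a ∙ b → Product₃ w
        product₂ {a} {b} {w} a∈ b∈ e = ε , here refl , product-resp Sₗ
          (trans (solve 1 (λ w → w ⊜ inv one · w) refl (a ∙ b)) (∙-congˡ (sym e))) (product-∙ Sₗ (U⊆S a∈) (U⊆S b∈))

        product₁ : ∀ {w} → w ∈ₗ U ± → Product₃ w
        product₁ {w} w∈ = ε , here refl , product-resp Sₗ (solve 1 (λ w → w ⊜ inv one · w) refl w) (product-∈ Sₗ (U⊆S w∈))

        product₀ : ∀ {w} → w ≈ ε → Product₃ w
        product₀ {w} e = ε , here refl , ε , ε , here refl , here refl
          , trans (∙-congˡ e) (solve 0 (inv one · one ⊜ one · one) refl)

        g∈± : g ∈ₗ U ±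
        g∈± = ∈-±ˡ g∈

        inv∈ : ∀ {w} → w ∈ₗ U ± → w ⁻¹ ∈ₗ U ±
        inv∈ = ∈-inv U

        class-U : ∀ {p q} → SameClass p q → q ∈ₗ U ± → p ∈ₗ U ±
        class-U (inj₁ e) q∈ = resp (sym e) q∈
        class-U (inj₂ e) q∈ = resp (sym e) (inv∈ q∈)

        inv-class : ∀ {p q} → SameClass p q → Inv q → Inv p
        inv-class (inj₁ e) i = inv-resp (sym e) i
        inv-class (inj₂ e) i = inv-resp (sym e) (inv-inv i)

        gen-inv : ∀ {q} → Gen q → ¬ Inv q
        gen-inv n (e , p , r , i) = proj₂ (n e p r) i

        gen-commutes : ∀ {q e} → Gen q → 1 ≤ e → e ≤ L → ¬ Commutes q (z ^ e)
        gen-commutes {e = e} n p r = proj₁ (n e p r)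

        gen-resp : ∀ {p q} → p ≈ q → Gen p → Gen q
        gen-resp e n k p r = (λ m → proj₁ (n k p r) (commutes-≈ e m))
                           , (λ m → proj₂ (n k p r) (trans (∙-congʳ (∙-congˡ e)) (trans m (sym e))))

        Inv-g : Inv g
        Inv-g = 1 , s≤s z≤n , 1≤L , inverts-resp (sym (identityʳ z)) ig

        y⁻¹≈ : y ⁻¹ ≈ g ∙ x
        y⁻¹≈ = trans (solve 2 (λ g x → inv (inv g · x) ⊜ inv x · g) refl g x)
          (trans (∙-congˡ (sym ix)) (solve 2 (λ g x → inv x · (x · g · x) ⊜ g · x) refl g x))

        yy≈ : y ∙ y ≈ g ⁻¹ ∙ g ⁻¹
        yy≈ = trans (solve 2 (λ g x → inv g · x · (inv g · x) ⊜ inv g · (x · inv g · x)) refl g x) (∙-congˡ (inverts-inv ix))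

        iy : Inverts y z
        iy = trans (∙-congʳ (sym (assoc z (g ⁻¹) x))) (trans (assoc _ _ _) (trans (∙-congˡ (sym cx))
          (trans (solve 3 (λ z g x → z · inv g · (z · x) ⊜ z · inv g · z · x) refl z g x) (∙-congʳ (inverts-inv ig)))))

        gg-commutes : ∀ n → Commutes (y ∙ y) (z ^ n)
        gg-commutes n = commutes-≈ yy≈ (commutes-^ n (inverts-square (inverts-inv ig)))

        x-class : ∀ {p} → SameClass p x → ¬ p ∈ₗ U ±
        x-class h p∈ = x∉ (product₁ (class-U (class-sym h) p∈))

        y-class : ∀ {p} → SameClass p y → ¬ p ∈ₗ U ±
        y-class h p∈ = y∉ (product₁ (class-U (class-sym h) p∈))

        product-class : ∀ {p q r v} → q ∈ₗ U ± → r ∈ₗ U ± → p ≈ q ∙ r → SameClass p v → Product₃ v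
        product-class q∈ r∈ e (inj₁ f) = product₂ q∈ r∈ (trans (sym f) e)
        product-class {p} {q} {r} {v} q∈ r∈ e (inj₂ f) = product₂ (inv∈ r∈) (inv∈ q∈)
          (trans (sym (⁻¹-involutive v)) (trans (⁻¹-cong (trans (sym f) e)) (solve 2 (λ q r → inv (q · r) ⊜ inv r · inv q) refl q r)))

        x-yclass : ∀ {p} → SameClass p x → ¬ SameClass p y
        x-yclass hx hy with class-via (class-sym hx) (class-sym hy)
        ... | inj₁ e = ε∉U (resp (trans (solve 2 (λ g x → g ⊜ x · inv (inv g · x)) refl g x)
                (trans (∙-congˡ (⁻¹-cong (sym e))) (inverseʳ x))) g∈±)
        ... | inj₂ e = ε∉U (resp (trans (solve 2 (λ g x → g ⊜ g · x · inv x) refl g x)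
                (trans (∙-congʳ (trans (sym y⁻¹≈) (sym e))) (inverseʳ x))) g∈±)

        x≉x⁻¹ : ¬ x ≈ x ⁻¹
        x≉x⁻¹ e = xx∉ (product₀ (trans (∙-congʳ e) (inverseˡ x)))

      Coloured-cases : Carrier → Set (c ⊔ ℓ)
      Coloured-cases t = SameClass t x ⊎ SameClass t y ⊎ t ∈ₗ U ±

      coloured⁻ : ∀ {t} → Coloured t → Coloured-cases t
      coloured⁻ {t} t∈ with class-of V t∈
      ... | r , here e , hr = inj₁ (class-via hr (inj₁ (sym e)))
      ... | r , there (here e) , hr = inj₂ (inj₁ (class-via hr (inj₁ (sym e))))
      ... | r , there (there r∈) , hr = inj₂ (inj₂ (class-U hr (∈-±ˡ r∈)))

      U⊆V : ∀ {t} → t ∈ₗ U ± → Coloured t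
      U⊆V = ±-⊆ U V (there ∘ there)

      x∈V : Coloured x
      x∈V = ∈-±ˡ {V} (here refl)

      y∈V : Coloured y
      y∈V = ∈-±ˡ {V} (there (here refl))

      irreflexive : Irreflexive
      irreflexive {i} r e = [ (λ k → x-class k p∈) , (λ k → y-class k p∈) ]′ (related-hub i r)
        where p∈ = resp (sym e) (related-generator i r)

      independent : ∀ {i p q v} → v ∈ₗ V → Related₂ i p q → Powers₂ v p → Powers₂ v q → ⊥
      independent {i} {p} {q} {v} v∈ r hp hq = cases v∈ (powers hp) (powers hq)
        where
        q∈ = related-generator i r
        powers : ∀ {p} → Powers₂ v p → SameClass p v ⊎ SameClass p (v ∙ v)
        powers (inj₁ e) = inj₁ (inj₁ e)
        powers (inj₂ (inj₁ e)) = inj₁ (inj₂ e)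
        powers (inj₂ (inj₂ (inj₁ e))) = inj₂ (inj₁ e)
        powers (inj₂ (inj₂ (inj₂ e))) = inj₂ (inj₂ e)
        to : ∀ {p v′} → v ≈ v′ → SameClass p v → SameClass p v′
        to e k = class-via k (inj₁ (sym e))
        to² : ∀ {p v′} → v ≈ v′ → SameClass p (v ∙ v) → SameClass p (v′ ∙ v′)
        to² e k = class-via k (inj₁ (∙-cong (sym e) (sym e)))
        -- The square `y² = g⁻²` may well be a generator. It commutes with the powers of `z`, hence
        -- is neither inverting nor generic; index 0 is excluded by its hub.
        not-yy : ∀ i → Related₂ i p q → SameClass p y ⊎ SameClass p (y ∙ y) → SameClass q (y ∙ y) → ⊥
        not-yy zero (hx , _) (inj₁ k) _ = x-yclass hx k
        not-yy zero (hx , _) (inj₂ k) _ = x∉ (product-class (inv∈ g∈±) (inv∈ g∈±) yy≈ (class-via (class-sym k) (class-sym hx)))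
        not-yy (suc zero) (_ , _ , j) _ k = [ (λ e → inv-square j (inv-inv Inv-g) (trans e yy≈))
          , (λ e → inv-square (inv-inv j) (inv-inv Inv-g) (trans (trans (⁻¹-cong e) (⁻¹-involutive _)) yy≈)) ]′ k
        not-yy (suc (suc zero)) (_ , _ , n) _ k = gen-commutes n (s≤s z≤n) 1≤L (commutes-class k (gg-commutes 1))
        cases : v ∈ₗ V → SameClass p v ⊎ SameClass p (v ∙ v) → SameClass q v ⊎ SameClass q (v ∙ v) → ⊥
        cases (here e) _ (inj₁ k) = x-class (to e k) q∈
        cases (here e) _ (inj₂ k) = xx∉ (product₁ (class-U (class-sym (to² e k)) q∈))
        cases (there (here e)) _ (inj₁ k) = y-class (to e k) q∈
        cases (there (here e)) kp (inj₂ k) = not-yy i r ([ inj₁ ∘ to e , inj₂ ∘ to² e ]′ kp) (to² e k)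
        cases (there (there v∈)) (inj₁ k) _ = [ (λ hx → x-class hx p∈) , (λ hy → y-class hy p∈) ]′ (related-hub i r)
          where p∈ = class-U k (∈-±ˡ v∈)
        cases (there (there v∈)) (inj₂ k) _ = [ (λ hx → x∉ (by hx)) , (λ hy → y∉ (by hy)) ]′ (related-hub i r)
          where
          by : ∀ {w} → SameClass p w → Product₃ w
          by hw = product-class (∈-±ˡ v∈) (∈-±ˡ v∈) refl (class-via (class-sym k) (class-sym hw))

      apart : AllPairs Apart V
      apart = outside-apart (y ∷ U) x∉yU ∷ outside-apart U (y-class (inj₁ refl)) ∷ representatives-apart Sₗ
        where
        x∉yU : ¬ x ∈ₗ (y ∷ U) ±
        x∉yU p with class-of (y ∷ U) p
        ... | r , here e , hr = x-yclass (inj₁ refl) (class-via hr (inj₁ (sym e)))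
        ... | r , there r∈ , hr = x-class (inj₁ refl) (class-U hr (∈-±ˡ r∈))

      base : List Carrier
      base = x ∷ y ∷ Sₗ

      base-coloured : ∀ {t} → t ∈ₗ base ± → Coloured t
      base-coloured {t} t∈ with class-of base t∈
      ... | r , here e , hr = class-∈ V (here e) hr
      ... | r , there (here e) , hr = class-∈ V (there (here e)) hr
      ... | r , there (there r∈) , hr = U⊆V (class-U hr (S⊆U (∈-±ˡ r∈)))

      baseStage : Stage base
      baseStage = record
        { coloured⊆ = into ∘ coloured⁻
        ; ε∉ = ε∉V ∘ coloured⁻ ∘ base-coloured
        ; low = inj₁ ∘ base-coloured
        ; conclude = λ _ t∈ t∉ → contradiction (base-coloured t∈) t∉
        ; noInvolution = λ nv t∈ e → [ (λ p → nv p e) , (λ p → nv p (trans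
            (solve 1 (λ x → inv x · inv x ⊜ inv (x · x)) refl _) (trans (⁻¹-cong e) ε⁻¹≈ε))) ]′
            (∈-±⁻ V (base-coloured (∈-±ˡ t∈))) }
        where
        into : ∀ {t} → Coloured-cases t → t ∈ₗ base ±
        into (inj₁ k) = class-∈ base (here refl) k
        into (inj₂ (inj₁ k)) = class-∈ base (there (here refl)) k
        into (inj₂ (inj₂ t∈)) = ±-⊆ Sₗ base (there ∘ there) (U⊆S t∈)
        ε∉V : ¬ Coloured-cases ε
        ε∉V (inj₁ k) = x∉ (product₀ ([ sym , (λ e → trans (sym (⁻¹-involutive x)) (trans (⁻¹-cong (sym e)) ε⁻¹≈ε)) ]′ k))
        ε∉V (inj₂ (inj₁ k)) = y∉ (product₀ ([ sym , (λ e → trans (sym (⁻¹-involutive y)) (trans (⁻¹-cong (sym e)) ε⁻¹≈ε)) ]′ k))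
        ε∉V (inj₂ (inj₂ p)) = ε∉U p

      coloured-product : ∀ {T} → Stages.Stage (plain setting) T → ∀ {p q} → Coloured p → Coloured q → p ∙ q ∈ₗ T ± → Coloured-cases (p ∙ q)
      coloured-product stage p∈ q∈ k = coloured⁻ ([ id , (λ (_ , np) → contradiction (inj₁ (product-∙ V p∈ q∈)) np) ]′ (Stages.Stage.low stage k))

      module _ {T : List Carrier} (stage : Stages.Stage (plain setting) T) {u : Carrier} (u∈ : u ∈ₗ U ±) where
        private
          closed : ∀ {p q} → Coloured p → Coloured q → p ∙ q ∈ₗ T ± → Coloured-cases (p ∙ q)
          closed = coloured-product stage

          divide : ∀ v {w} → u ⁻¹ ∙ v ≈ w → u ≈ v ∙ w ⁻¹
          divide v e = trans (solve 2 (λ u v → u ⊜ v · inv (inv u · v)) refl u v) (∙-congˡ (⁻¹-cong e))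

          multiply : ∀ v {w} → u ∙ v ⁻¹ ≈ w → u ≈ w ∙ v
          multiply v e = trans (solve 2 (λ u v → u ⊜ u · inv v · v) refl u v) (∙-congʳ e)

          not-ε : ¬ u ≈ ε
          not-ε e = ε∉U (resp e u∈)

          not-xx : ¬ u ≈ x ∙ x
          not-xx e = xx∉ (product₁ (resp e u∈))

        -- The restriction on `u` takes care of `g` and `g⁻¹`, for which the quotient is `y` and
        -- `y⁻¹`.
        x-quotient∉ : ¬ Inv u → ¬ u ⁻¹ ∙ x ∈ₗ T ±
        x-quotient∉ n k with closed (U⊆V (inv∈ u∈)) x∈V k
        ... | inj₁ (inj₁ e) = not-ε (trans (divide x e) (inverseʳ x))
        ... | inj₁ (inj₂ e) = not-xx (trans (divide x e) (∙-congˡ (⁻¹-involutive x)))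
        ... | inj₂ (inj₁ (inj₁ e)) = n (inv-resp (sym (trans (divide x e)
                (solve 2 (λ g x → x · inv (inv g · x) ⊜ g) refl g x))) Inv-g)
        ... | inj₂ (inj₁ (inj₂ e)) = n (inv-resp (sym (trans (divide x (trans e y⁻¹≈))
                (solve 2 (λ g x → x · inv (g · x) ⊜ inv g) refl g x))) (inv-inv Inv-g))
        ... | inj₂ (inj₂ p) = x∉ (product₂ u∈ p (solve 2 (λ u x → x ⊜ u · (inv u · x)) refl u x))

        x-quotient∉′ : ¬ u ∙ x ⁻¹ ∈ₗ T ±
        x-quotient∉′ k with closed (U⊆V u∈) (∈-inv V x∈V) k
        ... | inj₁ (inj₁ e) = not-xx (multiply x e)
        ... | inj₁ (inj₂ e) = not-ε (trans (multiply x e) (inverseˡ x))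
        ... | inj₂ (inj₁ (inj₁ e)) = xx∉ (product₂ g∈± u∈ (trans
                (solve 2 (λ g x → x · x ⊜ g · (inv g · x · x)) refl g x) (∙-congˡ (sym (multiply x e)))))
        ... | inj₂ (inj₁ (inj₂ e)) = xx∉ (product₂ (inv∈ g∈±) u∈ (trans
                (solve 2 (λ g x → x · x ⊜ inv g · (g · x · x)) refl g x) (∙-congˡ (sym (multiply x (trans e y⁻¹≈))))))
        ... | inj₂ (inj₂ p) = x∉ (product₂ (inv∈ p) u∈ (solve 2 (λ u x → x ⊜ inv (u · inv x) · u) refl u x))

        -- For `u = g⁻¹` the quotient is `g y = x`. Among the representatives such a `u` can only be
        -- `g` itself, as an involution, and then every automorphism in question fixes it.
        y-quotient∉ : Inv u → ¬ u ≈ g ⁻¹ → ¬ u ⁻¹ ∙ y ∈ₗ T ±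
        y-quotient∉ i n k with closed (U⊆V (inv∈ u∈)) y∈V k
        ... | inj₁ (inj₁ e) = n (trans (divide y e) (solve 2 (λ g x → inv g · x · inv x ⊜ inv g) refl g x))
        ... | inj₁ (inj₂ e) = xx∉ (product₂ g∈± u∈ (trans
                (solve 2 (λ g x → x · x ⊜ g · (inv g · x · inv (inv x))) refl g x) (∙-congˡ (sym (divide y e)))))
        ... | inj₂ (inj₁ (inj₁ e)) = not-ε (trans (divide y e) (inverseʳ y))
        ... | inj₂ (inj₁ (inj₂ e)) = inv-square i (inv-inv Inv-g) (trans (divide y e) (trans (∙-congˡ (⁻¹-involutive y)) yy≈))
        ... | inj₂ (inj₂ p) = y∉ (product₂ u∈ p (solve 2 (λ u y → y ⊜ u · (inv u · y)) refl u y))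

        twisted-quotient∉ : Gen u → ¬ y ⁻¹ ∙ u ∈ₗ T ±
        twisted-quotient∉ n k with closed (∈-inv V y∈V) (U⊆V u∈) k
        ... | inj₁ (inj₁ e) = xx∉ (product₂ g∈± u∈ (trans
                (solve 2 (λ g x → x · x ⊜ g · (inv g · x · x)) refl g x) (∙-congˡ (sym (factor e)))))
          where
          factor : ∀ {w} → y ⁻¹ ∙ u ≈ w → u ≈ y ∙ w
          factor e = trans (solve 2 (λ u y → u ⊜ y · (inv y · u)) refl u y) (∙-congˡ e)
        ... | inj₁ (inj₂ e) = gen-inv n (inv-resp (sym (trans (solve 2 (λ u y → u ⊜ y · (inv y · u)) refl u y) (trans (∙-congˡ e)
                (solve 2 (λ g x → inv g · x · inv x ⊜ inv g) refl g x)))) (inv-inv Inv-g))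
        ... | inj₂ (inj₁ (inj₁ e)) = gen-commutes n (s≤s z≤n) 1≤L (commutes-≈
                (trans (solve 2 (λ u y → u ⊜ y · (inv y · u)) refl u y) (∙-congˡ e)) (gg-commutes 1))
        ... | inj₂ (inj₁ (inj₂ e)) = not-ε (trans (solve 2 (λ u y → u ⊜ y · (inv y · u)) refl u y) (trans (∙-congˡ e) (inverseʳ y)))
        ... | inj₂ (inj₂ p) = y∉ (product₂ u∈ (inv∈ p) (solve 2 (λ u y → y ⊜ u · inv (inv y · u)) refl u y))

      private
        product₃-class : ∀ {p a b d v} → a ∈ₗ U ± → b ∈ₗ U ± → d ∈ₗ U ± → p ≈ a ∙ (b ∙ d) → SameClass p v → Product₃ v
        product₃-class a∈ b∈ d∈ e (inj₁ k) = product₃ a∈ b∈ d∈ (trans (sym k) e)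
        product₃-class {p} {a} {b} {d} {v} a∈ b∈ d∈ e (inj₂ k) = product₃ (inv∈ d∈) (inv∈ b∈) (inv∈ a∈)
          (trans (sym (⁻¹-involutive v)) (trans (⁻¹-cong (trans (sym k) e))
            (solve 3 (λ a b d → inv (a · (b · d)) ⊜ inv d · (inv b · inv a)) refl a b d)))

      -- The values of an inverting tie up to inversion, which is enough to rule out the pairs of
      -- the other two indices.
      Kind : Carrier → Carrier → Carrier → Set ℓ
      Kind e f p = SameClass p e ⊎ SameClass p (e ∙ e) ⊎ SameClass p f ⊎ SameClass p (f ⁻¹ ∙ (e ∙ e))

      module _ {T : List Carrier} (stage : Stage T) {e f : Carrier} (e∈ : Coloured e) (f∈ : Coloured f) where
        open InvertingTie stage ε e f e∈ f∈ using (Listed)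

        kind : ∀ s i {p} → Listed s i p → Kind e f p
        kind true #0 (inj₁ k) = inj₁ (inj₁ k)
        kind true #0 (inj₂ (inj₁ k)) = inj₂ (inj₂ (inj₁ (inj₁ k)))
        kind true #0 (inj₂ (inj₂ k)) = inj₂ (inj₁ (inj₁ k))
        kind true #1 (inj₁ k) = inj₁ (inj₂ k)
        kind true #1 (inj₂ k) = inj₁ (inj₁ k)
        kind true #2 (inj₁ k) = inj₂ (inj₂ (inj₁ (inj₂ k)))
        kind true #2 (inj₂ k) = inj₂ (inj₂ (inj₂ (inj₁ k)))
        kind false #0 (inj₁ k) = inj₂ (inj₁ (inj₂ k))
        kind false #0 (inj₂ (inj₁ k)) = inj₁ (inj₂ k)
        kind false #0 (inj₂ (inj₂ k)) = inj₂ (inj₂ (inj₂ (inj₂ k)))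
        kind false #1 (lift ())
        kind false #2 (lift ())

      module _ {T : List Carrier} (stage : Stage T) {u : Carrier} (u∈ : u ∈ₗ U) (iu : Inv u) where
        private
          u∈± = ∈-±ˡ u∈
          r = y ⁻¹ ∙ (u ∙ u)

          not-x : ∀ {p} → SameClass p x → Kind u y p → ⊥
          not-x hx (inj₁ k) = x-class hx (class-U k u∈±)
          not-x hx (inj₂ (inj₁ k)) = x∉ (product-class u∈± u∈± refl (class-via (class-sym k) (class-sym hx)))
          not-x hx (inj₂ (inj₂ (inj₁ k))) = x-yclass hx k
          not-x hx (inj₂ (inj₂ (inj₂ k))) with class-via (class-sym k) (class-sym hx)
          ... | inj₁ e = xx∉ (product₃ g∈± u∈± u∈± (trans (∙-congˡ (sym e))
                  (solve 3 (λ g x u → x · (inv (inv g · x) · (u · u)) ⊜ g · (u · u)) refl g x u)))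
          ... | inj₂ e = inv-square (inv-inv Inv-g) iu (sym (trans
                  (solve 3 (λ g x u → u · u ⊜ inv g · (x · (inv (inv g · x) · (u · u)))) refl g x u)
                  (trans (∙-congˡ (trans (∙-congˡ e) (inverseʳ x))) (identityʳ _))))

          Strange : Carrier → Set ℓ
          Strange q = SameClass q y ⊎ SameClass q r

          not-strange : ∀ {q} → q ∈ₗ U ± → ¬ Strange q
          not-strange q∈ (inj₁ k) = y-class k q∈
          not-strange q∈ (inj₂ k) = y∉ (product₃ u∈± u∈± (inv∈ (class-U (class-sym k) q∈))
            (solve 2 (λ u y → y ⊜ u · (u · inv (inv y · (u · u)))) refl u y))

          not-generic : ∀ {q} → q ∈ₗ U ± → Gen q → Kind u y q → ⊥
          not-generic q∈ n (inj₁ k) = gen-inv n (inv-class k iu)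
          not-generic q∈ n (inj₂ (inj₁ k)) = gen-commutes n (proj₁ (proj₂ iu)) (proj₁ (proj₂ (proj₂ iu)))
            (commutes-class k (inverts-square (proj₂ (proj₂ (proj₂ iu)))))
          not-generic q∈ n (inj₂ (inj₂ k)) = not-strange q∈ k

          not-square : ∀ {q} → Inv q → ¬ SameClass q (u ∙ u)
          not-square i (inj₁ e) = inv-square i iu e
          not-square i (inj₂ e) = inv-square (inv-inv i) iu (trans (⁻¹-cong e) (⁻¹-involutive _))

          not-hub : ∀ {p} → SameClass p y → SameClass p u ⊎ SameClass p (u ∙ u) → ⊥
          not-hub hy (inj₁ k) = y-class hy (class-U k u∈±)
          not-hub hy (inj₂ k) = y∉ (product-class u∈± u∈± refl (class-via (class-sym k) (class-sym hy)))

          -- If `p = y⁻¹`, then `y⁻¹ = (y⁻¹ u²)⁻¹`, that is `u² = y²`. If `p = y`, then `u² = ε`,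
          -- and `q = u⁻¹` is the representative `u`.
          negative : ∀ {p q} → SameClass p y → p ≈ r ⁻¹ → q ≈ u ⁻¹ → Conclusion₂ #1 p q
          negative {p} {q} hy ep eq with hy
          ... | inj₁ e = inj₁ (e , resp (sym (trans eq (trans (solve 1 (λ u → inv u ⊜ u · inv (u · u)) refl u)
                  (trans (∙-congˡ (trans (⁻¹-cong uu≈) (trans (⁻¹-cong (trans (∙-congˡ (⁻¹-cong e)) (inverseʳ y))) ε⁻¹≈ε))) (identityʳ u))))) u∈)
            where
            uu≈ : u ∙ u ≈ y ∙ p ⁻¹
            uu≈ = trans (solve 2 (λ u y → u · u ⊜ y · inv (inv (inv y · (u · u)))) refl u y) (∙-congˡ (⁻¹-cong (sym ep)))
          ... | inj₂ e = inj₂ (e , resp (sym q⁻¹≈u) u∈ , trans (∙-cong q⁻¹≈u q⁻¹≈u)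
                  (trans (solve 2 (λ u y → u · u ⊜ y · inv (inv (inv y · (u · u)))) refl u y)
                    (∙-congˡ (trans (⁻¹-cong (trans (sym ep) e)) (⁻¹-involutive y)))))
            where
            q⁻¹≈u : q ⁻¹ ≈ u
            q⁻¹≈u = trans (⁻¹-cong eq) (⁻¹-involutive u)

          module L′ = InvertingTie stage ε u y (U⊆V u∈±) y∈V

          inverted : ∀ s i {p q} → Related₂ #1 p q → L′.Listed s i p → L′.Listed s i q → Conclusion₂ #1 p q
          inverted true #0 (hy , q∈ , i) (inj₁ k) _ = contradiction (inj₁ (inj₁ k)) (not-hub hy)
          inverted true #0 (hy , q∈ , i) (inj₂ (inj₂ k)) _ = contradiction (inj₂ (inj₁ k)) (not-hub hy)
          inverted true #0 (hy , q∈ , i) (inj₂ (inj₁ k)) (inj₁ k′) = inj₁ (k , resp (sym k′) u∈)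
          inverted true #0 (hy , q∈ , i) (inj₂ (inj₁ k)) (inj₂ (inj₁ k′)) = contradiction (inj₁ (inj₁ k′)) (not-strange q∈)
          inverted true #0 (hy , q∈ , i) (inj₂ (inj₁ k)) (inj₂ (inj₂ k′)) = contradiction (inj₁ k′) (not-square i)
          inverted true #1 (hy , q∈ , i) l _ = contradiction (inj₁ ([ inj₂ , inj₁ ]′ l)) (not-hub hy)
          inverted true #2 (hy , q∈ , i) _ l = contradiction ([ inj₁ ∘ inj₂ , inj₂ ∘ inj₁ ]′ l) (not-strange q∈)
          inverted false #0 (hy , q∈ , i) (inj₁ k) _ = contradiction (inj₂ (inj₂ k)) (not-hub hy)
          inverted false #0 (hy , q∈ , i) (inj₂ (inj₁ k)) _ = contradiction (inj₁ (inj₂ k)) (not-hub hy)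
          inverted false #0 (hy , q∈ , i) (inj₂ (inj₂ k)) (inj₁ k′) = contradiction (inj₂ k′) (not-square i)
          inverted false #0 (hy , q∈ , i) (inj₂ (inj₂ k)) (inj₂ (inj₁ k′)) = negative hy k k′
          inverted false #0 (hy , q∈ , i) (inj₂ (inj₂ k)) (inj₂ (inj₂ k′)) = contradiction (inj₂ (inj₂ k′)) (not-strange q∈)
          inverted false #1 _ (lift ())
          inverted false #2 _ (lift ())

          conclude : ∀ s i {k p q} → Related₂ k p q → L′.Listed s i p → L′.Listed s i q → Conclusion₂ k p q
          conclude s i {#0} (hx , _) l _ = ⊥-elim (not-x hx (kind stage (U⊆V u∈±) y∈V s i l))
          conclude s i {#1} rel l l′ = inverted s i rel l l′
          conclude s i {#2} (_ , q∈ , n) _ l′ = ⊥-elim (not-generic q∈ n (kind stage (U⊆V u∈±) y∈V s i l′))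

        abstract
          inverting-tie : ∀ Q → 5 * size T < L → room (size T) (length R) < Q → Torsionless z (3 * (Q * L) * L) → ¬ u ≈ g ⁻¹ →
            Σ[ E ∈ Enlarged T 3 ] Tied (Enlarged.T′ E) y u
          inverting-tie Q short enough tlQ n =
            let (e , p , q , i) = iu
                (E , tied) = inverting-step stage (proj₂ (invertedTie stage R id L Q short enough u y (U⊆V u∈±) y∈V
                  (y-quotient∉ (forget setting stage) u∈± iu n) (λ _ → inj₂ (inj₂ (∈-±ˡ (Membershipₚ.∈-map⁺ setoid setoid
                    (λ e → ∙-congˡ (∙-cong e e)) u∈)))) conclude
                  (z ^ e) (torsionless-^ e p (ℕₚ.*-monoʳ-≤ (3 * (Q * L)) q) tlQ) i (inverts-^ e iy)))
            in E , tied-sym (Enlarged.T′ E) tied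

      module _ {T : List Carrier} (stage : Stage T) (coloured : ∀ {t} → t ∈ₗ T ± → Coloured t) (h∈ : h ∈ₗ U) (nh : Gen h) where
        private
          h∈± = ∈-±ˡ h∈

          not-x : ∀ {p} → SameClass p x → Kind y h p → ⊥
          not-x hx (inj₁ k) = x-yclass hx k
          not-x hx (inj₂ (inj₁ k)) = x∉ (product-class (inv∈ g∈±) (inv∈ g∈±) yy≈ (class-via (class-sym k) (class-sym hx)))
          not-x hx (inj₂ (inj₂ (inj₁ k))) = x-class hx (class-U k h∈±)
          not-x hx (inj₂ (inj₂ (inj₂ k))) = x∉ (product₃-class (inv∈ h∈±) (inv∈ g∈±) (inv∈ g∈±) (∙-congˡ yy≈)
            (class-via (class-sym k) (class-sym hx)))

          not-inverting : ∀ {q} → q ∈ₗ U ± → Inv q → Kind y h q → ⊥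
          not-inverting q∈ i (inj₁ k) = y-class k q∈
          not-inverting q∈ i (inj₂ (inj₁ (inj₁ e))) = inv-square i (inv-inv Inv-g) (trans e yy≈)
          not-inverting q∈ i (inj₂ (inj₁ (inj₂ e))) = inv-square (inv-inv i) (inv-inv Inv-g)
            (trans (⁻¹-cong e) (trans (⁻¹-involutive _) yy≈))
          not-inverting q∈ i (inj₂ (inj₂ (inj₁ k))) = gen-inv nh (inv-class (class-sym k) i)
          -- If `h⁻¹ y²` inverts a power of `z`, then so does `h`, because `y²` commutes with that
          -- power.
          not-inverting q∈ i (inj₂ (inj₂ (inj₂ k))) with inv-inv (inv-class (class-sym k) i)
          ... | e , p , q , j = gen-inv nh (e , p , q , trans
            (solve 3 (λ w h y → w · h · w ⊜ w · (y · y) · inv (inv h · (y · y)) · w) refl (z ^ e) h y)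
            (trans (∙-congʳ (∙-congʳ (gg-commutes e))) (trans
            (solve 3 (λ w h y → y · y · w · inv (inv h · (y · y)) · w ⊜ y · y · (w · inv (inv h · (y · y)) · w)) refl (z ^ e) h y)
            (trans (∙-congˡ j) (solve 2 (λ h y → y · y · inv (inv h · (y · y)) ⊜ h) refl h y)))))

          not-square : ∀ {q} → Gen q → ¬ SameClass q (y ∙ y)
          not-square n k = gen-commutes n (s≤s z≤n) 1≤L (commutes-class k (gg-commutes 1))

          not-hub : ∀ {p} → SameClass p y → SameClass p (y ∙ y) ⊎ SameClass p h ⊎ SameClass p (h ⁻¹ ∙ (y ∙ y)) → ⊥
          not-hub hy (inj₁ k) = y∉ (product-class (inv∈ g∈±) (inv∈ g∈±) yy≈ (class-via (class-sym k) (class-sym hy)))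
          not-hub hy (inj₂ (inj₁ k)) = y-class hy (class-U k h∈±)
          not-hub hy (inj₂ (inj₂ k)) = y∉ (product₃-class (inv∈ h∈±) (inv∈ g∈±) (inv∈ g∈±) (∙-congˡ yy≈)
            (class-via (class-sym k) (class-sym hy)))

          module L′ = InvertingTie stage ε y h y∈V (U⊆V h∈±)

          generic-pair : ∀ s i {p q} → Related₂ #2 p q → L′.Listed s i p → L′.Listed s i q → Conclusion₂ #2 p q
          generic-pair true #0 (hy , q∈ , n) (inj₁ k) _ = lift (inj₁ k)
          generic-pair true #0 (hy , q∈ , n) (inj₂ (inj₁ k)) _ = contradiction (inj₂ (inj₁ (inj₁ k))) (not-hub hy)
          generic-pair true #0 (hy , q∈ , n) (inj₂ (inj₂ k)) _ = contradiction (inj₁ (inj₁ k)) (not-hub hy)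
          generic-pair true #1 (hy , q∈ , n) _ l = contradiction q∈ (y-class ([ inj₂ , inj₁ ]′ l))
          generic-pair true #2 (hy , q∈ , n) l _ = contradiction (inj₂ ([ inj₁ ∘ inj₂ , inj₂ ∘ inj₁ ]′ l)) (not-hub hy)
          generic-pair false #0 (hy , q∈ , n) _ (inj₁ k) = contradiction (inj₂ k) (not-square n)
          generic-pair false #0 (hy , q∈ , n) _ (inj₂ (inj₁ k)) = contradiction q∈ (y-class (inj₂ k))
          generic-pair false #0 (hy , q∈ , n) _ (inj₂ (inj₂ k)) = lift (inj₂ (trans k
            (solve 2 (λ h y → inv (inv h · (y · y)) ⊜ inv (y · y) · h) refl h y)))
          generic-pair false #1 _ (lift ())
          generic-pair false #2 _ (lift ())

          conclude : ∀ s i {k p q} → Related₂ k p q → L′.Listed s i p → L′.Listed s i q → Conclusion₂ k p q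
          conclude s i {#0} (hx , _) l _ = ⊥-elim (not-x hx (kind stage y∈V (U⊆V h∈±) s i l))
          conclude s i {#1} (_ , q∈ , j) _ l′ = ⊥-elim (not-inverting q∈ j (kind stage y∈V (U⊆V h∈±) s i l′))
          conclude s i {#2} rel l l′ = generic-pair s i rel l l′

        abstract
          -- This tie is made before the others: its value `h⁻¹ y²` is not on the reserved list, but
          -- it is harmless while every element is coloured.
          twisted-tie : ∀ Q → 5 * size T < L → room (size T) (length R) < Q → Torsionless z (3 * (Q * L)) →
            Σ[ E ∈ Enlarged T 3 ] Tied (Enlarged.T′ E) y h
          twisted-tie Q short enough tlQ = inverting-step stage (proj₂ (twistedTie stage R id L Q short enough y h y∈V (U⊆V h∈±)
            (twisted-quotient∉ (forget setting stage) h∈± nh) (inj₁ ∘ coloured) conclude z tlQ iy nh))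

      module _ {T : List Carrier} (stage : Stage T) {u : Carrier} (u∈ : u ∈ₗ U) (nu : ¬ Inv u) where
        private
          u∈± = ∈-±ˡ u∈

          not-generator : ∀ {k p q} → Related₂ k p q → ¬ p ≈ u
          not-generator {k} r e = [ (λ hx → x-class hx p∈) , (λ hy → y-class hy p∈) ]′ (related-hub k r)
            where p∈ = resp (sym e) u∈±

          positive : ∀ {k p q} → Related₂ k p q → p ≈ u ⊎ p ≈ x → q ≈ u ⊎ q ≈ x → Conclusion₂ k p q
          positive {k} r (inj₁ e) _ = contradiction e (not-generator {k} r)
          positive {k} r (inj₂ e) (inj₂ e′) = contradiction (related-generator k r) (x-class (inj₁ e′))
          positive {#0} r (inj₂ e) (inj₁ e′) = inj₁ (e , resp (sym e′) u∈)
          positive {#1} (hy , _) (inj₂ e) (inj₁ e′) = ⊥-elim (x-yclass (inj₁ e) hy)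
          positive {#2} (hy , _) (inj₂ e) (inj₁ e′) = ⊥-elim (x-yclass (inj₁ e) hy)

          same : ε ⁻¹ ∙ u ⁻¹ ∙ ε ≈ u ⁻¹
          same = solve 1 (λ u → inv one · inv u · one ⊜ inv u) refl u

          negative : ∀ {k p q} → Related₂ k p q → p ≈ ε ⁻¹ ∙ u ⁻¹ ∙ ε ⊎ p ≈ x ⁻¹ → q ≈ ε ⁻¹ ∙ u ⁻¹ ∙ ε ⊎ q ≈ x ⁻¹ → Conclusion₂ k p q
          negative {k} r (inj₁ e) _ = ⊥-elim ([ (λ hx → x-class hx p∈) , (λ hy → y-class hy p∈) ]′ (related-hub k r))
            where p∈ = resp (sym (trans e same)) (inv∈ u∈±)
          negative {#0} r (inj₂ e) _ = inj₂ e
          negative {#1} (hy , _) (inj₂ e) _ = ⊥-elim (x-yclass (inj₂ e) hy)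
          negative {#2} (hy , _) (inj₂ e) _ = ⊥-elim (x-yclass (inj₂ e) hy)

        abstract
          x-tie : ∀ Q → 5 * size T < L → room (size T) (length R) < Q → Torsionless z (3 * (Q * L) * L) →
            Σ[ E ∈ Enlarged T 3 ] Tied (Enlarged.T′ E) x u
          x-tie Q short enough tlQ with classify u z L
          ... | inverting e p q i = contradiction (e , p , q , i) nu
          ... | central e p q k = commuting-step stage (proj₂ (centralTie stage R id L Q short enough (z ^ e) ε u x
                  (U⊆V u∈±) x∈V (torsionless-^ e p (ℕₚ.*-monoʳ-≤ (3 * (Q * L)) q) tlQ)
                  (trans (identityʳ _) (sym (identityˡ _))) k (commutes-^ e cx) (commutes-ε x)
                  (x-quotient∉ (forget setting stage) u∈± nu)
                  (λ h → x-quotient∉′ (forget setting stage) u∈± (resp (solve 2 (λ u x → inv one · (u · inv x) · one ⊜ u · inv x) refl u x) h))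
                  (λ e _ → inj₁ (resp (sym (trans e (solve 1 (λ u → inv one · u · one ⊜ u) refl u))) (U⊆V u∈±)))
                  (λ {k} → irreflexive {k}) (λ {k} → positive {k}) (λ {k} → negative {k})))
          ... | generic n = commuting-step stage (proj₂ (genericTie stage R id L Q short enough z u x
                  (U⊆V u∈±) x∈V (torsionless-≤ (ℕₚ.m≤m*n (3 * (Q * L)) L {{ℕ.>-nonZero 1≤L}}) tlQ) n cx
                  (x-quotient∉ (forget setting stage) u∈± nu) (λ {k} → irreflexive {k}) (λ {k} → positive {k})))

      module _ {T : List Carrier} (stage : Stages.Stage (plain setting) T)
               (distinct : ∀ {u v} → u ∈ₗ V → v ∈ₗ V → degree T u ≡ degree T v → u ≈ v)
               (high : ∀ {u} → u ∈ₗ V → 7 ≤ degree T u)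
               (x-tied : ∀ {u} → u ∈ₗ U → ¬ Inv u → Tied T x u)
               (y-tied : ∀ {u} → u ∈ₗ U → Inv u → ¬ u ≈ g ⁻¹ → Tied T y u)
               (special : ∀ {u} → u ∈ₗ U → Gen u → h ∈ₗ U × Gen h × Tied T y h)
               (tlL : Torsionless z (2 * (L * L * L)))
               {f f′ : Carrier → Carrier} (Φ : BallMap T f f′) (Ψ : BallMap T f′ f) where
        open Coloured-automorphism (plain setting)
        open Stages.Stage stage using (coloured⊆)

        fixed-coloured : ∀ {v} → Coloured v → f v ≈ v ⊎ f v ≈ v ⁻¹
        fixed-coloured = coloured-fixed stage distinct high Φ Ψ

        private
          ap = representatives-apart Sₗ

          fixed : ∀ {u} → u ∈ₗ U ± → f u ≈ u ⊎ f u ≈ u ⁻¹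
          fixed = fixed-coloured ∘ U⊆V

          image∈ : ∀ {u} → u ∈ₗ U → f u ∈ₗ U ±
          image∈ u∈ = class-U (fixed (∈-±ˡ u∈)) (∈-±ˡ u∈)

          tie : ∀ i {p q} → Coloured p → Coloured q → Tied T p q → Related₂ i (f p) (f q) → Conclusion₂ i (f p) (f q)
          tie i p∈ q∈ (t , t∈ , t∉ , a , b) = transport stage distinct high Φ Ψ i t∈ t∉ (coloured⊆ p∈) (coloured⊆ q∈) a b

          -- Because of y, x is adjacent to g, while x⁻¹ is adjacent neither to g nor to g⁻¹.
          fixed-x : f x ≈ x
          fixed-x with fixed-coloured x∈V
          ... | inj₁ e = e
          ... | inj₂ e = ⊥-elim (x-quotient∉′ stage (inv∈ (class-U (fixed g∈±) g∈±))
            (resp (∙-congˡ e) (BallMap.adj Φ (coloured⊆ (U⊆V g∈±)) (coloured⊆ x∈V) (coloured⊆ y∈V))))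

          fixed-noninv : ∀ {u} → u ∈ₗ U → ¬ Inv u → f u ≈ u
          fixed-noninv u∈ n with tie #0 x∈V (U⊆V (∈-±ˡ u∈)) (x-tied u∈ n)
              (inj₁ fixed-x , image∈ u∈ , n ∘ inv-class (class-sym (fixed (∈-±ˡ u∈))))
          ... | inj₁ (_ , fu∈) = [ id , antisymmetric ap fu∈ u∈ ]′ (fixed (∈-±ˡ u∈))
          ... | inj₂ e = contradiction (trans (sym fixed-x) e) x≉x⁻¹

          inv-conclusion : ∀ {u} → u ∈ₗ U → Inv u → ¬ u ≈ g ⁻¹ → Conclusion₂ #1 (f y) (f u)
          inv-conclusion u∈ i n = tie #1 y∈V (U⊆V (∈-±ˡ u∈)) (y-tied u∈ i n)
            (fixed-coloured y∈V , image∈ u∈ , inv-class (fixed (∈-±ˡ u∈)) i)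

          fixed-inv : f y ≈ y → ∀ {u} → u ∈ₗ U → Inv u → f u ≈ u
          fixed-inv e {u} u∈ i with em≈ {u ≈ g ⁻¹}
          ... | yes k = [ id , (λ m → trans m (trans (⁻¹-cong (antisymmetric ap u∈ g∈ k)) (sym k))) ]′ (fixed (∈-±ˡ u∈))
          ... | no n with inv-conclusion u∈ i n
          ...   | inj₁ (_ , fu∈) = [ id , antisymmetric ap fu∈ u∈ ]′ (fixed (∈-±ˡ u∈))
          -- Now `y` is both fixed and inverted, hence an involution; if `u` is inverted, then
          -- `u² = y² = ε` and it is fixed all the same.
          ...   | inj₂ (k , _ , sq) = [ id , (λ m → trans m (self-inverse (square≈ε (trans (⁻¹-cong m) (⁻¹-involutive u))))) ]′ (fixed (∈-±ˡ u∈))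
            where
            square≈ε : f u ⁻¹ ≈ u → u ∙ u ≈ ε
            square≈ε m = trans (∙-cong (sym m) (sym m)) (trans sq (trans (∙-congʳ (trans (sym e) k)) (inverseˡ y)))
            self-inverse : u ∙ u ≈ ε → u ⁻¹ ≈ u
            self-inverse m = trans (solve 1 (λ u → inv u ⊜ inv (u · u) · u) refl u)
              (trans (∙-congʳ (trans (⁻¹-cong m) ε⁻¹≈ε)) (identityˡ u))

          fixed⁻ : ∀ {p} → p ∈ₗ U ± → f (p ⁻¹) ≈ p ⁻¹ → f p ≈ p
          fixed⁻ {p} p∈ e = trans (BallMap.cong Φ (sym (⁻¹-involutive p))) (trans
            (fixed-inverse Φ Ψ (coloured⊆ (U⊆V (inv∈ p∈))) (fixed (inv∈ (inv∈ p∈))) e) (⁻¹-involutive p))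

          flipped⁻ : ∀ {p} → p ∈ₗ U ± → f (p ⁻¹) ≈ p ⁻¹ ⁻¹ → f p ≈ p ⁻¹
          flipped⁻ {p} p∈ e = trans (BallMap.cong Φ (sym (⁻¹-involutive p))) (trans
            (flipped-inverse Φ Ψ (coloured⊆ (U⊆V (inv∈ p∈))) (fixed (inv∈ (inv∈ p∈))) e) (⁻¹-cong (⁻¹-involutive p)))

          fixed-noninv± : ∀ {p} → p ∈ₗ U ± → ¬ Inv p → f p ≈ p
          fixed-noninv± {p} p∈ n with ∈-±⁻ U p∈
          ... | inj₁ u∈ = fixed-noninv u∈ n
          ... | inj₂ u∈ = fixed⁻ p∈ (fixed-noninv u∈ (n ∘ inv-class (inj₂ (sym (⁻¹-involutive p)))))

          fixed-inv± : f y ≈ y → ∀ {p} → p ∈ₗ U ± → Inv p → f p ≈ p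
          fixed-inv± e {p} p∈ i with ∈-±⁻ U p∈
          ... | inj₁ u∈ = fixed-inv e u∈ i
          ... | inj₂ u∈ = fixed⁻ p∈ (fixed-inv e u∈ (inv-inv i))

          fixed± : f y ≈ y → ∀ {p} → p ∈ₗ U ± → f p ≈ p
          fixed± e {p} p∈ with em≈ {Inv p}
          ... | yes i = fixed-inv± e p∈ i
          ... | no n = fixed-noninv± p∈ n

          module Flipped (y≉ : ¬ y ≈ y ⁻¹) (fy : f y ≈ y ⁻¹) where

            yy≉ε : ¬ y ∙ y ≈ ε
            yy≉ε e = y≉ (trans (solve 1 (λ y → y ⊜ y · y · inv y) refl y) (trans (∙-congʳ e) (identityˡ _)))

            flipped-inv : ∀ {u} → u ∈ₗ U → Inv u → f u ≈ u ⁻¹ × u ∙ u ≈ y ∙ y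
            flipped-inv {u} u∈ i with em≈ {u ≈ g ⁻¹}
            -- Then `g` would be an involution and `y² = g⁻² = ε`.
            ... | yes k = contradiction (trans yy≈ (trans (∙-congʳ (trans (sym k) (antisymmetric ap u∈ g∈ k))) (inverseʳ g))) yy≉ε
            ... | no n with inv-conclusion u∈ i n
            ...   | inj₁ (k , _) = contradiction (trans (sym k) fy) y≉
            ...   | inj₂ (_ , fu⁻¹∈ , sq) = image , trans (∙-cong (sym fu⁻¹≈u) (sym fu⁻¹≈u)) sq
              where
              fu⁻¹≈u : f u ⁻¹ ≈ u
              fu⁻¹≈u = [ (λ m → antisymmetric ap fu⁻¹∈ u∈ (⁻¹-cong m)) , (λ m → trans (⁻¹-cong m) (⁻¹-involutive u)) ]′ (fixed (∈-±ˡ u∈))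
              image : f u ≈ u ⁻¹
              image = trans (sym (⁻¹-involutive (f u))) (⁻¹-cong fu⁻¹≈u)

            -- The tie to `x` fixes `h`, and then the tie to `y` leaves only `h = y⁻² h`.
            no-generic : ∀ {u} → u ∈ₗ U → ¬ Gen u
            no-generic u∈ n with special u∈ n
            ... | h∈ , nh , tied with fixed-noninv h∈ (gen-inv nh)
            ...   | fh with lower (tie #2 y∈V (U⊆V (∈-±ˡ h∈)) tied (fixed-coloured y∈V , image∈ h∈ , gen-resp (sym fh) nh))
            ...     | inj₁ k = y≉ (trans (sym k) fy)
            ...     | inj₂ k = yy≉ε (trans (solve 2 (λ h y → y · y ⊜ h · inv (inv (y · y) · h)) refl h y)
                        (trans (∙-congˡ (⁻¹-cong (trans (sym k) fh))) (inverseʳ h)))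

            -- Being inverting, `g` satisfies `g² = y²`, whereas `y² = g⁻²` by the choice of `y`.
            yy-involution : y ∙ y ≈ (y ∙ y) ⁻¹
            yy-involution = trans (sym (proj₂ (flipped-inv g∈ Inv-g)))
              (trans (solve 1 (λ g → g · g ⊜ inv (inv g · inv g)) refl g) (⁻¹-cong (sym yy≈)))

            flipped-inv± : ∀ {p} → p ∈ₗ U ± → Inv p → f p ≈ p ⁻¹ × p ∙ p ≈ y ∙ y
            flipped-inv± {p} p∈ i with ∈-±⁻ U p∈
            ... | inj₁ u∈ = flipped-inv u∈ i
            ... | inj₂ u∈ with flipped-inv u∈ (inv-inv i)
            ...   | k , sq = flipped⁻ p∈ k , trans (solve 1 (λ p → p · p ⊜ inv (inv p · inv p)) refl p)
                      (trans (⁻¹-cong sq) (sym yy-involution))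

            commuting : ∀ {p} → p ∈ₗ U ± → ¬ Inv p → ∃[ e ] 1 ≤ e × e ≤ L × Commutes p (z ^ e)
            commuting {p} p∈ n with classify p z L
            ... | central e a b k = e , a , b , k
            ... | inverting e a b k = contradiction (e , a , b , k) n
            ... | generic m with ∈-±⁻ U p∈
            ...   | inj₁ u∈ = contradiction m (no-generic u∈)
            ...   | inj₂ u∈ = contradiction (notNormal-inv m) (no-generic u∈)

            -- Generic generators being excluded, `q` and `r` commute with powers of `z`, so `q r`
            -- commutes with one and cannot invert another. Hence an edge never has exactly one
            -- inverting element among its two ends and its colour.
            not-product : ∀ {p q r} → Inv p → q ∈ₗ U ± → r ∈ₗ U ± → ¬ Inv q → ¬ Inv r → ¬ p ≈ q ∙ r
            not-product {p} {q} {r} (c , 1≤c , c≤ , i) q∈ r∈ nq nr e with commuting q∈ nq | commuting r∈ nr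
            ... | a , 1≤a , a≤ , kq | b , 1≤b , b≤ , kr =
              commutes-inverts-^ (ℕₚ.*-mono-≤ 1≤a 1≤b) 1≤c
                (ℕₚ.*-monoʳ-≤ 2 (ℕₚ.*-mono-≤ (ℕₚ.*-mono-≤ a≤ b≤) c≤)) tlL
                (commutes-≈ e (sym (commutes-∙
                  (sym (commutes-resp (trans (^-* z b a) (×-congˡ (ℕₚ.*-comm b a))) (commutes-^ b kq)))
                  (sym (commutes-resp (^-* z a b) (commutes-^ a kr)))))) i

            pairs : ∀ {p q} → p ∈ₗ U ± → q ∈ₗ U ± → p ⁻¹ ∙ q ∈ₗ U ± → PairOK f p q
            pairs {p} {q} p∈ q∈ s∈ with em≈ {Inv p} | em≈ {Inv q}
            ... | yes i | yes j = let (k , sq) = flipped-inv± p∈ i ; (k′ , sq′) = flipped-inv± q∈ j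
                                  in pair-squares k k′ (trans sq (sym sq′))
            ... | no n | no m = pair-fixed (fixed-noninv± p∈ n) (fixed-noninv± q∈ m)
            ... | yes i | no m with em≈ {Inv (p ⁻¹ ∙ q)}
            ...   | no l = contradiction (solve 2 (λ p q → p ⊜ q · inv (inv p · q)) refl p q)
                      (not-product i q∈ (inv∈ s∈) m (l ∘ inv-class (class-sym (inj₂ refl))))
            -- With `s = p⁻¹ q` inverting as well, `p² = y² = s²`, and this element is its own
            -- inverse; so `p² = s⁻²`, which is the relation required.
            ...   | yes l = pair-flipped-fixed (proj₁ (flipped-inv± p∈ i)) (fixed-noninv± q∈ m)
                      (trans (solve 2 (λ p q → q ⊜ inv p · (p · p) · (inv p · q)) refl p q)
                      (trans (sandwich (p ⁻¹) (p ⁻¹ ∙ q) (trans (proj₂ (flipped-inv± p∈ i))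
                        (trans yy-involution (⁻¹-cong (sym (proj₂ (flipped-inv± s∈ l)))))))
                      (solve 2 (λ p q → inv p · inv (inv p · q · (inv p · q)) · (inv p · q) ⊜ inv p · inv q · p) refl p q)))
            pairs {p} {q} p∈ q∈ s∈ | no n | yes j with em≈ {Inv (p ⁻¹ ∙ q)}
            ...   | no l = contradiction (solve 2 (λ p q → q ⊜ p · (inv p · q)) refl p q) (not-product j p∈ s∈ n l)
            ...   | yes l = pair-fixed-flipped (fixed-noninv± p∈ n) (proj₁ (flipped-inv± q∈ j))
                      (trans (solve 1 (λ q → inv q ⊜ q · inv (q · q)) refl q)
                      (trans (∙-congˡ (⁻¹-cong (trans (proj₂ (flipped-inv± q∈ j)) (sym (proj₂ (flipped-inv± s∈ l))))))
                      (solve 2 (λ p q → q · inv (inv p · q · (inv p · q)) ⊜ p · inv q · p) refl p q)))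

        preserved : PairsPreserved Sₗ f
        preserved {p} {q} p∈ q∈ s∈ with em≈ {y ≈ y ⁻¹} | fixed-coloured y∈V
        ... | _ | inj₁ e = pair-fixed (fixed± e (S⊆U p∈)) (fixed± e (S⊆U q∈))
        ... | yes k | inj₂ e = pair-fixed (fixed± (trans e (sym k)) (S⊆U p∈)) (fixed± (trans e (sym k)) (S⊆U q∈))
        ... | no k | inj₂ e = Flipped.pairs k e (S⊆U p∈) (S⊆U q∈) (S⊆U s∈)

      -- The triangle formed by `ε`, `g` and `x` and its translates provide for `x`, `y` and `g`,
      -- which is left without a tie if it is an involution.
      positive-degrees : ∀ T → (∀ {v} → Coloured v → v ∈ₗ T ±) →
        (∀ {u} → u ∈ₗ U → ¬ Inv u → Tied T x u) → (∀ {u} → u ∈ₗ U → Inv u → ¬ u ≈ g ⁻¹ → Tied T y u) →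
        ∀ {v} → v ∈ₗ V → 1 ≤ degree T v
      positive-degrees T in-T x-tied y-tied = go
        where
        triangle : 1 ≤ degree T g
        triangle = degree-positive T {g} {x} (in-T x∈V) (in-T y∈V)
        go : ∀ {v} → v ∈ₗ V → 1 ≤ degree T v
        go (here e) = ≡.subst (1 ≤_) (degree-cong T (sym e)) (degree-positive T {x} {g} (in-T (U⊆V g∈±))
          (resp (solve 2 (λ g x → inv (inv g · x) ⊜ inv x · g) refl g x) (in-T (∈-inv V y∈V))))
        go (there (here e)) = ≡.subst (1 ≤_) (degree-cong T (sym e)) (degree-positive T {y} {g ⁻¹} (in-T (U⊆V (inv∈ g∈±)))
          (resp (solve 2 (λ g x → inv x ⊜ inv (inv g · x) · inv g) refl g x) (in-T (∈-inv V x∈V))))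
        go {v} (there (there v∈)) with em≈ {Inv v}
        ... | no n = proj₂ (tied-degree T (x-tied v∈ n))
        ... | yes i with em≈ {v ≈ g ⁻¹}
        ...   | no n = proj₂ (tied-degree T (y-tied v∈ i n))
        ...   | yes e = ≡.subst (1 ≤_) (≡.trans (≡.sym (degree-inv T g)) (degree-cong T (sym e))) triangle

      length-R : length R ≡ length U + length U
      length-R = ≡.trans (length-++ (map (λ u → y ⁻¹ ∙ (u ∙ u)) U))
        (≡.cong₂ _+_ (length-map _ U) (≡.trans (length-map _⁻¹ (map (λ u → y ⁻¹ ∙ (u ∙ u)) U)) (length-map _ U)))

      module _ (Q M B bound : ℕ)
               (short : ∀ T → length T ≤ B → 5 * size T < L)
               (enough : ∀ T → length T ≤ B → room (size T) (length U + length U) < Q)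
               (fits : length U * 3 + (3 + length base) ≤ B)
               (tlQ : Torsionless z (3 * (Q * L) * L)) (tlL : Torsionless z (2 * (L * L * L)))
               (tlM : Torsionless z (3 * M * M))
               (room′ : ∀ T → length T ≤ bound → 2 * (size T * size T) + 6 * size T < M)
               (le : B + cost 1 (2 + length U) 0 ≤ bound) where
        private
          enough′ : ∀ T → length T ≤ B → room (size T) (length R) < Q
          enough′ T l = ≡.subst (λ r → room (size T) r < Q) (≡.sym length-R) (enough T l)

          Start : Set (c ⊔ ℓ)
          Start = ∃[ T ] Stage T × (∀ {t} → t ∈ₗ base → t ∈ₗ T) × length T ≤ 3 + length base ×
            (∀ {u} → u ∈ₗ U → Gen u → h ∈ₗ U × Gen h × Tied T y h)

          abstract
            start : (h ∈ₗ U × Gen h) ⊎ (∀ {u} → u ∈ₗ U → ¬ Gen u) → Start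
            start (inj₂ none) = base , baseStage , id , ℕₚ.m≤n+m _ 3 , λ u∈ n → contradiction n (none u∈)
            start (inj₁ (h∈ , nh)) =
              let fit = ℕₚ.≤-trans (ℕₚ.m≤n+m (length base) (length U * 3 + 3)) (ℕₚ.≤-trans (ℕₚ.≤-reflexive (ℕₚ.+-assoc (length U * 3) 3 _)) fits)
                  (E , tied) = twisted-tie baseStage base-coloured h∈ nh Q (short base fit) (enough′ base fit)
                    (torsionless-≤ (ℕₚ.m≤m*n (3 * (Q * L)) L {{ℕ.>-nonZero 1≤L}}) tlQ)
              in Enlarged.T′ E , Enlarged.stage E , Enlarged.⊆T′ E , ℕₚ.≤-reflexive (Enlarged.length≡ E) , λ _ _ → h∈ , nh , tied

          Inv? : ∀ u → Dec (Inv u)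
          Inv? u = em≈
          Other? : ∀ u → Dec (¬ Inv u)
          Other? u = em≈
          New? : ∀ u → Dec (¬ u ≈ g ⁻¹)
          New? u = em≈

          inverted others : List Carrier
          inverted = filter New? (filter Inv? U)
          others = filter Other? U

          lengths : length others + length inverted ≤ length U
          lengths = ℕₚ.≤-trans (ℕₚ.+-monoʳ-≤ (length others) (length-filter New? (filter Inv? U)))
            (ℕₚ.≤-reflexive (≡.trans (ℕₚ.+-comm (length others) _) (partition-length Inv? Other? (λ i n → n i) (λ n n′ → n′ n) U)))

          other-resp : ∀ {u v} → u ≈ v → ¬ Inv u → ¬ Inv v
          other-resp e n i = n (inv-resp (sym e) i)

          new-resp : ∀ {u v} → u ≈ v → ¬ u ≈ g ⁻¹ → ¬ v ≈ g ⁻¹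
          new-resp e n k = n (trans e k)

          inverted⁻ : ∀ {u} → u ∈ₗ inverted → (u ∈ₗ U × Inv u) × ¬ u ≈ g ⁻¹
          inverted⁻ u∈ = let (p , n) = Membershipₚ.∈-filter⁻ setoid New? new-resp u∈
                          in Membershipₚ.∈-filter⁻ setoid Inv? inv-resp p , n

          others⁻ : ∀ {u} → u ∈ₗ others → u ∈ₗ U × ¬ Inv u
          others⁻ = Membershipₚ.∈-filter⁻ setoid Other? other-resp

        finish : (h ∈ₗ U × Gen h) ⊎ (∀ {u} → u ∈ₗ U → ¬ Gen u) → Target S bound InvolutionFree
        finish gen with start gen
        ... | T₀ , stage₀ , base⊆ , len₀ , special = conclusion
          where
          total≤ : length others * 3 + (length inverted * 3 + length T₀) ≤ B
          total≤ = ℕₚ.≤-trans (ℕₚ.≤-reflexive (≡.trans (≡.sym (ℕₚ.+-assoc (length others * 3) _ _))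
            (≡.cong (_+ length T₀) (≡.sym (ℕₚ.*-distribʳ-+ 3 (length others) (length inverted))))))
            (ℕₚ.≤-trans (ℕₚ.+-mono-≤ (ℕₚ.*-monoˡ-≤ 3 lengths) len₀) fits)
          first = ties y B inverted stage₀ (ℕₚ.≤-trans (ℕₚ.m≤n+m _ (length others * 3)) total≤)
            λ {_} {T} u∈ stage l → let ((u∈U , i) , n) = inverted⁻ u∈
                                   in inverting-tie stage u∈U i Q (short T l) (enough′ T l) tlQ n
          module E₁ = Enlarged (proj₁ first)
          second = ties x B others E₁.stage
            (≡.subst (λ k → length others * 3 + k ≤ B) (≡.sym E₁.length≡) total≤)
            λ {_} {T} u∈ stage l → let (u∈U , n) = others⁻ u∈
                                   in x-tie stage u∈U n Q (short T l) (enough′ T l) tlQ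
          module E₂ = Enlarged (proj₁ second)
          x-tied : ∀ {u} → u ∈ₗ U → ¬ Inv u → Tied E₂.T′ x u
          x-tied u∈ n = proj₂ second (Membershipₚ.∈-filter⁺ setoid Other? other-resp u∈ n)
          y-tied : ∀ {u} → u ∈ₗ U → Inv u → ¬ u ≈ g ⁻¹ → Tied E₂.T′ y u
          y-tied u∈ i n = tied-mono E₁.T′ E₂.T′ E₂.⊆T′ (proj₂ first
            (Membershipₚ.∈-filter⁺ setoid New? new-resp (Membershipₚ.∈-filter⁺ setoid Inv? inv-resp u∈ i) n))
          special′ : ∀ {u} → u ∈ₗ U → Gen u → h ∈ₗ U × Gen h × Tied E₂.T′ y h
          special′ u∈ n = let (h∈ , nh , tied) = special u∈ n in h∈ , nh , tied-mono T₀ E₂.T′ (E₂.⊆T′ ∘ E₁.⊆T′) tied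
          degrees : ∀ {v} → v ∈ₗ V → 1 ≤ degree E₂.T′ v
          degrees = positive-degrees E₂.T′ (Stage.coloured⊆ E₂.stage) x-tied y-tied
          length≤ : length E₂.T′ ≤ B
          length≤ = ℕₚ.≤-trans (ℕₚ.≤-reflexive (≡.trans E₂.length≡ (≡.cong (λ k → length others * 3 + k) E₁.length≡))) total≤
          no-involution : InvolutionFree → NoInvolution V
          no-involution free (here e) ee = xx∉ (product₀ (trans (∙-cong (sym e) (sym e)) ee))
          no-involution free (there (here e)) ee = free g∈ (trans (solve 1 (λ g → g · g ⊜ inv (inv g · inv g)) refl g)
            (trans (⁻¹-cong (trans (sym yy≈) (trans (∙-cong (sym e) (sym e)) ee))) ε⁻¹≈ε))
          no-involution free (there (there u∈)) = free u∈
          conclusion : Target S bound InvolutionFree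
          conclusion = target-map S no-involution $ complete S setting z M bound 1 tlM room′ (λ {i} → independent {i}) apart E₂.stage
            (E₂.⊆T′ ∘ E₁.⊆T′ ∘ base⊆ ∘ there ∘ there) degrees
            (ℕₚ.≤-trans (ℕₚ.+-monoˡ-≤ (cost 1 (2 + length U) 0) length≤) le)
            λ {T′} stage ⊆T′ distinct high Φ Ψ →
              let xt = λ {u} (u∈ : u ∈ₗ U) n → tied-mono E₂.T′ T′ ⊆T′ (x-tied u∈ n)
                  yt = λ {u} (u∈ : u ∈ₗ U) i n → tied-mono E₂.T′ T′ ⊆T′ (y-tied u∈ i n)
                  sp = λ {u} (u∈ : u ∈ₗ U) n → let (h∈ , nh , tied) = special′ u∈ n in h∈ , nh , tied-mono E₂.T′ T′ ⊆T′ tied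
              in (λ p∈ → fixed-coloured stage distinct high xt yt sp tlL Φ Ψ (U⊆V (S⊆U p∈)))
               , preserved stage distinct high xt yt sp tlL Φ Ψ

  -- The size of the final generating set.

  module CostEstimates where
    open Colouring using (cost)
    open Estimates
    open import Data.Nat.Solver using (module +-*-Solver)
    open +-*-Solver
    open ℕₚ.≤-Reasoning

    -- The cost is an arithmetic series; the summand `m` on the left avoids subtraction.
    cost-closed : ∀ δ m d → cost δ m d + m ≡ m * m + 2 * ((7 ∸ δ + d) * m)
    cost-closed δ zero d = ≡.trans (≡.cong (2 *_) (≡.sym (ℕₚ.*-zeroʳ (7 ∸ δ + d)))) ≡.refl
    cost-closed δ (suc m) d = step (7 ∸ δ) d m (cost δ m (suc d)) (cost-closed δ m (suc d))
      where
      step : ∀ c d m x → x + m ≡ m * m + 2 * ((c + suc d) * m) → 2 * (c + d) + x + suc m ≡ suc m * suc m + 2 * ((c + d) * suc m)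
      step c d m x e = ≡.trans (solve 4 (λ c d m x → con 2 :* (c :+ d) :+ x :+ (con 1 :+ m) := con 2 :* (c :+ d) :+ con 1 :+ (x :+ m)) ≡.refl c d m x)
        (≡.trans (≡.cong (λ t → 2 * (c + d) + 1 + t) e)
          (solve 3 (λ c d m → con 2 :* (c :+ d) :+ con 1 :+ (m :* m :+ con 2 :* ((c :+ (con 1 :+ d)) :* m))
            := (con 1 :+ m) :* (con 1 :+ m) :+ con 2 :* ((c :+ d) :* (con 1 :+ m))) ≡.refl c d m))

    -- Generators, hubs, ties and markers for `2 + u` classes sum up to at most `k² + 19k + 31`.
    -- This fits into `2k² + 28k` from `k = 3` on but not for `k = 2`, whence the separate treatment
    -- of few generators.
    budget : ∀ {u k j} → k ≡ 3 + j → u ≤ k → u * 3 + (5 + k) + cost 1 (2 + u) 0 ≤ 4 + modulus j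
    budget {u} {k} {j} ≡.refl u≤k = ℕₚ.+-cancelʳ-≤ (2 + u) _ _ (begin
      u * 3 + (5 + k) + cost 1 (2 + u) 0 + (2 + u)        ≡⟨ ℕₚ.+-assoc (u * 3 + (5 + k)) _ (2 + u) ⟩
      u * 3 + (5 + k) + (cost 1 (2 + u) 0 + (2 + u))      ≡⟨ ≡.cong (λ t → u * 3 + (5 + k) + t) (cost-closed 1 (2 + u) 0) ⟩
      u * 3 + (5 + k) + ((2 + u) * (2 + u) + 2 * (6 * (2 + u)))
        ≡⟨ solve 2 (λ u k → u :* con 3 :+ (con 5 :+ k) :+ ((con 2 :+ u) :* (con 2 :+ u) :+ con 2 :* (con 6 :* (con 2 :+ u)))
             := u :* u :+ con 18 :* u :+ k :+ con 31 :+ (con 2 :+ u)) ≡.refl u k ⟩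
      u * u + 18 * u + k + 31 + (2 + u)
        ≤⟨ ℕₚ.+-monoˡ-≤ (2 + u) (ℕₚ.+-monoˡ-≤ 31 (ℕₚ.+-monoˡ-≤ k (ℕₚ.+-mono-≤ (ℕₚ.*-mono-≤ u≤k u≤k) (ℕₚ.*-monoʳ-≤ 18 u≤k)))) ⟩
      k * k + 18 * k + k + 31 + (2 + u)
        ≤⟨ ℕₚ.+-monoˡ-≤ (2 + u) (below (j * j + j * 15 + 5) (solve 1 (λ j →
             (con 3 :+ j) :* (con 3 :+ j) :+ con 18 :* (con 3 :+ j) :+ (con 3 :+ j) :+ con 31 :+ (j :* j :+ j :* con 15 :+ con 5)
             := con 4 :+ (j :* j :* con 2 :+ j :* con 40 :+ con 98)) ≡.refl j)) ⟩
      4 + modulus j + (2 + u) ∎)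

    budget-few : ∀ {u k} → u ≤ 2 → u ≤ k → 1 ≤ k → k + cost 0 u 0 ≤ N k
    budget-few {u} {suc i} u≤2 u≤k _ = ℕₚ.≤-trans (few u u≤2 u≤k) (ℕₚ.≤-reflexive (solve 1 (λ i →
        con 30 :+ con 32 :* i :+ con 2 :* (i :* i) := con 2 :* ((con 1 :+ i) :* ((con 1 :+ i) :* con 1)) :+ con 28 :* (con 1 :+ i)) ≡.refl i))
      where
      few : ∀ u → u ≤ 2 → u ≤ suc i → suc i + cost 0 u 0 ≤ 30 + 32 * i + 2 * (i * i)
      few 0 _ _ = below (29 + 31 * i + 2 * (i * i)) (solve 1 (λ i → con 1 :+ i :+ con 0 :+ (con 29 :+ con 31 :* i :+ con 2 :* (i :* i))
        := con 30 :+ con 32 :* i :+ con 2 :* (i :* i)) ≡.refl i)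
      few 1 _ _ = below (15 + 31 * i + 2 * (i * i)) (solve 1 (λ i → con 1 :+ i :+ con 14 :+ (con 15 :+ con 31 :* i :+ con 2 :* (i :* i))
        := con 30 :+ con 32 :* i :+ con 2 :* (i :* i)) ≡.refl i)
      few 2 _ (s≤s (s≤s {n = m} _)) = below (32 + 35 * m + 2 * (m * m)) (solve 1 (λ m →
        con 2 :+ m :+ con 30 :+ (con 32 :+ con 35 :* m :+ con 2 :* (m :* m))
        := con 30 :+ con 32 :* (con 1 :+ m) :+ con 2 :* ((con 1 :+ m) :* (con 1 :+ m))) ≡.refl m)
      few (suc (suc (suc _))) (s≤s (s≤s ())) _

  -- The choice of hubs for at least three generators.

  module ManyGenerators (S : GeneratingSet) where
    open Mult monoid using (×-congˡ)
    open GroupSolver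
    open Counting
    open Powers
    open Gadgets
    open Markers using (size; shift; ∈-shift; length-shift; InvertsUpTo)
    open Colouring using (cost)
    open Automorphisms
    open Completion
    open Pairs
    open Generators S

    private
      -- If this fails, conjugation by `p` sends `q` neither to `q` nor to `q⁻¹`, which a hub
      -- containing the factor `p` can detect.
      Compatible : Carrier → Carrier → Set ℓ
      Compatible p q = Commutes p q ⊎ Inverts p q

      compatible-inv : ∀ {p q} → Compatible p q → Compatible (p ⁻¹) q
      compatible-inv (inj₁ k) = inj₁ (commutes-inv k)
      compatible-inv (inj₂ i) = inj₂ (inverts-inv i)

      compatible-invʳ : ∀ {p q} → Compatible p q → Compatible p (q ⁻¹)
      compatible-invʳ (inj₁ k) = inj₁ (sym (commutes-inv (sym k)))
      compatible-invʳ {p} {q} (inj₂ i) = inj₂ (trans (sandwich (q ⁻¹) (q ⁻¹) (sym i))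
        (solve 2 (λ p q → inv q · (q · p · q) · inv q ⊜ p) refl p q))

      compatible-resp : ∀ {p p′ q q′} → p ≈ p′ → q ≈ q′ → Compatible p q → Compatible p′ q′
      compatible-resp e e′ (inj₁ k) = inj₁ (trans (∙-cong (sym e′) (sym e)) (trans k (∙-cong e e′)))
      compatible-resp e e′ (inj₂ i) = inj₂ (trans (∙-cong (∙-cong (sym e′) (sym e)) (sym e′)) (trans i e))

      mutual-inversion : ∀ {p q} → Inverts p q → Inverts q p → p ∙ p ≈ q ∙ q
      mutual-inversion {p} {q} i i′ = begin
        p ∙ p                     ≈⟨ ∙-congʳ i ⟨
        q ∙ p ∙ q ∙ p             ≈⟨ solve 2 (λ p q → q · p · q · p ⊜ q · (p · q · p)) refl p q ⟩
        q ∙ (p ∙ q ∙ p)           ≈⟨ ∙-congˡ i′ ⟩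
        q ∙ q                     ∎
        where open SetoidReasoning setoid

      class-compatible : (∀ {p q} → p ∈ₗ U → q ∈ₗ U → Compatible p q) → ∀ {p q} → p ∈ₗ U ± → q ∈ₗ U ± → Compatible p q
      class-compatible h {p} {q} p∈ q∈ with ∈-±⁻ U p∈ | ∈-±⁻ U q∈
      ... | inj₁ a | inj₁ b = h a b
      ... | inj₂ a | inj₁ b = compatible-resp (⁻¹-involutive p) refl (compatible-inv (h a b))
      ... | inj₁ a | inj₂ b = compatible-resp refl (⁻¹-involutive q) (compatible-invʳ (h a b))
      ... | inj₂ a | inj₂ b = compatible-resp (⁻¹-involutive p) (⁻¹-involutive q) (compatible-inv (compatible-invʳ (h a b)))

    -- The torsion hypotheses carry spare factors `L`, because `z` gives way to a power `z^d` with
    -- `d ≤ L` that a generator inverts, or to a power whose exponent is a product of two numbers up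
    -- to `L`.
    module _ (z : Carrier) (L Q M B bound : ℕ)
             (short : ∀ T → length T ≤ B → 5 * size T < L)
             (enough : ∀ T r → length T ≤ B → r ≤ length U + length U → 3 * (size T * size T) + 10 * size T + 3 + 3 * r < Q)
             (room : ∀ T → length T ≤ bound → 2 * (size T * size T) + 6 * size T < M)
             (words : 3 * (size Sₗ * size Sₗ * size Sₗ) < Q * L)
             (fits : length U * 3 + (5 + length Sₗ) ≤ B)
             (le : B + cost 1 (2 + length U) 0 ≤ bound)
             (tlQ : Torsionless z (3 * (Q * L) * L * L)) (tlL : Torsionless z (2 * (L * L * L) * L))
             (tlC : Torsionless z (3 * L * L * L)) (tlM : Torsionless z (3 * M * M * L))
             (nonempty : ∃[ u ] u ∈ₗ U) where

      private
        1≤L : 1 ≤ L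
        1≤L = ℕₚ.≤-<-trans z≤n (short [] z≤n)

        L≢0 : ℕ.NonZero L
        L≢0 = ℕ.>-nonZero 1≤L

        scale : ∀ {e} A → 1 ≤ e → e ≤ L → Torsionless z (A * L) → Torsionless (z ^ e) A
        scale {e} A p q = torsionless-^ e p (ℕₚ.*-monoʳ-≤ A q)

        scale² : ∀ {a b} → 1 ≤ a → a ≤ L → 1 ≤ b → b ≤ L → Torsionless (z ^ (a * b)) (3 * (Q * L))
        scale² {a} {b} p q p′ q′ = torsionless-^ (a * b) (ℕₚ.*-mono-≤ p p′)
          (ℕₚ.≤-trans (ℕₚ.*-monoʳ-≤ (3 * (Q * L)) (ℕₚ.*-mono-≤ q q′)) (ℕₚ.≤-reflexive (≡.sym (ℕₚ.*-assoc (3 * (Q * L)) L L)))) tlQ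

        tlQ₁ : Torsionless z (3 * (Q * L) * L)
        tlQ₁ = torsionless-≤ (ℕₚ.m≤m*n _ L {{L≢0}}) tlQ

        tlQ₀ : Torsionless z (3 * (Q * L))
        tlQ₀ = torsionless-≤ (ℕₚ.m≤m*n _ L {{L≢0}}) tlQ₁

        tlM₀ : Torsionless z (3 * M * M)
        tlM₀ = torsionless-≤ (ℕₚ.m≤m*n _ L {{L≢0}}) tlM

      -- The translates `κ` and `κ′` are `g` and `ε` for the hubs `x` and `g⁻¹ x`, both `ε` for a
      -- single power, and `g⁻¹` and `g⁻²` for `X = g x`, whose square is `g² x²`.
      HubFacts : (y κ κ′ : Carrier) → ℕ → Set (c ⊔ ℓ)
      HubFacts y κ κ′ m = ¬ Product₃ (y ^ m) × ¬ Product₃ (κ ⁻¹ ∙ y ^ m) × ¬ Product₃ (κ′ ⁻¹ ∙ (y ^ m ∙ y ^ m))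

      abstract
        pickHub : ∀ y κ κ′ → Torsionless y (3 * (Q * L)) → ∃[ m ] HubFacts y κ κ′ m
        pickHub y κ κ′ tl =
          let (m , _ , _ , a₁ , a₂ , a₃ , _) = pick (Q * L) forbidden (inj , inj , injective-square tl , tt) few
          in m , (a₁ ∘ ∈-words₃) , (a₂ ∘ shifted κ) , (a₃ ∘ shifted κ′)
          where
          forbidden : Forbidden
          forbidden = ((y ^_) , words₃) ∷ ((y ^_) , shift κ words₃) ∷ ((λ m → square (y ^ m)) , shift κ′ words₃) ∷ []
          inj : InjectiveUpTo (Q * L) (y ^_)
          inj = injective-^ (torsionless-≤ (ℕₚ.m≤n*m (Q * L) 3) tl)
          shifted : ∀ κ {w} → Product₃ (κ ⁻¹ ∙ w) → w ∈ₗ shift κ words₃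
          shifted κ {w} p = ∈-shift (∈-words₃ p) (solve 2 (λ κ w → w ⊜ κ · (inv κ · w)) refl κ w)
          few : total forbidden < Q * L
          few rewrite length-shift κ words₃ | length-shift κ′ words₃ | length-words₃ = words

      module Inverting {g : Carrier} (g∈ : g ∈ₗ U) {d : ℕ} (1≤d : 1 ≤ d) (d≤L : d ≤ L) (i : Inverts g (z ^ d)) where
        private
          -- Now `g` inverts `z₁` itself. From here on the classes of the generators refer to `z₁`.
          z₁ = z ^ d
          hub = pickHub z₁ g ε (scale (3 * (Q * L)) 1≤d d≤L tlQ₁)
          x = z₁ ^ proj₁ hub

          facts = proj₂ hub

          target-with : ∀ h → (h ∈ₗ U × NotNormal h z₁ L) ⊎ (∀ {u} → u ∈ₗ U → ¬ NotNormal u z₁ L) → Target S bound InvolutionFree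
          target-with h = TwoHubs.finish S z₁ g x h L g∈ i (sym (commutes-^ (proj₁ hub) refl)) (inverts-^ (proj₁ hub) i) 1≤L
            (scale (3 * L * L) 1≤d d≤L tlC) (proj₁ facts) (proj₁ (proj₂ facts))
            (proj₂ (proj₂ facts) ∘ product₃-resp (solve 1 (λ w → w ⊜ inv one · w) refl _))
            Q M B bound short (λ T l → enough T _ l ℕₚ.≤-refl) fits
            (scale (3 * (Q * L) * L) 1≤d d≤L tlQ) (scale (2 * (L * L * L)) 1≤d d≤L tlL) (scale (3 * M * M) 1≤d d≤L tlM) room le

        target : Target S bound InvolutionFree
        target with dec (∃[ h ] h ∈ₗ U × NotNormal h z₁ L)
        ... | yes (h , h∈ , n) = target-with h (inj₁ (h∈ , n))
        ... | no none = target-with ε (inj₂ λ u∈ n → none (_ , u∈ , n))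

      Central : Carrier → Set ℓ
      Central u = ∃[ e ] 1 ≤ e × e ≤ L × Commutes u (z ^ e)

      central-resp : ∀ {p q} → SameClass q p → Central p → Central q
      central-resp e (n , a , b , k) = n , a , b , commutes-class e k

      private
        fits₁ : length U * 3 + suc (length Sₗ) ≤ B
        fits₁ = ℕₚ.≤-trans (ℕₚ.+-monoʳ-≤ (length U * 3) (ℕₚ.m≤n+m (suc (length Sₗ)) 4)) fits

        fits₄ : ∀ {m} → m ≤ length U → m * 3 + (4 + length Sₗ) ≤ B
        fits₄ {m} h = ℕₚ.≤-trans (ℕₚ.+-mono-≤ (ℕₚ.*-monoˡ-≤ 3 h) (ℕₚ.n≤1+n (4 + length Sₗ))) fits

        le₁ : B + cost 1 (1 + length U) 0 ≤ bound
        le₁ = ℕₚ.≤-trans (ℕₚ.+-monoʳ-≤ B (cost-mono (length U) 0)) le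
          where
          cost-mono : ∀ m d → cost 1 (1 + m) d ≤ cost 1 (2 + m) d
          cost-mono zero d = ℕₚ.+-monoʳ-≤ (2 * (6 + d)) z≤n
          cost-mono (suc m) d = ℕₚ.+-monoʳ-≤ (2 * (6 + d)) (cost-mono m (suc d))

      module _ (none : ∀ {u} → u ∈ₗ U → ¬ InvertsUpTo z L u) where

        module Power where
          private
            hub = pickHub z ε ε tlQ₀
            facts = proj₂ hub

          x : Carrier
          x = z ^ proj₁ hub

          x∉ : ¬ Product Sₗ x
          x∉ = proj₁ facts ∘ product-product₃

          xx∉ : ¬ x ∙ x ∈ₗ Ball₁ Sₗ
          xx∉ = proj₂ (proj₂ facts) ∘ product₃-resp (solve 1 (λ w → w ⊜ inv one · w) refl _) ∘ ball-product₃

          commutes : Commutes x z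
          commutes = sym (commutes-^ (proj₁ hub) refl)

        module SomeGeneric {h : Carrier} (h∈ : h ∈ₗ U) (n : NotNormal h z L) where
          open Power

          -- Centrality is recorded because the image of the generic `h` cannot have it; an inverted
          -- hub is thereby excluded.
          Negative : Carrier → Set (c ⊔ ℓ)
          Negative q = q ⁻¹ ∈ₗ U × Central q

          negative-resp : ∀ {p q} → p ≈ q → Negative p → Negative q
          negative-resp e (p∈ , k) = resp (⁻¹-cong e) p∈ , central-resp (inj₁ (sym e)) k

          module O = OneHub S x Negative
          open TieSteps O.setting using (Enlarged; Tied)
          open Stages O.setting using (Stage)

          step : ∀ {u T} → u ∈ₗ U → Stage T → length T ≤ B → Σ[ E ∈ Enlarged T 3 ] Tied (Enlarged.T′ E) x u
          step {u} {T} u∈ stage l with classify u z L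
          ... | central e p q k = O.central-step x∉ xx∉ negative-resp stage L Q (short T l) (enough T 0 l z≤n) u∈ (z ^ e)
                  (scale (3 * (Q * L)) p q tlQ₁) k (commutes-^ e commutes)
                  (resp (sym (⁻¹-involutive u)) u∈ , e , p , q , commutes-inv k)
          ... | inverting e p q i = contradiction (e , p , q , i) (none u∈)
          ... | generic m = O.generic-step x∉ xx∉ negative-resp stage L Q (short T l) (enough T 0 l z≤n) u∈ z tlQ₀ m commutes

          target : Target S bound InvolutionFree
          target = O.finish x∉ xx∉ negative-resp z M B bound tlM₀ room (O.baseStage x∉ xx∉ negative-resp) id U fits₁ step inj₁
            nonempty le₁ λ neg fix _ → ⊥-elim (impossible (neg h∈) (fix h∈))
            where
            impossible : ∀ {q} → Negative q → SameClass q h → ⊥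
            impossible (_ , k) s = let (e , p , q , k′) = central-resp (class-sym s) k in proj₁ (n e p q) k′

        module AllCentral (central : ∀ {u} → u ∈ₗ U → Central u) where

          module AllCompatible (compatible : ∀ {p q} → p ∈ₗ U → q ∈ₗ U → Compatible p q) where
            open Power

            Negative : Carrier → Set (c ⊔ ℓ)
            Negative q = q ⁻¹ ∈ₗ U

            negative-resp : ∀ {p q} → p ≈ q → Negative p → Negative q
            negative-resp e = resp (⁻¹-cong e)

            module O = OneHub S x Negative
            open TieSteps O.setting using (Enlarged; Tied)
            open Stages O.setting using (Stage)

            step : ∀ {u T} → u ∈ₗ U → Stage T → length T ≤ B → Σ[ E ∈ Enlarged T 3 ] Tied (Enlarged.T′ E) x u
            step {u} {T} u∈ stage l =
              let (e , p , q , k) = central u∈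
              in O.central-step x∉ xx∉ negative-resp stage L Q (short T l) (enough T 0 l z≤n) u∈ (z ^ e)
                   (scale (3 * (Q * L)) p q tlQ₁) k (commutes-^ e commutes) (resp (sym (⁻¹-involutive u)) u∈)

            flips : O.FlipsOK x∉ xx∉ negative-resp
            flips {f} neg fix all {p} {q} p∈ q∈ _ = pair (both p∈ q∈) (both q∈ p∈)
              where
              flipped : ∀ {u} → u ∈ₗ U → f u ≈ u ⁻¹
              flipped {u} u∈ = [ (λ e → trans (sym (⁻¹-involutive (f u))) (⁻¹-cong
                  (antisymmetric (representatives-apart Sₗ) (neg u∈) u∈ (⁻¹-cong e)))) , id ]′ (fix u∈)
              both : ∀ {p q} → p ∈ₗ Sₗ ± → q ∈ₗ Sₗ ± → Compatible p q
              both p∈ q∈ = class-compatible compatible (S⊆U p∈) (S⊆U q∈)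
              pair : Compatible p q → Compatible q p → PairOK f p q
              pair (inj₁ k) _ = pair-commuting (all flipped p∈) (all flipped q∈) k
              pair (inj₂ _) (inj₁ k) = pair-commuting (all flipped p∈) (all flipped q∈) (sym k)
              pair (inj₂ i) (inj₂ i′) = pair-squares (all flipped p∈) (all flipped q∈) (mutual-inversion i i′)

            target : Target S bound InvolutionFree
            target = O.finish x∉ xx∉ negative-resp z M B bound tlM₀ room (O.baseStage x∉ xx∉ negative-resp) id U fits₁ step inj₁
              nonempty le₁ flips

          -- X acts on u by conjugation like g, so f u can neither be u nor u⁻¹ when X is inverted.
          module Incompatible {g u : Carrier} (g∈ : g ∈ₗ U) (u∈ : u ∈ₗ U) (incompatible : ¬ Compatible g u) where
            private
              a b : ℕ
              a = proj₁ (central u∈)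
              b = proj₁ (central g∈)
              -- This power commutes with both `g` and `u`, and so do its own powers, among them the
              -- factor `x` of the hub.
              y₀ = z ^ (a * b)

              module _ {w : Carrier} where
                multipleˡ : ∀ e n → Commutes w (z ^ e) → Commutes w (z ^ (n * e))
                multipleˡ e n k = commutes-resp (^-* z n e) (commutes-^ n k)

                multipleʳ : ∀ e n → Commutes w (z ^ e) → Commutes w (z ^ (e * n))
                multipleʳ e n k = commutes-resp (×-congˡ (ℕₚ.*-comm n e)) (multipleˡ e n k)

              bounds : ∀ {v} (v∈ : v ∈ₗ U) → 1 ≤ proj₁ (central v∈) × proj₁ (central v∈) ≤ L × Commutes v (z ^ proj₁ (central v∈))
              bounds v∈ = proj₂ (central v∈)

              shared : ∀ {v w} (v∈ : v ∈ₗ U) (w∈ : w ∈ₗ U) → Torsionless (z ^ (proj₁ (central v∈) * proj₁ (central w∈))) (3 * (Q * L))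
              shared v∈ w∈ = let (p , q , _) = bounds v∈ ; (p′ , q′ , _) = bounds w∈ in scale² p q p′ q′

              hub = pickHub y₀ (g ⁻¹) ((g ∙ g) ⁻¹) (shared u∈ g∈)
              facts = proj₂ hub
              x X : Carrier
              x = y₀ ^ proj₁ hub
              X = g ∙ x

              gx : Commutes g x
              gx = commutes-^ (proj₁ hub) (multipleˡ b a (proj₂ (proj₂ (bounds g∈))))

              ux : Commutes u x
              ux = commutes-^ (proj₁ hub) (multipleʳ a b (proj₂ (proj₂ (bounds u∈))))

              xz : ∀ n → Commutes x (z ^ n)
              xz n = commutes-^ n (sym (commutes-^ (proj₁ hub) (commutes-^ (a * b) refl)))

              X∉ : ¬ Product Sₗ X
              X∉ = proj₁ (proj₂ facts) ∘ product₃-resp (∙-congʳ (sym (⁻¹-involutive g))) ∘ product-product₃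

              XX∉ : ¬ X ∙ X ∈ₗ Ball₁ Sₗ
              XX∉ = proj₂ (proj₂ facts) ∘ product₃-resp (trans (swap g x gx) (∙-congʳ (sym (⁻¹-involutive _)))) ∘ ball-product₃
                where
                swap : ∀ g x → Commutes g x → g ∙ x ∙ (g ∙ x) ≈ g ∙ g ∙ (x ∙ x)
                swap g x k = trans (solve 2 (λ g x → g · x · (g · x) ⊜ g · (x · g) · x) refl g x)
                  (trans (sandwich g x k) (solve 2 (λ g x → g · (g · x) · x ⊜ g · g · (x · x)) refl g x))

              -- Only the tie of `u` contains the factor `X`. Excluding the class of `u` from the
              -- first alternative leaves the conjugate as the only possibility for `f u`.
              Negative : Carrier → Set (c ⊔ ℓ)
              Negative q = (q ⁻¹ ∈ₗ U × ¬ SameClass q u) ⊎ Lift (c ⊔ ℓ) (q ≈ X ⁻¹ ∙ u ⁻¹ ∙ X)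

              negative-resp : ∀ {p q} → p ≈ q → Negative p → Negative q
              negative-resp e (inj₁ (p∈ , n)) = inj₁ (resp (⁻¹-cong e) p∈ , λ { (inj₁ k) → n (inj₁ (trans e k)) ; (inj₂ k) → n (inj₂ (trans e k)) })
              negative-resp e (inj₂ (lift k)) = inj₂ (lift (trans (sym e) k))

            module O = OneHub S X Negative
            open TieSteps O.setting using (Enlarged; Tied; tied-cong)
            open Stages O.setting using (Stage)

            private
              base : List Carrier
              base = X ∷ Sₗ

              New? : ∀ v → Dec (¬ v ≈ u)
              New? v = em≈

              new-resp : ∀ {v w} → v ≈ w → ¬ v ≈ u → ¬ w ≈ u
              new-resp e n k = n (trans e k)

              base≤ : length base ≤ B
              base≤ = ℕₚ.≤-trans (ℕₚ.m≤n+m _ (length U * 3)) fits₁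

              abstract
                first : Σ[ E ∈ Enlarged base 3 ] Tied (Enlarged.T′ E) X u
                first = O.conjugating-step X∉ XX∉ negative-resp (O.baseStage X∉ XX∉ negative-resp) L Q (short base base≤) (enough base 0 base≤ z≤n)
                  u∈ (O.base-coloured X∉ XX∉ negative-resp) y₀ (shared u∈ g∈) (multipleʳ a b (proj₂ (proj₂ (bounds u∈))))
                  (commutes-∙ˡ (multipleˡ b a (proj₂ (proj₂ (bounds g∈)))) (xz (a * b))) (inj₂ (lift refl))

              module E = Enlarged (proj₁ first)

              step : ∀ {v T} → v ∈ₗ filter New? U → Stage T → length T ≤ B → Σ[ E ∈ Enlarged T 3 ] Tied (Enlarged.T′ E) X v
              step {v} {T} v∈′ stage l =
                let (v∈ , n) = Membershipₚ.∈-filter⁻ setoid New? new-resp v∈′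
                    e = proj₁ (central v∈)
                in O.central-step X∉ XX∉ negative-resp stage L Q (short T l) (enough T 0 l z≤n) v∈ (z ^ (e * b))
                  (shared v∈ g∈) (multipleʳ e b (proj₂ (proj₂ (bounds v∈))))
                  (commutes-∙ˡ (multipleˡ b e (proj₂ (proj₂ (bounds g∈)))) (xz (e * b)))
                  (inj₁ (resp (sym (⁻¹-involutive v)) v∈ , λ k → n ([ (λ h → sym (antisymmetric (representatives-apart Sₗ) u∈ v∈ (sym h)))
                    , (λ h → trans (sym (⁻¹-involutive v)) (trans (⁻¹-cong h) (⁻¹-involutive u))) ]′ k)))

              cover : ∀ {v} → v ∈ₗ U → v ∈ₗ filter New? U ⊎ Tied E.T′ X v
              cover {v} v∈ with em≈ {v ≈ u}
              ... | yes e = inj₂ (tied-cong E.T′ (sym e) (proj₂ first))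
              ... | no n = inj₁ (Membershipₚ.∈-filter⁺ setoid New? new-resp v∈ n)

              moves : ∀ {q} → Negative q → SameClass q u → ⊥
              moves (inj₁ (_ , n)) k = n k
              moves (inj₂ (lift e)) (inj₁ k) = incompatible (inj₂ (trans (assoc u g u) (trans (∙-congˡ gu) (solve 2 (λ g u → u · (inv u · g) ⊜ g) refl g u))))
                where
                gu : g ∙ u ≈ u ⁻¹ ∙ g
                gu = trans (solve 3 (λ g u x → g · u ⊜ g · (u · x) · inv x) refl g u x) (trans (∙-congʳ (∙-congˡ (sym ux)))
                  (trans (solve 3 (λ g u x → g · (x · u) · inv x ⊜ g · x · u · inv x) refl g u x)
                  (trans (∙-congʳ (∙-congˡ (trans (sym k) e)))
                  (solve 3 (λ g u x → g · x · (inv (g · x) · inv u · (g · x)) · inv x ⊜ inv u · g) refl g u x))))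
              moves (inj₂ (lift e)) (inj₂ k) = incompatible (inj₁ (trans (solve 2 (λ g u → u · g ⊜ u · (g · inv u) · u) refl g u)
                  (trans (∙-congʳ (∙-congˡ gu)) (solve 2 (λ g u → u · (inv u · g) · u ⊜ g · u) refl g u))))
                where
                gu : g ∙ u ⁻¹ ≈ u ⁻¹ ∙ g
                gu = trans (solve 3 (λ g u x → g · inv u ⊜ g · (inv u · x) · inv x) refl g u x) (trans (∙-congʳ (∙-congˡ (sym (commutes-inv ux))))
                  (trans (solve 3 (λ g u x → g · (x · inv u) · inv x ⊜ g · x · inv u · inv x) refl g u x)
                  (trans (∙-congʳ (∙-congˡ (trans (sym k) e)))
                  (solve 3 (λ g u x → g · x · (inv (g · x) · inv u · (g · x)) · inv x ⊜ inv u · g) refl g u x))))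

            target : Target S bound InvolutionFree
            target = O.finish X∉ XX∉ negative-resp z M B bound tlM₀ room E.stage E.⊆T′ (filter New? U)
              (≡.subst (λ k → length (filter New? U) * 3 + k ≤ B) (≡.sym E.length≡) (fits₄ (length-filter New? U)))
              step cover nonempty le₁ λ neg fix _ → ⊥-elim (moves (neg u∈) (fix u∈))

      target : Target S bound InvolutionFree
      target with dec (∃[ g ] g ∈ₗ U × InvertsUpTo z L g)
      ... | yes (g , g∈ , d , p , q , i) = Inverting.target g∈ p q i
      ... | no none with dec (∃[ h ] h ∈ₗ U × NotNormal h z L)
      ...   | yes (h , h∈ , n) = SomeGeneric.target (λ u∈ i → none (_ , u∈ , i)) h∈ n
      ...   | no none′ = decide (dec _)
        where
        inv∉ : ∀ {u} → u ∈ₗ U → ¬ InvertsUpTo z L u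
        inv∉ u∈ i = none (_ , u∈ , i)
        all-central : ∀ {u} → u ∈ₗ U → Central u
        all-central {u} u∈ with classify u z L
        ... | central e p q k = e , p , q , k
        ... | inverting e p q i = contradiction (e , p , q , i) (inv∉ u∈)
        ... | generic n = contradiction (u , u∈ , n) none′
        decide : Dec (∃[ g ] ∃[ u ] g ∈ₗ U × u ∈ₗ U × ¬ Compatible g u) → Target S bound InvolutionFree
        decide (yes (g , u , g∈ , u∈ , n)) = AllCentral.Incompatible.target inv∉ all-central g∈ u∈ n
        decide (no none″) = AllCentral.AllCompatible.target inv∉ all-central compatible
          where
          compatible : ∀ {p q} → p ∈ₗ U → q ∈ₗ U → Compatible p q
          compatible {p} {q} p∈ q∈ with em≈ {Compatible p q}
          ... | yes k = k
          ... | no n = contradiction (p , q , p∈ , q∈ , n) none″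

  -- The choice of the parameters.

  module Enlargement (S : GeneratingSet) where
    open Counting
    open Powers
    open Gadgets
    open Markers using (size; size≡)
    open Completion
    open Pairs
    open Generators S
    open Estimates
    open CostEstimates
    open Thresholds

    -- The first positive exponent that kills `z` would be its order, which is at least `v` and so
    -- larger than `n`.
    torsionless : ∀ {z i n} → Exceeds i n → HasOrderAtLeast z i → Torsionless z n
    torsionless {z} {i} {n} (v , i≡v , n<v) order = λ m → below-order n ℕₚ.≤-refl m
      where
      below-order : ∀ m → m ≤ n → Torsionless z m
      below-order zero _ (suc _) _ ()
      below-order (suc m) m≤ i 1≤i i≤ e with ℕₚ.m≤n⇒m<n∨m≡n i≤
      ... | inj₁ (s≤s i≤m) = below-order m (ℕₚ.≤-trans (ℕₚ.n≤1+n m) m≤) i 1≤i i≤m e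
      ... | inj₂ ≡.refl = contradiction (ℤₚ.drop‿+≤+ (≡.subst (ℤ._≤ + suc m) i≡v (order (suc m)
            (s≤s z≤n , e , λ k 1≤k e′ → ℕₚ.≰⇒> (λ k≤m → below-order m (ℕₚ.≤-trans (ℕₚ.n≤1+n m) m≤) k 1≤k k≤m e′)))))
            (ℕₚ.<⇒≱ (ℕₚ.≤-<-trans m≤ n<v))

    private
      markers : ∀ {n} i → n ≡ 26 + i → ∀ T → length T ≤ 4 + n → 2 * (size T * size T) + 6 * size T < 12 * (n * n)
      markers i e T l = ≡.subst (λ s → 2 * (s * s) + 6 * s < _) (≡.sym (size≡ T)) (marker-estimate e l)

      few : ∀ {z k} n i → n ≡ 26 + i → length Sₗ ≡ k → 1 ≤ k → k ≤ 2 → N k ≡ 4 + n → 6 ≤ n →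
        Torsionless z (12 * sixth n) → Target S (N k) InvolutionFree
      few {z} {k} n i n≡ k≡ 1≤k k≤2 N≡ 6≤n tl = FewGenerators.fewGenerators S z M (N k) (ℕₚ.≤-trans u≤k k≤2)
        (torsionless-≤ small tl) large (λ T l → markers i n≡ T (ℕₚ.≤-trans l (ℕₚ.≤-reflexive N≡)))
        (≡.subst (λ m → m + _ ≤ N k) (≡.sym k≡) (budget-few (ℕₚ.≤-trans u≤k k≤2) u≤k 1≤k))
        where
        M : ℕ
        M = 12 * (n * n)
        u≤k : length U ≤ k
        u≤k = ℕₚ.≤-trans (representatives-length Sₗ) (ℕₚ.≤-reflexive k≡)
        small : 3 * M * M ≤ 12 * sixth n
        small = few-torsion 6≤n
        large : 5 ≤ 3 * M * M
        large = ℕₚ.≤-trans (ℕₚ.m≤m+n 5 31) (ℕₚ.*-mono-≤ {36} {3 * M} {1} {M} (ℕₚ.*-monoʳ-≤ 3 12≤M) (ℕₚ.≤-trans (s≤s z≤n) 12≤M))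
          where
          12≤M : 12 ≤ M
          12≤M = ℕₚ.*-monoʳ-≤ 12 (ℕₚ.*-mono-≤ {1} {n} {1} {n} (ℕₚ.≤-trans (s≤s z≤n) 6≤n) (ℕₚ.≤-trans (s≤s z≤n) 6≤n))

      many : ∀ {z j} n → n ≡ modulus j → length Sₗ ≡ 3 + j → N (3 + j) ≡ 4 + n →
        Torsionless z (12 * sixth n) → Target S (N (3 + j)) InvolutionFree
      many {z} {j} n n≡ k≡ N≡ tl = ≡.subst (λ b → Target S b InvolutionFree) (≡.sym N≡)
        -- While ties are made the ball is linear in `k` and `n` is quadratic, so windows of length
        -- `2n` and `n²` of them suffice. The final ball has about `2n` elements, and `12n²` exceeds
        -- twice its square with room for the linear terms.
        (ManyGenerators.target S z (2 * n) (n * n) (12 * (n * n)) (length U * 3 + (5 + length Sₗ)) (4 + n)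
          (λ T l → ≡.subst₂ (λ s n → 5 * s < 2 * n) (≡.sym (size≡ T)) (≡.sym n≡) (short-estimate j (sizes l)))
          (λ T r l r≤ → ≡.subst₂ (λ s n → 3 * (s * s) + 10 * s + 3 + 3 * r < n * n) (≡.sym (size≡ T)) (≡.sym n≡)
            (room-estimate j (sizes l) (ℕₚ.≤-trans r≤ doubled)))
          (markers (72 + (n ∸ 98)) (≡.trans (≡.sym (ℕₚ.m+[n∸m]≡n 98≤n)) ≡.refl))
          (words-estimate (size Sₗ) n (ℕₚ.≤-trans (s≤s z≤n) 98≤n) (≡.subst₂ (λ s n → 3 * s ≤ n)
            (≡.sym (≡.trans (size≡ Sₗ) (≡.cong (λ k → suc (2 * k)) k≡))) (≡.sym n≡) (generators-estimate j)))
          ℕₚ.≤-refl (≡.subst (λ n → _ ≤ 4 + n) (≡.sym n≡) (budget k≡ (representatives-length Sₗ)))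
          (torsionless-≤ (tie-torsion 72≤n) tl) (torsionless-≤ (mixed-torsion 72≤n) tl)
          (torsionless-≤ (class-torsion 72≤n) tl) (torsionless-≤ (marker-torsion 72≤n) tl) (nonempty Sₗ id k≡))
        where
        98≤n : 98 ≤ n
        98≤n = ≡.subst (98 ≤_) (≡.sym n≡) (ℕₚ.m≤n+m 98 (j * j * 2 + j * 40))
        72≤n : 72 ≤ n
        72≤n = ℕₚ.≤-trans (ℕₚ.m≤m+n 72 26) 98≤n
        sizes : ∀ {l} → l ≤ length U * 3 + (5 + length Sₗ) → suc (2 * l) ≤ j * 8 + 35
        sizes = size-estimate k≡ (representatives-length Sₗ)
        doubled : length U + length U ≤ j * 2 + 6
        doubled = ℕₚ.≤-trans (ℕₚ.+-mono-≤ u≤ u≤) (ℕₚ.≤-reflexive (twice j))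
          where
          open import Data.Nat.Solver using (module +-*-Solver)
          open +-*-Solver
          u≤ : length U ≤ 3 + j
          u≤ = ℕₚ.≤-trans (representatives-length Sₗ) (ℕₚ.≤-reflexive k≡)
          twice : ∀ j → 3 + j + (3 + j) ≡ j * 2 + 6
          twice = solve 1 (λ j → con 3 :+ j :+ (con 3 :+ j) := j :* con 2 :+ con 6) ≡.refl
        nonempty : ∀ ss → (∀ {s} → s ∈ₗ ss → s ∈ₗ Sₗ) → length ss ≡ 3 + j → ∃[ u ] u ∈ₗ U
        nonempty (s ∷ _) sub _ = let (u , u∈ , _) = class-of U (representatives-cover Sₗ (sub (here refl))) in u , u∈

      trivial : length Sₗ ≡ 0 → ∀ g → g ≈ ε
      trivial k≡ g with GeneratingSet.generates S g
      ... | [] , _ , e = e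
      ... | w ∷ _ , w∈ ∷ _ , _ = contradiction (no-letters Sₗ k≡ w∈) id
        where
        no-letters : ∀ ss → length ss ≡ 0 → ¬ w ∈ₗ ss ±
        no-letters [] _ ()

    -- Both thresholds enter through the same bound on exponents. The value for empty `S`, where the
    -- argument is negative, is a separate hypothesis.
    enlargement : ∀ (threshold : ℤ.ℤ → ℤ.ℤ) → (∀ n → 1 ≤ n → Exceeds (threshold (+ n)) (12 * sixth n)) →
      Exceeds (threshold (+ N 0 - + 4)) 1 →
      ∃[ g ] HasOrderAtLeast g (threshold (+ N ∣ S ∣ - + 4)) → Target S (N ∣ S ∣) InvolutionFree
    enlargement threshold exceeds exceeds₀ (z , order) = go (length Sₗ) ≡.refl order
      where
      AtLeast : ℕ → Set ℓ
      AtLeast k = HasOrderAtLeast z (threshold (+ N k - + 4))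
      torsion : ∀ k n → N k ≡ 4 + n → 1 ≤ n → AtLeast k → Torsionless z (12 * sixth n)
      torsion k n N≡ 1≤n h = torsionless (exceeds n 1≤n) (≡.subst (λ i → HasOrderAtLeast z (threshold i)) (pos-minus 4 n N≡) h)
      go : ∀ k → length Sₗ ≡ k → AtLeast k → Target S (N k) InvolutionFree
      -- Without generators the group is trivial, but the threshold still demands an element of
      -- order greater than 1.
      go 0 k≡ h = contradiction (trans (identityʳ z) (trivial k≡ z)) (torsionless exceeds₀ h 1 (s≤s z≤n) (s≤s z≤n))
      go 1 k≡ h = few 26 0 ≡.refl k≡ (s≤s z≤n) (s≤s z≤n) ≡.refl (ℕₚ.m≤m+n 6 20) (torsion 1 26 ≡.refl (s≤s z≤n) h)
      go 2 k≡ h = few 60 34 ≡.refl k≡ (s≤s z≤n) (s≤s (s≤s z≤n)) ≡.refl (ℕₚ.m≤m+n 6 54) (torsion 2 60 ≡.refl (s≤s z≤n) h)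
      go (suc (suc (suc j))) k≡ h = many (modulus j) ≡.refl k≡ (bound≡ j) (torsion (3 + j) (modulus j) (bound≡ j) (ℕₚ.≤-trans (s≤s z≤n) (ℕₚ.m≤n+m 98 (j * j * 2 + j * 40))) h)
        where
        open import Data.Nat.Solver using (module +-*-Solver)
        open +-*-Solver
        bound≡ : ∀ j → N (3 + j) ≡ 4 + modulus j
        bound≡ = solve 1 (λ j → con 2 :* ((con 3 :+ j) :* ((con 3 :+ j) :* con 1)) :+ con 28 :* (con 3 :+ j)
          := con 4 :+ (j :* j :* con 2 :+ j :* con 40 :+ con 98)) ≡.refl

theorem9 : ∀ {c ℓ} → ExcludedMiddle (c ⊔ ℓ) →
    (G : Group c ℓ) → let open Cayley G in
    (S : GeneratingSet) →
    ( (∃[ g ] HasOrderAtLeast g (F (+ N ∣ S ∣ - + 4))) →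
    ∃[ T ] Σ[ S⊆T ∈ S ⊆ T ]
    (∣ T ∣ ≤ N ∣ S ∣ × StrongColourRigidTriple S T S⊆T) )
    ×
    ( NoElementOfOrder2 S →
    (∃[ g ] HasOrderAtLeast g (F̌ (+ N ∣ S ∣ - + 4))) →
    ∃[ T ] Σ[ S⊆T ∈ S ⊆ T ]
    (∣ T ∣ ≤ N ∣ S ∣ × StrongColourRigidTriple S T S⊆T × NoElementOfOrder2 T) )
theorem9 {c} {ℓ} em G S = rigid , rigid-without-involutions
  where
  open Cayley G
  open Construction em G
  open Enlargement S
  open Generators S using (involutionFree)
  open Thresholds

  rigid : (∃[ g ] HasOrderAtLeast g (F (+ N ∣ S ∣ - + 4))) →
    ∃[ T ] Σ[ S⊆T ∈ S ⊆ T ] (∣ T ∣ ≤ N ∣ S ∣ × StrongColourRigidTriple S T S⊆T)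
  -- The witness is `F (-4)`, the threshold for empty `S`.
  rigid order = let (T , S⊆T , le , triple , _) = enlargement F F-exceeds (9720 , ≡.refl , s≤s (s≤s z≤n)) order
                in T , S⊆T , le , triple

  rigid-without-involutions : NoElementOfOrder2 S → (∃[ g ] HasOrderAtLeast g (F̌ (+ N ∣ S ∣ - + 4))) →
    ∃[ T ] Σ[ S⊆T ∈ S ⊆ T ] (∣ T ∣ ≤ N ∣ S ∣ × StrongColourRigidTriple S T S⊆T × NoElementOfOrder2 T)
  rigid-without-involutions none order =
    -- The witness is `F̌ (-4)`, positive because both linear factors are negative there.
    let (T , S⊆T , le , triple , free) = enlargement F̌ F̌-exceeds (10368 , ≡.refl , s≤s (s≤s z≤n)) order
    in T , S⊆T , le , triple , free (involutionFree none)
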